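{- As power series (Laurent series where negative powers appear) in $q$, $|q|<1$: \begin{align*} &\sum_{n\ge0}N^{0}(0,2;2n+1)q^n=-qg(-q^2;q^4)+\frac{J_{2}^8J_{8}^2}{J_{1}^4J_{4}^5},\qquad \sum_{n\ge0}N^{0}(0,2;4n+1)q^n=\frac{J_{2}^9}{J_{1}^6J_{4}^2},\\ &\sum_{n\ge0}N^{0}(0,2;4n+3)q^n=-g(-q;q^2)+4\frac{J_{4}^6}{J_{1}^2J_{2}^3},\qquad \sum_{n\ge0}N^{0}(1,2;2n)q^n=-1+g(-1;q^4)+\frac{1}{2}\frac{J_{2}^6J_{4}}{J_{1}^4J_{8}^2},\\ &\sum_{n\ge0}N^{0}(1,2;4n)q^n=-1+g(-1;q^2)+\frac{1}{2}\frac{J_{2}^{15}}{J_{1}^8J_{4}^6},\qquad \sum_{n\ge0}N^{0}(1,2;4n+2)q^n=2\frac{J_{2}^3J_{4}^2}{J_{1}^4},\\ &\sum_{n\ge0}N^{0}(0,2;8n+1)q^n=\frac{J_{2}^{12}J_{4}}{J_{1}^{10}J_{8}^2}+8q\frac{J_{2}^2J_{4}^3J_{8}^2}{J_{1}^6},\\ &\sum_{n\ge0}N^{0}(0,2;8n+3)q^n=qg(-q^2;q^4)-\frac{J_{2}^8J_{8}^2}{J_{1}^4J_{4}^5}+4\frac{J_{2}^6J_{4}^5}{J_{1}^8J_{8}^2},\\ &\sum_{n\ge0}N^{0}(0,2;8n+5)q^n=2\left(\frac{J_{2}^{14}J_{8}^2}{J_{1}^{10}J_{4}^5}+2\frac{J_{4}^9}{J_{1}^6J_{8}^2}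 \right),\\ &\sum_{n\ge0}N^{0}(0,2;8n+7)q^n=-q^{ -1}+q^{ -1}g(-1;q^4)+\frac{1}{2}q^{ -1}\frac{J_{2}^6J_{4}}{J_{1}^4J_{8}^2}+8\frac{J_{2}^8J_{8}^2}{J_{1}^8J_{4}},\\ &\sum_{n\ge0}N^{0}(1,2;8n)q^n=-1+g(-1;q)+\frac{1}{2}\frac{J_{2}^{22}}{J_{1}^{13}J_{4}^8}+8q\frac{J_{4}^8}{J_{1}^5J_{2}^2},\qquad \sum_{n\ge0}N^{0}(1,2;8n+2)q^n=2\frac{J_{2}^{16}}{J_{1}^{11}J_{4}^4},\\ &\sum_{n\ge0}N^{0}(1,2;8n+4)q^n=4\frac{J_{2}^{10}}{J_{1}^9},\qquad \sum_{n\ge0}N^{0}(1,2;8n+6)q^n=8\frac{J_{2}^4J_{4}^4}{J_{1}^7}. \end{align*}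
   Context: For $|q|<1$: $(a;q)_n=\prod_{k=0}^{n-1}(1-aq^k)$, $(a;q)_\infty=\prod_{k\ge0}(1-aq^k)$, $J_m=(q^m;q^m)_\infty$, and for $x$ not an integer power of $q$, \[g(x;q)=x^{ -1}\Big(-1+\sum_{n=0}^{\infty}\frac{q^{n^2}}{(x;q)_{n+1}(q/x;q)_{n}}\Big)\] (expressions such as $g(-q^2;q^4)$ mean this function with $x=-q^2$ and $q$ replaced by $q^4$). An odd Durfee symbol of a positive integer $n$ consists of a nonnegative integer $D$ together with two (possibly empty) non-increasing sequences of odd positive integers $a_1\ge\cdots\ge a_s$ (top row) and $b_1\ge\cdots\ge b_t$ (bottom row), all entries at most $2D+1$, with $n=\sum a_i+\sum b_j+2D^2+2D+1$; its odd rank is $s-t$. $N^{0}(a,M;n)$ is the number of odd Durfee symbols of $n$ with odd rank congruent to $a$ modulo $M$, and $N^0(a,M;0)=0$. -}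

module Defs where

open import Data.Bool using (Bool; true; false; _∧_; if_then_else_)
open import Data.Nat as ℕ using (ℕ; zero; suc; _∸_; _≤ᵇ_; _≡ᵇ_; NonZero)
open import Data.Nat.DivMod using (_%_)
open import Data.Integer as ℤ using (ℤ; +_; +[1+_]; -[1+_])
open import Data.Integer.DivMod using (_%ℕ_)
open import Data.Rational as ℚ using (ℚ; mkℚ; 0ℚ; 1ℚ; _/_; 1/_)
open import Data.List as List using (List; []; _∷_; length; upTo; concatMap; filter; foldr; zipWith)
open import Data.Nat.ListAction using (sum)
open import Data.Product using (_×_; _,_)
open import Relation.Binary.PropositionalEquality using (_≡_)

-- An odd Durfee symbol candidate: (D , top row , bottom row)
OddDurfeeData : Set
OddDurfeeData = ℕ × List ℕ × List ℕ

nonIncreasing : List ℕ → Bool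
nonIncreasing []           = true
nonIncreasing (x ∷ [])     = true
nonIncreasing (x ∷ y ∷ xs) = (y ≤ᵇ x) ∧ nonIncreasing (y ∷ xs)

isOdd : ℕ → Bool
isOdd k = (k % 2) ≡ᵇ 1

validRow : ℕ → List ℕ → Bool
validRow D xs = nonIncreasing xs ∧ List.foldr (λ x r → isOdd x ∧ (x ≤ᵇ (2 ℕ.* D ℕ.+ 1)) ∧ r) true xs

isOddDurfeeOf : ℕ → OddDurfeeData → Bool
isOddDurfeeOf n (D , as , bs) =
  validRow D as ∧ validRow D bs ∧
  ((sum as ℕ.+ sum bs ℕ.+ (2 ℕ.* D ℕ.* D ℕ.+ 2 ℕ.* D ℕ.+ 1)) ≡ᵇ n)

oddRank : OddDurfeeData → ℤ
oddRank (D , as , bs) = + length as ℤ.- + length bs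

allLists : ℕ → ℕ → List (List ℕ)
allLists zero    b = [] ∷ []
allLists (suc l) b = concatMap (λ x → List.map (x ∷_) (allLists l b)) (upTo (suc b))

rowsUpTo : ℕ → List (List ℕ)
rowsUpTo n = concatMap (λ l → allLists l n) (upTo (suc n))

-- a finite, duplicate-free list of triples containing every odd Durfee symbol of n
-- (any such symbol has D ≤ n, rows of length ≤ n, entries ≤ n)
candidates : ℕ → List OddDurfeeData
candidates n =
  concatMap (λ D → concatMap (λ as → List.map (λ bs → (D , as , bs)) (rowsUpTo n)) (rowsUpTo n))
            (upTo (suc n))

N0 : ℤ → (M : ℕ) → .{{NonZero M}} → ℕ → ℕ
N0 a M n = length (List.filter (λ σ → (isOddDurfeeOf n σ ∧ (((oddRank σ ℤ.- a) %ℕ M) ≡ᵇ 0)) Data.Bool.≟ true)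
                               (candidates n))
  where import Data.Bool

PS : Set
PS = ℕ → ℚ

ℕ→ℚ : ℕ → ℚ
ℕ→ℚ n = + n / 1

genFun : (ℕ → ℕ) → PS
genFun f n = ℕ→ℚ (f n)

-- reciprocal of a rational, with the convention recip 0 = 0 (never used at 0 below)
recip : ℚ → ℚ
recip (mkℚ (+ zero) _ _)        = 0ℚ
recip (mkℚ +[1+ n ] d c)        = 1/ (mkℚ +[1+ n ] d c)
recip (mkℚ -[1+ n ] d c)        = 1/ (mkℚ -[1+ n ] d c)

sumTo : ℕ → (ℕ → ℚ) → ℚ
sumTo zero    f = f 0
sumTo (suc n) f = sumTo n f ℚ.+ f (suc n)

X^ : ℕ → PS
X^ k n = if k ≡ᵇ n then 1ℚ else 0ℚ

const : ℚ → PS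
const c zero    = c
const c (suc n) = 0ℚ

oneS : PS
oneS = const 1ℚ

infixl 6 _⊕_ _⊖_
infixl 7 _⊛_ _·_
infixr 8 _^ₛ_

_⊕_ : PS → PS → PS
(f ⊕ g) n = f n ℚ.+ g n

_⊖_ : PS → PS → PS
(f ⊖ g) n = f n ℚ.- g n

_·_ : ℚ → PS → PS
(c · f) n = c ℚ.* f n

_⊛_ : PS → PS → PS
(f ⊛ g) n = sumTo n (λ i → f i ℚ.* g (n ∸ i))

_^ₛ_ : PS → ℕ → PS
f ^ₛ zero  = oneS
f ^ₛ suc k = f ⊛ (f ^ₛ k)

prodTo : ℕ → (ℕ → PS) → PS
prodTo zero    F = oneS
prodTo (suc n) F = prodTo n F ⊛ F n

-- multiplicative inverse of a series with nonzero constant term a₀: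
-- b₀ = 1/a₀ , b_n = -(1/a₀) Σ_{i=1}^{n} a_i b_{n-i}
-- invList f n = b_n ∷ b_{n-1} ∷ … ∷ b₀
invList : PS → ℕ → List ℚ
invList f zero    = recip (f 0) ∷ []
invList f (suc n) =
  (ℚ.- (recip (f 0) ℚ.* foldr ℚ._+_ 0ℚ (zipWith (λ i b → f (suc i) ℚ.* b) (upTo (suc n)) bs))) ∷ bs
  where bs = invList f n

headQ : List ℚ → ℚ
headQ []      = 0ℚ
headQ (x ∷ _) = x

inv : PS → PS
inv f n = headQ (invList f n)

-- J_m = (q^m;q^m)_∞ = ∏_{k≥1} (1 - q^{mk}); for m ≥ 1 the coefficient of qⁿ
-- only depends on the factors with k ≤ n
Jm : ℕ → PS
Jm m n = prodTo n (λ k → oneS ⊖ X^ (m ℕ.* suc k)) n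

poch : ℚ → ℕ → ℕ → ℕ → PS
poch c α b n = prodTo n (λ k → oneS ⊖ c · X^ (α ℕ.+ b ℕ.* k))

-- Σ_{n≥0} q^{b n²} / ((x;q^b)_{n+1} (q^b/x;q^b)_n)  with x = c q^α (α ≤ b, b ≥ 1);
-- the n-th term has q-adic valuation ≥ b n² > k for n > k, so the
-- coefficient of q^k only involves n ≤ k.
gSum : ℚ → ℕ → ℕ → PS
gSum c α b k =
  sumTo k (λ n → (X^ (b ℕ.* n ℕ.* n) ⊛ inv (poch c α b (suc n) ⊛ poch (recip c) (b ∸ α) b n)) k)

-- Laurent series with finitely many negative powers:  q^{-e} · f

record Laurent : Set where
  constructor ⟨_,_⟩
  field
    negExp : ℕ
    series : PS
open Laurent public

-- equality: q^{-e₁} f₁ = q^{-e₂} f₂  iff  q^{e₂} f₁ = q^{e₁} f₂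
infix 4 _≈L_
_≈L_ : Laurent → Laurent → Set
⟨ e₁ , f₁ ⟩ ≈L ⟨ e₂ , f₂ ⟩ = ∀ n → (X^ e₂ ⊛ f₁) n ≡ (X^ e₁ ⊛ f₂) n

infixl 6 _+L_ _-L_
infixl 7 _*L_

_+L_ : Laurent → Laurent → Laurent
⟨ e₁ , f₁ ⟩ +L ⟨ e₂ , f₂ ⟩ = ⟨ e₁ ℕ.+ e₂ , X^ e₂ ⊛ f₁ ⊕ X^ e₁ ⊛ f₂ ⟩

_*L_ : Laurent → Laurent → Laurent
⟨ e₁ , f₁ ⟩ *L ⟨ e₂ , f₂ ⟩ = ⟨ e₁ ℕ.+ e₂ , f₁ ⊛ f₂ ⟩

negL : Laurent → Laurent
negL ⟨ e , f ⟩ = ⟨ e , (ℚ.- 1ℚ) · f ⟩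

_-L_ : Laurent → Laurent → Laurent
x -L y = x +L negL y

↑ : PS → Laurent
↑ f = ⟨ 0 , f ⟩

q⁻¹ : Laurent
q⁻¹ = ⟨ 1 , oneS ⟩

-- g(x;q^b) with x = c q^α :  x^{-1} ( -1 + gSum ) = q^{-α} · c^{-1} (gSum - 1)
g : ℚ → ℕ → ℕ → Laurent
g c α b = ⟨ α , recip c · (gSum c α b ⊖ oneS) ⟩

-1ℚ ½ : ℚ
-1ℚ = ℚ.- 1ℚ
½   = + 1 / 2

{-# OPTIONS --safe #-}
module Submission where

-- The parity of n determines the parity of the odd rank, so the theorem is about P(q) = Σ p(n) qⁿ,
-- where p(n) counts all odd Durfee symbols of n, and 1 + P(q) is the series part of g(q ; q²).
--
-- Partial fractions of 1/((x ; Q)_{N+1} (Q/x ; Q)_N) give in the limit N → ∞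
--   Σ (-1)ⁿ Q^{n(n+1)/2} / (1 - x Qⁿ) = (Q ; Q)²_∞ / ((x ; Q)_∞ (Q/x ; Q)_∞)            (sums over ℤ)
-- and, after weighting with Q^{N²} and summing over N,
--   Σ_N Q^{N²} / ((x ; Q)_{N+1} (Q/x ; Q)_N) = (Q ; Q)_∞⁻¹ Σ (-1)ⁿ Q^{n(3n+1)/2} / (1 - x Qⁿ).
-- Multiply the first identity for (x, Q) = (q, q²) with the one for (-q^j, q⁴), j = 0 or 2, and
-- expand each product 1/((1 - q^a)(1 + q^b)) = 1/((1 - q^a)(1 + q^{b-a})) + 1/((1 + q^b)(1 + q^{a-b})).
-- The inner sums are quasi-periodic and collapse, leaving the even or odd part of P(q) plus a
-- multiple of g(-1 ; q⁴) or g(-q² ; q⁴).  These are the 2-dissections of P; iterating them only needs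
-- the 2-dissections of 1/J₁² and 1/J₁⁴, which come from the triple product.

open import Defs
open import Algebra.Bundles using (CommutativeRing)
import Algebra.Solver.Ring
open import Algebra.Solver.Ring.AlmostCommutativeRing using (fromCommutativeRing; _-Raw-AlmostCommutative⟶_)
open import Data.Bool using (Bool; true; false; _∧_; if_then_else_)
import Data.Bool
import Data.Bool.Properties as BoolP
open import Data.Integer as ℤ using (ℤ; +_; -[1+_]; ∣_∣)
open import Data.Integer.DivMod using (_%ℕ_)
import Data.Integer.Properties as ℤP
open import Data.Integer.Tactic.RingSolver using () renaming (solve-∀ to ℤ-solve)
open import Data.List as List using (List; []; _∷_; length; upTo; applyUpTo; concatMap; filter; foldr; zipWith; _++_)
open import Data.Maybe using (Maybe; just; nothing)
open import Data.Nat as ℕ using (ℕ; zero; suc; _+_; _*_; _∸_; _≤_; _<_; _≤ᵇ_; _≡ᵇ_; z≤n; s≤s)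
open import Data.Nat.ListAction using (sum)
import Data.Nat.Properties as ℕP
open import Data.Nat.Tactic.RingSolver using () renaming (solve-∀ to ℕ-solve)
open import Data.Product using (_×_; _,_; ∃; proj₂)
open import Data.Rational as ℚ using (ℚ; mkℚ; 0ℚ; 1ℚ)
import Data.Rational.Properties as ℚP
import Data.Rational.Unnormalised as ℚᵘ
import Data.Rational.Unnormalised.Properties as ℚᵘP
open import Data.Sum using (_⊎_; inj₁; inj₂)
open import Relation.Binary.Bundles using (Setoid)
open import Relation.Binary.PropositionalEquality using (_≡_; _≢_; refl; sym; trans; cong; cong₂; subst; module ≡-Reasoning)
import Relation.Binary.Reasoning.Setoid
open import Relation.Nullary using (yes; no; contradiction)

-- Only x = ±q^α occurs, so x is not a variable and arguments by poles in x are out of reach.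
-- Identities in x are replaced by recurrences in N for truncated sums, and limits by congruences
-- modulo q^N. Negative exponents are avoided by 1/(1 + η q^(-j)) = 1 - 1/(1 + η q^j) for η = ±1.
-- The bases q² and q⁴ are matched on purpose. After the splitting, each inner sum has an odd
-- argument 1 + 2i. Shifts by the base b and the reflection k ↦ b - k reduce it to one constant
-- times q^(i(i-1)/2) for b = 4 and q^(i²) for b = 2. The first power produces the summands of the
-- two halves of P, up to Euler's pentagonal sum in the even half; the second is, for i = -2m, the
-- weight q^(4m²) in the Appell form of g in base q⁴. The iteration closes up because g(-q ; q²) has
-- the same halves as P up to sign and a factor q, while g(-q² ; q⁴) in the odd half of P is g(-q ;
-- q²) at q². Its next dissection therefore leads back to the halves of P.

-- Finite sums of rationals and coefficients of Cauchy products

module FiniteSums where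

  module _ where
    open ≡-Reasoning

    sumTo-cong≤ : ∀ n {F G : ℕ → ℚ} → (∀ i → i ≤ n → F i ≡ G i) → sumTo n F ≡ sumTo n G
    sumTo-cong≤ zero    h = h 0 z≤n
    sumTo-cong≤ (suc n) h = cong₂ ℚ._+_ (sumTo-cong≤ n (λ i i≤n → h i (ℕP.m≤n⇒m≤1+n i≤n))) (h (suc n) ℕP.≤-refl)

    sumTo-cong : ∀ n {F G : ℕ → ℚ} → (∀ i → F i ≡ G i) → sumTo n F ≡ sumTo n G
    sumTo-cong n h = sumTo-cong≤ n (λ i _ → h i)

    ℚ-swap : ∀ a b c d → (a ℚ.+ b) ℚ.+ (c ℚ.+ d) ≡ (a ℚ.+ c) ℚ.+ (b ℚ.+ d)
    ℚ-swap a b c d = begin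
      (a ℚ.+ b) ℚ.+ (c ℚ.+ d) ≡⟨ ℚP.+-assoc a b (c ℚ.+ d) ⟩
      a ℚ.+ (b ℚ.+ (c ℚ.+ d)) ≡⟨ cong (a ℚ.+_) (ℚP.+-assoc b c d) ⟨
      a ℚ.+ ((b ℚ.+ c) ℚ.+ d) ≡⟨ cong (λ t → a ℚ.+ (t ℚ.+ d)) (ℚP.+-comm b c) ⟩
      a ℚ.+ ((c ℚ.+ b) ℚ.+ d) ≡⟨ cong (a ℚ.+_) (ℚP.+-assoc c b d) ⟩
      a ℚ.+ (c ℚ.+ (b ℚ.+ d)) ≡⟨ ℚP.+-assoc a c (b ℚ.+ d) ⟨
      (a ℚ.+ c) ℚ.+ (b ℚ.+ d) ∎

    sumTo-+ : ∀ n (F G : ℕ → ℚ) → sumTo n (λ i → F i ℚ.+ G i) ≡ sumTo n F ℚ.+ sumTo n G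
    sumTo-+ zero    F G = refl
    sumTo-+ (suc n) F G = trans (cong (ℚ._+ (F (suc n) ℚ.+ G (suc n))) (sumTo-+ n F G))
      (ℚ-swap (sumTo n F) (sumTo n G) (F (suc n)) (G (suc n)))

    sumTo-*ˡ : ∀ n c (F : ℕ → ℚ) → sumTo n (λ i → c ℚ.* F i) ≡ c ℚ.* sumTo n F
    sumTo-*ˡ zero    c F = refl
    sumTo-*ˡ (suc n) c F = trans (cong (ℚ._+ (c ℚ.* F (suc n))) (sumTo-*ˡ n c F))
      (sym (ℚP.*-distribˡ-+ c (sumTo n F) (F (suc n))))

    sumTo-*ʳ : ∀ n c (F : ℕ → ℚ) → sumTo n (λ i → F i ℚ.* c) ≡ sumTo n F ℚ.* c
    sumTo-*ʳ n c F = trans (sumTo-cong n (λ i → ℚP.*-comm (F i) c))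
      (trans (sumTo-*ˡ n c F) (ℚP.*-comm c (sumTo n F)))

    sumTo-head : ∀ n (F : ℕ → ℚ) → sumTo (suc n) F ≡ F 0 ℚ.+ sumTo n (λ i → F (suc i))
    sumTo-head zero    F = refl
    sumTo-head (suc n) F = trans (cong (ℚ._+ F (suc (suc n))) (sumTo-head n F))
      (ℚP.+-assoc (F 0) _ _)

    sumTo-rev : ∀ n (F : ℕ → ℚ) → sumTo n F ≡ sumTo n (λ i → F (n ∸ i))
    sumTo-rev zero    F = refl
    sumTo-rev (suc n) F = begin
      sumTo n F ℚ.+ F (suc n)                    ≡⟨ ℚP.+-comm (sumTo n F) (F (suc n)) ⟩
      F (suc n) ℚ.+ sumTo n F                    ≡⟨ cong (F (suc n) ℚ.+_) (sumTo-rev n F) ⟩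
      F (suc n) ℚ.+ sumTo n (λ i → F (n ∸ i))    ≡⟨ sumTo-head n (λ i → F (suc n ∸ i)) ⟨
      sumTo (suc n) (λ i → F (suc n ∸ i))        ∎

    -- Both sides run over the pairs (j, k) with j + k ≤ n, along antidiagonals and along columns.
    -- The inductive step appends one term to every old column and opens a new one.
    sumTo-triangle : ∀ n (K : ℕ → ℕ → ℚ) →
      sumTo n (λ i → sumTo i (λ j → K j (i ∸ j))) ≡ sumTo n (λ j → sumTo (n ∸ j) (K j))
    sumTo-triangle zero    K = refl
    sumTo-triangle (suc n) K = begin
      sumTo n (λ i → sumTo i (λ j → K j (i ∸ j))) ℚ.+ (sumTo n (λ j → K j (suc n ∸ j)) ℚ.+ K (suc n) (n ∸ n))
        ≡⟨ cong (ℚ._+ (sumTo n (λ j → K j (suc n ∸ j)) ℚ.+ K (suc n) (n ∸ n))) (sumTo-triangle n K) ⟩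
      sumTo n (λ j → sumTo (n ∸ j) (K j)) ℚ.+ (sumTo n (λ j → K j (suc n ∸ j)) ℚ.+ K (suc n) (n ∸ n))
        ≡⟨ ℚP.+-assoc (sumTo n (λ j → sumTo (n ∸ j) (K j))) _ _ ⟨
      sumTo n (λ j → sumTo (n ∸ j) (K j)) ℚ.+ sumTo n (λ j → K j (suc n ∸ j)) ℚ.+ K (suc n) (n ∸ n)
        ≡⟨ cong₂ ℚ._+_ (sym (sumTo-+ n (λ j → sumTo (n ∸ j) (K j)) (λ j → K j (suc n ∸ j)))) lastTerm ⟩
      sumTo n (λ j → sumTo (n ∸ j) (K j) ℚ.+ K j (suc n ∸ j)) ℚ.+ sumTo (n ∸ n) (K (suc n))
        ≡⟨ cong (ℚ._+ sumTo (n ∸ n) (K (suc n))) (sumTo-cong≤ n inner) ⟩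
      sumTo n (λ j → sumTo (suc n ∸ j) (K j)) ℚ.+ sumTo (n ∸ n) (K (suc n)) ∎
      where
      lastTerm : K (suc n) (n ∸ n) ≡ sumTo (n ∸ n) (K (suc n))
      lastTerm rewrite ℕP.n∸n≡0 n = refl
      inner : ∀ j → j ≤ n → sumTo (n ∸ j) (K j) ℚ.+ K j (suc n ∸ j) ≡ sumTo (suc n ∸ j) (K j)
      inner j j≤n rewrite ℕP.+-∸-assoc 1 j≤n = refl

    sumTo-zero : ∀ n → sumTo n (λ _ → 0ℚ) ≡ 0ℚ
    sumTo-zero zero    = refl
    sumTo-zero (suc n) = trans (ℚP.+-identityʳ _) (sumTo-zero n)

    ⊛-comm : ∀ f g n → (f ⊛ g) n ≡ (g ⊛ f) n
    ⊛-comm f g n = trans (sumTo-rev n (λ i → f i ℚ.* g (n ∸ i))) (sumTo-cong≤ n λ i i≤n →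
      trans (cong (λ t → f (n ∸ i) ℚ.* g t) (ℕP.m∸[m∸n]≡n i≤n)) (ℚP.*-comm (f (n ∸ i)) (g i)))

    ⊛-assoc : ∀ f g h n → ((f ⊛ g) ⊛ h) n ≡ (f ⊛ (g ⊛ h)) n
    ⊛-assoc f g h n = begin
      sumTo n (λ i → sumTo i (λ j → f j ℚ.* g (i ∸ j)) ℚ.* h (n ∸ i))
        ≡⟨ sumTo-cong n (λ i → sym (sumTo-*ʳ i (h (n ∸ i)) (λ j → f j ℚ.* g (i ∸ j)))) ⟩
      sumTo n (λ i → sumTo i (λ j → f j ℚ.* g (i ∸ j) ℚ.* h (n ∸ i)))
        ≡⟨ sumTo-cong n (λ i → sumTo-cong≤ i (λ j j≤i → reindex i j j≤i)) ⟩
      sumTo n (λ i → sumTo i (λ j → K j (i ∸ j)))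
        ≡⟨ sumTo-triangle n K ⟩
      sumTo n (λ j → sumTo (n ∸ j) (K j))
        ≡⟨ sumTo-cong n (λ j → sumTo-*ˡ (n ∸ j) (f j) (λ k → g k ℚ.* h (n ∸ j ∸ k))) ⟩
      sumTo n (λ j → f j ℚ.* sumTo (n ∸ j) (λ k → g k ℚ.* h (n ∸ j ∸ k))) ∎
      where
      K : ℕ → ℕ → ℚ
      K j k = f j ℚ.* (g k ℚ.* h (n ∸ j ∸ k))
      reindex : ∀ i j → j ≤ i → f j ℚ.* g (i ∸ j) ℚ.* h (n ∸ i) ≡ K j (i ∸ j)
      reindex i j j≤i = trans (ℚP.*-assoc (f j) (g (i ∸ j)) (h (n ∸ i)))
        (cong (λ t → f j ℚ.* (g (i ∸ j) ℚ.* h t))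
          (trans (cong (n ∸_) (sym (ℕP.m+[n∸m]≡n j≤i))) (sym (ℕP.∸-+-assoc n j (i ∸ j)))))

    ⊛-distribˡ : ∀ f g h n → (f ⊛ (g ⊕ h)) n ≡ ((f ⊛ g) ⊕ (f ⊛ h)) n
    ⊛-distribˡ f g h n = trans (sumTo-cong n (λ i → ℚP.*-distribˡ-+ (f i) (g (n ∸ i)) (h (n ∸ i))))
      (sumTo-+ n (λ i → f i ℚ.* g (n ∸ i)) (λ i → f i ℚ.* h (n ∸ i)))

    const-⊛ : ∀ c f n → (const c ⊛ f) n ≡ c ℚ.* f n
    const-⊛ c f zero    = refl
    const-⊛ c f (suc n) = begin
      (const c ⊛ f) (suc n)                              ≡⟨ sumTo-head n (λ i → const c i ℚ.* f (suc n ∸ i)) ⟩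
      c ℚ.* f (suc n) ℚ.+ sumTo n (λ i → 0ℚ ℚ.* f (n ∸ i)) ≡⟨ cong (c ℚ.* f (suc n) ℚ.+_) (sumTo-cong n (λ i → ℚP.*-zeroˡ (f (n ∸ i)))) ⟩
      c ℚ.* f (suc n) ℚ.+ sumTo n (λ _ → 0ℚ)              ≡⟨ cong (c ℚ.* f (suc n) ℚ.+_) (sumTo-zero n) ⟩
      c ℚ.* f (suc n) ℚ.+ 0ℚ                              ≡⟨ ℚP.+-identityʳ _ ⟩
      c ℚ.* f (suc n) ∎

    -- The inverse `r` excludes p = 0, where `recip` has its default value 0.
    recip-inverse : ∀ p r → p ℚ.* r ≡ 1ℚ → p ℚ.* recip p ≡ 1ℚ
    recip-inverse (mkℚ (+ zero) d c) r eq = contradiction (trans (sym eq) (trans (cong (ℚ._* r) (ℚP.↥p≡0⇒p≡0 (mkℚ (+ zero) d c) refl)) (ℚP.*-zeroˡ r))) λ ()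
    recip-inverse p@(mkℚ ℤ.+[1+ n ] d c) r eq = ℚP.*-inverseʳ p
    recip-inverse p@(mkℚ -[1+ n ] d c) r eq = ℚP.*-inverseʳ p

    -- The tail of `upTo` is `applyUpTo` of a shifted map, so the induction has to carry an
    -- arbitrary index map `φ`.
    invList-sum : ∀ f n (F : ℕ → ℚ) (φ : ℕ → ℕ) →
      foldr ℚ._+_ 0ℚ (zipWith (λ i b → F i ℚ.* b) (applyUpTo φ (suc n)) (invList f n))
        ≡ sumTo n (λ i → F (φ i) ℚ.* inv f (n ∸ i))
    invList-sum f zero    F φ = ℚP.+-identityʳ _
    invList-sum f (suc n) F φ = trans (cong (F (φ 0) ℚ.* inv f (suc n) ℚ.+_) (invList-sum f n F (λ i → φ (suc i))))
      (sym (sumTo-head n (λ i → F (φ i) ℚ.* inv f (suc n ∸ i))))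

    -- In positive degree the recursion chooses the newest coefficient so that its product with
    -- `f 0` cancels the rest of the convolution.
    ⊛-inv : ∀ f → f 0 ℚ.* recip (f 0) ≡ 1ℚ → ∀ n → (f ⊛ inv f) n ≡ oneS n
    ⊛-inv f u zero    = u
    ⊛-inv f u (suc n) = begin
      (f ⊛ inv f) (suc n)  ≡⟨ sumTo-head n (λ i → f i ℚ.* inv f (suc n ∸ i)) ⟩
      f 0 ℚ.* (ℚ.- (r ℚ.* W)) ℚ.+ V ≡⟨ cong (λ t → f 0 ℚ.* (ℚ.- (r ℚ.* t)) ℚ.+ V) (invList-sum f n (λ i → f (suc i)) (λ i → i)) ⟩
      f 0 ℚ.* (ℚ.- (r ℚ.* V)) ℚ.+ V ≡⟨ cong (ℚ._+ V) (sym (ℚP.neg-distribʳ-* (f 0) (r ℚ.* V))) ⟩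
      ℚ.- (f 0 ℚ.* (r ℚ.* V)) ℚ.+ V ≡⟨ cong (λ t → ℚ.- t ℚ.+ V) (trans (sym (ℚP.*-assoc (f 0) r V)) (trans (cong (ℚ._* V) u) (ℚP.*-identityˡ V))) ⟩
      ℚ.- V ℚ.+ V ≡⟨ ℚP.+-inverseˡ V ⟩
      0ℚ ∎
      where
      r = recip (f 0)
      W = foldr ℚ._+_ 0ℚ (zipWith (λ i b → f (suc i) ℚ.* b) (List.upTo (suc n)) (invList f n))
      V = sumTo n (λ i → f (suc i) ℚ.* inv f (n ∸ i))

    X^-suc-⊛ : ∀ a f n → (X^ (suc a) ⊛ f) (suc n) ≡ (X^ a ⊛ f) n
    X^-suc-⊛ a f n = begin
      (X^ (suc a) ⊛ f) (suc n) ≡⟨ sumTo-head n (λ i → X^ (suc a) i ℚ.* f (suc n ∸ i)) ⟩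
      0ℚ ℚ.* f (suc n) ℚ.+ (X^ a ⊛ f) n ≡⟨ cong (ℚ._+ (X^ a ⊛ f) n) (ℚP.*-zeroˡ (f (suc n))) ⟩
      0ℚ ℚ.+ (X^ a ⊛ f) n ≡⟨ ℚP.+-identityˡ _ ⟩
      (X^ a ⊛ f) n ∎

    X^-zero-⊛ : ∀ f n → (X^ 0 ⊛ f) n ≡ f n
    X^-zero-⊛ f n = trans (sumTo-cong n {G = λ i → oneS i ℚ.* f (n ∸ i)} (λ { zero → refl ; (suc i) → refl }))
      (trans (const-⊛ 1ℚ f n) (ℚP.*-identityˡ (f n)))

    X^-⊛-shift : ∀ a f n → (X^ a ⊛ f) (a + n) ≡ f n
    X^-⊛-shift zero    f n = X^-zero-⊛ f n
    X^-⊛-shift (suc a) f n = trans (X^-suc-⊛ a f (a + n)) (X^-⊛-shift a f n)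

    X^-⊛-low : ∀ a f n → n < a → (X^ a ⊛ f) n ≡ 0ℚ
    X^-⊛-low (suc a) f zero    _         = ℚP.*-zeroˡ (f 0)
    X^-⊛-low (suc a) f (suc n) (s≤s n<a) = trans (X^-suc-⊛ a f n) (X^-⊛-low a f n n<a)

open FiniteSums

-- The commutative ring of formal power series over the rationals

module SeriesRing where

  -- Without η, series are compared syntactically instead of coefficient by
  -- coefficient, which keeps unification predictable.
  record S : Set where
    no-eta-equality
    constructor ser
    field coef : PS
  open S public

  infix 4 _≈_ _≈[_]_
  record _≈_ (f g : S) : Set where
    constructor mk≈
    field at : ∀ n → coef f n ≡ coef g n
  open _≈_ public

  -- Congruence modulo q^N, through which all q-adic limits are expressed.
  record _≈[_]_ (f : S) (N : ℕ) (g : S) : Set where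
    constructor mk[]
    field below : ∀ k → k < N → coef f k ≡ coef g k
  open _≈[_]_ public

  infixl 6 _⊞_ _⊟_
  infixl 7 _⊠_
  infix  8 ⊝_

  opaque
    _⊞_ _⊠_ : S → S → S
    f ⊞ g = ser (coef f ⊕ coef g)
    f ⊠ g = ser (coef f ⊛ coef g)
    ⊝_ : S → S
    ⊝ f = ser (λ n → ℚ.- coef f n)
    K : ℚ → S
    K c = ser (const c)
    q^ : ℕ → S
    q^ n = ser (X^ n)
    invS : S → S
    invS f = ser (inv (coef f))

  _⊟_ : S → S → S
  f ⊟ g = f ⊞ (⊝ g)

  𝟘 𝟙 : S
  𝟘 = K 0ℚ
  𝟙 = K 1ℚ

  private variable
    f u h f′ u′ : S
    N : ℕ

  ≈-refl : f ≈ f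
  ≈-refl = mk≈ λ n → refl

  ≈-sym : f ≈ u → u ≈ f
  ≈-sym p = mk≈ λ n → sym (at p n)

  ≈-trans : f ≈ u → u ≈ h → f ≈ h
  ≈-trans p r = mk≈ λ n → trans (at p n) (at r n)

  ≡⇒≈ : f ≡ u → f ≈ u
  ≡⇒≈ refl = ≈-refl

  opaque
    unfolding _⊞_

    coef-⊞ : ∀ f g n → coef (f ⊞ g) n ≡ coef f n ℚ.+ coef g n
    coef-⊞ f g n = refl

    ⊞-cong : f ≈ f′ → u ≈ u′ → f ⊞ u ≈ f′ ⊞ u′
    ⊞-cong p r = mk≈ λ n → cong₂ ℚ._+_ (at p n) (at r n)

    ⊝-cong : f ≈ u → ⊝ f ≈ ⊝ u
    ⊝-cong p = mk≈ λ n → cong ℚ.-_ (at p n)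

    ⊠-cong : f ≈ f′ → u ≈ u′ → f ⊠ u ≈ f′ ⊠ u′
    ⊠-cong p r = mk≈ λ n → sumTo-cong n λ i → cong₂ ℚ._*_ (at p i) (at r (n ∸ i))

    ⊠-identityˡ : ∀ f → 𝟙 ⊠ f ≈ f
    ⊠-identityˡ f = mk≈ λ n → trans (const-⊛ 1ℚ (coef f) n) (ℚP.*-identityˡ _)

    ⊠-comm : ∀ f g → f ⊠ g ≈ g ⊠ f
    ⊠-comm f g = mk≈ (⊛-comm (coef f) (coef g))

    const-0 : ∀ n → const 0ℚ n ≡ 0ℚ
    const-0 zero = refl
    const-0 (suc n) = refl

    ⊞-assoc : ∀ f g h → f ⊞ g ⊞ h ≈ f ⊞ (g ⊞ h)
    ⊞-assoc f g h = mk≈ λ n → ℚP.+-assoc (coef f n) (coef g n) (coef h n)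

    ⊞-comm : ∀ f g → f ⊞ g ≈ g ⊞ f
    ⊞-comm f g = mk≈ λ n → ℚP.+-comm (coef f n) (coef g n)

    ⊞-identityˡ : ∀ f → 𝟘 ⊞ f ≈ f
    ⊞-identityˡ f = mk≈ λ n → trans (cong (ℚ._+ coef f n) (const-0 n)) (ℚP.+-identityˡ _)

    ⊝-inverseˡ : ∀ f → ⊝ f ⊞ f ≈ 𝟘
    ⊝-inverseˡ f = mk≈ λ n → trans (ℚP.+-inverseˡ (coef f n)) (sym (const-0 n))

    ⊠-assoc : ∀ f g h → f ⊠ g ⊠ h ≈ f ⊠ (g ⊠ h)
    ⊠-assoc f g h = mk≈ (⊛-assoc (coef f) (coef g) (coef h))

    ⊠-distribˡ : ∀ f g h → f ⊠ (g ⊞ h) ≈ f ⊠ g ⊞ f ⊠ h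
    ⊠-distribˡ f g h = mk≈ (⊛-distribˡ (coef f) (coef g) (coef h))

    K-⊞ : ∀ a b → K (a ℚ.+ b) ≈ K a ⊞ K b
    K-⊞ a b = mk≈ λ { zero → refl ; (suc n) → refl }

    K-⊠ : ∀ a b → K (a ℚ.* b) ≈ K a ⊠ K b
    K-⊠ a b = mk≈ λ { zero → sym (const-⊛ a (const b) zero) ; (suc n) → sym (trans (const-⊛ a (const b) (suc n)) (ℚP.*-zeroʳ a)) }

    K-⊝ : ∀ a → K (ℚ.- a) ≈ ⊝ K a
    K-⊝ a = mk≈ λ { zero → refl ; (suc n) → refl }

  S-commutativeRing : CommutativeRing _ _
  S-commutativeRing = record
    { Carrier = S ; _≈_ = _≈_ ; _+_ = _⊞_ ; _*_ = _⊠_ ; -_ = ⊝_ ; 0# = 𝟘 ; 1# = 𝟙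
    ; isCommutativeRing = record
      { isRing = record
        { +-isAbelianGroup = record
          { isGroup = record
            { isMonoid = record
              { isSemigroup = record
                { isMagma = record
                  { isEquivalence = record { refl = ≈-refl ; sym = ≈-sym ; trans = ≈-trans }
                  ; ∙-cong = ⊞-cong }
                ; assoc = ⊞-assoc }
              ; identity = ⊞-identityˡ , (λ f → ≈-trans (⊞-comm f 𝟘) (⊞-identityˡ f)) }
            ; inverse = ⊝-inverseˡ , (λ f → ≈-trans (⊞-comm f (⊝ f)) (⊝-inverseˡ f))
            ; ⁻¹-cong = ⊝-cong }
          ; comm = ⊞-comm }
        ; *-cong = ⊠-cong
        ; *-assoc = ⊠-assoc
        ; *-identity = ⊠-identityˡ , (λ f → ≈-trans (⊠-comm f 𝟙) (⊠-identityˡ f))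
        ; distrib = ⊠-distribˡ
                  , (λ f g h → ≈-trans (⊠-comm (g ⊞ h) f) (≈-trans (⊠-distribˡ f g h) (⊞-cong (⊠-comm f g) (⊠-comm f h)))) }
      ; *-comm = ⊠-comm } }

  module ≈-Reasoning = Relation.Binary.Reasoning.Setoid (CommutativeRing.setoid S-commutativeRing)

  ι : ℤ → S
  ι z = K (z ℚ./ 1)

  private
    fromℤ : ∀ z → ℚ.toℚᵘ (z ℚ./ 1) ℚᵘ.≃ ℚᵘ.mkℚᵘ z 0
    fromℤ z = ℚP.toℚᵘ-fromℚᵘ (ℚᵘ.mkℚᵘ z 0)

  -- Normalised fractions do not add by computation; on unnormalised ones with denominator 1 the
  -- claim is an identity of integers.
  /1-+ : ∀ a b → (a ℤ.+ b) ℚ./ 1 ≡ a ℚ./ 1 ℚ.+ b ℚ./ 1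
  /1-+ a b = ℚP.toℚᵘ-injective (ℚᵘP.≃-trans (fromℤ (a ℤ.+ b)) (ℚᵘP.≃-trans
    (ℚᵘ.*≡* (cong (ℤ._* + 1) (cong₂ ℤ._+_ (sym (ℤP.*-identityʳ a)) (sym (ℤP.*-identityʳ b)))))
    (ℚᵘP.≃-sym (ℚᵘP.≃-trans (ℚP.toℚᵘ-homo-+ (a ℚ./ 1) (b ℚ./ 1)) (ℚᵘP.+-cong (fromℤ a) (fromℤ b))))))

  /1-* : ∀ a b → (a ℤ.* b) ℚ./ 1 ≡ (a ℚ./ 1) ℚ.* (b ℚ./ 1)
  /1-* a b = ℚP.toℚᵘ-injective (ℚᵘP.≃-trans (fromℤ (a ℤ.* b))
    (ℚᵘP.≃-sym (ℚᵘP.≃-trans (ℚP.toℚᵘ-homo-* (a ℚ./ 1) (b ℚ./ 1)) (ℚᵘP.*-cong (fromℤ a) (fromℤ b)))))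

  /1-neg : ∀ a → (ℤ.- a) ℚ./ 1 ≡ ℚ.- (a ℚ./ 1)
  /1-neg a = ℚP.toℚᵘ-injective (ℚᵘP.≃-trans (fromℤ (ℤ.- a))
    (ℚᵘP.≃-sym (ℚᵘP.≃-trans (ℚP.toℚᵘ-homo‿- (a ℚ./ 1)) (ℚᵘP.-‿cong (fromℤ a)))))

  ι-+ : ∀ a b → ι (a ℤ.+ b) ≈ ι a ⊞ ι b
  ι-+ a b = ≈-trans (≡⇒≈ (cong K (/1-+ a b))) (K-⊞ _ _)

  ι-* : ∀ a b → ι (a ℤ.* b) ≈ ι a ⊠ ι b
  ι-* a b = ≈-trans (≡⇒≈ (cong K (/1-* a b))) (K-⊠ _ _)

  ι-neg : ∀ a → ι (ℤ.- a) ≈ ⊝ ι a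
  ι-neg a = ≈-trans (≡⇒≈ (cong K (/1-neg a))) (K-⊝ _)

  -- Makes the integers the coefficients of the ring solver, so that numerals such as 4, 8 and 16
  -- are calculated with during normalisation.
  ι-morphism : CommutativeRing.rawRing ℤP.+-*-commutativeRing -Raw-AlmostCommutative⟶ fromCommutativeRing S-commutativeRing
  ι-morphism = record { ⟦_⟧ = ι ; +-homo = ι-+ ; *-homo = ι-* ; -‿homo = ι-neg ; 0-homo = ≈-refl ; 1-homo = ≈-refl }

  ι-≟ : ∀ a b → Maybe (ι a ≈ ι b)
  ι-≟ a b with a ℤ.≟ b
  ... | yes p = just (≡⇒≈ (cong ι p))
  ... | no _  = nothing

  module RS = Algebra.Solver.Ring (CommutativeRing.rawRing ℤP.+-*-commutativeRing) (fromCommutativeRing S-commutativeRing) ι-morphism ι-≟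
  open RS using (solve; _:=_; _:+_; _:*_; :-_; _:-_; con; _:^_) public

  :0 :1 : ∀ {n} → RS.Polynomial n
  :0 = con (+ 0)
  :1 = con (+ 1)

  ⊠-congʳ : ∀ {f u u′} → u ≈ u′ → f ⊠ u ≈ f ⊠ u′
  ⊠-congʳ = ⊠-cong ≈-refl

  ⊞-congʳ : ∀ {f u u′} → u ≈ u′ → f ⊞ u ≈ f ⊞ u′
  ⊞-congʳ = ⊞-cong ≈-refl

  ⊠-congˡ : ∀ {f f′ u} → f ≈ f′ → f ⊠ u ≈ f′ ⊠ u
  ⊠-congˡ p = ⊠-cong p ≈-refl

open SeriesRing

-- Congruences modulo powers of q, units and limits

module Congruences where

  private variable
    f u h f′ u′ : S
    N M : ℕ

  opaque
    unfolding _⊞_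

    q^-0 : q^ 0 ≈ 𝟙
    q^-0 = mk≈ λ { zero → refl ; (suc n) → refl }

    q^-shift : ∀ a f n → coef (q^ a ⊠ f) (a + n) ≡ coef f n
    q^-shift a f n = X^-⊛-shift a (coef f) n

    q^-low : ∀ a f n → n < a → coef (q^ a ⊠ f) n ≡ 0ℚ
    q^-low a f n = X^-⊛-low a (coef f) n

    X^-+ : ∀ a b n → X^ (a + b) n ≡ (X^ a ⊛ X^ b) n
    X^-+ zero    b n       = sym (X^-zero-⊛ (X^ b) n)
    X^-+ (suc a) b zero    = sym (ℚP.*-zeroˡ (X^ b 0))
    X^-+ (suc a) b (suc n) = trans (X^-+ a b n) (sym (X^-suc-⊛ a (X^ b) n))

    q^-+ : ∀ a b → q^ (a + b) ≈ q^ a ⊠ q^ b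
    q^-+ a b = mk≈ (X^-+ a b)

    coef-𝟘 : ∀ n → coef 𝟘 n ≡ 0ℚ
    coef-𝟘 = const-0

    ⊞-cong[] : f ≈[ N ] f′ → u ≈[ N ] u′ → f ⊞ u ≈[ N ] f′ ⊞ u′
    ⊞-cong[] p r = mk[] λ k k<N → cong₂ ℚ._+_ (below p k k<N) (below r k k<N)

    ⊝-cong[] : f ≈[ N ] u → ⊝ f ≈[ N ] ⊝ u
    ⊝-cong[] p = mk[] λ k k<N → cong ℚ.-_ (below p k k<N)

    ⊠-cong[] : f ≈[ N ] f′ → u ≈[ N ] u′ → f ⊠ u ≈[ N ] f′ ⊠ u′
    ⊠-cong[] p r = mk[] λ k k<N → sumTo-cong≤ k λ i i≤k →
      cong₂ ℚ._*_ (below p i (ℕP.≤-<-trans i≤k k<N)) (below r (k ∸ i) (ℕP.≤-<-trans (ℕP.m∸n≤m k i) k<N))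

    -- The source of every gain of precision: a factor q^a shifts all coefficients by a places.
    q^-mod : ∀ a → f ≈[ N ] u → q^ a ⊠ f ≈[ a + N ] q^ a ⊠ u
    q^-mod {f} {N} {u} a p = mk[] λ k k<a+N → go k k<a+N
      where
      go : ∀ k → k < a + N → coef (q^ a ⊠ f) k ≡ coef (q^ a ⊠ u) k
      go k k< with k ℕ.<? a
      ... | yes k<a = trans (q^-low a f k k<a) (sym (q^-low a u k k<a))
      ... | no k≮a with ℕP.m≤n⇒∃[o]m+o≡n (ℕP.≮⇒≥ k≮a)
      ...   | j , refl =
        trans (q^-shift a f j) (trans (below p j (ℕP.+-cancelˡ-< a j N k<)) (sym (q^-shift a u j)))

    coef-invS₀ : ∀ f g → f ⊠ g ≈ 𝟙 → f ⊠ invS f ≈ 𝟙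
    coef-invS₀ f g p = mk≈ (⊛-inv (coef f) (recip-inverse (coef f 0) (coef g 0) (at p 0)))

    invS-unit : ∀ f → coef f 0 ≡ 1ℚ → f ⊠ invS f ≈ 𝟙
    invS-unit f p = mk≈ (⊛-inv (coef f) (trans (cong (λ c → c ℚ.* recip c) p) refl))

  q^-≡ : ∀ {a b} → a ≡ b → q^ a ≈ q^ b
  q^-≡ refl = ≈-refl

  q^-cancel : ∀ a → q^ a ⊠ f ≈ q^ a ⊠ u → f ≈ u
  q^-cancel {f} {u} a p = mk≈ λ n → trans (sym (q^-shift a f n)) (trans (at p (a + n)) (q^-shift a u n))

  ≈⇒[] : f ≈ u → f ≈[ N ] u
  ≈⇒[] p = mk[] λ k _ → at p k

  []⇒≈ : (∀ N → f ≈[ N ] u) → f ≈ u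
  []⇒≈ p = mk≈ λ k → below (p (suc k)) k ℕP.≤-refl

  []-refl : f ≈[ N ] f
  []-refl = mk[] λ _ _ → refl

  []-sym : f ≈[ N ] u → u ≈[ N ] f
  []-sym p = mk[] λ k l → sym (below p k l)

  []-trans : f ≈[ N ] u → u ≈[ N ] h → f ≈[ N ] h
  []-trans p r = mk[] λ k l → trans (below p k l) (below r k l)

  []-mono : M ≤ N → f ≈[ N ] u → f ≈[ M ] u
  []-mono M≤N p = mk[] λ k l → below p k (ℕP.<-≤-trans l M≤N)

  []-setoid : ℕ → Setoid _ _
  []-setoid N = record { Carrier = S ; _≈_ = _≈[ N ]_
    ; isEquivalence = record { refl = []-refl ; sym = []-sym ; trans = []-trans } }

  module []-Reasoning (N : ℕ) = Relation.Binary.Reasoning.Setoid ([]-setoid N)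

  ⊠-zeroʳ : ∀ f → f ⊠ 𝟘 ≈ 𝟘
  ⊠-zeroʳ = CommutativeRing.zeroʳ S-commutativeRing

  ⊠-zeroˡ : ∀ f → 𝟘 ⊠ f ≈ 𝟘
  ⊠-zeroˡ = CommutativeRing.zeroˡ S-commutativeRing

  ⊠-identityʳ : ∀ f → f ⊠ 𝟙 ≈ f
  ⊠-identityʳ = CommutativeRing.*-identityʳ S-commutativeRing

  ⊞-identityʳ : ∀ f → f ⊞ 𝟘 ≈ f
  ⊞-identityʳ = CommutativeRing.+-identityʳ S-commutativeRing

  q^-vanish : ∀ a f → N ≤ a → q^ a ⊠ f ≈[ N ] 𝟘
  q^-vanish a f N≤a = mk[] λ k k<N → trans (q^-low a f k (ℕP.<-≤-trans k<N N≤a)) (sym (coef-𝟘 k))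

  -- To derive A ≈ B from L ≈ R it suffices to solve A + cR ≈ B + cL in the free ring.
  linear : ∀ {A B L R} c → L ≈ R → A ⊞ c ⊠ R ≈ B ⊞ c ⊠ L → A ≈ B
  linear {A} {B} {L} {R} c p e = begin
    A ≈⟨ solve 2 (λ a x → a := a :+ x :+ :- x) ≈-refl A (c ⊠ R) ⟩
    A ⊞ c ⊠ R ⊞ ⊝ (c ⊠ R) ≈⟨ ⊞-cong e ≈-refl ⟩
    B ⊞ c ⊠ L ⊞ ⊝ (c ⊠ R) ≈⟨ ⊞-cong (⊞-congʳ (⊠-congʳ p)) ≈-refl ⟩
    B ⊞ c ⊠ R ⊞ ⊝ (c ⊠ R) ≈⟨ solve 2 (λ a x → a :+ x :+ :- x := a) ≈-refl B (c ⊠ R) ⟩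
    B ∎
    where open ≈-Reasoning

  -- `invS` is total and has no meaning at a vanishing constant term, so invertibility is carried as
  -- separate evidence.
  U : S → Set
  U f = ∃ λ g → f ⊠ g ≈ 𝟙

  ⊠-invS : U f → f ⊠ invS f ≈ 𝟙
  ⊠-invS {f} (g , p) = coef-invS₀ f g p

  U-one : coef f 0 ≡ 1ℚ → U f
  U-one {f} p = invS f , invS-unit f p

  U-⊠ : U f → U u → U (f ⊠ u)
  U-⊠ {f} {u} (g , p) (v , r) = g ⊠ v , (begin
    f ⊠ u ⊠ (g ⊠ v) ≈⟨ solve 4 (λ a b c d → a :* b :* (c :* d) := a :* c :* (b :* d)) ≈-refl f u g v ⟩
    f ⊠ g ⊠ (u ⊠ v) ≈⟨ ⊠-cong p r ⟩
    𝟙 ⊠ 𝟙 ≈⟨ ⊠-identityˡ 𝟙 ⟩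
    𝟙 ∎)
    where open ≈-Reasoning

  U-cong : f ≈ u → U f → U u
  U-cong p (g , r) = g , ≈-trans (⊠-congˡ (≈-sym p)) r

  U-invS : U f → U (invS f)
  U-invS {f} u = f , ≈-trans (⊠-comm _ _) (⊠-invS u)

  U-cancel : U f → f ⊠ u ≈ f ⊠ h → u ≈ h
  U-cancel {f} {u} {h} (g , p) e = begin
    u ≈⟨ ⊠-identityˡ u ⟨
    𝟙 ⊠ u ≈⟨ ⊠-congˡ p ⟨
    f ⊠ g ⊠ u ≈⟨ solve 3 (λ a b c → a :* b :* c := b :* (a :* c)) ≈-refl f g u ⟩
    g ⊠ (f ⊠ u) ≈⟨ ⊠-congʳ e ⟩
    g ⊠ (f ⊠ h) ≈⟨ solve 3 (λ a b c → b :* (a :* c) := a :* b :* c) ≈-refl f g h ⟩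
    f ⊠ g ⊠ h ≈⟨ ⊠-congˡ p ⟩
    𝟙 ⊠ h ≈⟨ ⊠-identityˡ h ⟩
    h ∎
    where open ≈-Reasoning

  inverse-unique : f ⊠ u ≈ 𝟙 → u ≈ invS f
  inverse-unique {f} {u} p = U-cancel (u , p) (≈-trans p (≈-sym (⊠-invS (u , p))))

  invS-cong : U f → f ≈ u → invS f ≈ invS u
  invS-cong u p = inverse-unique (≈-trans (⊠-congˡ (≈-sym p)) (⊠-invS u))

  invS-⊠ : U f → U u → invS (f ⊠ u) ≈ invS f ⊠ invS u
  invS-⊠ {f} {u} p r = ≈-sym (inverse-unique (proj₂ (U-⊠ (invS f , ⊠-invS p) (invS u , ⊠-invS r))))

  -- Insert u · 1/u after 1/f and replace that u by f modulo q^N; then f cancels against 1/f and 1/u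
  -- remains.
  invS-cong[] : U f → U u → f ≈[ N ] u → invS f ≈[ N ] invS u
  invS-cong[] {f} {u} {N} p r e = begin
    invS f ≈⟨ ≈⇒[] (⊠-identityʳ (invS f)) ⟨
    invS f ⊠ 𝟙 ≈⟨ ≈⇒[] (⊠-congʳ (⊠-invS r)) ⟨
    invS f ⊠ (u ⊠ invS u) ≈⟨ ⊠-cong[] []-refl (⊠-cong[] e []-refl) ⟨
    invS f ⊠ (f ⊠ invS u) ≈⟨ ≈⇒[] (solve 3 (λ a b c → a :* (b :* c) := b :* a :* c) ≈-refl (invS f) f (invS u)) ⟩
    f ⊠ invS f ⊠ invS u ≈⟨ ≈⇒[] (⊠-congˡ (⊠-invS p)) ⟩
    𝟙 ⊠ invS u ≈⟨ ≈⇒[] (⊠-identityˡ (invS u)) ⟩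
    invS u ∎
    where open []-Reasoning N

  -- limits of sequences whose N-th term is correct modulo q^N
  lim : (ℕ → S) → S
  lim F = ser λ k → coef (F (suc k)) k

  Cauchy : (ℕ → S) → Set
  Cauchy F = ∀ N → F N ≈[ N ] F (suc N)

  Cauchy-+ : ∀ {F} → Cauchy F → ∀ N d → F N ≈[ N ] F (N + d)
  Cauchy-+ {F} c N zero    = ≈⇒[] (≡⇒≈ (cong F (sym (ℕP.+-identityʳ N))))
  Cauchy-+ {F} c N (suc d) = []-trans (Cauchy-+ c N d)
    ([]-trans ([]-mono (ℕP.m≤m+n N d) (c (N + d))) (≈⇒[] (≡⇒≈ (cong F (sym (ℕP.+-suc N d))))))

  lim-approx : ∀ {F} → Cauchy F → ∀ N → F N ≈[ N ] lim F
  lim-approx {F} c N = mk[] go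
    where
    go : ∀ k → k < N → coef (F N) k ≡ coef (F (suc k)) k
    go k k<N with ℕP.m≤n⇒∃[o]m+o≡n k<N
    ... | d , refl = sym (below (Cauchy-+ c (suc k) d) k ℕP.≤-refl)

  lim-unique : ∀ {F} → Cauchy F → (∀ N → F N ≈[ N ] f) → lim F ≈ f
  lim-unique c p = []⇒≈ λ N → []-trans ([]-sym (lim-approx c N)) (p N)

open Congruences

-- Sums over symmetric ranges of integers and their limits

module BilateralSums where

  private variable
    f : S
    N M : ℕ

  suc-neg : ∀ N → ℤ.suc -[1+ N ] ≡ ℤ.- (+ N)
  suc-neg zero    = refl
  suc-neg (suc N) = refl

  -- sum over 0 ≤ i < n
  sumS : ℕ → (ℕ → S) → S
  sumS zero    F = 𝟘
  sumS (suc n) F = sumS n F ⊞ F n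

  -- sum over -N ≤ n ≤ N
  sumZ : ℕ → (ℤ → S) → S
  sumZ zero    F = F (+ 0)
  sumZ (suc N) F = sumZ N F ⊞ (F (+ suc N) ⊞ F -[1+ N ])

  sumS-cong : ∀ n {F G : ℕ → S} → (∀ i → i < n → F i ≈ G i) → sumS n F ≈ sumS n G
  sumS-cong zero    p = ≈-refl
  sumS-cong (suc n) p = ⊞-cong (sumS-cong n (λ i l → p i (ℕP.m<n⇒m<1+n l))) (p n ℕP.≤-refl)

  sumS-cong[] : ∀ n {F G : ℕ → S} → (∀ i → i < n → F i ≈[ N ] G i) → sumS n F ≈[ N ] sumS n G
  sumS-cong[] zero    p = []-refl
  sumS-cong[] (suc n) p = ⊞-cong[] (sumS-cong[] n (λ i l → p i (ℕP.m<n⇒m<1+n l))) (p n ℕP.≤-refl)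

  sumS-⊞ : ∀ n (F G : ℕ → S) → sumS n (λ i → F i ⊞ G i) ≈ sumS n F ⊞ sumS n G
  sumS-⊞ zero    F G = ≈-sym (⊞-identityˡ 𝟘)
  sumS-⊞ (suc n) F G = ≈-trans (⊞-cong (sumS-⊞ n F G) ≈-refl)
    (solve 4 (λ a b c d → a :+ b :+ (c :+ d) := a :+ c :+ (b :+ d)) ≈-refl (sumS n F) (sumS n G) (F n) (G n))

  sumS-⊠ˡ : ∀ n c (F : ℕ → S) → sumS n (λ i → c ⊠ F i) ≈ c ⊠ sumS n F
  sumS-⊠ˡ zero    c F = ≈-sym (⊠-zeroʳ c)
  sumS-⊠ˡ (suc n) c F = ≈-trans (⊞-cong (sumS-⊠ˡ n c F) ≈-refl) (≈-sym (⊠-distribˡ c (sumS n F) (F n)))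

  sumS-head : ∀ n (F : ℕ → S) → sumS (suc n) F ≈ F 0 ⊞ sumS n (λ i → F (suc i))
  sumS-head zero    F = ⊞-comm 𝟘 (F 0)
  sumS-head (suc n) F = ≈-trans (⊞-cong (sumS-head n F) ≈-refl) (⊞-assoc (F 0) _ _)

  sumZ-cong : ∀ N {F G : ℤ → S} → (∀ n → ∣ n ∣ ≤ N → F n ≈ G n) → sumZ N F ≈ sumZ N G
  sumZ-cong zero    p = p (+ 0) z≤n
  sumZ-cong (suc N) p = ⊞-cong (sumZ-cong N (λ n l → p n (ℕP.m≤n⇒m≤1+n l)))
    (⊞-cong (p (+ suc N) ℕP.≤-refl) (p -[1+ N ] ℕP.≤-refl))

  sumZ-cong[] : ∀ N {F G : ℤ → S} → (∀ n → ∣ n ∣ ≤ N → F n ≈[ M ] G n) → sumZ N F ≈[ M ] sumZ N G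
  sumZ-cong[] zero    p = p (+ 0) z≤n
  sumZ-cong[] (suc N) p = ⊞-cong[] (sumZ-cong[] N (λ n l → p n (ℕP.m≤n⇒m≤1+n l)))
    (⊞-cong[] (p (+ suc N) ℕP.≤-refl) (p -[1+ N ] ℕP.≤-refl))

  sumZ-⊞ : ∀ N (F G : ℤ → S) → sumZ N (λ n → F n ⊞ G n) ≈ sumZ N F ⊞ sumZ N G
  sumZ-⊞ zero    F G = ≈-refl
  sumZ-⊞ (suc N) F G = ≈-trans (⊞-cong (sumZ-⊞ N F G) ≈-refl)
    (solve 6 (λ a b c d e f → a :+ b :+ (c :+ d :+ (e :+ f)) := a :+ (c :+ e) :+ (b :+ (d :+ f))) ≈-refl
      (sumZ N F) (sumZ N G) (F (+ suc N)) (G (+ suc N)) (F -[1+ N ]) (G -[1+ N ]))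

  sumZ-⊠ˡ : ∀ N c (F : ℤ → S) → sumZ N (λ n → c ⊠ F n) ≈ c ⊠ sumZ N F
  sumZ-⊠ˡ zero    c F = ≈-refl
  sumZ-⊠ˡ (suc N) c F = ≈-trans (⊞-cong (sumZ-⊠ˡ N c F) ≈-refl)
    (solve 4 (λ c a x y → c :* a :+ (c :* x :+ c :* y) := c :* (a :+ (x :+ y))) ≈-refl
      c (sumZ N F) (F (+ suc N)) (F -[1+ N ]))

  sumZ-⊠ʳ : ∀ N c (F : ℤ → S) → sumZ N (λ n → F n ⊠ c) ≈ sumZ N F ⊠ c
  sumZ-⊠ʳ N c F = ≈-trans (sumZ-cong N (λ n _ → ⊠-comm (F n) c)) (≈-trans (sumZ-⊠ˡ N c F) (⊠-comm c _))

  sumZ-zero : ∀ N {F : ℤ → S} → (∀ n → ∣ n ∣ ≤ N → F n ≈ 𝟘) → sumZ N F ≈ 𝟘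
  sumZ-zero zero    p = p (+ 0) z≤n
  sumZ-zero (suc N) p = ≈-trans (⊞-cong (sumZ-zero N (λ n l → p n (ℕP.m≤n⇒m≤1+n l)))
    (⊞-cong (p (+ suc N) ℕP.≤-refl) (p -[1+ N ] ℕP.≤-refl))) (≈-trans (⊞-identityˡ _) (⊞-identityˡ _))

  sumZ-swap : ∀ N M (F : ℤ → ℤ → S) → sumZ N (λ n → sumZ M (F n)) ≈ sumZ M (λ m → sumZ N (λ n → F n m))
  sumZ-swap zero    M F = ≈-refl
  sumZ-swap (suc N) M F = ≈-trans (⊞-cong (sumZ-swap N M F) (≈-sym (sumZ-⊞ M (F (+ suc N)) (F -[1+ N ]))))
    (≈-sym (sumZ-⊞ M _ _))

  sumS-sumZ-swap : ∀ N M (F : ℕ → ℤ → S) → sumS N (λ n → sumZ M (F n)) ≈ sumZ M (λ m → sumS N (λ n → F n m))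
  sumS-sumZ-swap zero    M F = ≈-sym (sumZ-zero M (λ _ _ → ≈-refl))
  sumS-sumZ-swap (suc N) M F = ≈-trans (⊞-cong (sumS-sumZ-swap N M F) ≈-refl) (≈-sym (sumZ-⊞ M _ _))

  sumZ-neg : ∀ N (F : ℤ → S) → sumZ N (λ n → F (ℤ.- n)) ≈ sumZ N F
  sumZ-neg zero    F = ≈-refl
  sumZ-neg (suc N) F = ⊞-cong (sumZ-neg N F) (⊞-comm _ _)

  -- The shifted window is [1 - N, N + 1]: compared with [-N, N] it loses -N and gains N + 1.
  sumZ-suc : ∀ N (F : ℤ → S) → sumZ N (λ n → F (ℤ.suc n)) ⊞ F (ℤ.- (+ N)) ≈ sumZ N F ⊞ F (+ suc N)
  sumZ-suc zero    F = ⊞-comm _ _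
  sumZ-suc (suc N) F = begin
    sumZ N F′ ⊞ (F (+ suc (suc N)) ⊞ F (ℤ.suc -[1+ N ])) ⊞ F -[1+ N ]
      ≈⟨ ⊞-cong (⊞-congʳ (⊞-congʳ (≡⇒≈ (cong F (suc-neg N))))) ≈-refl ⟩
    sumZ N F′ ⊞ (F (+ suc (suc N)) ⊞ F (ℤ.- (+ N))) ⊞ F -[1+ N ]
      ≈⟨ linear 𝟙 (sumZ-suc N F) (solve 6 (λ s x y z t w → s :+ (x :+ y) :+ z :+ :1 :* (t :+ w)
           := t :+ (w :+ z) :+ x :+ :1 :* (s :+ y)) ≈-refl
           (sumZ N F′) (F (+ suc (suc N))) (F (ℤ.- (+ N))) (F -[1+ N ]) (sumZ N F) (F (+ suc N))) ⟩
    sumZ N F ⊞ (F (+ suc N) ⊞ F -[1+ N ]) ⊞ F (+ suc (suc N)) ∎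
    where
    open ≈-Reasoning
    F′ = λ n → F (ℤ.suc n)

  sumZ-extend : ∀ N d {F : ℤ → S} → (∀ n → N < ∣ n ∣ → F n ≈ 𝟘) → sumZ (d + N) F ≈ sumZ N F
  sumZ-extend N zero    p = ≈-refl
  sumZ-extend N (suc d) p = ≈-trans (⊞-cong (sumZ-extend N d p)
    (≈-trans (⊞-cong (p (+ suc (d + N)) l) (p -[1+ d + N ] l)) (⊞-identityˡ 𝟘))) (⊞-identityʳ _)
    where
    l : N < suc (d + N)
    l = s≤s (ℕP.m≤n+m N d)

  -- For |n| ≤ N the numbers 2n fill the even part of the window, while 2n + 1 runs from 1 - 2N to
  -- 2N + 1 and misses only -(2N + 1).
  sumZ-parity : ∀ N (F : ℤ → S) → sumZ (suc (N + N)) F ≈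
    sumZ N (λ n → F (n ℤ.+ n)) ⊞ sumZ N (λ n → F (ℤ.suc (n ℤ.+ n))) ⊞ F -[1+ N + N ]
  sumZ-parity zero    F = ≈-sym (⊞-assoc _ _ _)
  sumZ-parity (suc N) F rewrite ℕP.+-suc N N = linear 𝟙 (sumZ-parity N F)
    (solve 8 (λ s a b x y z t w → s :+ (x :+ y) :+ (z :+ t) :+ :1 :* (a :+ b :+ w)
           := (a :+ (x :+ y)) :+ (b :+ (z :+ w)) :+ t :+ :1 :* s) ≈-refl
     (sumZ (suc (N + N)) F) (sumZ N (λ n → F (n ℤ.+ n))) (sumZ N (λ n → F (ℤ.suc (n ℤ.+ n))))
     (F (+ suc (suc (N + N)))) (F -[1+ suc (N + N) ]) (F (+ suc (suc (suc (N + N))))) (F -[1+ suc (suc (N + N)) ]) (F -[1+ N + N ]))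

  -- Divisibility of the n-th term by q^(|n| - 1). The loss of one order is forced by the weights: b
  -- n(n + 1)/2 vanishes at n = -1.
  Tame : (ℤ → S) → Set
  Tame F = ∀ N n → N < ∣ n ∣ → F n ≈[ N ] 𝟘

  ∑ℤ : (ℤ → S) → S
  ∑ℤ F = lim (λ N → sumZ N F)

  sumZ-Cauchy : ∀ {F} → Tame F → Cauchy (λ N → sumZ N F)
  sumZ-Cauchy {F} t N = []-sym ([]-trans
    (⊞-cong[] []-refl (⊞-cong[] (t N (+ suc N) ℕP.≤-refl) (t N -[1+ N ] ℕP.≤-refl)))
    (≈⇒[] (≈-trans (⊞-congʳ (⊞-identityˡ 𝟘)) (⊞-identityʳ _))))

  ∑-approx : ∀ {F} → Tame F → ∀ N → sumZ N F ≈[ N ] ∑ℤ F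
  ∑-approx t = lim-approx (sumZ-Cauchy t)

  ∑-unique : ∀ {F} → Tame F → (∀ N → sumZ N F ≈[ N ] f) → ∑ℤ F ≈ f
  ∑-unique t = lim-unique (sumZ-Cauchy t)

  ∑-cong : ∀ {F G} → Tame F → Tame G → (∀ n → F n ≈ G n) → ∑ℤ F ≈ ∑ℤ G
  ∑-cong t t′ p = ∑-unique t λ N → []-trans (≈⇒[] (sumZ-cong N λ n _ → p n)) (∑-approx t′ N)

  Tame-⊞ : ∀ {F G} → Tame F → Tame G → Tame (λ n → F n ⊞ G n)
  Tame-⊞ t t′ N n l = []-trans (⊞-cong[] (t N n l) (t′ N n l)) (≈⇒[] (⊞-identityˡ 𝟘))

  Tame-⊠ˡ : ∀ {F} (c : ℤ → S) → Tame F → Tame (λ n → c n ⊠ F n)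
  Tame-⊠ˡ c t N n l = []-trans (⊠-cong[] []-refl (t N n l)) (≈⇒[] (⊠-zeroʳ (c n)))

  Tame-⊠ʳ : ∀ {F} (c : ℤ → S) → Tame F → Tame (λ n → F n ⊠ c n)
  Tame-⊠ʳ c t N n l = []-trans (⊠-cong[] (t N n l) []-refl) (≈⇒[] (⊠-zeroˡ (c n)))

  Tame-cong : ∀ {F G} → (∀ n → F n ≈ G n) → Tame F → Tame G
  Tame-cong p t N n l = []-trans (≈⇒[] (≈-sym (p n))) (t N n l)

  ∑-⊞ : ∀ {F G} → Tame F → Tame G → ∑ℤ (λ n → F n ⊞ G n) ≈ ∑ℤ F ⊞ ∑ℤ G
  ∑-⊞ {F} {G} t t′ = ∑-unique (Tame-⊞ t t′) λ N →
    []-trans (≈⇒[] (sumZ-⊞ N F G)) (⊞-cong[] (∑-approx t N) (∑-approx t′ N))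

  ∑-⊠ˡ : ∀ c {F} → Tame F → ∑ℤ (λ n → c ⊠ F n) ≈ c ⊠ ∑ℤ F
  ∑-⊠ˡ c {F} t = ∑-unique (Tame-⊠ˡ (λ _ → c) t) λ N →
    []-trans (≈⇒[] (sumZ-⊠ˡ N c F)) (⊠-cong[] []-refl (∑-approx t N))

  -- Both sums are cut at N + 1, where the two boundary terms of the shift vanish modulo q^N.
  ∑-suc : ∀ {F} → Tame F → Tame (λ n → F (ℤ.suc n)) → ∑ℤ (λ n → F (ℤ.suc n)) ≈ ∑ℤ F
  ∑-suc {F} t t′ = []⇒≈ λ N → []-trans ([]-sym (∑-approx′ t′ N)) ([]-trans (step N) (∑-approx′ t N))
    where
    ∑-approx′ : ∀ {F} → Tame F → ∀ N → sumZ (suc N) F ≈[ N ] ∑ℤ F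
    ∑-approx′ t N = []-mono (ℕP.n≤1+n N) (∑-approx t (suc N))
    step : ∀ N → sumZ (suc N) (λ n → F (ℤ.suc n)) ≈[ N ] sumZ (suc N) F
    step N = begin
      sumZ (suc N) (λ n → F (ℤ.suc n)) ≈⟨ ≈⇒[] (⊞-identityʳ _) ⟨
      sumZ (suc N) (λ n → F (ℤ.suc n)) ⊞ 𝟘 ≈⟨ ⊞-cong[] []-refl (t N -[1+ N ] ℕP.≤-refl) ⟨
      sumZ (suc N) (λ n → F (ℤ.suc n)) ⊞ F -[1+ N ] ≈⟨ ≈⇒[] (sumZ-suc (suc N) F) ⟩
      sumZ (suc N) F ⊞ F (+ suc (suc N)) ≈⟨ ⊞-cong[] []-refl (t N (+ suc (suc N)) (ℕP.n≤1+n (suc N))) ⟩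
      sumZ (suc N) F ⊞ 𝟘 ≈⟨ ≈⇒[] (⊞-identityʳ _) ⟩
      sumZ (suc N) F ∎
      where open []-Reasoning N

  Tame-neg : ∀ {F} → Tame F → Tame (λ n → F (ℤ.- n))
  Tame-neg t N n l = t N (ℤ.- n) (subst (N <_) (sym (ℤP.∣-i∣≡∣i∣ n)) l)

  ∑-neg : ∀ {F} → Tame F → ∑ℤ (λ n → F (ℤ.- n)) ≈ ∑ℤ F
  ∑-neg {F} t = ∑-unique (Tame-neg t) λ N → []-trans (≈⇒[] (sumZ-neg N F)) (∑-approx t N)

  ∑-parity : ∀ {F} → Tame F → Tame (λ n → F (n ℤ.+ n)) → Tame (λ n → F (ℤ.suc (n ℤ.+ n))) →
    ∑ℤ F ≈ ∑ℤ (λ n → F (n ℤ.+ n)) ⊞ ∑ℤ (λ n → F (ℤ.suc (n ℤ.+ n)))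
  ∑-parity {F} t t₀ t₁ = []⇒≈ λ N → []-trans
    ([]-sym ([]-mono (ℕP.m≤n⇒m≤1+n (ℕP.m≤m+n N N)) (∑-approx t (suc (N + N)))))
    ([]-trans (≈⇒[] (sumZ-parity N F))
    ([]-trans (⊞-cong[] (⊞-cong[] (∑-approx t₀ N) (∑-approx t₁ N)) (t N -[1+ N + N ] (s≤s (ℕP.m≤m+n N N))))
    (≈⇒[] (⊞-identityʳ _))))

open BilateralSums

-- The q-Pascal recurrence behind the finite triple product

module QBinomial where

  ℤ-minus : ∀ a k j → + j ≡ + a ℤ.- + k → a ≡ k + j
  ℤ-minus a k j e = ℤP.+-injective (trans (lem (+ a) (+ k)) (cong (λ t → + k ℤ.+ t) (sym e)))
    where
    lem : ∀ a k → a ≡ k ℤ.+ (a ℤ.- k)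
    lem = ℤ-solve

  -- tri n = n (n - 1) / 2
  tri : ℕ → ℕ
  tri zero    = 0
  tri (suc n) = n + tri n

  -- E α β n = (α + β) n (n - 1) / 2 + α n
  E : ℕ → ℕ → ℤ → ℕ
  E α β (+ n)    = (α + β) * tri n + α * n
  E α β -[1+ n ] = (α + β) * tri (suc n) + β * suc n

  pow : S → ℕ → S
  pow η zero    = 𝟙
  pow η (suc n) = η ⊠ pow η n

  -- General term of the Jacobi triple product in base q^(α + β). As η = ±1 in all uses, the power
  -- with exponent |n| is η^n.
  θ : S → ℕ → ℕ → ℤ → S
  θ η α β n = pow η ∣ n ∣ ⊠ q^ (E α β n)

  -- (q^b ; q^b)_n
  qf : ℕ → ℕ → S
  qf b zero    = 𝟙
  qf b (suc n) = qf b n ⊠ (𝟙 ⊟ q^ (b * suc n))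

  -- (-η q^α ; q^b)_n
  pp : S → ℕ → ℕ → ℕ → S
  pp η α b zero    = 𝟙
  pp η α b (suc n) = pp η α b n ⊠ (𝟙 ⊞ η ⊠ q^ (α + b * n))

  opaque
    unfolding _⊞_
    coef₀-1-cq^ : ∀ c a → 1 ≤ a → coef (𝟙 ⊞ c ⊠ q^ a) 0 ≡ 1ℚ
    coef₀-1-cq^ c (suc a) _ = trans (cong (1ℚ ℚ.+_) (ℚP.*-zeroʳ (coef c 0))) refl

  U-𝟙 : U 𝟙
  U-𝟙 = 𝟙 , ⊠-identityˡ 𝟙

  U-1+cq^ : ∀ c {a} → 1 ≤ a → U (𝟙 ⊞ c ⊠ q^ a)
  U-1+cq^ c {a} l = U-one (coef₀-1-cq^ c a l)

  ⊝-as-⊠ : ∀ f → ⊝ f ≈ ⊝ 𝟙 ⊠ f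
  ⊝-as-⊠ f = solve 1 (λ x → :- x := :- :1 :* x) ≈-refl f

  U-1-q^ : ∀ {a} → 1 ≤ a → U (𝟙 ⊟ q^ a)
  U-1-q^ {a} l = U-cong (⊞-congʳ (≈-sym (⊝-as-⊠ (q^ a)))) (U-1+cq^ (⊝ 𝟙) l)

  1≤b*suc : ∀ {b} n → 1 ≤ b → 1 ≤ b * suc n
  1≤b*suc {suc b} n _ = s≤s z≤n

  U-qf : ∀ {b} n → 1 ≤ b → U (qf b n)
  U-qf zero    l = U-𝟙
  U-qf (suc n) l = U-⊠ (U-qf n l) (U-1-q^ (1≤b*suc n l))

  -- 1/(q^b ; q^b)_n with the usual convention 0 for n < 0, which gives bilateral sums finite
  -- support and removes boundary cases from recurrences.
  I : ℕ → ℤ → S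
  I b (+ n)    = invS (qf b n)
  I b -[1+ n ] = 𝟘

  -- At n = 0 the factor 1 - q^0 vanishes, in agreement with the convention at -1.
  I-step : ∀ {b} → 1 ≤ b → ∀ n → (𝟙 ⊟ q^ (b * n)) ⊠ I b (+ n) ≈ I b (ℤ.pred (+ n))
  I-step {b} l zero    = ≈-trans (⊠-congˡ (≈-trans (⊞-congʳ (⊝-cong (≈-trans (q^-≡ (ℕP.*-zeroʳ b)) q^-0)))
    (solve 0 (:1 :- :1 := :0) ≈-refl))) (⊠-zeroˡ _)
  I-step {b} l (suc n) = inverse-unique (≈-trans
    (solve 3 (λ a x v → a :* (x :* v) := a :* x :* v) ≈-refl (qf b n) (𝟙 ⊟ q^ (b * suc n)) (invS (qf b (suc n))))
    (⊠-invS (U-qf (suc n) l)))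

  E-neg : ∀ α β n → E α β (ℤ.- n) ≡ E β α n
  E-neg α β (+ zero)  rewrite ℕP.+-comm α β | ℕP.*-zeroʳ α | ℕP.*-zeroʳ β = refl
  E-neg α β (+ suc n) rewrite ℕP.+-comm α β = refl
  E-neg α β -[1+ n ]  rewrite ℕP.+-comm α β = refl

  θ-neg : ∀ η α β n → θ η α β (ℤ.- n) ≈ θ η β α n
  θ-neg η α β n = ⊠-cong (≡⇒≈ (cong (pow η) (ℤP.∣-i∣≡∣i∣ n))) (q^-≡ (E-neg α β n))

  -- With Q = q^b, `W K a d` is the q-binomial expansion of a product of a + d factors, divided by
  -- (Q)_(a+d). The cutoff `K` is independent of a and d so that recurrences compare sums over one
  -- range.
  module Wsum (η : S) (η²≈1 : η ⊠ η ≈ 𝟙) (α β : ℕ) (b≥1 : 1 ≤ α + β) where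
    open ≈-Reasoning
    b = α + β

    w : ℤ → S
    w = θ η α β

    -- the exponents b j + E(n+1) and α + b a + E(n) agree when n = a - j
    w-suc : ∀ a j n → + j ≡ + a ℤ.- n → q^ (b * j) ⊠ w (ℤ.suc n) ≈ η ⊠ q^ (α + b * a) ⊠ w n
    w-suc a j (+ k) e = begin
      q^ (b * j) ⊠ (η ⊠ pow η k ⊠ q^ (E α β (+ suc k)))
        ≈⟨ solve 4 (λ x h p y → x :* (h :* p :* y) := h :* p :* (x :* y)) ≈-refl (q^ (b * j)) η (pow η k) (q^ (E α β (+ suc k))) ⟩
      η ⊠ pow η k ⊠ (q^ (b * j) ⊠ q^ (E α β (+ suc k)))
        ≈⟨ ⊠-congʳ (≈-trans (≈-sym (q^-+ _ _)) (≈-trans (q^-≡ ex) (q^-+ _ _))) ⟩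
      η ⊠ pow η k ⊠ (q^ (α + b * a) ⊠ q^ (E α β (+ k)))
        ≈⟨ solve 4 (λ x h p y → h :* p :* (x :* y) := h :* x :* (p :* y)) ≈-refl (q^ (α + b * a)) η (pow η k) (q^ (E α β (+ k))) ⟩
      η ⊠ q^ (α + b * a) ⊠ (pow η k ⊠ q^ (E α β (+ k))) ∎
      where
      a≡ : a ≡ k + j
      a≡ = ℤ-minus a k j e
      ex : b * j + E α β (+ suc k) ≡ α + b * a + E α β (+ k)
      ex rewrite a≡ = lem α β j k (tri k)
        where
        lem : ∀ α β j k t → (α + β) * j + ((α + β) * (k + t) + α * suc k) ≡ α + (α + β) * (k + j) + ((α + β) * t + α * k)
        lem = ℕ-solve
    w-suc a j -[1+ k ] e = begin
      q^ (b * j) ⊠ w (ℤ.suc -[1+ k ])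
        ≈⟨ ⊠-congʳ (≈-trans (≡⇒≈ (cong w (suc-neg k))) (θ-neg η α β (+ k))) ⟩
      q^ (b * j) ⊠ (pow η k ⊠ q^ (E β α (+ k)))
        ≈⟨ solve 3 (λ x p y → x :* (p :* y) := p :* (x :* y)) ≈-refl (q^ (b * j)) (pow η k) (q^ (E β α (+ k))) ⟩
      pow η k ⊠ (q^ (b * j) ⊠ q^ (E β α (+ k)))
        ≈⟨ ⊠-congʳ (≈-trans (≈-sym (q^-+ _ _)) (≈-trans (q^-≡ ex) (q^-+ _ _))) ⟩
      pow η k ⊠ (q^ (α + b * a) ⊠ q^ (E α β -[1+ k ]))
        ≈⟨ ⊠-identityˡ _ ⟨
      𝟙 ⊠ (pow η k ⊠ (q^ (α + b * a) ⊠ q^ (E α β -[1+ k ])))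
        ≈⟨ ⊠-congˡ η²≈1 ⟨
      η ⊠ η ⊠ (pow η k ⊠ (q^ (α + b * a) ⊠ q^ (E α β -[1+ k ])))
        ≈⟨ solve 4 (λ p x y h → h :* h :* (p :* (x :* y)) := h :* x :* (h :* p :* y)) ≈-refl
             (pow η k) (q^ (α + b * a)) (q^ (E α β -[1+ k ])) η ⟩
      η ⊠ q^ (α + b * a) ⊠ (η ⊠ pow η k ⊠ q^ (E α β -[1+ k ])) ∎
      where
      ex : b * j + E β α (+ k) ≡ α + b * a + E α β -[1+ k ]
      ex rewrite ℤP.+-injective e = lem α β a k (tri k)
        where
        lem : ∀ α β a k t → (α + β) * (a + suc k) + ((β + α) * t + β * k) ≡ α + (α + β) * a + ((α + β) * (k + t) + β * suc k)
        lem = ℕ-solve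

    c : ℕ → ℕ → ℤ → S
    c a d n = I b (+ a ℤ.- n) ⊠ I b (+ d ℤ.+ n)

    W : ℕ → ℕ → ℕ → S
    W K a d = sumZ K (λ n → w n ⊠ c a d n)

    -- the second half of the q-Pascal rule; the exponent is only meaningful when a + 1 - n ≥ 0
    G : ℕ → ℕ → ℤ → S
    G a d n = q^ (b * ∣ + suc a ℤ.- n ∣) ⊠ w n ⊠ (I b (+ suc a ℤ.- n) ⊠ I b (ℤ.pred (+ d ℤ.+ n)))

    -- 1 - Q^(x+y) = (1 - Q^x) + Q^x (1 - Q^y) with Q = q^b. If x or y is negative, every term is 0
    -- by the convention for `I`.
    pascal : ∀ a d x y → + suc (a + d) ≡ x ℤ.+ y →
      (𝟙 ⊟ q^ (b * suc (a + d))) ⊠ (I b x ⊠ I b y) ≈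
      I b (ℤ.pred x) ⊠ I b y ⊞ q^ (b * ∣ x ∣) ⊠ (I b x ⊠ I b (ℤ.pred y))
    pascal a d (+ x) (+ y) e = begin
      (𝟙 ⊟ q^ (b * suc (a + d))) ⊠ (X ⊠ Y)
        ≈⟨ ⊠-congˡ (⊞-congʳ (⊝-cong (≈-trans (q^-≡ (trans (cong (b *_) (ℤP.+-injective e)) (ℕP.*-distribˡ-+ b x y))) (q^-+ _ _)))) ⟩
      (𝟙 ⊟ q^ (b * x) ⊠ q^ (b * y)) ⊠ (X ⊠ Y)
        ≈⟨ solve 4 (λ A B X Y → (:1 :- A :* B) :* (X :* Y) := ((:1 :- A) :* X) :* Y :+ A :* (X :* ((:1 :- B) :* Y))) ≈-refl (q^ (b * x)) (q^ (b * y)) X Y ⟩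
      (𝟙 ⊟ q^ (b * x)) ⊠ X ⊠ Y ⊞ q^ (b * x) ⊠ (X ⊠ ((𝟙 ⊟ q^ (b * y)) ⊠ Y))
        ≈⟨ ⊞-cong (⊠-congˡ (I-step b≥1 x)) (⊠-congʳ (⊠-congʳ (I-step b≥1 y))) ⟩
      I b (ℤ.pred (+ x)) ⊠ Y ⊞ q^ (b * x) ⊠ (X ⊠ I b (ℤ.pred (+ y))) ∎
      where
      X = I b (+ x)
      Y = I b (+ y)
    pascal a d -[1+ x ] y e =
      solve 4 (λ A B Y Z → A :* (:0 :* Y) := :0 :* Y :+ B :* (:0 :* Z)) ≈-refl _ _ _ _
    pascal a d (+ x) -[1+ y ] e =
      solve 4 (λ A B X Z → A :* (X :* :0) := Z :* :0 :+ B :* (X :* :0)) ≈-refl _ _ _ _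

    term-split : ∀ a d n → (𝟙 ⊟ q^ (b * suc (a + d))) ⊠ (w n ⊠ c (suc a) d n) ≈ w n ⊠ c a d n ⊞ G a d n
    term-split a d n = begin
      (𝟙 ⊟ q^ (b * suc (a + d))) ⊠ (w n ⊠ c (suc a) d n)
        ≈⟨ solve 3 (λ x y z → x :* (y :* z) := y :* (x :* z)) ≈-refl _ _ _ ⟩
      w n ⊠ ((𝟙 ⊟ q^ (b * suc (a + d))) ⊠ c (suc a) d n)
        ≈⟨ ⊠-congʳ (pascal a d (+ suc a ℤ.- n) (+ d ℤ.+ n) (lem₁ (+ a) (+ d) n)) ⟩
      w n ⊠ (I b (ℤ.pred (+ suc a ℤ.- n)) ⊠ I b (+ d ℤ.+ n) ⊞ q^ (b * ∣ + suc a ℤ.- n ∣) ⊠ (I b (+ suc a ℤ.- n) ⊠ I b (ℤ.pred (+ d ℤ.+ n))))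
        ≈⟨ solve 4 (λ w x y z → w :* (x :+ y :* z) := w :* x :+ y :* w :* z) ≈-refl _ _ _ _ ⟩
      w n ⊠ (I b (ℤ.pred (+ suc a ℤ.- n)) ⊠ I b (+ d ℤ.+ n)) ⊞ G a d n
        ≈⟨ ⊞-cong (⊠-congʳ (⊠-congˡ (≡⇒≈ (cong (I b) (lem₂ (+ a) n))))) ≈-refl ⟩
      w n ⊠ c a d n ⊞ G a d n ∎
      where
      lem₁ : ∀ a d n → + 1 ℤ.+ (a ℤ.+ d) ≡ (+ 1 ℤ.+ a ℤ.- n) ℤ.+ (d ℤ.+ n)
      lem₁ = ℤ-solve
      lem₂ : ∀ a n → ℤ.- (+ 1) ℤ.+ (+ 1 ℤ.+ a ℤ.- n) ≡ a ℤ.- n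
      lem₂ = ℤ-solve

    -- The shift n ↦ n + 1 restores the denominators of `c a d`, and the power of q in `G` absorbs
    -- the ratio of consecutive weights.
    G-suc : ∀ a d n → G a d (ℤ.suc n) ≈ η ⊠ q^ (α + b * a) ⊠ (w n ⊠ c a d n)
    G-suc a d n = begin
      G a d (ℤ.suc n)
        ≈⟨ ≡⇒≈ (cong₂ (λ x y → q^ (b * ∣ x ∣) ⊠ w (ℤ.suc n) ⊠ (I b x ⊠ I b y)) (lem₁ (+ a) n) (lem₂ (+ d) n)) ⟩
      q^ (b * ∣ + a ℤ.- n ∣) ⊠ w (ℤ.suc n) ⊠ (I b (+ a ℤ.- n) ⊠ I b (+ d ℤ.+ n))
        ≈⟨ go (+ a ℤ.- n) refl ⟩
      η ⊠ q^ (α + b * a) ⊠ (w n ⊠ c a d n) ∎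
      where
      lem₁ : ∀ a n → + 1 ℤ.+ a ℤ.- (+ 1 ℤ.+ n) ≡ a ℤ.- n
      lem₁ = ℤ-solve
      lem₂ : ∀ d n → ℤ.- (+ 1) ℤ.+ (d ℤ.+ (+ 1 ℤ.+ n)) ≡ d ℤ.+ n
      lem₂ = ℤ-solve
      go : ∀ x → x ≡ + a ℤ.- n → q^ (b * ∣ x ∣) ⊠ w (ℤ.suc n) ⊠ (I b x ⊠ I b (+ d ℤ.+ n)) ≈
           η ⊠ q^ (α + b * a) ⊠ (w n ⊠ (I b x ⊠ I b (+ d ℤ.+ n)))
      go (+ j) e = ≈-trans (⊠-congˡ (w-suc a j n e)) (⊠-assoc _ _ _)
      go -[1+ j ] e = solve 5 (λ x y z t w → x :* y :* (:0 :* z) := t :* (w :* (:0 :* z))) ≈-refl _ _ _ _ _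

    I-neg : ∀ {x} k → x ≡ -[1+ k ] → I b x ≈ 𝟘
    I-neg k refl = ≈-refl

    -- The q-Pascal rule splits the sum into the one for `a` and a shifted multiple of it; the
    -- bounds on `a` and `d` put both boundary terms of the shift outside the support of `G`.
    W-step : ∀ K a d → a < K → d ≤ K →
      (𝟙 ⊟ q^ (b * suc (a + d))) ⊠ W K (suc a) d ≈ (𝟙 ⊞ η ⊠ q^ (α + b * a)) ⊠ W K a d
    W-step K a d a<K d≤K = begin
      (𝟙 ⊟ q^ (b * suc (a + d))) ⊠ W K (suc a) d ≈⟨ sumZ-⊠ˡ K _ _ ⟨
      sumZ K (λ n → (𝟙 ⊟ q^ (b * suc (a + d))) ⊠ (w n ⊠ c (suc a) d n)) ≈⟨ sumZ-cong K (λ n _ → term-split a d n) ⟩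
      sumZ K (λ n → w n ⊠ c a d n ⊞ G a d n) ≈⟨ sumZ-⊞ K _ _ ⟩
      W K a d ⊞ sumZ K (G a d) ≈⟨ ⊞-congʳ (⊞-identityʳ _) ⟨
      W K a d ⊞ (sumZ K (G a d) ⊞ 𝟘) ≈⟨ ⊞-congʳ (⊞-congʳ G-top) ⟨
      W K a d ⊞ (sumZ K (G a d) ⊞ G a d (+ suc K)) ≈⟨ ⊞-congʳ (sumZ-suc K (G a d)) ⟨
      W K a d ⊞ (sumZ K (λ n → G a d (ℤ.suc n)) ⊞ G a d (ℤ.- (+ K)))
        ≈⟨ ⊞-congʳ (⊞-cong (≈-trans (sumZ-cong K (λ n _ → G-suc a d n)) (sumZ-⊠ˡ K _ _)) G-bot) ⟩
      W K a d ⊞ (η ⊠ q^ (α + b * a) ⊠ W K a d ⊞ 𝟘)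
        ≈⟨ solve 2 (λ x v → v :+ (x :* v :+ :0) := (:1 :+ x) :* v) ≈-refl _ _ ⟩
      (𝟙 ⊞ η ⊠ q^ (α + b * a)) ⊠ W K a d ∎
      where
      G-top : G a d (+ suc K) ≈ 𝟘
      G-top with ℕP.m≤n⇒∃[o]m+o≡n a<K
      ... | k , refl = ≈-trans (⊠-congʳ (⊠-congˡ (I-neg k (lem (+ a) (+ k)))))
        (solve 2 (λ x y → x :* (:0 :* y) := :0) ≈-refl _ _)
        where
        lem : ∀ a k → + 1 ℤ.+ a ℤ.- (+ 1 ℤ.+ (+ 1 ℤ.+ (a ℤ.+ k))) ≡ ℤ.- (+ 1 ℤ.+ k)
        lem = ℤ-solve
      G-bot : G a d (ℤ.- (+ K)) ≈ 𝟘
      G-bot with ℕP.m≤n⇒∃[o]m+o≡n d≤K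
      ... | k , refl = ≈-trans (⊠-congʳ (⊠-congʳ (I-neg k (lem (+ d) (+ k)))))
        (solve 2 (λ x y → x :* (y :* :0) := :0) ≈-refl _ _)
        where
        lem : ∀ d k → ℤ.- (+ 1) ℤ.+ (d ℤ.+ ℤ.- (d ℤ.+ k)) ≡ ℤ.- (+ 1 ℤ.+ k)
        lem = ℤ-solve

open QBinomial

-- Finite triple product and finite partial fractions

module FinitePartialFractions where

  private variable
    N M : ℕ

  invS-𝟙 : invS 𝟙 ≈ 𝟙
  invS-𝟙 = ≈-sym (inverse-unique (⊠-identityˡ 𝟙))

  θ-0 : ∀ η α β → θ η α β (+ 0) ≈ 𝟙
  θ-0 η α β = ≈-trans (⊠-identityˡ _) (≈-trans (q^-≡ (lem α β)) q^-0)
    where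
    lem : ∀ α β → (α + β) * 0 + α * 0 ≡ 0
    lem = ℕ-solve

  module _ (η : S) (η²≈1 : η ⊠ η ≈ 𝟙) where
    open ≈-Reasoning

    module _ (α β : ℕ) (b≥1 : 1 ≤ α + β) (b′≥1 : 1 ≤ β + α) where
      private
        module A = Wsum η η²≈1 α β b≥1
        module B = Wsum η η²≈1 β α b′≥1

      -- The substitution n ↦ -n. It turns the recurrence in a into one in d.
      W-sym : ∀ K a d → A.W K a d ≈ B.W K d a
      W-sym K a d = ≈-trans (≈-sym (sumZ-neg K _)) (sumZ-cong K λ n _ → ⊠-cong (θ-neg η α β n) (begin
        I (α + β) (+ a ℤ.- (ℤ.- n)) ⊠ I (α + β) (+ d ℤ.+ ℤ.- n)
          ≈⟨ ≡⇒≈ (cong₂ (λ s t → I s t ⊠ I s (+ d ℤ.+ ℤ.- n)) (ℕP.+-comm α β) (cong (λ t → + a ℤ.+ t) (ℤP.neg-involutive n))) ⟩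
        I (β + α) (+ a ℤ.+ n) ⊠ I (β + α) (+ d ℤ.- n) ≈⟨ ⊠-comm _ _ ⟩
        I (β + α) (+ d ℤ.- n) ⊠ I (β + α) (+ a ℤ.+ n) ∎))

      W-00 : ∀ K → A.W K 0 0 ≈ 𝟙
      W-00 K = begin
        A.W K 0 0 ≈⟨ ≡⇒≈ (cong (λ k → A.W k 0 0) (ℕP.+-identityʳ K)) ⟨
        A.W (K + 0) 0 0 ≈⟨ sumZ-extend 0 K vanish ⟩
        A.w (+ 0) ⊠ (invS 𝟙 ⊠ invS 𝟙) ≈⟨ ⊠-cong (θ-0 η α β) (⊠-cong invS-𝟙 invS-𝟙) ⟩
        𝟙 ⊠ (𝟙 ⊠ 𝟙) ≈⟨ solve 0 (:1 :* (:1 :* :1) := :1) ≈-refl ⟩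
        𝟙 ∎
        where
        vanish : ∀ n → 0 < ∣ n ∣ → A.w n ⊠ A.c 0 0 n ≈ 𝟘
        vanish (+ suc k) _ = solve 2 (λ x y → x :* (:0 :* y) := :0) ≈-refl _ _
        vanish -[1+ k ]  _ = solve 2 (λ x y → x :* (y :* :0) := :0) ≈-refl _ _

    module _ (α β : ℕ) (b≥1 : 1 ≤ α + β) where
      private
        b′≥1 : 1 ≤ β + α
        b′≥1 = subst (1 ≤_) (ℕP.+-comm α β) b≥1
        module A = Wsum η η²≈1 α β b≥1
        module B = Wsum η η²≈1 β α b′≥1
        b = α + β

      W-a0 : ∀ K a → a ≤ K → qf b a ⊠ A.W K a 0 ≈ pp η α b a
      W-a0 K zero    _ = ≈-trans (⊠-identityˡ _) (W-00 α β b≥1 b′≥1 K)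
      W-a0 K (suc a) l = begin
        qf b a ⊠ (𝟙 ⊟ q^ (b * suc a)) ⊠ A.W K (suc a) 0 ≈⟨ ⊠-assoc _ _ _ ⟩
        qf b a ⊠ ((𝟙 ⊟ q^ (b * suc a)) ⊠ A.W K (suc a) 0)
          ≈⟨ ⊠-congʳ (⊠-congˡ (⊞-congʳ (⊝-cong (q^-≡ (cong (λ t → b * suc t) (sym (ℕP.+-identityʳ a))))))) ⟩
        qf b a ⊠ ((𝟙 ⊟ q^ (b * suc (a + 0))) ⊠ A.W K (suc a) 0) ≈⟨ ⊠-congʳ (A.W-step K a 0 l z≤n) ⟩
        qf b a ⊠ ((𝟙 ⊞ η ⊠ q^ (α + b * a)) ⊠ A.W K a 0) ≈⟨ solve 3 (λ x y z → x :* (y :* z) := (x :* z) :* y) ≈-refl _ _ _ ⟩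
        qf b a ⊠ A.W K a 0 ⊠ (𝟙 ⊞ η ⊠ q^ (α + b * a)) ≈⟨ ⊠-congˡ (W-a0 K a (ℕP.<⇒≤ l)) ⟩
        pp η α b (suc a) ∎

      -- the finite form of the Jacobi triple product
      W-product : ∀ K a d → a ≤ K → d ≤ K → qf b (d + a) ⊠ A.W K a d ≈ pp η α b a ⊠ pp η β b d
      W-product K a zero    la ld = ≈-trans (W-a0 K a la) (≈-sym (⊠-identityʳ _))
      W-product K a (suc d) la ld = begin
        qf b (d + a) ⊠ (𝟙 ⊟ q^ (b * suc (d + a))) ⊠ A.W K a (suc d)
          ≈⟨ ⊠-congʳ (W-sym α β b≥1 b′≥1 K a (suc d)) ⟩
        qf b (d + a) ⊠ (𝟙 ⊟ q^ (b * suc (d + a))) ⊠ B.W K (suc d) a ≈⟨ ⊠-assoc _ _ _ ⟩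
        qf b (d + a) ⊠ ((𝟙 ⊟ q^ (b * suc (d + a))) ⊠ B.W K (suc d) a)
          ≈⟨ ⊠-congʳ (≈-trans (⊠-congˡ (⊞-congʳ (⊝-cong (q^-≡ (cong (_* suc (d + a)) (ℕP.+-comm α β)))))) (B.W-step K d a ld la)) ⟩
        qf b (d + a) ⊠ ((𝟙 ⊞ η ⊠ q^ (β + (β + α) * d)) ⊠ B.W K d a)
          ≈⟨ ⊠-congʳ (⊠-cong (⊞-congʳ (⊠-congʳ (q^-≡ (cong (λ t → β + t * d) (ℕP.+-comm β α))))) (≈-sym (W-sym α β b≥1 b′≥1 K a d))) ⟩
        qf b (d + a) ⊠ ((𝟙 ⊞ η ⊠ q^ (β + b * d)) ⊠ A.W K a d)
          ≈⟨ solve 3 (λ x y z → x :* (y :* z) := (x :* z) :* y) ≈-refl _ _ _ ⟩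
        qf b (d + a) ⊠ A.W K a d ⊠ (𝟙 ⊞ η ⊠ q^ (β + b * d)) ≈⟨ ⊠-congˡ (W-product K a d la (ℕP.<⇒≤ ld)) ⟩
        pp η α b a ⊠ pp η β b d ⊠ (𝟙 ⊞ η ⊠ q^ (β + b * d)) ≈⟨ ⊠-assoc _ _ _ ⟩
        pp η α b a ⊠ pp η β b (suc d) ∎

  -1²≈1 : ⊝ 𝟙 ⊠ ⊝ 𝟙 ≈ 𝟙
  -1²≈1 = solve 0 (:- :1 :* :- :1 := :1) ≈-refl

  pp-vanish : ∀ b n → pp (⊝ 𝟙) 0 b (suc n) ≈ 𝟘
  pp-vanish b zero    = ≈-trans (⊠-congʳ (⊞-congʳ (⊠-congʳ (≈-trans (q^-≡ (ℕP.*-zeroʳ b)) q^-0))))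
    (solve 0 (:1 :* (:1 :+ :- :1 :* :1) := :0) ≈-refl)
  pp-vanish b (suc n) = ≈-trans (⊠-congˡ (pp-vanish b n)) (⊠-zeroˡ _)

  -- The kernel 1/((Q)_(N-n) (Q)_(N+n)), Q = q^b, of Bailey pairs relative to 1.
  cc : ℕ → ℕ → ℤ → S
  cc b N n = I b (+ N ℤ.- n) ⊠ I b (+ N ℤ.+ n)

  cc-neg : ∀ b N n → cc b N (ℤ.- n) ≈ cc b N n
  cc-neg b N n = ≈-trans (≡⇒≈ (cong (λ t → I b (+ N ℤ.+ t) ⊠ I b (+ N ℤ.+ ℤ.- n)) (ℤP.neg-involutive n))) (⊠-comm _ _)

  cc-vanish : ∀ b N n → N < ∣ n ∣ → cc b N n ≈ 𝟘
  cc-vanish b N (+ n) l with ℕP.m≤n⇒∃[o]m+o≡n l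
  ... | k , refl = ≈-trans (⊠-congˡ (≡⇒≈ (cong (I b) (lem (+ N) (+ k))))) (⊠-zeroˡ _)
    where
    lem : ∀ n k → n ℤ.- (+ 1 ℤ.+ (n ℤ.+ k)) ≡ ℤ.- (+ 1 ℤ.+ k)
    lem = ℤ-solve
  cc-vanish b N -[1+ n ] l with ℕP.m≤n⇒∃[o]m+o≡n l
  ... | k , refl = ≈-trans (⊠-congʳ (≡⇒≈ (cong (I b) (lem (+ N) (+ k))))) (⊠-zeroʳ _)
    where
    lem : ∀ n k → n ℤ.+ (ℤ.- (+ 1 ℤ.+ (n ℤ.+ k))) ≡ ℤ.- (+ 1 ℤ.+ k)
    lem = ℤ-solve

  module _ (b : ℕ) (b≥1 : 1 ≤ b) (M : ℕ) where

    -- At η = -1 and α = 0 the finite triple product contains the factor 1 - q^0. This sum and its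
    -- mirror image are the remainders in the recurrence for partial fractions.
    vanishing₀ : sumZ (suc M) (λ n → θ (⊝ 𝟙) 0 b n ⊠ cc b (suc M) n) ≈ 𝟘
    vanishing₀ = U-cancel (U-qf (suc M + suc M) b≥1) (≈-trans
      (W-product (⊝ 𝟙) -1²≈1 0 b b≥1 (suc M) (suc M) (suc M) ℕP.≤-refl ℕP.≤-refl)
      (≈-trans (⊠-congˡ (pp-vanish b M)) (≈-trans (⊠-zeroˡ _) (≈-sym (⊠-zeroʳ _)))))

    vanishing₁ : sumZ (suc M) (λ n → θ (⊝ 𝟙) b 0 n ⊠ cc b (suc M) n) ≈ 𝟘
    vanishing₁ = ≈-trans (≈-sym (sumZ-neg (suc M) _))
      (≈-trans (sumZ-cong (suc M) λ n _ → ⊠-cong (θ-neg (⊝ 𝟙) b 0 n) (cc-neg b (suc M) n)) vanishing₀)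

  -- Partial fractions of 1 / ((x ; q^b)_{N+1} (q^b / x ; q^b)_N) for x = -η q^α, where α + β = b
  -- and r n stands for 1 / (1 - x q^{b n}).
  module PartialFractions (η : S) (η²≈1 : η ⊠ η ≈ 𝟙) (α β : ℕ) (b≥1 : 1 ≤ α + β)
    (Uα : ∀ k → U (𝟙 ⊞ η ⊠ q^ (α + (α + β) * k))) (Uβ : ∀ k → U (𝟙 ⊞ η ⊠ q^ (β + (α + β) * k))) where
    open ≈-Reasoning
    private b = α + β

    -- At n = -(k + 1) one has x q^(b n) = -η q^(-(β + b k)), and 1/(1 + η/z) = 1 - 1/(1 + η z)
    -- because η² = 1.
    r : ℤ → S
    r (+ k)    = invS (𝟙 ⊞ η ⊠ q^ (α + b * k))
    r -[1+ k ] = 𝟙 ⊟ invS (𝟙 ⊞ η ⊠ q^ (β + b * k))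

    t : ℤ → S
    t = θ (⊝ 𝟙) b 0

    A : ℕ → S
    A N = sumZ N (λ n → t n ⊠ cc b N n ⊠ r n)

    -- With Q = q^b and M = N + 1 this is (1 - x Q^M)(1 - Q^M/x), the growth of the denominator from
    -- N to N + 1.
    factor : ℕ → S
    factor N = (𝟙 ⊞ η ⊠ q^ (α + b * suc N)) ⊠ (𝟙 ⊞ η ⊠ q^ (β + b * N))

    private
      q^-*+ : ∀ {x} y z → x ≡ y + z → q^ x ≈ q^ y ⊠ q^ z
      q^-*+ y z refl = q^-+ y z

      -- With M = N + 1, (1 - x Q^M)(1 - Q^M/x) - (1 - Q^(M-n))(1 - Q^(M+n)) = (1 - x Q^n)(Q^(M-n) -
      -- Q^M/x), so the pole cancels from the difference. The two signs of n differ only in how the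
      -- exponents are kept nonnegative.
      core : ∀ N n i j → + i ≡ + suc N ℤ.- n → + j ≡ + suc N ℤ.+ n →
        factor N ⊠ r n ≈ (𝟙 ⊟ q^ (b * i)) ⊠ (𝟙 ⊟ q^ (b * j)) ⊠ r n ⊞ q^ (b * i) ⊞ η ⊠ q^ (β + b * N)
      core N (+ k) i j ei ej = begin
        factor N ⊠ v
          ≈⟨ ⊠-congˡ (⊠-congˡ (⊞-congʳ (⊠-congʳ (q^-*+ (α + b * k) (b * i) e₁)))) ⟩
        (𝟙 ⊞ η ⊠ (X ⊠ Y)) ⊠ (𝟙 ⊞ η ⊠ B) ⊠ v
          ≈⟨ linear (B ⊠ X ⊠ Y ⊠ v ⊟ B ⊠ X ⊠ v) η²≈1 (linear (Y ⊞ η ⊠ B) (⊠-invS (Uα k))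
            (solve 5 (λ X Y B h v →
               ((:1 :+ h :* (X :* Y)) :* (:1 :+ h :* B) :* v :+ (B :* X :* Y :* v :- B :* X :* v) :* :1)
                 :+ (Y :+ h :* B) :* :1
               := ((:1 :- Y) :* (:1 :- X :* B) :* v :+ Y :+ h :* B :+ (B :* X :* Y :* v :- B :* X :* v) :* (h :* h))
                 :+ (Y :+ h :* B) :* ((:1 :+ h :* X) :* v)) ≈-refl X Y B η v)) ⟩
        (𝟙 ⊟ Y) ⊠ (𝟙 ⊟ X ⊠ B) ⊠ v ⊞ Y ⊞ η ⊠ B
          ≈⟨ ⊞-cong (⊞-cong (⊠-congˡ (⊠-congʳ (⊞-congʳ (⊝-cong (q^-*+ (α + b * k) (β + b * N) e₂))))) ≈-refl) ≈-refl ⟨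
        (𝟙 ⊟ Y) ⊠ (𝟙 ⊟ q^ (b * j)) ⊠ v ⊞ Y ⊞ η ⊠ B ∎
        where
        v = invS (𝟙 ⊞ η ⊠ q^ (α + b * k))
        X = q^ (α + b * k)
        Y = q^ (b * i)
        B = q^ (β + b * N)
        M≡ : suc N ≡ k + i
        M≡ = ℤ-minus (suc N) k i ei
        e₁ : α + b * suc N ≡ α + b * k + b * i
        e₁ rewrite M≡ = lem α b k i
          where
          lem : ∀ α b k i → α + b * (k + i) ≡ α + b * k + b * i
          lem = ℕ-solve
        e₂ : b * j ≡ α + b * k + (β + b * N)
        e₂ rewrite ℤP.+-injective ej = lem α β k N
          where
          lem : ∀ α β k N → (α + β) * (suc N + k) ≡ α + (α + β) * k + (β + (α + β) * N)
          lem = ℕ-solve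
      core N -[1+ k ] i j ei ej = begin
        (𝟙 ⊞ η ⊠ D) ⊠ (𝟙 ⊞ η ⊠ q^ (β + b * N)) ⊠ (𝟙 ⊟ v)
          ≈⟨ ⊠-congˡ (⊠-congʳ (⊞-congʳ (⊠-congʳ eB))) ⟩
        (𝟙 ⊞ η ⊠ D) ⊠ (𝟙 ⊞ η ⊠ (C ⊠ Y)) ⊠ (𝟙 ⊟ v)
          ≈⟨ linear (⊝ (η ⊠ D ⊞ Y)) (⊠-invS (Uβ k))
            (linear (D ⊠ C ⊠ Y ⊟ D ⊠ C ⊠ Y ⊠ v ⊞ D ⊠ C ⊠ v) η²≈1
            (solve 5 (λ C D Y h v →
               ((:1 :+ h :* D) :* (:1 :+ h :* (C :* Y)) :* (:1 :- v)
                 :+ :- (h :* D :+ Y) :* :1)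
                 :+ (D :* C :* Y :- D :* C :* Y :* v :+ D :* C :* v) :* :1
               := ((:1 :- D :* C) :* (:1 :- Y) :* (:1 :- v) :+ D :* C :+ h :* (C :* Y)
                 :+ :- (h :* D :+ Y) :* ((:1 :+ h :* C) :* v))
                 :+ (D :* C :* Y :- D :* C :* Y :* v :+ D :* C :* v) :* (h :* h)) ≈-refl C D Y η v)) ⟩
        (𝟙 ⊟ D ⊠ C) ⊠ (𝟙 ⊟ Y) ⊠ (𝟙 ⊟ v) ⊞ D ⊠ C ⊞ η ⊠ (C ⊠ Y)
          ≈⟨ ⊞-cong (⊞-cong (⊠-congˡ (⊠-congˡ (⊞-congʳ (⊝-cong eDC)))) eDC) (⊠-congʳ eB) ⟨
        (𝟙 ⊟ q^ (b * i)) ⊠ (𝟙 ⊟ Y) ⊠ (𝟙 ⊟ v) ⊞ q^ (b * i) ⊞ η ⊠ q^ (β + b * N) ∎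
        where
        v = invS (𝟙 ⊞ η ⊠ q^ (β + b * k))
        C = q^ (β + b * k)
        D = q^ (α + b * suc N)
        Y = q^ (b * j)
        N≡ : N ≡ k + j
        N≡ = ℤP.+-injective (trans (lem (+ N) (+ k)) (cong (λ t → + k ℤ.+ t) (sym ej)))
          where
          lem : ∀ N k → N ≡ k ℤ.+ (+ 1 ℤ.+ N ℤ.+ ℤ.- (+ 1 ℤ.+ k))
          lem = ℤ-solve
        eB : q^ (β + b * N) ≈ C ⊠ Y
        eB rewrite N≡ = q^-*+ (β + b * k) (b * j) (lem β b k j)
          where
          lem : ∀ α b k i → α + b * (k + i) ≡ α + b * k + b * i
          lem = ℕ-solve
        eDC : q^ (b * i) ≈ D ⊠ C
        eDC rewrite ℤP.+-injective ei = q^-*+ (α + b * suc N) (β + b * k) (lem α β N k)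
          where
          lem : ∀ α β N k → (α + β) * (suc N + suc k) ≡ α + (α + β) * suc N + (β + (α + β) * k)
          lem = ℕ-solve

      -- n(n + 1)/2 - n = n(n - 1)/2: the factor Q^(M-n) changes one triple product weight into the
      -- other, which brings the remainder under `vanishing₀`.
      t-shift : ∀ M n i → + i ≡ + M ℤ.- n → t n ⊠ q^ (b * i) ≈ q^ (b * M) ⊠ θ (⊝ 𝟙) 0 b n
      t-shift M n i e = begin
        pow (⊝ 𝟙) ∣ n ∣ ⊠ q^ (E b 0 n) ⊠ q^ (b * i) ≈⟨ ⊠-assoc _ _ _ ⟩
        pow (⊝ 𝟙) ∣ n ∣ ⊠ (q^ (E b 0 n) ⊠ q^ (b * i)) ≈⟨ ⊠-congʳ (≈-trans (≈-sym (q^-+ _ _)) (q^-*+ _ _ (ex n e))) ⟩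
        pow (⊝ 𝟙) ∣ n ∣ ⊠ (q^ (b * M) ⊠ q^ (E 0 b n)) ≈⟨ solve 3 (λ x y z → x :* (y :* z) := y :* (x :* z)) ≈-refl _ _ _ ⟩
        q^ (b * M) ⊠ θ (⊝ 𝟙) 0 b n ∎
        where
        ex : ∀ n → + i ≡ + M ℤ.- n → E b 0 n + b * i ≡ b * M + E 0 b n
        ex (+ k) e rewrite ℤ-minus M k i e = lem b k i (tri k)
          where
          lem : ∀ b k i t → (b + 0) * t + b * k + b * i ≡ b * (k + i) + (b * t + 0 * k)
          lem = ℕ-solve
        ex -[1+ k ] e rewrite ℤP.+-injective e = lem b k M (tri k)
          where
          lem : ∀ b k M t → (b + 0) * (k + t) + 0 * suc k + b * (M + suc k) ≡ b * M + (b * (k + t) + b * suc k)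
          lem = ℕ-solve

      in-range : ∀ M n → ∣ n ∣ ≤ M → ∃ λ i → ∃ λ j → (+ i ≡ + M ℤ.- n) × (+ j ≡ + M ℤ.+ n)
      in-range M (+ k) l with ℕP.m≤n⇒∃[o]m+o≡n l
      ... | i , refl = i , k + i + k , lem (+ k) (+ i) , refl
        where
        lem : ∀ k i → i ≡ k ℤ.+ i ℤ.- k
        lem = ℤ-solve
      in-range M -[1+ k ] l with ℕP.m≤n⇒∃[o]m+o≡n l
      ... | j , refl = suc k + j + suc k , j , refl , lem (+ k) (+ j)
        where
        lem : ∀ k i → i ≡ + 1 ℤ.+ k ℤ.+ i ℤ.+ ℤ.- (+ 1 ℤ.+ k)
        lem = ℤ-solve

      cc-step : ∀ N n i j → + i ≡ + suc N ℤ.- n → + j ≡ + suc N ℤ.+ n →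
        (𝟙 ⊟ q^ (b * i)) ⊠ (𝟙 ⊟ q^ (b * j)) ⊠ cc b (suc N) n ≈ cc b N n
      cc-step N n i j ei ej = begin
        (𝟙 ⊟ q^ (b * i)) ⊠ (𝟙 ⊟ q^ (b * j)) ⊠ cc b (suc N) n
          ≈⟨ ⊠-congʳ (≡⇒≈ (cong₂ (λ x y → I b x ⊠ I b y) (sym ei) (sym ej))) ⟩
        (𝟙 ⊟ q^ (b * i)) ⊠ (𝟙 ⊟ q^ (b * j)) ⊠ (I b (+ i) ⊠ I b (+ j))
          ≈⟨ solve 4 (λ x y z w → x :* y :* (z :* w) := x :* z :* (y :* w)) ≈-refl _ _ _ _ ⟩
        (𝟙 ⊟ q^ (b * i)) ⊠ I b (+ i) ⊠ ((𝟙 ⊟ q^ (b * j)) ⊠ I b (+ j))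
          ≈⟨ ⊠-cong (I-step b≥1 i) (I-step b≥1 j) ⟩
        I b (ℤ.pred (+ i)) ⊠ I b (ℤ.pred (+ j))
          ≈⟨ ≡⇒≈ (cong₂ (λ x y → I b x ⊠ I b y) (trans (cong ℤ.pred ei) (lem (+ N) (ℤ.- n))) (trans (cong ℤ.pred ej) (lem (+ N) n))) ⟩
        cc b N n ∎
        where
        lem : ∀ N n → ℤ.- (+ 1) ℤ.+ (+ 1 ℤ.+ N ℤ.+ n) ≡ N ℤ.+ n
        lem = ℤ-solve

      term : ∀ N n → ∣ n ∣ ≤ suc N → factor N ⊠ (t n ⊠ cc b (suc N) n ⊠ r n) ≈
        t n ⊠ cc b N n ⊠ r n ⊞ (q^ (b * suc N) ⊠ (θ (⊝ 𝟙) 0 b n ⊠ cc b (suc N) n) ⊞ η ⊠ q^ (β + b * N) ⊠ (t n ⊠ cc b (suc N) n))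
      term N n l with in-range (suc N) n l
      ... | i , j , ei , ej = begin
        factor N ⊠ (t n ⊠ cc b (suc N) n ⊠ r n)
          ≈⟨ solve 4 (λ f t c r → f :* (t :* c :* r) := t :* c :* (f :* r)) ≈-refl _ _ _ _ ⟩
        t n ⊠ cc b (suc N) n ⊠ (factor N ⊠ r n) ≈⟨ ⊠-congʳ (core N n i j ei ej) ⟩
        t n ⊠ cc b (suc N) n ⊠ (X ⊠ r n ⊞ q^ (b * i) ⊞ Y)
          ≈⟨ solve 6 (λ t c X r Q Y → t :* c :* (X :* r :+ Q :+ Y) := t :* (X :* c) :* r :+ (t :* Q :* c :+ Y :* (t :* c))) ≈-refl (t n) (cc b (suc N) n) X (r n) (q^ (b * i)) Y ⟩
        t n ⊠ (X ⊠ cc b (suc N) n) ⊠ r n ⊞ (t n ⊠ q^ (b * i) ⊠ cc b (suc N) n ⊞ Y ⊠ (t n ⊠ cc b (suc N) n))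
          ≈⟨ ⊞-cong (⊠-congˡ (⊠-congʳ (cc-step N n i j ei ej))) (⊞-cong (≈-trans (⊠-congˡ (t-shift (suc N) n i ei)) (⊠-assoc _ _ _)) ≈-refl) ⟩
        t n ⊠ cc b N n ⊠ r n ⊞ (q^ (b * suc N) ⊠ (θ (⊝ 𝟙) 0 b n ⊠ cc b (suc N) n) ⊞ Y ⊠ (t n ⊠ cc b (suc N) n)) ∎
        where
        X = (𝟙 ⊟ q^ (b * i)) ⊠ (𝟙 ⊟ q^ (b * j))
        Y = η ⊠ q^ (β + b * N)

      -- Both remainder sums are vanishing finite triple products, and the kernel for N is 0 at the
      -- two extra indices of absolute value N + 1.
      A-step : ∀ N → factor N ⊠ A (suc N) ≈ A N
      A-step N = begin
        factor N ⊠ A (suc N) ≈⟨ sumZ-⊠ˡ (suc N) _ _ ⟨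
        sumZ (suc N) (λ n → factor N ⊠ (t n ⊠ cc b (suc N) n ⊠ r n)) ≈⟨ sumZ-cong (suc N) (term N) ⟩
        sumZ (suc N) (λ n → t n ⊠ cc b N n ⊠ r n ⊞ (q^ (b * suc N) ⊠ (θ (⊝ 𝟙) 0 b n ⊠ cc b (suc N) n) ⊞ η ⊠ q^ (β + b * N) ⊠ (t n ⊠ cc b (suc N) n)))
          ≈⟨ ≈-trans (sumZ-⊞ (suc N) _ _) (⊞-congʳ (≈-trans (sumZ-⊞ (suc N) _ _) (⊞-cong (sumZ-⊠ˡ (suc N) _ _) (sumZ-⊠ˡ (suc N) _ _)))) ⟩
        sumZ (suc N) (λ n → t n ⊠ cc b N n ⊠ r n) ⊞ (q^ (b * suc N) ⊠ sumZ (suc N) (λ n → θ (⊝ 𝟙) 0 b n ⊠ cc b (suc N) n) ⊞ η ⊠ q^ (β + b * N) ⊠ sumZ (suc N) (λ n → t n ⊠ cc b (suc N) n))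
          ≈⟨ ⊞-cong (sumZ-extend N 1 (λ n l → ≈-trans (⊠-congˡ (⊠-congʳ (cc-vanish b N n l))) (solve 2 (λ x y → x :* :0 :* y := :0) ≈-refl _ _)))
               (⊞-cong (⊠-congʳ (vanishing₀ b b≥1 N)) (⊠-congʳ (vanishing₁ b b≥1 N))) ⟩
        A N ⊞ (q^ (b * suc N) ⊠ 𝟘 ⊞ η ⊠ q^ (β + b * N) ⊠ 𝟘)
          ≈⟨ solve 3 (λ a x y → a :+ (x :* :0 :+ y :* :0) := a) ≈-refl _ _ _ ⟩
        A N ∎

    partial-fractions : ∀ N → pp η α b (suc N) ⊠ pp η β b N ⊠ A N ≈ 𝟙
    partial-fractions zero    = begin
      𝟙 ⊠ (𝟙 ⊞ η ⊠ q^ (α + b * 0)) ⊠ 𝟙 ⊠ (t (+ 0) ⊠ (invS 𝟙 ⊠ invS 𝟙) ⊠ r (+ 0))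
        ≈⟨ ⊠-congʳ (⊠-congˡ (⊠-cong (θ-0 (⊝ 𝟙) b 0) (⊠-cong invS-𝟙 invS-𝟙))) ⟩
      𝟙 ⊠ (𝟙 ⊞ η ⊠ q^ (α + b * 0)) ⊠ 𝟙 ⊠ (𝟙 ⊠ (𝟙 ⊠ 𝟙) ⊠ r (+ 0))
        ≈⟨ solve 2 (λ x y → :1 :* x :* :1 :* (:1 :* (:1 :* :1) :* y) := x :* y) ≈-refl _ _ ⟩
      (𝟙 ⊞ η ⊠ q^ (α + b * 0)) ⊠ r (+ 0) ≈⟨ ⊠-invS (Uα 0) ⟩
      𝟙 ∎
    partial-fractions (suc N) = begin
      pp η α b (suc N) ⊠ X ⊠ (pp η β b N ⊠ Y) ⊠ A (suc N)
        ≈⟨ solve 5 (λ p x r y a → p :* x :* (r :* y) :* a := p :* r :* (x :* y :* a)) ≈-refl (pp η α b (suc N)) X (pp η β b N) Y (A (suc N)) ⟩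
      pp η α b (suc N) ⊠ pp η β b N ⊠ (factor N ⊠ A (suc N)) ≈⟨ ⊠-congʳ (A-step N) ⟩
      pp η α b (suc N) ⊠ pp η β b N ⊠ A N ≈⟨ partial-fractions N ⟩
      𝟙 ∎
      where
      X = 𝟙 ⊞ η ⊠ q^ (α + b * suc N)
      Y = 𝟙 ⊞ η ⊠ q^ (β + b * N)

open FinitePartialFractions

-- Limits of the finite identities and Durfee rectangles

module DurfeeLimits where

  private variable
    f u : S
    N : ℕ

  opaque
    unfolding _⊞_
    -- A power series is invertible as soon as its constant term is, and a congruence modulo q fixes
    -- that term.
    U-approx : U u → f ≈[ 1 ] u → U f
    U-approx {u} {f} (g , p) e = invS f , mk≈ (⊛-inv (coef f)
      (recip-inverse (coef f 0) (coef g 0) (trans (cong (ℚ._* coef g 0) (below e 0 (s≤s z≤n))) (at p 0))))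

  U-lim : ∀ {F} → Cauchy F → U (F 1) → U (lim F)
  U-lim c p = U-approx p ([]-sym (lim-approx c 1))

  n≤b*n : ∀ {b} n → 1 ≤ b → n ≤ b * n
  n≤b*n {b} n l = subst (_≤ b * n) (ℕP.*-identityˡ n) (ℕP.*-monoˡ-≤ n l)

  n≤b*n*n : ∀ {b} n → 1 ≤ b → n ≤ b * n * n
  n≤b*n*n zero    l = z≤n
  n≤b*n*n (suc n) l = ℕP.≤-trans (n≤b*n (suc n) l) (ℕP.m≤m*n _ (suc n))

  pp-Cauchy : ∀ η α {b} → 1 ≤ b → Cauchy (pp η α b)
  pp-Cauchy η α {b} l N = begin
    pp η α b N ≈⟨ ≈⇒[] (⊠-identityʳ _) ⟨
    pp η α b N ⊠ 𝟙 ≈⟨ ≈⇒[] (⊠-congʳ (⊞-identityʳ 𝟙)) ⟨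
    pp η α b N ⊠ (𝟙 ⊞ 𝟘) ≈⟨ ⊠-cong[] []-refl (⊞-cong[] []-refl ([]-trans (≈⇒[] (⊠-comm η _)) (q^-vanish _ η (ℕP.≤-trans (n≤b*n N l) (ℕP.m≤n+m (b * N) α))))) ⟨
    pp η α b (suc N) ∎
    where open []-Reasoning N

  pp∞ : S → ℕ → ℕ → S
  pp∞ η α b = lim (pp η α b)

  J : ℕ → S
  J b = lim (qf b)

  qf≈pp : ∀ b n → qf b n ≈ pp (⊝ 𝟙) b b n
  qf≈pp b zero    = ≈-refl
  qf≈pp b (suc n) = ⊠-cong (qf≈pp b n) (⊞-congʳ (≈-trans (⊝-as-⊠ _) (⊠-congʳ (q^-≡ (ℕP.*-suc b n)))))

  qf-Cauchy : ∀ {b} → 1 ≤ b → Cauchy (qf b)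
  qf-Cauchy {b} l N = []-trans (≈⇒[] (qf≈pp b N)) ([]-trans (pp-Cauchy (⊝ 𝟙) b l N) (≈⇒[] (≈-sym (qf≈pp b (suc N)))))

  U-J : ∀ {b} → 1 ≤ b → U (J b)
  U-J {b} l = U-lim (qf-Cauchy l) (U-qf 1 l)

  I∞ : ℕ → S
  I∞ b = invS (J b)

  I-approx : ∀ {b} → 1 ≤ b → ∀ n → I b (+ n) ≈[ n ] I∞ b
  I-approx l n = invS-cong[] (U-qf n l) (U-J l) (lim-approx (qf-Cauchy l) n)

  tri-bound : ∀ k → k ≤ tri (suc k)
  tri-bound k = ℕP.m≤m+n k (tri k)

  E-bound : ∀ {b} → 1 ≤ b → ∀ n → ∣ n ∣ ≤ suc (E b 0 n)
  E-bound {b} l (+ zero)  = z≤n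
  E-bound {b} l (+ suc k) = ℕP.m≤n⇒m≤1+n (ℕP.≤-trans (n≤b*n (suc k) l) (ℕP.m≤n+m _ _))
  E-bound {b} l -[1+ k ]  = s≤s (ℕP.≤-trans (tri-bound k) (ℕP.≤-trans (n≤b*n _ (ℕP.≤-trans l (ℕP.m≤m+n b 0))) (ℕP.m≤m+n _ _)))

  -- The growth bound is a parameter, so that one development serves the Appell weights and the
  -- series of φ and ψ.
  module ThetaLimits (η : S) (α β : ℕ) (E-bound : ∀ n → ∣ n ∣ ≤ suc (E α β n)) {b : ℕ} (b≥1 : 1 ≤ b) where
    t : ℤ → S
    t = θ η α β

    t-tame : Tame t
    t-tame N n l = []-trans (≈⇒[] (⊠-comm _ _)) (q^-vanish (E α β n) _ (ℕP.≤-pred (ℕP.≤-trans l (E-bound n))))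

    t-mod : ∀ n → f ≈[ N ] u → t n ⊠ f ≈[ E α β n + N ] t n ⊠ u
    t-mod {f} {N} {u} n e = []-trans (≈⇒[] (⊠-assoc _ _ _)) ([]-trans (⊠-cong[] []-refl (q^-mod (E α β n) e)) (≈⇒[] (≈-sym (⊠-assoc _ _ _))))

    cc-approx : ∀ N n → ∣ n ∣ ≤ N → cc b N n ≈[ N ∸ ∣ n ∣ ] I∞ b ⊠ I∞ b
    cc-approx N (+ k) l with ℕP.m≤n⇒∃[o]m+o≡n l
    ... | i , refl = ⊠-cong[] ([]-trans (≈⇒[] (≡⇒≈ (cong (I b) (lem (+ k) (+ i))))) ([]-mono (ℕP.≤-reflexive (ℕP.m+n∸m≡n k i)) (I-approx b≥1 i)))
        ([]-mono (ℕP.≤-trans (ℕP.≤-reflexive (ℕP.m+n∸m≡n k i)) (ℕP.≤-trans (ℕP.m≤n+m i k) (ℕP.m≤m+n (k + i) k))) (I-approx b≥1 (k + i + k)))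
      where
      lem : ∀ k i → k ℤ.+ i ℤ.- k ≡ i
      lem = ℤ-solve
    cc-approx N -[1+ k ] l with ℕP.m≤n⇒∃[o]m+o≡n l
    ... | i , refl = ⊠-cong[] ([]-mono (ℕP.≤-trans (ℕP.≤-reflexive (ℕP.m+n∸m≡n k i)) (ℕP.≤-trans (ℕP.m≤n+m i (suc k)) (ℕP.m≤m+n (suc k + i) (suc k)))) (I-approx b≥1 (suc k + i + suc k)))
        ([]-trans (≈⇒[] (≡⇒≈ (cong (I b) (lem (+ k) (+ i))))) ([]-mono (ℕP.≤-reflexive (ℕP.m+n∸m≡n k i)) (I-approx b≥1 i)))
      where
      lem : ∀ k i → + 1 ℤ.+ k ℤ.+ i ℤ.+ ℤ.- (+ 1 ℤ.+ k) ≡ i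
      lem = ℤ-solve

    -- The kernel is accurate to order N + 1 - |n| and the weight adds at least |n| - 1 orders;
    -- together they give N.
    t-cc-approx : ∀ N n → ∣ n ∣ ≤ suc N → t n ⊠ cc b (suc N) n ≈[ N ] t n ⊠ (I∞ b ⊠ I∞ b)
    t-cc-approx N n l = []-mono (ℕP.≤-pred (begin
      suc N ≡⟨ ℕP.m+[n∸m]≡n l ⟨
      ∣ n ∣ + (suc N ∸ ∣ n ∣) ≤⟨ ℕP.+-monoˡ-≤ _ (E-bound n) ⟩
      suc (E α β n + (suc N ∸ ∣ n ∣)) ∎)) (t-mod n (cc-approx (suc N) n l))
      where open ℕP.≤-Reasoning

    cc-sum-limit : ∀ (ρ : ℤ → S) N →
      sumZ (suc N) (λ n → t n ⊠ cc b (suc N) n ⊠ ρ n) ≈[ N ] I∞ b ⊠ I∞ b ⊠ ∑ℤ (λ n → t n ⊠ ρ n)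
    cc-sum-limit ρ N = begin
      sumZ (suc N) (λ n → t n ⊠ cc b (suc N) n ⊠ ρ n) ≈⟨ sumZ-cong[] (suc N) (λ n l → ⊠-cong[] (t-cc-approx N n l) []-refl) ⟩
      sumZ (suc N) (λ n → t n ⊠ (I∞ b ⊠ I∞ b) ⊠ ρ n)
        ≈⟨ ≈⇒[] (≈-trans (sumZ-cong (suc N) (λ n _ → solve 3 (λ t i r → t :* i :* r := i :* (t :* r)) ≈-refl _ _ _)) (sumZ-⊠ˡ (suc N) _ _)) ⟩
      I∞ b ⊠ I∞ b ⊠ sumZ (suc N) (λ n → t n ⊠ ρ n)
        ≈⟨ ⊠-cong[] []-refl ([]-mono (ℕP.n≤1+n N) (∑-approx (Tame-⊠ʳ ρ t-tame) (suc N))) ⟩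
      I∞ b ⊠ I∞ b ⊠ ∑ℤ (λ n → t n ⊠ ρ n) ∎
      where open []-Reasoning N

  module Limits {b : ℕ} (b≥1 : 1 ≤ b) where
    open ThetaLimits (⊝ 𝟙) b 0 (E-bound b≥1) b≥1 public

    -- D K s is a partial sum of the Durfee rectangle identity
    -- Σ_j Q^{j(j+s)} / ((Q)_j (Q)_{j+s}) = 1 / (Q)_∞, where Q = q^b.
    Dt : ℕ → ℕ → S
    Dt s j = q^ (b * (j * (j + s))) ⊠ (I b (+ j) ⊠ I b (+ (j + s)))

    D : ℕ → ℕ → S
    D K s = sumS K (Dt s)

    private
      -- Telescoping certificate: its differences in j are the terms of D_s - D_(s+1) + Q^(s+1)
      -- (D_(s+1) - D_(s+2)), and it vanishes at j = 0.
      a : ℕ → ℕ → S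
      a s j = q^ (b * (j * (j + s))) ⊠ (I b (ℤ.pred (+ j)) ⊠ I b (+ suc (j + s)))

      D-term : ∀ s j → (Dt s j ⊟ Dt (suc s) j) ⊞ q^ (b * suc s) ⊠ (Dt (suc s) j ⊟ Dt (suc (suc s)) j) ≈ a s j ⊟ a s (suc j)
      D-term s j = begin
        (Dt s j ⊟ Dt (suc s) j) ⊞ Y ⊠ (Dt (suc s) j ⊟ Dt (suc (suc s)) j)
          ≈⟨ ⊞-cong (⊞-cong e₁ (⊝-cong e₂)) (⊠-congʳ (⊞-cong e₂ (⊝-cong e₃))) ⟩
        (X ⊠ (i ⊠ ((𝟙 ⊟ Z ⊠ Y) ⊠ i₁)) ⊟ X ⊠ Z ⊠ (i ⊠ i₁)) ⊞ Y ⊠ (X ⊠ Z ⊠ (i ⊠ i₁) ⊟ X ⊠ Z ⊠ Z ⊠ (i ⊠ i₂))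
          ≈⟨ solve 6 (λ X Y Z i i₁ i₂ → (X :* (i :* ((:1 :- Z :* Y) :* i₁)) :- X :* Z :* (i :* i₁)) :+ Y :* (X :* Z :* (i :* i₁) :- X :* Z :* Z :* (i :* i₂))
               := X :* (((:1 :- Z) :* i) :* i₁) :- X :* Y :* Z :* Z :* (i :* i₂)) ≈-refl X Y Z i i₁ i₂ ⟩
        X ⊠ (((𝟙 ⊟ Z) ⊠ i) ⊠ i₁) ⊟ X ⊠ Y ⊠ Z ⊠ Z ⊠ (i ⊠ i₂)
          ≈⟨ ⊞-cong (⊠-congʳ (⊠-congˡ (I-step b≥1 j))) (⊝-cong (⊠-congˡ e₄)) ⟩
        a s j ⊟ a s (suc j) ∎
        where
        open ≈-Reasoning
        X = q^ (b * (j * (j + s)))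
        Y = q^ (b * suc s)
        Z = q^ (b * j)
        i = I b (+ j)
        i₁ = I b (+ suc (j + s))
        i₂ = I b (+ suc (suc (j + s)))
        e₁ : Dt s j ≈ X ⊠ (i ⊠ ((𝟙 ⊟ Z ⊠ Y) ⊠ i₁))
        e₁ = ⊠-congʳ (⊠-congʳ (≈-trans (≈-sym (I-step b≥1 (suc (j + s))))
          (⊠-congˡ (⊞-congʳ (⊝-cong (≈-trans (q^-≡ (lem b j s)) (q^-+ _ _)))))))
          where
          lem : ∀ b j s → b * suc (j + s) ≡ b * j + b * suc s
          lem = ℕ-solve
        e₂ : Dt (suc s) j ≈ X ⊠ Z ⊠ (i ⊠ i₁)
        e₂ = ⊠-cong (≈-trans (q^-≡ (lem b j s)) (q^-+ _ _)) (⊠-congʳ (≡⇒≈ (cong (λ n → I b (+ n)) (ℕP.+-suc j s))))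
          where
          lem : ∀ b j s → b * (j * (j + suc s)) ≡ b * (j * (j + s)) + b * j
          lem = ℕ-solve
        e₃ : Dt (suc (suc s)) j ≈ X ⊠ Z ⊠ Z ⊠ (i ⊠ i₂)
        e₃ = ⊠-cong (≈-trans (q^-≡ (lem b j s)) (≈-trans (q^-+ _ _) (⊠-congˡ (q^-+ _ _))))
          (⊠-congʳ (≡⇒≈ (cong (λ n → I b (+ n)) (trans (ℕP.+-suc j (suc s)) (cong suc (ℕP.+-suc j s))))))
          where
          lem : ∀ b j s → b * (j * (j + suc (suc s))) ≡ b * (j * (j + s)) + b * j + b * j
          lem = ℕ-solve
        e₄ : X ⊠ Y ⊠ Z ⊠ Z ≈ q^ (b * (suc j * (suc j + s)))
        e₄ = ≈-sym (≈-trans (q^-≡ (lem b j s)) (≈-trans (q^-+ _ _) (⊠-congˡ (≈-trans (q^-+ _ _) (⊠-congˡ (q^-+ _ _))))))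
          where
          lem : ∀ b j s → b * (suc j * (suc j + s)) ≡ b * (j * (j + s)) + b * suc s + b * j + b * j
          lem = ℕ-solve

      D-tele : ∀ K s → (D K s ⊟ D K (suc s)) ⊞ q^ (b * suc s) ⊠ (D K (suc s) ⊟ D K (suc (suc s))) ⊞ a s K ≈ 𝟘
      D-tele zero    s = ≈-trans (⊞-congʳ (⊠-congʳ (⊠-zeroˡ _)))
        (solve 2 (λ x y → (:0 :- :0) :+ x :* (:0 :- :0) :+ y :* :0 := :0) ≈-refl _ _)
      D-tele (suc K) s = linear 𝟙 (D-tele K s) (linear 𝟙 (D-term s K)
        (solve 9 (λ D₀ D₁ D₂ d₀ d₁ d₂ Y a a′ →
           ((D₀ :+ d₀) :- (D₁ :+ d₁)) :+ Y :* ((D₁ :+ d₁) :- (D₂ :+ d₂)) :+ a′ :+ :1 :* :0 :+ :1 :* (a :- a′)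
           := :0 :+ :1 :* ((D₀ :- D₁) :+ Y :* (D₁ :- D₂) :+ a) :+ :1 :* ((d₀ :- d₁) :+ Y :* (d₁ :- d₂))) ≈-refl
           (D K s) (D K (suc s)) (D K (suc (suc s))) (Dt s K) (Dt (suc s) K) (Dt (suc (suc s)) K) (q^ (b * suc s)) (a s K) (a s (suc K))))

      a-small : ∀ s K → a s K ≈[ K ] 𝟘
      a-small s zero    = mk[] λ _ ()
      a-small s (suc K) = q^-vanish _ _ (ℕP.≤-trans (ℕP.m≤m*n (suc K) (suc K + s)) (n≤b*n _ b≥1))

      -- The telescoped recurrence expresses D_s - D_(s+1) by -Q^(s+1) times the next difference, up
      -- to a tail divisible by q^K. Each application gains at least one power of q.
      D-diff : ∀ K m → m ≤ K → ∀ s → D K s ⊟ D K (suc s) ≈[ m ] 𝟘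
      D-diff K zero    l s = mk[] λ _ ()
      D-diff K (suc m) l s = begin
        Δ ≈⟨ ≈⇒[] (solve 3 (λ d y a → d := d :+ y :+ a :- y :- a) ≈-refl Δ (Y ⊠ Δ′) (a s K)) ⟩
        Δ ⊞ Y ⊠ Δ′ ⊞ a s K ⊟ Y ⊠ Δ′ ⊟ a s K
          ≈⟨ ⊞-cong[] (⊞-cong[] (≈⇒[] (D-tele K s)) (⊝-cong[] ([]-mono (ℕP.+-monoˡ-≤ m (1≤b*suc s b≥1)) (q^-mod (b * suc s) (D-diff K m (ℕP.<⇒≤ l) (suc s))))))
                (⊝-cong[] ([]-mono l (a-small s K))) ⟩
        𝟘 ⊟ Y ⊠ 𝟘 ⊟ 𝟘 ≈⟨ ≈⇒[] (solve 1 (λ y → :0 :- y :* :0 :- :0 := :0) ≈-refl Y) ⟩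
        𝟘 ∎
        where
        open []-Reasoning (suc m)
        Δ = D K s ⊟ D K (suc s)
        Δ′ = D K (suc s) ⊟ D K (suc (suc s))
        Y = q^ (b * suc s)

      D-shift : ∀ K d s → D K s ≈[ K ] D K (d + s)
      D-shift K zero    s = []-refl
      D-shift K (suc d) s = []-trans (D-shift K d s) ([]-trans (≈⇒[] (solve 2 (λ x y → x := y :+ (x :- y)) ≈-refl _ _))
        ([]-trans (⊞-cong[] []-refl (D-diff K K ℕP.≤-refl (d + s))) (≈⇒[] (⊞-identityʳ _))))

    -- Modulo q^K the sum is independent of s, and for large s all terms but j = 0 are negligible,
    -- which leaves 1/(Q)_s.
    D-limit : ∀ K s → D K s ≈[ K ] I∞ b
    D-limit zero    s = mk[] λ _ ()
    D-limit (suc K) s = begin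
      D (suc K) s ≈⟨ D-shift (suc K) (suc K) s ⟩
      D (suc K) s′ ≈⟨ ≈⇒[] (sumS-head K (Dt s′)) ⟩
      Dt s′ 0 ⊞ sumS K (λ j → Dt s′ (suc j)) ≈⟨ ⊞-cong[] head (small K) ⟩
      I∞ b ⊞ 𝟘 ≈⟨ ≈⇒[] (⊞-identityʳ _) ⟩
      I∞ b ∎
      where
      open []-Reasoning (suc K)
      s′ = suc K + s
      head : Dt s′ 0 ≈[ suc K ] I∞ b
      head = []-trans (≈⇒[] (≈-trans (⊠-cong (≈-trans (q^-≡ (ℕP.*-zeroʳ b)) q^-0) (⊠-congˡ invS-𝟙))
        (≈-trans (⊠-identityˡ _) (⊠-identityˡ _)))) ([]-mono (ℕP.m≤m+n (suc K) s) (I-approx b≥1 s′))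
      small : ∀ K′ → sumS K′ (λ j → Dt s′ (suc j)) ≈[ suc K ] 𝟘
      small zero     = []-refl
      small (suc K′) = []-trans (⊞-cong[] (small K′) (q^-vanish _ _ (ℕP.≤-trans (ℕP.≤-trans (ℕP.m≤m+n (suc K) s)
        (ℕP.≤-trans (ℕP.m≤n+m s′ (suc K′)) (ℕP.m≤n*m (suc K′ + s′) (suc K′)))) (n≤b*n _ b≥1)))) (≈⇒[] (⊞-identityˡ 𝟘))

open DurfeeLimits

-- The limiting Bailey lemma and the Appell form of g

module AppellSeries where

  private variable
    N : ℕ

  sumS-zero : ∀ n {F : ℕ → S} → (∀ i → i < n → F i ≈ 𝟘) → sumS n F ≈ 𝟘
  sumS-zero zero    p = ≈-refl
  sumS-zero (suc n) p = ≈-trans (⊞-cong (sumS-zero n (λ i l → p i (ℕP.m<n⇒m<1+n l))) (p n ℕP.≤-refl)) (⊞-identityˡ 𝟘)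

  sumS-skip : ∀ k n {F : ℕ → S} → (∀ i → i < k → F i ≈ 𝟘) → sumS (k + n) F ≈ sumS n (λ i → F (k + i))
  sumS-skip zero    n p = ≈-refl
  sumS-skip (suc k) n {F} p = ≈-trans (sumS-head (k + n) F) (≈-trans (⊞-cong (p 0 (s≤s z≤n)) ≈-refl)
    (≈-trans (⊞-identityˡ _) (sumS-skip k n (λ i l → p (suc i) (s≤s l)))))

  module Bailey {b : ℕ} (b≥1 : 1 ≤ b) where
    open Limits b≥1 public

    square : ℤ → S
    square n = q^ (b * ∣ n ∣ * ∣ n ∣)

    private
      -- Put n = k + j: from (k + j)² = k² + j(j + 2k) the sum becomes Q^(k²) times the Durfee
      -- rectangle sum with s = 2k, while terms with n < k vanish.
      Durfee⁺ : ∀ L k → sumS L (λ n → q^ (b * n * n) ⊠ cc b n (+ k)) ≈[ L ] square (+ k) ⊠ I∞ b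
      Durfee⁺ L k with ℕP.≤-total k L
      ... | inj₂ L≤k = []-trans (≈⇒[] (sumS-zero L λ i i<L → low i (ℕP.<-≤-trans i<L L≤k)))
        ([]-sym (q^-vanish _ _ (ℕP.≤-trans L≤k (n≤b*n*n k b≥1))))
        where
        low : ∀ i → i < k → q^ (b * i * i) ⊠ cc b i (+ k) ≈ 𝟘
        low i l = ≈-trans (⊠-congʳ (cc-vanish b i (+ k) l)) (⊠-zeroʳ _)
      ... | inj₁ k≤L with ℕP.m≤n⇒∃[o]m+o≡n k≤L
      ...   | K , refl = begin
        sumS (k + K) (λ n → q^ (b * n * n) ⊠ cc b n (+ k)) ≈⟨ ≈⇒[] (sumS-skip k K λ i l → ≈-trans (⊠-congʳ (cc-vanish b i (+ k) l)) (⊠-zeroʳ _)) ⟩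
        sumS K (λ j → q^ (b * (k + j) * (k + j)) ⊠ cc b (k + j) (+ k)) ≈⟨ ≈⇒[] (≈-trans (sumS-cong K (λ j _ → term j)) (sumS-⊠ˡ K _ _)) ⟩
        square (+ k) ⊠ D K (k + k) ≈⟨ []-mono (ℕP.+-monoˡ-≤ K (n≤b*n*n k b≥1)) (q^-mod (b * k * k) (D-limit K (k + k))) ⟩
        square (+ k) ⊠ I∞ b ∎
        where
        open []-Reasoning (k + K)
        term : ∀ j → q^ (b * (k + j) * (k + j)) ⊠ cc b (k + j) (+ k) ≈ square (+ k) ⊠ Dt (k + k) j
        term j = ≈-trans (⊠-cong (≈-trans (q^-≡ (lem₁ b k j)) (q^-+ _ _))
          (≡⇒≈ (cong₂ (λ x y → I b x ⊠ I b y) (lem₂ (+ k) (+ j)) (cong +_ (lem₃ k j))))) (⊠-assoc _ _ _)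
          where
          lem₁ : ∀ b k j → b * (k + j) * (k + j) ≡ b * k * k + b * (j * (j + (k + k)))
          lem₁ = ℕ-solve
          lem₂ : ∀ k j → k ℤ.+ j ℤ.- k ≡ j
          lem₂ = ℤ-solve
          lem₃ : ∀ k j → k + j + k ≡ j + (k + k)
          lem₃ = ℕ-solve

    Durfee : ∀ L m → sumS L (λ n → q^ (b * n * n) ⊠ cc b n m) ≈[ L ] square m ⊠ I∞ b
    Durfee L (+ k)    = Durfee⁺ L k
    Durfee L -[1+ k ] = []-trans (≈⇒[] (sumS-cong L λ n _ → ⊠-congʳ (≈-sym (cc-neg b n -[1+ k ])))) (Durfee⁺ L (suc k))

    -- Interchange of summations; the sum over n is then a Durfee rectangle sum. Convergence comes
    -- from the weight `t`, so `ρ` is arbitrary.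
    bailey : ∀ (ρ : ℤ → S) N →
      sumS N (λ n → q^ (b * n * n) ⊠ sumZ n (λ m → t m ⊠ cc b n m ⊠ ρ m)) ≈[ N ] I∞ b ⊠ ∑ℤ (λ m → t m ⊠ (square m ⊠ ρ m))
    bailey ρ N = begin
      sumS N (λ n → q^ (b * n * n) ⊠ sumZ n (λ m → t m ⊠ cc b n m ⊠ ρ m))
        ≈⟨ ≈⇒[] (sumS-cong N (λ n l → ≈-trans (⊠-congʳ (extend n l)) (≈-sym (sumZ-⊠ˡ N _ _)))) ⟩
      sumS N (λ n → sumZ N (λ m → q^ (b * n * n) ⊠ (t m ⊠ cc b n m ⊠ ρ m))) ≈⟨ ≈⇒[] (sumS-sumZ-swap N N _) ⟩
      sumZ N (λ m → sumS N (λ n → q^ (b * n * n) ⊠ (t m ⊠ cc b n m ⊠ ρ m))) ≈⟨ sumZ-cong[] N (λ m _ → inner m) ⟩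
      sumZ N (λ m → I∞ b ⊠ (t m ⊠ (square m ⊠ ρ m))) ≈⟨ ≈⇒[] (sumZ-⊠ˡ N _ _) ⟩
      I∞ b ⊠ sumZ N (λ m → t m ⊠ (square m ⊠ ρ m)) ≈⟨ ⊠-cong[] []-refl (∑-approx (Tame-⊠ʳ _ t-tame) N) ⟩
      I∞ b ⊠ ∑ℤ (λ m → t m ⊠ (square m ⊠ ρ m)) ∎
      where
      open []-Reasoning N
      extend : ∀ n → n < N → sumZ n (λ m → t m ⊠ cc b n m ⊠ ρ m) ≈ sumZ N (λ m → t m ⊠ cc b n m ⊠ ρ m)
      extend n n<N = ≈-sym (≈-trans (≡⇒≈ (cong (λ k → sumZ k _) (sym (ℕP.m∸n+n≡m (ℕP.<⇒≤ n<N))))) (sumZ-extend n (N ∸ n)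
        λ m l → ≈-trans (⊠-congˡ (⊠-congʳ (cc-vanish b n m l))) (solve 2 (λ x y → x :* :0 :* y := :0) ≈-refl _ _)))
      inner : ∀ m → sumS N (λ n → q^ (b * n * n) ⊠ (t m ⊠ cc b n m ⊠ ρ m)) ≈[ N ] I∞ b ⊠ (t m ⊠ (square m ⊠ ρ m))
      inner m = []-trans (≈⇒[] (≈-trans (sumS-cong N (λ n _ → solve 4 (λ q t c r → q :* (t :* c :* r) := t :* r :* (q :* c)) ≈-refl _ _ _ _)) (sumS-⊠ˡ N _ _)))
        ([]-trans (⊠-cong[] []-refl (Durfee N m)) (≈⇒[] (solve 4 (λ t r s i → t :* r :* (s :* i) := i :* (t :* (s :* r))) ≈-refl _ _ _ _)))

    -- Euler's pentagonal number theorem, from `bailey` with ρ = 1: for n ≥ 1 the inner sums vanish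
    -- by `vanishing₁`, and n = 0 contributes 1.
    pentagonal : I∞ b ⊠ ∑ℤ (λ m → t m ⊠ square m) ≈ 𝟙
    pentagonal = []⇒≈ λ N → []-sym ([]-trans ([]-mono (ℕP.n≤1+n N) ([]-trans (≈⇒[] (≈-sym (finite N))) (bailey (λ _ → 𝟙) (suc N))))
      (≈⇒[] (⊠-congʳ (∑-cong (Tame-⊠ʳ _ t-tame) (Tame-⊠ʳ _ t-tame) λ m → ⊠-congʳ (⊠-identityʳ _)))))
      where
      F : ℕ → S
      F n = q^ (b * n * n) ⊠ sumZ n (λ m → t m ⊠ cc b n m ⊠ 𝟙)
      F-0 : F 0 ≈ 𝟙
      F-0 = ≈-trans (⊠-cong (≈-trans (q^-≡ (ℕP.*-zeroʳ (b * 0))) q^-0) (⊠-congˡ (⊠-cong (θ-0 (⊝ 𝟙) b 0) (⊠-cong invS-𝟙 invS-𝟙))))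
        (solve 0 (:1 :* (:1 :* (:1 :* :1) :* :1) := :1) ≈-refl)
      F-suc : ∀ n → F (suc n) ≈ 𝟘
      F-suc n = ≈-trans (⊠-congʳ (≈-trans (sumZ-cong (suc n) (λ m _ → ⊠-identityʳ _)) (vanishing₁ b b≥1 n))) (⊠-zeroʳ _)
      finite : ∀ N → sumS (suc N) F ≈ 𝟙
      finite N = ≈-trans (sumS-head N F) (≈-trans (⊞-cong F-0 (sumS-zero N λ i _ → F-suc i)) (⊞-identityʳ _))

  -- the series part of g(x ; q^b) at x = -η q^α, with β = b - α
  gS : S → ℕ → ℕ → ℕ → S
  gS η α β b = lim (λ N → sumS N (λ n → q^ (b * n * n) ⊠ invS (pp η α b (suc n) ⊠ pp η β b n)))

  module AppellSums (η : S) (η²≈1 : η ⊠ η ≈ 𝟙) (α β : ℕ) (b≥1 : 1 ≤ α + β)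
    (Uα : ∀ k → U (𝟙 ⊞ η ⊠ q^ (α + (α + β) * k))) (Uβ : ∀ k → U (𝟙 ⊞ η ⊠ q^ (β + (α + β) * k))) where
    open PartialFractions η η²≈1 α β b≥1 Uα Uβ public using (r; A; partial-fractions)
    open Bailey b≥1 public
    private b = α + β

    AS : S
    AS = ∑ℤ (λ n → t n ⊠ r n)

    -- Limit of the finite partial fractions, whose kernel tends to 1/(Q)²_∞. The index N + 1 makes
    -- up for the order lost in `cc-sum-limit`.
    product-formula : pp∞ η α b ⊠ pp∞ η β b ⊠ AS ≈ J b ⊠ J b
    product-formula = U-cancel (U-⊠ uI uI) (≈-trans ([]⇒≈ λ N → begin
      I∞ b ⊠ I∞ b ⊠ (pp∞ η α b ⊠ pp∞ η β b ⊠ AS)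
        ≈⟨ ≈⇒[] (solve 4 (λ i x y a → i :* i :* (x :* y :* a) := x :* y :* (i :* i :* a)) ≈-refl _ _ _ _) ⟩
      pp∞ η α b ⊠ pp∞ η β b ⊠ (I∞ b ⊠ I∞ b ⊠ AS)
        ≈⟨ ⊠-cong[] (⊠-cong[] ([]-mono (ℕP.≤-trans (ℕP.n≤1+n N) (ℕP.n≤1+n (suc N))) (lim-approx (pp-Cauchy η α b≥1) (suc (suc N)))) ([]-mono (ℕP.n≤1+n N) (lim-approx (pp-Cauchy η β b≥1) (suc N)))) (cc-sum-limit r N) ⟨
      pp η α b (suc (suc N)) ⊠ pp η β b (suc N) ⊠ A (suc N) ≈⟨ ≈⇒[] (partial-fractions (suc N)) ⟩
      𝟙 ∎)
      (≈-sym (≈-trans (solve 2 (λ i j → i :* i :* (j :* j) := (j :* i) :* (j :* i)) ≈-refl (I∞ b) (J b))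
        (≈-trans (⊠-cong (⊠-invS (U-J b≥1)) (⊠-invS (U-J b≥1))) (⊠-identityˡ 𝟙)))))
      where
      open module R {N} = []-Reasoning N
      uI = U-invS (U-J b≥1)

    private
      gF : ℕ → S
      gF n = q^ (b * n * n) ⊠ invS (pp η α b (suc n) ⊠ pp η β b n)

      gF-Cauchy : Cauchy (λ N → sumS N gF)
      gF-Cauchy N = []-sym ([]-trans (⊞-cong[] []-refl (q^-vanish _ _ (n≤b*n*n N b≥1))) (≈⇒[] (⊞-identityʳ _)))

    -- By `partial-fractions`, `A n` is the reciprocal of the n-th denominator of g, so the partial
    -- sums are those treated by `bailey`.
    gS-formula : gS η α β b ≈ I∞ b ⊠ ∑ℤ (λ n → t n ⊠ (square n ⊠ r n))
    gS-formula = lim-unique gF-Cauchy λ N → []-trans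
      (≈⇒[] (sumS-cong N λ n _ → ⊠-congʳ (≈-sym (inverse-unique (partial-fractions n))))) (bailey r N)

open AppellSeries

-- Calculus of 1/(1 ± q^j) for integral j

module Reciprocals where

  private variable
    u : S

  -- 1 / (1 + η q^j) for integral j, where η = ±1
  rc : S → ℤ → S
  rc η (+ n)    = invS (𝟙 ⊞ η ⊠ q^ n)
  rc η -[1+ n ] = 𝟙 ⊟ invS (𝟙 ⊞ η ⊠ q^ (suc n))

  d e : ℤ → S
  d = rc (⊝ 𝟙)
  e = rc 𝟙

  -- At j = 0 the denominator of `e` is 2, a unit, while that of `d` is 0; hence the condition j ≠ 0
  -- in statements about `d`.
  U-2 : U (𝟙 ⊞ 𝟙)
  U-2 = K ½ , ≈-trans (⊠-congˡ (≈-sym (K-⊞ 1ℚ 1ℚ))) (≈-sym (K-⊠ (1ℚ ℚ.+ 1ℚ) ½))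

  U-e : ∀ n → U (𝟙 ⊞ 𝟙 ⊠ q^ n)
  U-e zero    = U-cong (⊞-congʳ (≈-sym (≈-trans (⊠-identityˡ _) q^-0))) U-2
  U-e (suc n) = U-1+cq^ 𝟙 (s≤s z≤n)

  U-pp : ∀ α b n → U (pp 𝟙 α b n)
  U-pp α b zero    = U-𝟙
  U-pp α b (suc n) = U-⊠ (U-pp α b n) (U-e _)

  -- With j = A - B the factor stands for q^B (1 + η q^j) free of negative powers. It need not be a
  -- unit, but as a unit times a power of q it can be cancelled.
  Reg : S → ℕ → ℕ → Set
  Reg η A B = ∀ {f g} → (q^ B ⊞ η ⊠ q^ A) ⊠ f ≈ (q^ B ⊞ η ⊠ q^ A) ⊠ g → f ≈ g

  module _ (η : S) (η²≈1 : η ⊠ η ≈ 𝟙) where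
    open ≈-Reasoning

    Reg-intro : ∀ A B → A ≢ B ⊎ U (𝟙 ⊞ η) → Reg η A B
    Reg-intro A B c {f} {g} p with ℕP.≤-total A B
    ... | inj₁ l with ℕP.m≤n⇒∃[o]m+o≡n l
    ...   | k , refl = U-cancel (unit k c) (q^-cancel A (≈-trans (≈-sym (eq f)) (≈-trans p (eq g))))
      where
      unit : ∀ k → A ≢ A + k ⊎ U (𝟙 ⊞ η) → U (η ⊞ q^ k)
      unit zero    (inj₁ c) = contradiction (sym (ℕP.+-identityʳ A)) c
      unit zero    (inj₂ u) = U-cong (≈-trans (⊞-comm 𝟙 η) (⊞-congʳ (≈-sym q^-0))) u
      unit (suc k) _        = U-cong (≈-trans (⊠-distribˡ η 𝟙 _) (⊞-cong (⊠-identityʳ η) (≈-trans (≈-sym (⊠-assoc _ _ _)) (≈-trans (⊠-congˡ η²≈1) (⊠-identityˡ _)))))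
        (U-⊠ (η , η²≈1) (U-1+cq^ η (s≤s z≤n)))
      eq : ∀ f → (q^ (A + k) ⊞ η ⊠ q^ A) ⊠ f ≈ q^ A ⊠ ((η ⊞ q^ k) ⊠ f)
      eq f = ≈-trans (⊠-congˡ (⊞-cong (q^-+ A k) ≈-refl)) (solve 4 (λ a k h f → (a :* k :+ h :* a) :* f := a :* ((h :+ k) :* f)) ≈-refl _ _ _ _)
    Reg-intro A B c {f} {g} p | inj₂ l with ℕP.m≤n⇒∃[o]m+o≡n l
    ...   | k , refl = U-cancel (unit k c) (q^-cancel B (≈-trans (≈-sym (eq f)) (≈-trans p (eq g))))
      where
      unit : ∀ k → B + k ≢ B ⊎ U (𝟙 ⊞ η) → U (𝟙 ⊞ η ⊠ q^ k)
      unit zero    (inj₁ c) = contradiction (ℕP.+-identityʳ B) c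
      unit zero    (inj₂ u) = U-cong (⊞-congʳ (≈-trans (≈-sym (⊠-identityʳ η)) (⊠-congʳ (≈-sym q^-0)))) u
      unit (suc k) _        = U-1+cq^ η (s≤s z≤n)
      eq : ∀ f → (q^ B ⊞ η ⊠ q^ (B + k)) ⊠ f ≈ q^ B ⊠ ((𝟙 ⊞ η ⊠ q^ k) ⊠ f)
      eq f = ≈-trans (⊠-congˡ (⊞-congʳ (⊠-congʳ (q^-+ B k)))) (solve 4 (λ a k h f → (a :+ h :* (a :* k)) :* f := a :* ((:1 :+ h :* k) :* f)) ≈-refl _ _ _ _)

    -- The homogeneous form treats both signs of j at once; identities between reciprocals are then
    -- proved by clearing such denominators.
    rc-spec : ∀ j A B → + A ≡ j ℤ.+ + B → j ≢ + 0 ⊎ U (𝟙 ⊞ η) → (q^ B ⊞ η ⊠ q^ A) ⊠ rc η j ≈ q^ B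
    rc-spec (+ n) A B p c rewrite ℤP.+-injective p = begin
      (q^ B ⊞ η ⊠ q^ (n + B)) ⊠ rc η (+ n) ≈⟨ ⊠-congˡ (⊞-congʳ (⊠-congʳ (q^-+ n B))) ⟩
      (q^ B ⊞ η ⊠ (q^ n ⊠ q^ B)) ⊠ rc η (+ n) ≈⟨ solve 4 (λ a k h f → (a :+ h :* (k :* a)) :* f := a :* ((:1 :+ h :* k) :* f)) ≈-refl _ _ _ _ ⟩
      q^ B ⊠ ((𝟙 ⊞ η ⊠ q^ n) ⊠ rc η (+ n)) ≈⟨ ⊠-congʳ (⊠-invS (unit n c)) ⟩
      q^ B ⊠ 𝟙 ≈⟨ ⊠-identityʳ _ ⟩
      q^ B ∎
      where
      unit : ∀ n → + n ≢ + 0 ⊎ U (𝟙 ⊞ η) → U (𝟙 ⊞ η ⊠ q^ n)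
      unit zero    (inj₁ c) = contradiction refl c
      unit zero    (inj₂ u) = U-cong (⊞-congʳ (≈-trans (≈-sym (⊠-identityʳ η)) (⊠-congʳ (≈-sym q^-0)))) u
      unit (suc n) _        = U-1+cq^ η (s≤s z≤n)
    rc-spec -[1+ n ] A B p c = begin
      (q^ B ⊞ η ⊠ q^ A) ⊠ (𝟙 ⊟ v) ≈⟨ ⊠-congˡ (⊞-cong B≈ ≈-refl) ⟩
      (Z ⊠ q^ A ⊞ η ⊠ q^ A) ⊠ (𝟙 ⊟ v)
        ≈⟨ linear (⊝ (η ⊠ q^ A)) (⊠-invS (U-1+cq^ η {suc n} (s≤s z≤n))) (linear (q^ A ⊠ Z ⊠ v) η²≈1
          (solve 4 (λ Z A h v → (Z :* A :+ h :* A) :* (:1 :- v) :+ :- (h :* A) :* :1 :+ A :* Z :* v :* :1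
             := Z :* A :+ :- (h :* A) :* ((:1 :+ h :* Z) :* v) :+ A :* Z :* v :* (h :* h)) ≈-refl Z (q^ A) η v)) ⟩
      Z ⊠ q^ A ≈⟨ B≈ ⟨
      q^ B ∎
      where
      v = invS (𝟙 ⊞ η ⊠ q^ (suc n))
      Z = q^ (suc n)
      B≡ : B ≡ suc n + A
      B≡ = ℤP.+-injective (trans (lem (+ n) (+ B)) (cong (λ x → + suc n ℤ.+ x) (sym p)))
        where
        lem : ∀ n B → B ≡ (+ 1 ℤ.+ n) ℤ.+ (ℤ.- (+ 1 ℤ.+ n) ℤ.+ B)
        lem = ℤ-solve
      B≈ : q^ B ≈ Z ⊠ q^ A
      B≈ = ≈-trans (q^-≡ B≡) (q^-+ (suc n) A)

  nonneg-diff : ∀ j → ∃ λ A → ∃ λ B → + A ≡ j ℤ.+ + B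
  nonneg-diff (+ n) = n , 0 , cong +_ (sym (ℕP.+-identityʳ n))
  nonneg-diff -[1+ n ] = 0 , suc n , sym (ℤP.+-inverseˡ (+ suc n))

  𝟙²≈𝟙 : 𝟙 ⊠ 𝟙 ≈ 𝟙
  𝟙²≈𝟙 = ⊠-identityˡ 𝟙

  e-reg : ∀ A B → Reg 𝟙 A B
  e-reg A B = Reg-intro 𝟙 𝟙²≈𝟙 A B (inj₂ U-2)

  d-reg : ∀ {A B} → A ≢ B → Reg (⊝ 𝟙) A B
  d-reg {A} {B} c = Reg-intro (⊝ 𝟙) -1²≈1 A B (inj₁ c)

  e-spec : ∀ j A B → + A ≡ j ℤ.+ + B → (q^ B ⊞ 𝟙 ⊠ q^ A) ⊠ e j ≈ q^ B
  e-spec j A B p = rc-spec 𝟙 𝟙²≈𝟙 j A B p (inj₂ U-2)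

  d-spec : ∀ j A B → + A ≡ j ℤ.+ + B → j ≢ + 0 → (q^ B ⊞ ⊝ 𝟙 ⊠ q^ A) ⊠ d j ≈ q^ B
  d-spec j A B p c = rc-spec (⊝ 𝟙) -1²≈1 j A B p (inj₁ c)

  diff-≢ : ∀ j {A B} → + A ≡ j ℤ.+ + B → j ≢ + 0 → A ≢ B
  diff-≢ j {A} p c refl = c (trans (lem j (+ A)) (trans (cong (ℤ._- + A) (sym p)) (ℤP.+-inverseʳ (+ A))))
    where
    lem : ∀ j A → j ≡ j ℤ.+ A ℤ.- A
    lem = ℤ-solve

  module _ where
    open ≈-Reasoning

    swap-diff : ∀ j {A B} → + A ≡ j ℤ.+ + B → + B ≡ ℤ.- j ℤ.+ + A
    swap-diff j {A} {B} p = trans (lem j (+ B)) (cong (λ x → ℤ.- j ℤ.+ x) (sym p))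
      where
      lem : ∀ j B → B ≡ ℤ.- j ℤ.+ (j ℤ.+ B)
      lem = ℤ-solve

    e-neg : ∀ j → e (ℤ.- j) ≈ 𝟙 ⊟ e j
    e-neg j with nonneg-diff j
    ... | A , B , p = e-reg A B (linear 𝟙 (e-spec j A B p) (linear 𝟙 (e-spec (ℤ.- j) B A (swap-diff j p))
      (solve 4 (λ A B x y → (B :+ :1 :* A) :* y :+ :1 :* B :+ :1 :* A
        := (B :+ :1 :* A) :* (:1 :- x) :+ :1 :* ((B :+ :1 :* A) :* x) :+ :1 :* ((A :+ :1 :* B) :* y)) ≈-refl (q^ A) (q^ B) (e j) (e (ℤ.- j)))))

    -- z/(1 + z) = 1 - 1/(1 + z) at z = q^j, multiplied by q^B.
    e-swap : ∀ j A B → + A ≡ j ℤ.+ + B → q^ A ⊠ e j ≈ q^ B ⊟ q^ B ⊠ e j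
    e-swap j A B p = linear 𝟙 (e-spec j A B p) (solve 3 (λ A B x → A :* x :+ :1 :* B := B :- B :* x :+ :1 :* ((B :+ :1 :* A) :* x)) ≈-refl (q^ A) (q^ B) (e j))

    d-swap : ∀ j A B → + A ≡ j ℤ.+ + B → j ≢ + 0 → q^ A ⊠ d j ≈ q^ B ⊠ d j ⊟ q^ B
    d-swap j A B p c = linear (⊝ 𝟙) (d-spec j A B p c) (solve 3 (λ A B x → A :* x :+ :- :1 :* B := B :* x :- B :+ :- :1 :* ((B :+ :- :1 :* A) :* x)) ≈-refl (q^ A) (q^ B) (d j))

    double-diff : ∀ j {A B} → + A ≡ j ℤ.+ + B → + (A + A) ≡ (j ℤ.+ j) ℤ.+ + (B + B)
    double-diff j {A} {B} p = trans (cong₂ ℤ._+_ p p) (lem j (+ B))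
      where
      lem : ∀ j B → (j ℤ.+ B) ℤ.+ (j ℤ.+ B) ≡ (j ℤ.+ j) ℤ.+ (B ℤ.+ B)
      lem = ℤ-solve

    double-≢ : ∀ j → j ≢ + 0 → j ℤ.+ j ≢ + 0
    double-≢ (+ zero)  c _  = c refl
    double-≢ (+ suc n) c ()
    double-≢ -[1+ n ]  c ()

    private
      d2-spec : ∀ j A B → + A ≡ j ℤ.+ + B → j ≢ + 0 → (q^ B ⊠ q^ B ⊞ ⊝ 𝟙 ⊠ (q^ A ⊠ q^ A)) ⊠ d (j ℤ.+ j) ≈ q^ B ⊠ q^ B
      d2-spec j A B p c = ≈-trans (⊠-congˡ (⊞-cong (≈-sym (q^-+ B B)) (⊠-congʳ (≈-sym (q^-+ A A)))))
        (≈-trans (d-spec (j ℤ.+ j) (A + A) (B + B) (double-diff j p) (double-≢ j c)) (q^-+ B B))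

    -- 1/(1 - z) = (1 + z)/(1 - z²) at z = q^j. For odd j this separates even from odd powers of q.
    d-split : ∀ j A B → + A ≡ j ℤ.+ + B → j ≢ + 0 → q^ B ⊠ d j ≈ q^ B ⊠ d (j ℤ.+ j) ⊞ q^ A ⊠ d (j ℤ.+ j)
    d-split j A B p c = d-reg (diff-≢ j p c) (linear (q^ B) (d-spec j A B p c) (linear (⊝ 𝟙) (d2-spec j A B p c)
      (solve 4 (λ A B x y → (B :+ :- :1 :* A) :* (B :* x) :+ B :* B :+ :- :1 :* (B :* B)
        := (B :+ :- :1 :* A) :* (B :* y :+ A :* y) :+ B :* ((B :+ :- :1 :* A) :* x) :+ :- :1 :* ((B :* B :+ :- :1 :* (A :* A)) :* y)) ≈-refl (q^ A) (q^ B) (d j) (d (j ℤ.+ j)))))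

    e-split : ∀ j A B → + A ≡ j ℤ.+ + B → j ≢ + 0 → q^ B ⊠ e j ≈ q^ B ⊠ d (j ℤ.+ j) ⊟ q^ A ⊠ d (j ℤ.+ j)
    e-split j A B p c = e-reg A B (linear (q^ B) (e-spec j A B p) (linear (⊝ 𝟙) (d2-spec j A B p c)
      (solve 4 (λ A B x y → (B :+ :1 :* A) :* (B :* x) :+ B :* B :+ :- :1 :* (B :* B)
        := (B :+ :1 :* A) :* (B :* y :- A :* y) :+ B :* ((B :+ :1 :* A) :* x) :+ :- :1 :* ((B :* B :+ :- :1 :* (A :* A)) :* y)) ≈-refl (q^ A) (q^ B) (e j) (d (j ℤ.+ j)))))

    common-diff : ∀ a b → ∃ λ A → ∃ λ B → ∃ λ C → (+ A ≡ a ℤ.+ + C) × (+ B ≡ b ℤ.+ + C)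
    common-diff a b with nonneg-diff a | nonneg-diff b
    ... | A , C , p | B , D , r = A + D , B + C , C + D , trans (cong (ℤ._+ + D) p) (lem₁ a (+ C) (+ D)) , trans (cong (ℤ._+ + C) r) (lem₂ b (+ C) (+ D))
      where
      lem₁ : ∀ a C D → a ℤ.+ C ℤ.+ D ≡ a ℤ.+ (C ℤ.+ D)
      lem₁ = ℤ-solve
      lem₂ : ∀ a C D → a ℤ.+ D ℤ.+ C ≡ a ℤ.+ (C ℤ.+ D)
      lem₂ = ℤ-solve

    -- partial fractions of 1 / ((1 - q^a)(1 + q^b))
    d-e-split : ∀ a b → a ≢ + 0 → d a ⊠ e b ≈ d a ⊠ e (b ℤ.- a) ⊞ e b ⊠ e (a ℤ.- b)
    d-e-split a b c with common-diff a b
    ... | A , B , C , p , r = d-reg {A} {C} (diff-≢ a p c) (e-reg B C (e-reg B A (begin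
        P ⊠ (Q ⊠ (R ⊠ (d a ⊠ e b)))
          ≈⟨ solve 5 (λ P Q R d e → P :* (Q :* (R :* (d :* e))) := P :* (R :* d) :* (Q :* e)) ≈-refl P Q R (d a) (e b) ⟩
        P ⊠ (R ⊠ d a) ⊠ (Q ⊠ e b) ≈⟨ ⊠-cong (⊠-congʳ hd) he ⟩
        P ⊠ q^ C ⊠ q^ C
          -- Up to homogenisation, with A = q^a, B = q^b and C in place of 1, this is A + B = (1 +
          -- B) A + (1 - A) B.
          ≈⟨ solve 3 (λ A B C → (A :+ :1 :* B) :* C :* C := (C :+ :1 :* B) :* (C :* A) :+ (C :+ :- :1 :* A) :* (C :* B)) ≈-refl (q^ A) (q^ B) (q^ C) ⟩
        Q ⊠ (q^ C ⊠ q^ A) ⊞ R ⊠ (q^ C ⊠ q^ B)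
          ≈⟨ ⊞-cong (⊠-congʳ (⊠-cong hd h₁)) (⊠-congʳ (⊠-cong he h₂)) ⟨
        Q ⊠ (R ⊠ d a ⊠ (P ⊠ e (b ℤ.- a))) ⊞ R ⊠ (Q ⊠ e b ⊠ (P ⊠ e (a ℤ.- b)))
          ≈⟨ solve 7 (λ P Q R d e x y → Q :* (R :* d :* (P :* x)) :+ R :* (Q :* e :* (P :* y)) := P :* (Q :* (R :* (d :* x :+ e :* y)))) ≈-refl P Q R (d a) (e b) _ _ ⟩
        P ⊠ (Q ⊠ (R ⊠ (d a ⊠ e (b ℤ.- a) ⊞ e b ⊠ e (a ℤ.- b)))) ∎)))
      where
      P = q^ A ⊞ 𝟙 ⊠ q^ B
      Q = q^ C ⊞ 𝟙 ⊠ q^ B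
      R = q^ C ⊞ ⊝ 𝟙 ⊠ q^ A
      hd : R ⊠ d a ≈ q^ C
      hd = d-spec a A C p c
      he : Q ⊠ e b ≈ q^ C
      he = e-spec b B C r
      h₁ : P ⊠ e (b ℤ.- a) ≈ q^ A
      h₁ = e-spec (b ℤ.- a) B A (trans r (trans (lem a b (+ C)) (cong (λ x → b ℤ.- a ℤ.+ x) (sym p))))
        where
        lem : ∀ a b C → b ℤ.+ C ≡ b ℤ.- a ℤ.+ (a ℤ.+ C)
        lem = ℤ-solve
      h₂ : P ⊠ e (a ℤ.- b) ≈ q^ B
      h₂ = ≈-trans (⊠-congˡ (solve 2 (λ A B → A :+ :1 :* B := B :+ :1 :* A) ≈-refl (q^ A) (q^ B)))
        (e-spec (a ℤ.- b) A B (trans p (trans (lem a b (+ C)) (cong (λ x → a ℤ.- b ℤ.+ x) (sym r)))))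
        where
        lem : ∀ a b C → a ℤ.+ C ≡ a ℤ.- b ℤ.+ (b ℤ.+ C)
        lem = ℤ-solve

open Reciprocals

-- Products of Appell sums and quasi-periodicity

module QuasiPeriodicSums where

  private variable
    f : S

  -- Partial fractions are applied on a square window; in each half the inner summation is over the
  -- index absent from the prefactor. Convergence rests on the weights `s` and `u` alone.
  double-sum : ∀ {s u : ℤ → S} → Tame s → Tame u → (a c : ℤ → ℤ) → (∀ n → a n ≢ + 0) →
    ∑ℤ (λ n → s n ⊠ d (a n)) ⊠ ∑ℤ (λ m → u m ⊠ e (c m)) ≈
    ∑ℤ (λ n → s n ⊠ (d (a n) ⊠ ∑ℤ (λ m → u m ⊠ e (c m ℤ.- a n)))) ⊞
    ∑ℤ (λ m → u m ⊠ (e (c m) ⊠ ∑ℤ (λ n → s n ⊠ e (a n ℤ.- c m))))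
  double-sum {s} {u} ts tu a c a≢0 = []⇒≈ λ N → begin
    ∑ℤ (λ n → s n ⊠ d (a n)) ⊠ ∑ℤ (λ m → u m ⊠ e (c m))
      ≈⟨ ⊠-cong[] (∑-approx (Tame-⊠ʳ _ ts) N) (∑-approx (Tame-⊠ʳ _ tu) N) ⟨
    sumZ N (λ n → s n ⊠ d (a n)) ⊠ sumZ N (λ m → u m ⊠ e (c m))
      ≈⟨ ≈⇒[] (≈-trans (≈-sym (sumZ-⊠ʳ N _ _)) (sumZ-cong N λ n _ → ≈-sym (sumZ-⊠ˡ N _ _))) ⟩
    sumZ N (λ n → sumZ N (λ m → s n ⊠ d (a n) ⊠ (u m ⊠ e (c m))))
      ≈⟨ ≈⇒[] (sumZ-cong N λ n _ → ≈-trans (sumZ-cong N λ m _ → split n m) (sumZ-⊞ N _ _)) ⟩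
    sumZ N (λ n → sumZ N (λ m → X n m) ⊞ sumZ N (λ m → Y n m)) ≈⟨ ≈⇒[] (≈-trans (sumZ-⊞ N _ _) (⊞-congʳ (sumZ-swap N N Y))) ⟩
    sumZ N (λ n → sumZ N (λ m → X n m)) ⊞ sumZ N (λ m → sumZ N (λ n → Y n m))
      ≈⟨ ⊞-cong[] (sumZ-cong[] N (λ n _ → innerX N n)) (sumZ-cong[] N (λ m _ → innerY N m)) ⟩
    sumZ N (λ n → s n ⊠ (d (a n) ⊠ ∑ℤ (λ m → u m ⊠ e (c m ℤ.- a n)))) ⊞ sumZ N (λ m → u m ⊠ (e (c m) ⊠ ∑ℤ (λ n → s n ⊠ e (a n ℤ.- c m))))
      ≈⟨ ⊞-cong[] (∑-approx (Tame-⊠ʳ _ ts) N) (∑-approx (Tame-⊠ʳ _ tu) N) ⟩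
    ∑ℤ (λ n → s n ⊠ (d (a n) ⊠ ∑ℤ (λ m → u m ⊠ e (c m ℤ.- a n)))) ⊞ ∑ℤ (λ m → u m ⊠ (e (c m) ⊠ ∑ℤ (λ n → s n ⊠ e (a n ℤ.- c m)))) ∎
    where
    open module R {N} = []-Reasoning N
    X Y : ℤ → ℤ → S
    X n m = s n ⊠ d (a n) ⊠ (u m ⊠ e (c m ℤ.- a n))
    Y n m = u m ⊠ e (c m) ⊠ (s n ⊠ e (a n ℤ.- c m))
    split : ∀ n m → s n ⊠ d (a n) ⊠ (u m ⊠ e (c m)) ≈ X n m ⊞ Y n m
    split n m = ≈-trans (solve 4 (λ s d u e → s :* d :* (u :* e) := s :* u :* (d :* e)) ≈-refl _ _ _ _)
      (≈-trans (⊠-congʳ (d-e-split (a n) (c m) (a≢0 n)))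
      (solve 6 (λ s u d e x y → s :* u :* (d :* x :+ e :* y) := s :* d :* (u :* x) :+ u :* e :* (s :* y)) ≈-refl _ _ _ _ _ _))
    innerX : ∀ N n → sumZ N (λ m → X n m) ≈[ N ] s n ⊠ (d (a n) ⊠ ∑ℤ (λ m → u m ⊠ e (c m ℤ.- a n)))
    innerX N n = []-trans (≈⇒[] (≈-trans (sumZ-⊠ˡ N _ _) (⊠-assoc _ _ _))) (⊠-cong[] []-refl (⊠-cong[] []-refl (∑-approx (Tame-⊠ʳ _ tu) N)))
    innerY : ∀ N m → sumZ N (λ n → Y n m) ≈[ N ] u m ⊠ (e (c m) ⊠ ∑ℤ (λ n → s n ⊠ e (a n ℤ.- c m)))
    innerY N m = []-trans (≈⇒[] (≈-trans (sumZ-⊠ˡ N _ _) (⊠-assoc _ _ _))) (⊠-cong[] []-refl (⊠-cong[] []-refl (∑-approx (Tame-⊠ʳ _ ts) N)))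

  T T′ : ℕ → ℤ → S
  T b = θ (⊝ 𝟙) b 0
  T′ b = θ (⊝ 𝟙) 0 b

  T-tame : ∀ {b} → 1 ≤ b → Tame (T b)
  T-tame l = Limits.t-tame l

  T-neg : ∀ b m → T b (ℤ.- m) ≈ T′ b m
  T-neg b m = θ-neg (⊝ 𝟙) b 0 m

  T′-neg : ∀ b m → T′ b (ℤ.- m) ≈ T b m
  T′-neg b m = θ-neg (⊝ 𝟙) 0 b m

  T′-tame : ∀ {b} → 1 ≤ b → Tame (T′ b)
  T′-tame l = Tame-cong (T-neg _) (Tame-neg (T-tame l))

  T′-suc : ∀ b m → T′ b (ℤ.suc m) ≈ ⊝ T b m
  T′-suc b (+ k) = ≈-trans (⊠-cong (≈-sym (⊝-as-⊠ _)) (q^-≡ (lem b k (tri k)))) (solve 2 (λ x y → :- x :* y := :- (x :* y)) ≈-refl _ _)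
    where
    lem : ∀ b k t → b * (k + t) + 0 * suc k ≡ (b + 0) * t + b * k
    lem = ℕ-solve
  T′-suc b -[1+ k ] = ≈-trans (≈-trans (≡⇒≈ (cong (T′ b) (suc-neg k))) (T′-neg b (+ k)))
    (≈-trans (⊠-congʳ (q^-≡ (lem b k (tri k)))) (solve 2 (λ x y → x :* y := :- (:- :1 :* x :* y)) ≈-refl _ _))
    where
    lem : ∀ b k t → (b + 0) * t + b * k ≡ (b + 0) * (k + t) + 0 * suc k
    lem = ℕ-solve

  2-cancel : f ≈ ⊝ f → f ≈ 𝟘
  2-cancel {f} p = U-cancel U-2 (linear 𝟙 p (solve 1 (λ f → (:1 :+ :1) :* f :+ :1 :* :- f := (:1 :+ :1) :* :0 :+ :1 :* f) ≈-refl f))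

  E-diff : ∀ b m → + E b 0 m ≡ + b ℤ.* m ℤ.+ + E 0 b m
  E-diff b (+ k) = trans (cong +_ (lem b k (tri k))) (cong (ℤ._+ + (b * tri k + 0 * k)) (ℤP.pos-* b k))
    where
    lem : ∀ b k t → (b + 0) * t + b * k ≡ b * k + (b * t + 0 * k)
    lem = ℕ-solve
  E-diff b -[1+ k ] = trans (cong +_ (lem b k (tri k))) (trans (lem₂ (+ (b * (k + tri k))) (+ (b * suc k)))
    (cong (λ x → x ℤ.+ + (b * tri (suc k) + b * suc k)) (trans (cong ℤ.-_ (ℤP.pos-* b (suc k))) (ℤP.neg-distribʳ-* (+ b) (+ suc k)))))
    where
    lem : ∀ b k t → (b + 0) * (k + t) + 0 * suc k ≡ b * (k + t)
    lem = ℕ-solve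
    lem₂ : ∀ x y → x ≡ ℤ.- y ℤ.+ (x ℤ.+ y)
    lem₂ = ℤ-solve

  -- The Appell sum at x = -q^k in base q^b for any integral k; for 0 ≤ k < b the product formula
  -- evaluates it.
  Sb : ℕ → ℤ → S
  Sb b k = ∑ℤ (λ m → T b m ⊠ e (k ℤ.+ + b ℤ.* m))

  module QuasiPeriodicity {b : ℕ} (b≥1 : 1 ≤ b) where
    open ≈-Reasoning
    private
      τ = T-tame b≥1
      τ′ = T′-tame b≥1

    -- m ↦ -1 - m preserves m(m + 1)/2 and reverses the sign; it is carried out as a reflection
    -- followed by a shift.
    ∑T≈0 : ∑ℤ (T b) ≈ 𝟘
    ∑T≈0 = 2-cancel (begin
      ∑ℤ (T b) ≈⟨ ∑-neg τ ⟨
      ∑ℤ (λ m → T b (ℤ.- m)) ≈⟨ ∑-cong (Tame-neg τ) τ′ (T-neg b) ⟩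
      ∑ℤ (T′ b) ≈⟨ ∑-suc τ′ suc-tame ⟨
      ∑ℤ (λ m → T′ b (ℤ.suc m)) ≈⟨ ∑-cong suc-tame (Tame-⊠ˡ (λ _ → ⊝ 𝟙) τ) (λ m → ≈-trans (T′-suc b m) (⊝-as-⊠ _)) ⟩
      ∑ℤ (λ m → ⊝ 𝟙 ⊠ T b m) ≈⟨ ∑-⊠ˡ (⊝ 𝟙) τ ⟩
      ⊝ 𝟙 ⊠ ∑ℤ (T b) ≈⟨ ⊝-as-⊠ _ ⟨
      ⊝ ∑ℤ (T b) ∎)
      where
      suc-tame : Tame (λ m → T′ b (ℤ.suc m))
      suc-tame = Tame-cong (λ m → ≈-trans (≈-sym (⊝-as-⊠ _)) (≈-sym (T′-suc b m))) (Tame-⊠ˡ (λ _ → ⊝ 𝟙) τ)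

    ∑T′≈0 : ∑ℤ (T′ b) ≈ 𝟘
    ∑T′≈0 = ≈-trans (∑-cong τ′ (Tame-neg τ) (λ m → ≈-sym (T-neg b m))) (≈-trans (∑-neg τ) ∑T≈0)

    private
      re : ∀ k → ∑ℤ (λ m → T′ b m ⊠ e (k ℤ.+ + b ℤ.* m)) ≈ ⊝ Sb b (k ℤ.+ + b)
      re k = begin
        ∑ℤ F ≈⟨ ∑-suc (Tame-⊠ʳ _ τ′) (Tame-cong (λ m → ≈-sym (F-suc m)) G-tame) ⟨
        ∑ℤ (λ m → F (ℤ.suc m)) ≈⟨ ∑-cong (Tame-cong (λ m → ≈-sym (F-suc m)) G-tame) G-tame F-suc ⟩
        ∑ℤ (λ m → ⊝ 𝟙 ⊠ (T b m ⊠ e (k ℤ.+ + b ℤ.+ + b ℤ.* m))) ≈⟨ ∑-⊠ˡ (⊝ 𝟙) (Tame-⊠ʳ _ τ) ⟩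
        ⊝ 𝟙 ⊠ Sb b (k ℤ.+ + b) ≈⟨ ⊝-as-⊠ _ ⟨
        ⊝ Sb b (k ℤ.+ + b) ∎
        where
        F : ℤ → S
        F m = T′ b m ⊠ e (k ℤ.+ + b ℤ.* m)
        G-tame : Tame (λ m → ⊝ 𝟙 ⊠ (T b m ⊠ e (k ℤ.+ + b ℤ.+ + b ℤ.* m)))
        G-tame = Tame-⊠ˡ _ (Tame-⊠ʳ _ τ)
        lem : ∀ k b m → k ℤ.+ b ℤ.* (+ 1 ℤ.+ m) ≡ k ℤ.+ b ℤ.+ b ℤ.* m
        lem = ℤ-solve
        F-suc : ∀ m → F (ℤ.suc m) ≈ ⊝ 𝟙 ⊠ (T b m ⊠ e (k ℤ.+ + b ℤ.+ + b ℤ.* m))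
        F-suc m = ≈-trans (⊠-cong (T′-suc b m) (≡⇒≈ (cong e (lem k (+ b) m)))) (solve 2 (λ x y → :- x :* y := :- :1 :* (x :* y)) ≈-refl _ _)

    -- q^k T(m) = q^(k + b m) T′(m), and z/(1 + z) = 1 - 1/(1 + z) at z = q^(k + b m). The constant
    -- part sums to 0, and the rest is reindexed by m + 1.
    Sb-shift : ∀ k → Sb b (+ k ℤ.+ + b) ≈ q^ k ⊠ Sb b (+ k)
    Sb-shift k = ≈-sym (begin
      q^ k ⊠ Sb b (+ k) ≈⟨ ∑-⊠ˡ (q^ k) (Tame-⊠ʳ _ τ) ⟨
      ∑ℤ (λ m → q^ k ⊠ (T b m ⊠ e (j m))) ≈⟨ ∑-cong (Tame-⊠ˡ _ (Tame-⊠ʳ _ τ)) (Tame-⊞ τ′ (Tame-⊠ˡ _ (Tame-⊠ʳ _ τ′))) term ⟩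
      ∑ℤ (λ m → T′ b m ⊞ ⊝ 𝟙 ⊠ (T′ b m ⊠ e (j m))) ≈⟨ ∑-⊞ τ′ (Tame-⊠ˡ _ (Tame-⊠ʳ _ τ′)) ⟩
      ∑ℤ (T′ b) ⊞ ∑ℤ (λ m → ⊝ 𝟙 ⊠ (T′ b m ⊠ e (j m))) ≈⟨ ⊞-cong ∑T′≈0 (≈-trans (∑-⊠ˡ (⊝ 𝟙) (Tame-⊠ʳ _ τ′)) (⊠-congʳ (re (+ k)))) ⟩
      𝟘 ⊞ ⊝ 𝟙 ⊠ ⊝ Sb b (+ k ℤ.+ + b) ≈⟨ solve 1 (λ x → :0 :+ :- :1 :* :- x := x) ≈-refl _ ⟩
      Sb b (+ k ℤ.+ + b) ∎)
      where
      j : ℤ → ℤ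
      j m = + k ℤ.+ + b ℤ.* m
      diff : ∀ m → + (k + E b 0 m) ≡ j m ℤ.+ + E 0 b m
      diff m = trans (cong (λ x → + k ℤ.+ x) (E-diff b m)) (sym (ℤP.+-assoc (+ k) (+ b ℤ.* m) (+ E 0 b m)))
      term : ∀ m → q^ k ⊠ (T b m ⊠ e (j m)) ≈ T′ b m ⊞ ⊝ 𝟙 ⊠ (T′ b m ⊠ e (j m))
      term m = ≈-trans (solve 4 (λ q p x e → q :* (p :* x :* e) := p :* (q :* x :* e)) ≈-refl _ _ _ _)
        (≈-trans (⊠-congʳ (≈-trans (⊠-congˡ (≈-sym (q^-+ k (E b 0 m)))) (e-swap (j m) (k + E b 0 m) (E 0 b m) (diff m))))
        (solve 3 (λ p x e → p :* (x :- x :* e) := p :* x :+ :- :1 :* (p :* x :* e)) ≈-refl _ _ _))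

    -- m ↦ -m, combined with 1/(1 + 1/z) = 1 - 1/(1 + z) and the vanishing of the sum of `T b`.
    Sb-reflect : ∀ k → Sb b (+ b ℤ.- k) ≈ Sb b k
    Sb-reflect k = linear 𝟙 main (solve 2 (λ x y → x :+ :1 :* (:0 :- x) := y :+ :1 :* :- y) ≈-refl _ _)
      where
      k′ = k ℤ.- + b
      F : ℤ → S
      F m = T′ b m ⊠ e (k′ ℤ.+ + b ℤ.* m)
      lem₁ : ∀ k b → k ℤ.- b ℤ.+ b ≡ k
      lem₁ = ℤ-solve
      lem₂ : ∀ k b m → k ℤ.- b ℤ.+ b ℤ.* (ℤ.- m) ≡ ℤ.- (b ℤ.- k ℤ.+ b ℤ.* m)
      lem₂ = ℤ-solve
      term : ∀ m → F (ℤ.- m) ≈ T b m ⊞ ⊝ 𝟙 ⊠ (T b m ⊠ e (+ b ℤ.- k ℤ.+ + b ℤ.* m))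
      term m = ≈-trans (⊠-cong (T′-neg b m) (≈-trans (≡⇒≈ (cong e (lem₂ k (+ b) m))) (e-neg (+ b ℤ.- k ℤ.+ + b ℤ.* m))))
        (solve 2 (λ x e → x :* (:1 :- e) := x :+ :- :1 :* (x :* e)) ≈-refl _ _)
      main : ⊝ Sb b k ≈ 𝟘 ⊟ Sb b (+ b ℤ.- k)
      main = begin
        ⊝ Sb b k ≈⟨ ⊝-cong (≡⇒≈ (cong (Sb b) (lem₁ k (+ b)))) ⟨
        ⊝ Sb b (k′ ℤ.+ + b) ≈⟨ re k′ ⟨
        ∑ℤ F ≈⟨ ∑-neg (Tame-⊠ʳ _ τ′) ⟨
        ∑ℤ (λ m → F (ℤ.- m)) ≈⟨ ∑-cong (Tame-neg {F} (Tame-⊠ʳ _ τ′)) (Tame-⊞ τ (Tame-⊠ˡ _ (Tame-⊠ʳ _ τ))) term ⟩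
        ∑ℤ (λ m → T b m ⊞ ⊝ 𝟙 ⊠ (T b m ⊠ e (+ b ℤ.- k ℤ.+ + b ℤ.* m))) ≈⟨ ∑-⊞ τ (Tame-⊠ˡ _ (Tame-⊠ʳ _ τ)) ⟩
        ∑ℤ (T b) ⊞ ∑ℤ (λ m → ⊝ 𝟙 ⊠ (T b m ⊠ e (+ b ℤ.- k ℤ.+ + b ℤ.* m))) ≈⟨ ⊞-cong ∑T≈0 (≈-trans (∑-⊠ˡ (⊝ 𝟙) (Tame-⊠ʳ _ τ)) (≈-sym (⊝-as-⊠ _))) ⟩
        𝟘 ⊟ Sb b (+ b ℤ.- k) ∎

  open QuasiPeriodicity

  module _ where
    open ≈-Reasoning
    private
      1≤2 : 1 ≤ 2
      1≤2 = s≤s z≤n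
      1≤4 : 1 ≤ 4
      1≤4 = s≤s z≤n

      -- Shifts by 4 connect only arguments congruent modulo 4; the second starting value comes from
      -- the reflection of 1 to 3. Exponent 0 at both starts and increments 1 + 2n give n(n - 1)/2.
      S4-nat : ∀ n → Sb 4 (+ (1 + 2 * n)) ≈ q^ (tri n) ⊠ Sb 4 (+ 1)
      S4-nat zero          = ≈-sym (≈-trans (⊠-congˡ q^-0) (⊠-identityˡ _))
      S4-nat (suc zero)    = ≈-trans (Sb-reflect 1≤4 (+ 1)) (≈-sym (≈-trans (⊠-congˡ q^-0) (⊠-identityˡ _)))
      S4-nat (suc (suc n)) = begin
        Sb 4 (+ (1 + 2 * suc (suc n))) ≈⟨ ≡⇒≈ (cong (λ x → Sb 4 (+ x)) (lem₁ n)) ⟩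
        Sb 4 (+ (1 + 2 * n) ℤ.+ + 4) ≈⟨ Sb-shift 1≤4 (1 + 2 * n) ⟩
        q^ (1 + 2 * n) ⊠ Sb 4 (+ (1 + 2 * n)) ≈⟨ ⊠-congʳ (S4-nat n) ⟩
        q^ (1 + 2 * n) ⊠ (q^ (tri n) ⊠ Sb 4 (+ 1)) ≈⟨ ⊠-assoc _ _ _ ⟨
        q^ (1 + 2 * n) ⊠ q^ (tri n) ⊠ Sb 4 (+ 1) ≈⟨ ⊠-congˡ (≈-trans (≈-sym (q^-+ _ _)) (q^-≡ (lem₂ n (tri n)))) ⟩
        q^ (tri (suc (suc n))) ⊠ Sb 4 (+ 1) ∎
        where
        lem₁ : ∀ n → 1 + 2 * suc (suc n) ≡ 1 + 2 * n + 4
        lem₁ = ℕ-solve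
        lem₂ : ∀ n t → 1 + 2 * n + t ≡ suc n + (n + t)
        lem₂ = ℕ-solve

      S2-nat : ∀ n → Sb 2 (+ (1 + 2 * n)) ≈ q^ (n * n) ⊠ Sb 2 (+ 1)
      S2-nat zero    = ≈-sym (≈-trans (⊠-congˡ q^-0) (⊠-identityˡ _))
      S2-nat (suc n) = begin
        Sb 2 (+ (1 + 2 * suc n)) ≈⟨ ≡⇒≈ (cong (λ x → Sb 2 (+ x)) (lem₁ n)) ⟩
        Sb 2 (+ (1 + 2 * n) ℤ.+ + 2) ≈⟨ Sb-shift 1≤2 (1 + 2 * n) ⟩
        q^ (1 + 2 * n) ⊠ Sb 2 (+ (1 + 2 * n)) ≈⟨ ⊠-congʳ (S2-nat n) ⟩
        q^ (1 + 2 * n) ⊠ (q^ (n * n) ⊠ Sb 2 (+ 1)) ≈⟨ ⊠-assoc _ _ _ ⟨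
        q^ (1 + 2 * n) ⊠ q^ (n * n) ⊠ Sb 2 (+ 1) ≈⟨ ⊠-congˡ (≈-trans (≈-sym (q^-+ _ _)) (q^-≡ (lem₂ n))) ⟩
        q^ (suc n * suc n) ⊠ Sb 2 (+ 1) ∎
        where
        lem₁ : ∀ n → 1 + 2 * suc n ≡ 1 + 2 * n + 2
        lem₁ = ℕ-solve
        lem₂ : ∀ n → 1 + 2 * n + n * n ≡ suc n * suc n
        lem₂ = ℕ-solve

    S4-odd : ∀ i → Sb 4 (+ 1 ℤ.+ + 2 ℤ.* i) ≈ q^ (E 0 1 i) ⊠ Sb 4 (+ 1)
    S4-odd (+ n) = ≈-trans (≡⇒≈ (cong (λ x → Sb 4 (+ 1 ℤ.+ x)) (sym (ℤP.pos-* 2 n))))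
      (≈-trans (S4-nat n) (⊠-congˡ (q^-≡ (lem (tri n) n))))
      where
      lem : ∀ t n → t ≡ 1 * t + 0 * n
      lem = ℕ-solve
    -- k ↦ 4 - k sends i to 1 - i, which preserves i(i - 1)/2 and makes the index nonnegative.
    S4-odd -[1+ n ] = begin
      Sb 4 (+ 1 ℤ.+ + 2 ℤ.* -[1+ n ]) ≈⟨ Sb-reflect 1≤4 (+ 1 ℤ.+ + 2 ℤ.* -[1+ n ]) ⟨
      Sb 4 (+ 4 ℤ.- (+ 1 ℤ.+ + 2 ℤ.* -[1+ n ])) ≈⟨ ≡⇒≈ (cong (Sb 4) (trans (lem₁ (+ n)) (cong (λ x → + 1 ℤ.+ x) (sym (ℤP.pos-* 2 (suc (suc n))))))) ⟩
      Sb 4 (+ (1 + 2 * suc (suc n))) ≈⟨ S4-nat (suc (suc n)) ⟩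
      q^ (tri (suc (suc n))) ⊠ Sb 4 (+ 1) ≈⟨ ⊠-congˡ (q^-≡ (lem₂ n (tri n))) ⟩
      q^ (E 0 1 -[1+ n ]) ⊠ Sb 4 (+ 1) ∎
      where
      lem₁ : ∀ n → + 4 ℤ.- (+ 1 ℤ.+ + 2 ℤ.* (ℤ.- (+ 1 ℤ.+ n))) ≡ + 1 ℤ.+ + 2 ℤ.* (+ 1 ℤ.+ (+ 1 ℤ.+ n))
      lem₁ = ℤ-solve
      lem₂ : ∀ n t → suc n + (n + t) ≡ 1 * (n + t) + 1 * suc n
      lem₂ = ℕ-solve

    S2-odd : ∀ i → Sb 2 (+ 1 ℤ.+ + 2 ℤ.* i) ≈ q^ (∣ i ∣ * ∣ i ∣) ⊠ Sb 2 (+ 1)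
    S2-odd (+ n) = ≈-trans (≡⇒≈ (cong (λ x → Sb 2 (+ 1 ℤ.+ x)) (sym (ℤP.pos-* 2 n)))) (S2-nat n)
    S2-odd -[1+ n ] = begin
      Sb 2 (+ 1 ℤ.+ + 2 ℤ.* -[1+ n ]) ≈⟨ Sb-reflect 1≤2 (+ 1 ℤ.+ + 2 ℤ.* -[1+ n ]) ⟨
      Sb 2 (+ 2 ℤ.- (+ 1 ℤ.+ + 2 ℤ.* -[1+ n ])) ≈⟨ ≡⇒≈ (cong (Sb 2) (trans (lem₁ (+ n)) (cong (λ x → + 1 ℤ.+ x) (sym (ℤP.pos-* 2 (suc n)))))) ⟩
      Sb 2 (+ (1 + 2 * suc n)) ≈⟨ S2-nat (suc n) ⟩
      q^ (suc n * suc n) ⊠ Sb 2 (+ 1) ∎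
      where
      lem₁ : ∀ n → + 2 ℤ.- (+ 1 ℤ.+ + 2 ℤ.* (ℤ.- (+ 1 ℤ.+ n))) ≡ + 1 ℤ.+ + 2 ℤ.* (+ 1 ℤ.+ n)
      lem₁ = ℤ-solve

open QuasiPeriodicSums

-- The substitution q ↦ q² and extraction of even and odd coefficients

module Substitution where

  private variable
    f u h : S
    N : ℕ

  -- Recursion in steps of two gives access to positions 2n and 2n + 1 without a division.
  Vc : PS → PS
  Vc f zero          = f 0
  Vc f (suc zero)    = 0ℚ
  Vc f (suc (suc n)) = Vc (λ k → f (suc k)) n

  Vc-even : ∀ f n → Vc f (n + n) ≡ f n
  Vc-even f zero    = refl
  Vc-even f (suc n) rewrite ℕP.+-suc n n = Vc-even (λ k → f (suc k)) n

  Vc-odd : ∀ f n → Vc f (suc (n + n)) ≡ 0ℚ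
  Vc-odd f zero    = refl
  Vc-odd f (suc n) rewrite ℕP.+-suc n n = Vc-odd (λ k → f (suc k)) n

  Vc-cong< : ∀ N {f g : PS} → (∀ k → k < N → f k ≡ g k) → ∀ k → k < N → Vc f k ≡ Vc g k
  Vc-cong< N       p zero          l = p 0 l
  Vc-cong< N       p (suc zero)    l = refl
  Vc-cong< (suc N) p (suc (suc k)) (s≤s l) = Vc-cong< N (λ k l → p (suc k) (s≤s l)) k (ℕP.<⇒≤ l)

  Vc-map₂ : ∀ (_∙_ : ℚ → ℚ → ℚ) → 0ℚ ∙ 0ℚ ≡ 0ℚ → ∀ (f g : PS) n → Vc (λ k → f k ∙ g k) n ≡ Vc f n ∙ Vc g n
  Vc-map₂ _∙_ z f g zero          = refl
  Vc-map₂ _∙_ z f g (suc zero)    = sym z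
  Vc-map₂ _∙_ z f g (suc (suc n)) = Vc-map₂ _∙_ z (λ k → f (suc k)) (λ k → g (suc k)) n

  opaque
    -- the substitution q ↦ q²
    V : S → S
    V f = ser (Vc (coef f))

  opaque
    unfolding V _⊞_

    V-even : ∀ f n → coef (V f) (n + n) ≡ coef f n
    V-even f = Vc-even (coef f)

    V-odd : ∀ f n → coef (V f) (suc (n + n)) ≡ 0ℚ
    V-odd f = Vc-odd (coef f)

    V-cong[] : f ≈[ N ] u → V f ≈[ N ] V u
    V-cong[] {N = N} p = mk[] (Vc-cong< N (below p))

    V-⊞ : ∀ f g → V (f ⊞ g) ≈ V f ⊞ V g
    V-⊞ f g = mk≈ (Vc-map₂ ℚ._+_ refl (coef f) (coef g))

    V-K : ∀ c → V (K c) ≈ K c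
    V-K c = mk≈ λ { zero → refl ; (suc zero) → refl ; (suc (suc n)) → trans (z n) refl }
      where
      z : ∀ n → Vc (λ _ → 0ℚ) n ≡ 0ℚ
      z zero = refl
      z (suc zero) = refl
      z (suc (suc n)) = z n

    V-K⊠ : ∀ c f → V (K c ⊠ f) ≈ K c ⊠ V f
    V-K⊠ c f = mk≈ λ n → trans (Vc-cong< (suc n) (λ k _ → const-⊛ c (coef f) k) n ℕP.≤-refl)
      (trans (Vc-map₂ (λ x y → c ℚ.* y) (ℚP.*-zeroʳ c) (coef f) (coef f) n) (sym (const-⊛ c (Vc (coef f)) n)))

    V-q⊠ : ∀ f → V (q^ 1 ⊠ f) ≈ q^ 2 ⊠ V f
    V-q⊠ f = mk≈ λ { zero → trans (ℚP.*-zeroˡ (coef f 0)) (sym (ℚP.*-zeroˡ (coef f 0)))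
                   ; (suc zero) → sym (trans (X^-suc-⊛ 1 (Vc (coef f)) 0) (ℚP.*-zeroˡ (coef f 0)))
                   ; (suc (suc n)) → trans (Vc-cong< (suc n) (λ k _ → X^-⊛-shift 1 (coef f) k) n ℕP.≤-refl) (sym (X^-⊛-shift 2 (Vc (coef f)) n)) }

    tl : S → S
    tl f = ser (λ n → coef f (suc n))

    hd-tl : ∀ f → f ≈ K (coef f 0) ⊞ q^ 1 ⊠ tl f
    hd-tl f = mk≈ λ { zero → sym (trans (cong (coef f 0 ℚ.+_) (ℚP.*-zeroˡ (coef f 1))) (ℚP.+-identityʳ _))
                    ; (suc n) → sym (trans (ℚP.+-identityˡ _) (X^-⊛-shift 1 (coef (tl f)) n)) }

  V-cong : f ≈ u → V f ≈ V u
  V-cong p = []⇒≈ λ N → V-cong[] (≈⇒[] p)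

  V-hd-tl : ∀ f → V f ≈ K (coef f 0) ⊞ q^ 2 ⊠ V (tl f)
  V-hd-tl f = ≈-trans (V-cong (hd-tl f)) (≈-trans (V-⊞ _ _) (⊞-cong (V-K _) (V-q⊠ _)))

  -- Peel off the constant term: f = f₀ + q · tl f gives V f = f₀ + q² · V (tl f). Each peeling
  -- raises the order of agreement, so the product rule holds to every order.
  V-⊠ : ∀ f g → V (f ⊠ g) ≈ V f ⊠ V g
  V-⊠ f g = []⇒≈ λ N → go N f
    where
    go : ∀ N f → V (f ⊠ g) ≈[ N ] V f ⊠ V g
    go zero    f = mk[] λ _ ()
    go (suc N) f = begin
      V (f ⊠ g) ≈⟨ ≈⇒[] (V-cong (≈-trans (⊠-congˡ (hd-tl f)) (solve 4 (λ k q t g → (k :+ q :* t) :* g := k :* g :+ q :* (t :* g)) ≈-refl _ _ _ _))) ⟩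
      V (k ⊠ g ⊞ q^ 1 ⊠ (tl f ⊠ g)) ≈⟨ ≈⇒[] (≈-trans (V-⊞ _ _) (⊞-cong (V-K⊠ _ g) (V-q⊠ _))) ⟩
      k ⊠ V g ⊞ q^ 2 ⊠ V (tl f ⊠ g) ≈⟨ ⊞-cong[] []-refl ([]-mono (ℕP.n≤1+n (suc N)) (q^-mod 2 (go N (tl f)))) ⟩
      k ⊠ V g ⊞ q^ 2 ⊠ (V (tl f) ⊠ V g) ≈⟨ ≈⇒[] (solve 4 (λ k q t g → k :* g :+ q :* (t :* g) := (k :+ q :* t) :* g) ≈-refl _ _ _ _) ⟩
      (k ⊞ q^ 2 ⊠ V (tl f)) ⊠ V g ≈⟨ ≈⇒[] (⊠-congˡ (V-hd-tl f)) ⟨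
      V f ⊠ V g ∎
      where
      open []-Reasoning (suc N)
      k = K (coef f 0)

  V-⊝ : ∀ f → V (⊝ f) ≈ ⊝ V f
  V-⊝ f = ≈-trans (V-cong (⊝-as-⊠ f)) (≈-trans (V-⊠ _ _) (≈-trans (⊠-congˡ (≈-trans (V-cong (≈-sym (K-⊝ 1ℚ))) (≈-trans (V-K _) (K-⊝ 1ℚ)))) (≈-sym (⊝-as-⊠ _))))

  V-q^ : ∀ n → V (q^ n) ≈ q^ (n + n)
  V-q^ zero    = ≈-trans (V-cong q^-0) (≈-trans (V-K _) (≈-sym q^-0))
  V-q^ (suc n) = ≈-trans (V-cong (q^-+ 1 n)) (≈-trans (V-q⊠ _) (≈-trans (⊠-congʳ (V-q^ n)) (≈-trans (≈-sym (q^-+ 2 (n + n))) (q^-≡ (cong suc (sym (ℕP.+-suc n n)))))))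

  V-invS : U f → V (invS f) ≈ invS (V f)
  V-invS {f} u = inverse-unique (≈-trans (≈-sym (V-⊠ _ _)) (≈-trans (V-cong (⊠-invS u)) (V-K _)))

  V-1+ηq^ : ∀ η → V η ≈ η → ∀ {n m} → n + n ≡ m → V (𝟙 ⊞ η ⊠ q^ n) ≈ 𝟙 ⊞ η ⊠ q^ m
  V-1+ηq^ η p {n} refl = ≈-trans (V-⊞ _ _) (⊞-cong (V-K _) (≈-trans (V-⊠ _ _) (⊠-cong p (V-q^ n))))

  V-⊝𝟙 : V (⊝ 𝟙) ≈ ⊝ 𝟙
  V-⊝𝟙 = ≈-trans (V-⊝ 𝟙) (⊝-cong (V-K _))

  V-pp : ∀ η → V η ≈ η → ∀ {α α′ b b′} → α + α ≡ α′ → b + b ≡ b′ → ∀ n → V (pp η α b n) ≈ pp η α′ b′ n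
  V-pp η p eα eb zero    = V-K _
  V-pp η p {α} {_} {b} refl refl (suc n) = ≈-trans (V-⊠ _ _) (⊠-cong (V-pp η p refl refl n) (V-1+ηq^ η p (lem α b n)))
    where
    lem : ∀ α b n → α + b * n + (α + b * n) ≡ α + α + (b + b) * n
    lem = ℕ-solve

  V-lim : ∀ {F G : ℕ → S} → Cauchy F → Cauchy G → (∀ n → V (F n) ≈ G n) → V (lim F) ≈ lim G
  V-lim cF cG p = []⇒≈ λ N → []-trans (V-cong[] ([]-sym (lim-approx cF N))) ([]-trans (≈⇒[] (p N)) (lim-approx cG N))

  V-qf : ∀ {b b′} → b + b ≡ b′ → ∀ n → V (qf b n) ≈ qf b′ n
  V-qf {b} {b′} p n = ≈-trans (V-cong (qf≈pp b n)) (≈-trans (V-pp (⊝ 𝟙) V-⊝𝟙 p p n) (≈-sym (qf≈pp b′ n)))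

  V-J : ∀ {b b′} → 1 ≤ b → b + b ≡ b′ → V (J b) ≈ J b′
  V-J {b} l refl = V-lim (qf-Cauchy l) (qf-Cauchy (ℕP.≤-trans l (ℕP.m≤m+n b b))) (V-qf refl)

  V-sumZ : ∀ N (F : ℤ → S) → V (sumZ N F) ≈ sumZ N (λ n → V (F n))
  V-sumZ zero    F = ≈-refl
  V-sumZ (suc N) F = ≈-trans (V-⊞ _ _) (⊞-cong (V-sumZ N F) (V-⊞ _ _))

  V-tame : ∀ {F} → Tame F → Tame (λ n → V (F n))
  V-tame t N n l = []-trans (V-cong[] (t N n l)) (≈⇒[] (V-K _))

  V-∑ : ∀ {F} → Tame F → V (∑ℤ F) ≈ ∑ℤ (λ n → V (F n))
  V-∑ {F} t = V-lim (sumZ-Cauchy t) (sumZ-Cauchy (V-tame t)) (λ N → V-sumZ N F)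

  V-d : ∀ j → j ≢ + 0 → V (d j) ≈ d (j ℤ.+ j)
  V-d (+ zero)  c = contradiction refl c
  V-d (+ suc n) c = ≈-trans (V-invS (U-1+cq^ _ (s≤s z≤n))) (invS-cong (U-cong (≈-sym eq) (U-1+cq^ _ (s≤s z≤n))) eq)
    where
    eq = V-1+ηq^ (⊝ 𝟙) V-⊝𝟙 {suc n} refl
  V-d -[1+ n ]  c = ≈-trans (V-⊞ _ _) (⊞-cong (V-K _) (≈-trans (V-⊝ _) (⊝-cong
    (≈-trans (V-invS (U-1+cq^ _ (s≤s z≤n))) (invS-cong (U-cong (≈-sym eq) (U-1+cq^ _ (s≤s z≤n))) eq)))))
    where
    eq = V-1+ηq^ (⊝ 𝟙) V-⊝𝟙 {suc n} (cong suc (ℕP.+-suc n n))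

  V-sumS : ∀ N (F : ℕ → S) → V (sumS N F) ≈ sumS N (λ n → V (F n))
  V-sumS zero    F = V-K _
  V-sumS (suc N) F = ≈-trans (V-⊞ _ _) (⊞-cong (V-sumS N F) ≈-refl)

  opaque
    unfolding _⊞_
    dissect-even : f ≈ V u ⊞ q^ 1 ⊠ V h → ∀ n → coef f (n + n) ≡ coef u n
    dissect-even {f} {u} {h} p n = trans (at p (n + n)) (trans (cong₂ ℚ._+_ (V-even u n) (z n)) (ℚP.+-identityʳ _))
      where
      z : ∀ n → coef (q^ 1 ⊠ V h) (n + n) ≡ 0ℚ
      z zero    = q^-low 1 (V h) 0 (s≤s z≤n)
      z (suc n) = trans (q^-shift 1 (V h) (n + suc n)) (trans (cong (coef (V h)) (ℕP.+-suc n n)) (V-odd h n))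

    dissect-odd : f ≈ V u ⊞ q^ 1 ⊠ V h → ∀ n → coef f (suc (n + n)) ≡ coef h n
    dissect-odd {f} {u} {h} p n = trans (at p (suc (n + n))) (trans (cong₂ ℚ._+_ (V-odd u n) (trans (q^-shift 1 (V h) (n + n)) (V-even h n))) (ℚP.+-identityˡ _))

open Substitution

-- Even and odd halves of the series of g(q ; q²) and g(-q ; q²)

module OmegaDissection where

  tri-2 : ∀ n → + 2 ℤ.* + tri n ≡ + n ℤ.* (+ n ℤ.- + 1)
  tri-2 zero    = refl
  tri-2 (suc n) = trans (ℤP.*-distribˡ-+ (+ 2) (+ n) (+ tri n)) (trans (cong (λ x → + 2 ℤ.* + n ℤ.+ x) (tri-2 n)) (lem (+ n)))
    where
    lem : ∀ n → + 2 ℤ.* n ℤ.+ n ℤ.* (n ℤ.- + 1) ≡ (+ 1 ℤ.+ n) ℤ.* (+ 1 ℤ.+ n ℤ.- + 1)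
    lem = ℤ-solve

  -- Doubling removes the division in n(n - 1)/2, so that one integer polynomial covers both signs
  -- and exponents can be compared through `diff-2` and `eq-2`.
  E-2 : ∀ α β i → + 2 ℤ.* + E α β i ≡ (+ α ℤ.+ + β) ℤ.* (i ℤ.* (i ℤ.- + 1)) ℤ.+ + 2 ℤ.* (+ α ℤ.* i)
  E-2 α β (+ n) = trans (cong₂ (λ x y → + 2 ℤ.* (x ℤ.+ y)) (ℤP.pos-* (α + β) (tri n)) (ℤP.pos-* α n))
    (trans (lem (+ (α + β)) (+ tri n) (+ α ℤ.* + n)) (cong (λ x → + (α + β) ℤ.* x ℤ.+ + 2 ℤ.* (+ α ℤ.* + n)) (tri-2 n)))
    where
    lem : ∀ b t y → + 2 ℤ.* (b ℤ.* t ℤ.+ y) ≡ b ℤ.* (+ 2 ℤ.* t) ℤ.+ + 2 ℤ.* y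
    lem = ℤ-solve
  E-2 α β -[1+ n ] = trans (cong₂ (λ x y → + 2 ℤ.* (x ℤ.+ y)) (ℤP.pos-* (α + β) (tri (suc n))) (ℤP.pos-* β (suc n)))
    (trans (lem (+ (α + β)) (+ tri (suc n)) (+ β ℤ.* + suc n)) (trans (cong (λ x → + (α + β) ℤ.* x ℤ.+ + 2 ℤ.* (+ β ℤ.* + suc n)) (tri-2 (suc n))) (lem₂ (+ α) (+ β) (+ n))))
    where
    lem : ∀ b t y → + 2 ℤ.* (b ℤ.* t ℤ.+ y) ≡ b ℤ.* (+ 2 ℤ.* t) ℤ.+ + 2 ℤ.* y
    lem = ℤ-solve
    lem₂ : ∀ α β n → (α ℤ.+ β) ℤ.* ((+ 1 ℤ.+ n) ℤ.* (+ 1 ℤ.+ n ℤ.- + 1)) ℤ.+ + 2 ℤ.* (β ℤ.* (+ 1 ℤ.+ n)) ≡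
      (α ℤ.+ β) ℤ.* ((ℤ.- (+ 1 ℤ.+ n)) ℤ.* (ℤ.- (+ 1 ℤ.+ n) ℤ.- + 1)) ℤ.+ + 2 ℤ.* (α ℤ.* (ℤ.- (+ 1 ℤ.+ n)))
    lem₂ = ℤ-solve

  square-ℤ : ∀ c i → + (c * ∣ i ∣ * ∣ i ∣) ≡ + c ℤ.* (i ℤ.* i)
  square-ℤ c (+ n) = trans (ℤP.pos-* (c * n) n) (trans (cong (ℤ._* + n) (ℤP.pos-* c n)) (ℤP.*-assoc (+ c) (+ n) (+ n)))
  square-ℤ c -[1+ n ] = trans (ℤP.pos-* (c * suc n) (suc n)) (trans (cong (ℤ._* + suc n) (ℤP.pos-* c (suc n))) (ℤP.*-assoc (+ c) (+ suc n) (+ suc n)))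

  square-2 : ∀ c i → + 2 ℤ.* + (c * ∣ i ∣ * ∣ i ∣) ≡ + 2 ℤ.* (+ c ℤ.* (i ℤ.* i))
  square-2 c i = cong (λ x → + 2 ℤ.* x) (square-ℤ c i)

  add-2 : ∀ a b {P Q} → + 2 ℤ.* + a ≡ P → + 2 ℤ.* + b ≡ Q → + 2 ℤ.* + (a + b) ≡ P ℤ.+ Q
  add-2 a b p r = trans (ℤP.*-distribˡ-+ (+ 2) (+ a) (+ b)) (cong₂ ℤ._+_ p r)

  diff-2 : ∀ A B j {P Q} → + 2 ℤ.* + A ≡ P → + 2 ℤ.* + B ≡ Q → P ≡ + 2 ℤ.* j ℤ.+ Q → + A ≡ j ℤ.+ + B
  diff-2 A B j p r e = ℤP.*-cancelˡ-≡ (+ 2) _ _ (trans p (trans e (trans (cong (λ x → + 2 ℤ.* j ℤ.+ x) (sym r)) (sym (ℤP.*-distribˡ-+ (+ 2) j (+ B))))))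

  eq-2 : ∀ A B {P Q} → + 2 ℤ.* + A ≡ P → + 2 ℤ.* + B ≡ Q → P ≡ Q → A ≡ B
  eq-2 A B p r e = ℤP.+-injective (ℤP.*-cancelˡ-≡ (+ 2) _ _ (trans p (trans e (sym r))))

  odd-≢0 : ∀ n → + 1 ℤ.+ + 2 ℤ.* n ≢ + 0
  odd-≢0 (+ n) p with trans (cong (λ x → + 1 ℤ.+ x) (ℤP.pos-* 2 n)) p
  ... | ()
  odd-≢0 -[1+ n ] p with trans (sym (lem (+ n))) p
    where
    lem : ∀ n → + 1 ℤ.+ + 2 ℤ.* (ℤ.- (+ 1 ℤ.+ n)) ≡ ℤ.- (+ 1 ℤ.+ (n ℤ.+ n))
    lem = ℤ-solve
  ... | ()

  module _ (η : S) (η²≈1 : η ⊠ η ≈ 𝟙) (α β′ : ℕ) (b≥1 : 1 ≤ α + suc β′)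
    (Uα : ∀ k → U (𝟙 ⊞ η ⊠ q^ (α + (α + suc β′) * k))) (Uβ : ∀ k → U (𝟙 ⊞ η ⊠ q^ (suc β′ + (α + suc β′) * k))) where
    private
      b = α + suc β′
      module P = PartialFractions η η²≈1 α (suc β′) b≥1 Uα Uβ

    -- For n = -(k + 1) one has α + b n = -(β + b k). With β a successor this is visibly negative,
    -- and both sides fall into the same case of their definitions.
    r≈rc : ∀ n → P.r n ≈ rc η (+ α ℤ.+ + b ℤ.* n)
    r≈rc (+ k)    = ≡⇒≈ (cong (λ x → rc η (+ α ℤ.+ x)) (ℤP.pos-* b k))
    r≈rc -[1+ k ] = ≡⇒≈ (cong (rc η) (sym (trans (lem (+ α) (+ β′) (+ k)) (cong (λ x → ℤ.- (+ 1 ℤ.+ (+ β′ ℤ.+ x))) (sym (ℤP.pos-* b k))))))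
      where
      lem : ∀ α β k → α ℤ.+ (α ℤ.+ (+ 1 ℤ.+ β)) ℤ.* (ℤ.- (+ 1 ℤ.+ k)) ≡ ℤ.- (+ 1 ℤ.+ (β ℤ.+ (α ℤ.+ (+ 1 ℤ.+ β)) ℤ.* k))
      lem = ℤ-solve

  1≤1+ : ∀ {n} → 1 ≤ suc n
  1≤1+ = s≤s z≤n

  module Appell₁ = AppellSums (⊝ 𝟙) -1²≈1 1 1 1≤1+ (λ _ → U-1+cq^ _ 1≤1+) (λ _ → U-1+cq^ _ 1≤1+)

  module Appell⁻ (α β′ : ℕ) (b≥1 : 1 ≤ α + suc β′) where
    open AppellSums 𝟙 𝟙²≈𝟙 α (suc β′) b≥1 (λ _ → U-e _) (λ _ → U-e _) public
    r≈e : ∀ n → r n ≈ e (+ α ℤ.+ + (α + suc β′) ℤ.* n)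
    r≈e = r≈rc 𝟙 𝟙²≈𝟙 α β′ b≥1 (λ _ → U-e _) (λ _ → U-e _)

    AS≈Sb : AS ≈ Sb (α + suc β′) (+ α)
    AS≈Sb = ∑-cong (Tame-⊠ʳ _ t-tame) (Tame-⊠ʳ _ t-tame) (λ n → ⊠-congʳ (r≈e n))

    Sb-product : pp∞ 𝟙 α (α + suc β′) ⊠ pp∞ 𝟙 (suc β′) (α + suc β′) ⊠ Sb (α + suc β′) (+ α) ≈ J (α + suc β′) ⊠ J (α + suc β′)
    Sb-product = ≈-trans (⊠-congʳ (≈-sym AS≈Sb)) product-formula

    gS-e : gS 𝟙 α (suc β′) (α + suc β′) ≈ I∞ (α + suc β′) ⊠ ∑ℤ (λ n → T (α + suc β′) n ⊠ (square n ⊠ e (+ α ℤ.+ + (α + suc β′) ℤ.* n)))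
    gS-e = ≈-trans gS-formula (⊠-congʳ (∑-cong (Tame-⊠ʳ _ t-tame) (Tame-⊠ʳ _ t-tame) λ n → ⊠-congʳ (⊠-congʳ (r≈e n))))

  r₁≈d : ∀ n → Appell₁.r n ≈ d (+ 1 ℤ.+ + 2 ℤ.* n)
  r₁≈d = r≈rc (⊝ 𝟙) -1²≈1 1 0 1≤1+ (λ _ → U-1+cq^ _ 1≤1+) (λ _ → U-1+cq^ _ 1≤1+)

  A₁ : S
  A₁ = ∑ℤ (λ n → T 2 n ⊠ d (+ 1 ℤ.+ + 2 ℤ.* n))

  private
    τ₁ = T-tame {1} 1≤1+
    τ₂ = T-tame {2} 1≤1+
    τ₄ = T-tame {4} 1≤1+

  A₁-product : pp∞ (⊝ 𝟙) 1 2 ⊠ pp∞ (⊝ 𝟙) 1 2 ⊠ A₁ ≈ J 2 ⊠ J 2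
  A₁-product = ≈-trans (⊠-congʳ (≈-sym (∑-cong (Tame-⊠ʳ _ τ₂) (Tame-⊠ʳ _ τ₂) (λ n → ⊠-congʳ (r₁≈d n))))) Appell₁.product-formula

  odd : ℤ → ℤ
  odd n = + 1 ℤ.+ + 2 ℤ.* n

  -- Multiplied by 1/J₁, the sums of `xe` and `xo` are the halves of the series of g(q ; q²). The
  -- weights q^(n(n+1)/2) of `xo` and q^((n+1)(n+2)/2) of `x` are written through `E 0 1` because
  -- `S4-odd` delivers them so.
  xe xo x : ℤ → S
  xe n = T 1 n ⊠ (q^ (1 * ∣ n ∣ * ∣ n ∣) ⊠ d (odd n))
  xo n = T 2 n ⊠ (q^ (E 0 1 (ℤ.- n)) ⊠ d (odd n))
  x  n = T 2 n ⊠ (q^ (E 0 1 (ℤ.- n ℤ.- + 1)) ⊠ d (odd n))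

  Xe Xo X : S
  Xe = ∑ℤ xe
  Xo = ∑ℤ xo
  X  = ∑ℤ x

  module _ where
    open ≈-Reasoning

    private
      sg : ℤ → S
      sg n = pow (⊝ 𝟙) ∣ n ∣

      V-pow : ∀ n → V (pow (⊝ 𝟙) n) ≈ pow (⊝ 𝟙) n
      V-pow zero    = V-K _
      V-pow (suc n) = ≈-trans (V-⊠ _ _) (⊠-cong V-⊝𝟙 (V-pow n))

      H G : ℤ → ℕ
      H n = E 1 0 n + 1 * ∣ n ∣ * ∣ n ∣
      G n = E 2 0 n + E 0 1 (ℤ.- n)

      merge : ∀ p a b z → p ⊠ q^ a ⊠ (q^ b ⊠ z) ≈ p ⊠ (q^ (a + b) ⊠ z)
      merge p a b z = ≈-trans (solve 4 (λ p a b z → p :* a :* (b :* z) := p :* (a :* b :* z)) ≈-refl _ _ _ _) (⊠-congʳ (⊠-congˡ (≈-sym (q^-+ a b))))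

      V-merge : ∀ n m {k} → m + m ≡ k → V (sg n ⊠ (q^ m ⊠ d (odd n))) ≈ sg n ⊠ (q^ k ⊠ d (odd n ℤ.+ odd n))
      V-merge n m refl = ≈-trans (V-⊠ _ _) (⊠-cong (V-pow ∣ n ∣) (≈-trans (V-⊠ _ _) (⊠-cong (V-q^ m) (V-d (odd n) (odd-≢0 n)))))

      H-2 : ∀ n → + 2 ℤ.* + H n ≡ (+ 1 ℤ.+ + 0) ℤ.* (n ℤ.* (n ℤ.- + 1)) ℤ.+ + 2 ℤ.* (+ 1 ℤ.* n) ℤ.+ + 2 ℤ.* (+ 1 ℤ.* (n ℤ.* n))
      H-2 n = add-2 (E 1 0 n) (1 * ∣ n ∣ * ∣ n ∣) (E-2 1 0 n) (square-2 1 n)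

      G-2 : ∀ n → + 2 ℤ.* + G n ≡ (+ 2 ℤ.+ + 0) ℤ.* (n ℤ.* (n ℤ.- + 1)) ℤ.+ + 2 ℤ.* (+ 2 ℤ.* n) ℤ.+ ((+ 0 ℤ.+ + 1) ℤ.* (ℤ.- n ℤ.* (ℤ.- n ℤ.- + 1)) ℤ.+ + 2 ℤ.* (+ 0 ℤ.* ℤ.- n))
      G-2 n = add-2 (E 2 0 n) (E 0 1 (ℤ.- n)) (E-2 2 0 n) (E-2 0 1 (ℤ.- n))

      HH : ∀ n → H n + H n ≡ E 2 0 n + 2 * ∣ n ∣ * ∣ n ∣
      HH n = eq-2 (H n + H n) (E 2 0 n + 2 * ∣ n ∣ * ∣ n ∣) (add-2 (H n) (H n) (H-2 n) (H-2 n)) (add-2 (E 2 0 n) (2 * ∣ n ∣ * ∣ n ∣) (E-2 2 0 n) (square-2 2 n)) (lem n)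
        where
        lem : ∀ n → (+ 1 ℤ.+ + 0) ℤ.* (n ℤ.* (n ℤ.- + 1)) ℤ.+ + 2 ℤ.* (+ 1 ℤ.* n) ℤ.+ + 2 ℤ.* (+ 1 ℤ.* (n ℤ.* n)) ℤ.+ ((+ 1 ℤ.+ + 0) ℤ.* (n ℤ.* (n ℤ.- + 1)) ℤ.+ + 2 ℤ.* (+ 1 ℤ.* n) ℤ.+ + 2 ℤ.* (+ 1 ℤ.* (n ℤ.* n)))
          ≡ (+ 2 ℤ.+ + 0) ℤ.* (n ℤ.* (n ℤ.- + 1)) ℤ.+ + 2 ℤ.* (+ 2 ℤ.* n) ℤ.+ + 2 ℤ.* (+ 2 ℤ.* (n ℤ.* n))
        lem = ℤ-solve

      AB : ∀ n → + (1 + (G n + G n)) ≡ odd n ℤ.+ + (E 2 0 n + 2 * ∣ n ∣ * ∣ n ∣)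
      AB n = diff-2 (1 + (G n + G n)) (E 2 0 n + 2 * ∣ n ∣ * ∣ n ∣) (odd n) (add-2 1 (G n + G n) refl (add-2 (G n) (G n) (G-2 n) (G-2 n))) (add-2 (E 2 0 n) (2 * ∣ n ∣ * ∣ n ∣) (E-2 2 0 n) (square-2 2 n)) (lem n)
        where
        lem : ∀ n → + 2 ℤ.+ ((+ 2 ℤ.+ + 0) ℤ.* (n ℤ.* (n ℤ.- + 1)) ℤ.+ + 2 ℤ.* (+ 2 ℤ.* n) ℤ.+ ((+ 0 ℤ.+ + 1) ℤ.* (ℤ.- n ℤ.* (ℤ.- n ℤ.- + 1)) ℤ.+ + 2 ℤ.* (+ 0 ℤ.* ℤ.- n))
            ℤ.+ ((+ 2 ℤ.+ + 0) ℤ.* (n ℤ.* (n ℤ.- + 1)) ℤ.+ + 2 ℤ.* (+ 2 ℤ.* n) ℤ.+ ((+ 0 ℤ.+ + 1) ℤ.* (ℤ.- n ℤ.* (ℤ.- n ℤ.- + 1)) ℤ.+ + 2 ℤ.* (+ 0 ℤ.* ℤ.- n))))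
          ≡ + 2 ℤ.* (+ 1 ℤ.+ + 2 ℤ.* n) ℤ.+ ((+ 2 ℤ.+ + 0) ℤ.* (n ℤ.* (n ℤ.- + 1)) ℤ.+ + 2 ℤ.* (+ 2 ℤ.* n) ℤ.+ + 2 ℤ.* (+ 2 ℤ.* (n ℤ.* n)))
        lem = ℤ-solve

      V-xe : ∀ n → V (xe n) ≈ sg n ⊠ (q^ (E 2 0 n + 2 * ∣ n ∣ * ∣ n ∣) ⊠ d (odd n ℤ.+ odd n))
      V-xe n = ≈-trans (V-cong (merge _ _ _ _)) (V-merge n (H n) (HH n))

      V-xo : ∀ n → V (xo n) ≈ sg n ⊠ (q^ (G n + G n) ⊠ d (odd n ℤ.+ odd n))
      V-xo n = ≈-trans (V-cong (merge _ _ _ _)) (V-merge n (G n) refl)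

      term : ∀ n z σ → q^ (E 2 0 n + 2 * ∣ n ∣ * ∣ n ∣) ⊠ z ≈ q^ (E 2 0 n + 2 * ∣ n ∣ * ∣ n ∣) ⊠ d (odd n ℤ.+ odd n) ⊞ σ ⊠ (q^ (1 + (G n + G n)) ⊠ d (odd n ℤ.+ odd n)) →
        T 2 n ⊠ (q^ (2 * ∣ n ∣ * ∣ n ∣) ⊠ z) ≈ V (xe n) ⊞ σ ⊠ q^ 1 ⊠ V (xo n)
      term n z σ p = begin
        T 2 n ⊠ (q^ (2 * ∣ n ∣ * ∣ n ∣) ⊠ z) ≈⟨ merge _ _ _ _ ⟩
        sg n ⊠ (q^ (E 2 0 n + 2 * ∣ n ∣ * ∣ n ∣) ⊠ z) ≈⟨ ⊠-congʳ p ⟩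
        sg n ⊠ (B ⊠ D ⊞ σ ⊠ (q^ (1 + (G n + G n)) ⊠ D)) ≈⟨ ⊠-congʳ (⊞-congʳ (⊠-congʳ (⊠-congˡ (q^-+ 1 (G n + G n))))) ⟩
        sg n ⊠ (B ⊠ D ⊞ σ ⊠ (q^ 1 ⊠ q^ (G n + G n) ⊠ D)) ≈⟨ solve 6 (λ g B D s Q A → g :* (B :* D :+ s :* (Q :* A :* D)) := g :* (B :* D) :+ s :* Q :* (g :* (A :* D))) ≈-refl _ _ _ _ _ _ ⟩
        sg n ⊠ (B ⊠ D) ⊞ σ ⊠ q^ 1 ⊠ (sg n ⊠ (q^ (G n + G n) ⊠ D)) ≈⟨ ⊞-cong (V-xe n) (⊠-congʳ (V-xo n)) ⟨
        V (xe n) ⊞ σ ⊠ q^ 1 ⊠ V (xo n) ∎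
        where
        D = d (odd n ℤ.+ odd n)
        B = q^ (E 2 0 n + 2 * ∣ n ∣ * ∣ n ∣)

      V-xe-tame : Tame (λ n → V (xe n))
      V-xe-tame = V-tame (Tame-⊠ʳ _ τ₁)
      V-xo-tame : Tame (λ n → V (xo n))
      V-xo-tame = V-tame (Tame-⊠ʳ _ τ₂)

      assemble : ∀ (z : ℤ → S) σ → (∀ n → T 2 n ⊠ (q^ (2 * ∣ n ∣ * ∣ n ∣) ⊠ z n) ≈ V (xe n) ⊞ σ ⊠ q^ 1 ⊠ V (xo n)) →
        I∞ 2 ⊠ ∑ℤ (λ n → T 2 n ⊠ (q^ (2 * ∣ n ∣ * ∣ n ∣) ⊠ z n)) ≈ V (I∞ 1 ⊠ Xe) ⊞ σ ⊠ q^ 1 ⊠ V (I∞ 1 ⊠ Xo)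
      assemble z σ p = begin
        I∞ 2 ⊠ ∑ℤ (λ n → T 2 n ⊠ (q^ (2 * ∣ n ∣ * ∣ n ∣) ⊠ z n))
          ≈⟨ ⊠-congʳ (≈-trans (∑-cong (Tame-⊠ʳ _ τ₂) (Tame-⊞ V-xe-tame (Tame-⊠ˡ _ V-xo-tame)) p) (≈-trans (∑-⊞ V-xe-tame (Tame-⊠ˡ _ V-xo-tame)) (⊞-congʳ (∑-⊠ˡ _ V-xo-tame)))) ⟩
        I∞ 2 ⊠ (∑ℤ (λ n → V (xe n)) ⊞ σ ⊠ q^ 1 ⊠ ∑ℤ (λ n → V (xo n)))
          ≈⟨ ⊠-congʳ (⊞-cong (V-∑ (Tame-⊠ʳ _ τ₁)) (⊠-congʳ (V-∑ (Tame-⊠ʳ _ τ₂)))) ⟨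
        I∞ 2 ⊠ (V Xe ⊞ σ ⊠ q^ 1 ⊠ V Xo) ≈⟨ solve 5 (λ i x s q y → i :* (x :+ s :* q :* y) := i :* x :+ s :* q :* (i :* y)) ≈-refl _ _ _ _ _ ⟩
        I∞ 2 ⊠ V Xe ⊞ σ ⊠ q^ 1 ⊠ (I∞ 2 ⊠ V Xo) ≈⟨ ⊞-cong (V-I Xe) (⊠-congʳ (V-I Xo)) ⟨
        V (I∞ 1 ⊠ Xe) ⊞ σ ⊠ q^ 1 ⊠ V (I∞ 1 ⊠ Xo) ∎
        where
        V-I : ∀ z → V (I∞ 1 ⊠ z) ≈ I∞ 2 ⊠ V z
        V-I z = ≈-trans (V-⊠ _ _) (⊠-congˡ (≈-trans (V-invS (U-J 1≤1+)) (≈-sym (invS-cong (U-J 1≤1+) (≈-sym (V-J 1≤1+ refl))))))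

    -- The summand carries the even exponent n(n + 1) + 2n²; writing 1/(1 - z) as (1 + z)/(1 - z²)
    -- with z = q^(2n+1) leaves a series in q² plus an odd power of q times such a series.
    gS-dissect⁺ : gS (⊝ 𝟙) 1 1 2 ≈ V (I∞ 1 ⊠ Xe) ⊞ 𝟙 ⊠ q^ 1 ⊠ V (I∞ 1 ⊠ Xo)
    gS-dissect⁺ = ≈-trans Appell₁.gS-formula (assemble Appell₁.r 𝟙 λ n → term n _ 𝟙
      (≈-trans (⊠-congʳ (r₁≈d n)) (≈-trans (d-split (odd n) _ _ (AB n) (odd-≢0 n)) (⊞-congʳ (≈-sym (⊠-identityˡ _))))))

    private module A₂ = Appell⁻ 1 0 1≤1+

    -- Since 1/(1 + z) = (1 - z)/(1 - z²), only the odd half changes sign; `assemble` carries that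
    -- sign as `σ`.
    gS-dissect⁻ : gS 𝟙 1 1 2 ≈ V (I∞ 1 ⊠ Xe) ⊞ ⊝ 𝟙 ⊠ q^ 1 ⊠ V (I∞ 1 ⊠ Xo)
    gS-dissect⁻ = ≈-trans A₂.gS-formula (assemble A₂.r (⊝ 𝟙) λ n → term n _ (⊝ 𝟙)
      (≈-trans (⊠-congʳ (A₂.r≈e n)) (≈-trans (e-split (odd n) _ _ (AB n) (odd-≢0 n)) (⊞-congʳ (⊝-as-⊠ _)))))

    -- z/(1 - z) = 1/(1 - z) - 1 at z = q^(2n+1) changes the weight of `xe` into that of `x`; the
    -- subtracted terms form Euler's pentagonal sum, which 1/J₁ turns into 1.
    even-part : I∞ 1 ⊠ Xe ≈ 𝟙 ⊞ I∞ 1 ⊠ X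
    even-part = ≈-sym (begin
      𝟙 ⊞ I∞ 1 ⊠ X ≈⟨ ⊞-cong (≈-sym (Bailey.pentagonal 1≤1+)) (⊠-congʳ X≈) ⟩
      I∞ 1 ⊠ P ⊞ I∞ 1 ⊠ (Xe ⊞ ⊝ 𝟙 ⊠ P) ≈⟨ solve 3 (λ i p x → i :* p :+ i :* (x :+ :- :1 :* p) := i :* x) ≈-refl _ _ _ ⟩
      I∞ 1 ⊠ Xe ∎)
      where
      P = ∑ℤ (λ n → T 1 n ⊠ q^ (1 * ∣ n ∣ * ∣ n ∣))
      L : ℤ → ℕ
      L n = E 2 0 n + E 0 1 (ℤ.- n ℤ.- + 1)
      LH : ∀ n → + L n ≡ odd n ℤ.+ + H n
      LH n = diff-2 (L n) (H n) (odd n) (add-2 (E 2 0 n) (E 0 1 (ℤ.- n ℤ.- + 1)) (E-2 2 0 n) (E-2 0 1 (ℤ.- n ℤ.- + 1))) (H-2 n) (lem n)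
        where
        lem : ∀ n → (+ 2 ℤ.+ + 0) ℤ.* (n ℤ.* (n ℤ.- + 1)) ℤ.+ + 2 ℤ.* (+ 2 ℤ.* n) ℤ.+ ((+ 0 ℤ.+ + 1) ℤ.* ((ℤ.- n ℤ.- + 1) ℤ.* (ℤ.- n ℤ.- + 1 ℤ.- + 1)) ℤ.+ + 2 ℤ.* (+ 0 ℤ.* (ℤ.- n ℤ.- + 1)))
          ≡ + 2 ℤ.* (+ 1 ℤ.+ + 2 ℤ.* n) ℤ.+ ((+ 1 ℤ.+ + 0) ℤ.* (n ℤ.* (n ℤ.- + 1)) ℤ.+ + 2 ℤ.* (+ 1 ℤ.* n) ℤ.+ + 2 ℤ.* (+ 1 ℤ.* (n ℤ.* n)))
        lem = ℤ-solve
      x≈ : ∀ n → x n ≈ xe n ⊞ ⊝ 𝟙 ⊠ (T 1 n ⊠ q^ (1 * ∣ n ∣ * ∣ n ∣))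
      x≈ n = begin
        x n ≈⟨ merge _ _ _ _ ⟩
        sg n ⊠ (q^ (L n) ⊠ d (odd n)) ≈⟨ ⊠-congʳ (d-swap (odd n) (L n) (H n) (LH n) (odd-≢0 n)) ⟩
        sg n ⊠ (q^ (H n) ⊠ d (odd n) ⊟ q^ (H n)) ≈⟨ ⊠-congʳ (⊞-cong (⊠-congˡ (q^-+ _ _)) (⊝-cong (q^-+ _ _))) ⟩
        sg n ⊠ (q^ (E 1 0 n) ⊠ q^ (1 * ∣ n ∣ * ∣ n ∣) ⊠ d (odd n) ⊟ q^ (E 1 0 n) ⊠ q^ (1 * ∣ n ∣ * ∣ n ∣))
          ≈⟨ solve 4 (λ s a b d → s :* (a :* b :* d :- a :* b) := s :* a :* (b :* d) :+ :- :1 :* (s :* a :* b)) ≈-refl _ _ _ _ ⟩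
        xe n ⊞ ⊝ 𝟙 ⊠ (T 1 n ⊠ q^ (1 * ∣ n ∣ * ∣ n ∣)) ∎
      X≈ : X ≈ Xe ⊞ ⊝ 𝟙 ⊠ P
      X≈ = ≈-trans (∑-cong (Tame-⊠ʳ _ τ₂) (Tame-⊞ (Tame-⊠ʳ _ τ₁) (Tame-⊠ˡ _ (Tame-⊠ʳ _ τ₁))) x≈)
        (≈-trans (∑-⊞ (Tame-⊠ʳ _ τ₁) (Tame-⊠ˡ _ (Tame-⊠ʳ _ τ₁))) (⊞-congʳ (∑-⊠ˡ _ (Tame-⊠ʳ _ τ₁))))

open OmegaDissection

-- Products of two Appell sums and rules for infinite products

module CrossMultiplication where

  private
    τ₂ = T-tame {2} 1≤1+
    τ₄ = T-tame {4} 1≤1+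

  module _ where
    open ≈-Reasoning

    -- The inner sums of `double-sum` are again Appell sums, with arguments moved by the outer
    -- index.
    cross : ∀ j → A₁ ⊠ Sb 4 j ≈ ∑ℤ (λ n → T 2 n ⊠ (d (odd n) ⊠ Sb 4 (j ℤ.- odd n))) ⊞ ∑ℤ (λ m → T 4 m ⊠ (e (j ℤ.+ + 4 ℤ.* m) ⊠ Sb 2 (+ 1 ℤ.- (j ℤ.+ + 4 ℤ.* m))))
    cross j = ≈-trans (double-sum τ₂ τ₄ odd (λ m → j ℤ.+ + 4 ℤ.* m) odd-≢0)
      (⊞-cong (∑-cong (Tame-⊠ʳ _ τ₂) (Tame-⊠ʳ _ τ₂) λ n → ⊠-congʳ (⊠-cong ≈-refl
                (∑-cong (Tame-⊠ʳ _ τ₄) (Tame-⊠ʳ _ τ₄) λ m → ⊠-congʳ (≡⇒≈ (cong e (lem₁ j n m))))))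
              (∑-cong (Tame-⊠ʳ _ τ₄) (Tame-⊠ʳ _ τ₄) λ m → ⊠-congʳ (⊠-cong ≈-refl
                (∑-cong (Tame-⊠ʳ _ τ₂) (Tame-⊠ʳ _ τ₂) λ n → ⊠-congʳ (≡⇒≈ (cong e (lem₂ j n m)))))))
      where
      lem₁ : ∀ j n m → j ℤ.+ + 4 ℤ.* m ℤ.- (+ 1 ℤ.+ + 2 ℤ.* n) ≡ j ℤ.- (+ 1 ℤ.+ + 2 ℤ.* n) ℤ.+ + 4 ℤ.* m
      lem₁ = ℤ-solve
      lem₂ : ∀ j n m → + 1 ℤ.+ + 2 ℤ.* n ℤ.- (j ℤ.+ + 4 ℤ.* m) ≡ + 1 ℤ.- (j ℤ.+ + 4 ℤ.* m) ℤ.+ + 2 ℤ.* n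
      lem₂ = ℤ-solve

    collect : ∀ {t z s k : ℤ → S} {c : S} → Tame t → (∀ n → s n ≈ k n ⊠ c) → ∑ℤ (λ n → t n ⊠ (z n ⊠ s n)) ≈ ∑ℤ (λ n → t n ⊠ (k n ⊠ z n)) ⊠ c
    collect {c = c} τ p = ≈-trans (∑-cong (Tame-⊠ʳ _ τ) (Tame-⊠ˡ _ (Tame-⊠ʳ _ τ)) λ n →
        ≈-trans (⊠-congʳ (⊠-congʳ (p n))) (solve 4 (λ t z k c → t :* (z :* (k :* c)) := c :* (t :* (k :* z))) ≈-refl _ _ _ _))
      (≈-trans (∑-⊠ˡ c (Tame-⊠ʳ _ τ)) (⊠-comm _ _))

    Y Y′ Z : S
    Y  = ∑ℤ (λ m → T 4 m ⊠ (q^ (4 * ∣ m ∣ * ∣ m ∣) ⊠ e (+ 0 ℤ.+ + 4 ℤ.* m)))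
    Y′ = ∑ℤ (λ m → T 4 m ⊠ (q^ (1 * ∣ odd m ∣ * ∣ odd m ∣) ⊠ e (+ 2 ℤ.+ + 4 ℤ.* m)))
    Z  = ∑ℤ (λ m → T 4 m ⊠ (q^ (4 * ∣ m ∣ * ∣ m ∣) ⊠ e (+ 2 ℤ.+ + 4 ℤ.* m)))

    -- The inner arguments are odd: -(1 + 2n) = 1 + 2(-n - 1) yields the weight of `x`, and 1 - 4m =
    -- 1 + 2(-2m) yields q^(4m²).
    cross₀ : A₁ ⊠ Sb 4 (+ 0) ≈ X ⊠ Sb 4 (+ 1) ⊞ Y ⊠ Sb 2 (+ 1)
    cross₀ = ≈-trans (cross (+ 0)) (⊞-cong
      (collect τ₂ λ n → ≈-trans (≡⇒≈ (cong (Sb 4) (lem₁ n))) (S4-odd (ℤ.- n ℤ.- + 1)))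
      (collect τ₄ λ m → ≈-trans (≡⇒≈ (cong (Sb 2) (lem₂ m))) (≈-trans (S2-odd (ℤ.- (m ℤ.+ m))) (⊠-congˡ (q^-≡ (ex m))))))
      where
      lem₁ : ∀ n → + 0 ℤ.- (+ 1 ℤ.+ + 2 ℤ.* n) ≡ + 1 ℤ.+ + 2 ℤ.* (ℤ.- n ℤ.- + 1)
      lem₁ = ℤ-solve
      lem₂ : ∀ m → + 1 ℤ.- (+ 0 ℤ.+ + 4 ℤ.* m) ≡ + 1 ℤ.+ + 2 ℤ.* (ℤ.- (m ℤ.+ m))
      lem₂ = ℤ-solve
      lem₃ : ∀ m → + 1 ℤ.* (ℤ.- (m ℤ.+ m) ℤ.* ℤ.- (m ℤ.+ m)) ≡ + 4 ℤ.* (m ℤ.* m)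
      lem₃ = ℤ-solve
      ex : ∀ m → ∣ ℤ.- (m ℤ.+ m) ∣ * ∣ ℤ.- (m ℤ.+ m) ∣ ≡ 4 * ∣ m ∣ * ∣ m ∣
      ex m = ℤP.+-injective (trans (cong (λ k → + (k * ∣ ℤ.- (m ℤ.+ m) ∣)) (sym (ℕP.*-identityˡ ∣ ℤ.- (m ℤ.+ m) ∣))) (trans (square-ℤ 1 (ℤ.- (m ℤ.+ m))) (trans (lem₃ m) (sym (square-ℤ 4 m)))))

    -- Here 2 - (1 + 2n) = 1 + 2(-n) yields the weight of `xo`, and 1 - (2 + 4m) = 1 + 2(-(2m + 1))
    -- yields q^((2m+1)²).
    cross₂ : A₁ ⊠ Sb 4 (+ 2) ≈ Xo ⊠ Sb 4 (+ 1) ⊞ Y′ ⊠ Sb 2 (+ 1)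
    cross₂ = ≈-trans (cross (+ 2)) (⊞-cong
      (collect τ₂ λ n → ≈-trans (≡⇒≈ (cong (Sb 4) (lem₁ n))) (S4-odd (ℤ.- n)))
      (collect τ₄ λ m → ≈-trans (≡⇒≈ (cong (Sb 2) (lem₂ m))) (≈-trans (S2-odd (ℤ.- odd m)) (⊠-congˡ (q^-≡ (ex m))))))
      where
      lem₁ : ∀ n → + 2 ℤ.- (+ 1 ℤ.+ + 2 ℤ.* n) ≡ + 1 ℤ.+ + 2 ℤ.* (ℤ.- n)
      lem₁ = ℤ-solve
      lem₂ : ∀ m → + 1 ℤ.- (+ 2 ℤ.+ + 4 ℤ.* m) ≡ + 1 ℤ.+ + 2 ℤ.* (ℤ.- (+ 1 ℤ.+ + 2 ℤ.* m))
      lem₂ = ℤ-solve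
      ex : ∀ m → ∣ ℤ.- odd m ∣ * ∣ ℤ.- odd m ∣ ≡ 1 * ∣ odd m ∣ * ∣ odd m ∣
      ex m rewrite ℤP.∣-i∣≡∣i∣ (odd m) = cong (_* ∣ odd m ∣) (sym (ℕP.*-identityˡ ∣ odd m ∣))

    Y-gS : I∞ 4 ⊠ Y ≈ gS 𝟙 0 4 4
    Y-gS = ≈-sym (Appell⁻.gS-e 0 3 1≤1+)

    -- 1 + (2m + 1)² = (2 + 4m) + 4m²: the extra factor q completes z = q^(2 + 4m), and z/(1 + z) =
    -- 1 - 1/(1 + z) separates the pentagonal sum from the series of g(-q² ; q⁴).
    Y′-gS : I∞ 4 ⊠ (q^ 1 ⊠ Y′) ≈ 𝟙 ⊟ gS 𝟙 2 2 4
    Y′-gS = begin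
      I∞ 4 ⊠ (q^ 1 ⊠ Y′) ≈⟨ ⊠-congʳ qY′ ⟩
      I∞ 4 ⊠ (P ⊞ ⊝ 𝟙 ⊠ Z) ≈⟨ solve 3 (λ i p z → i :* (p :+ :- :1 :* z) := i :* p :- i :* z) ≈-refl _ _ _ ⟩
      I∞ 4 ⊠ P ⊟ I∞ 4 ⊠ Z ≈⟨ ⊞-cong (Bailey.pentagonal 1≤1+) (⊝-cong (≈-sym (Appell⁻.gS-e 2 1 1≤1+))) ⟩
      𝟙 ⊟ gS 𝟙 2 2 4 ∎
      where
      P = ∑ℤ (λ m → T 4 m ⊠ q^ (4 * ∣ m ∣ * ∣ m ∣))
      A B : ℤ → ℕ
      A m = 1 + (E 4 0 m + 1 * ∣ odd m ∣ * ∣ odd m ∣)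
      B m = E 4 0 m + 4 * ∣ m ∣ * ∣ m ∣
      AB : ∀ m → + A m ≡ + 2 ℤ.+ + 4 ℤ.* m ℤ.+ + B m
      AB m = trans (cong (λ z → + 1 ℤ.+ (+ E 4 0 m ℤ.+ z)) (square-ℤ 1 (odd m))) (trans (lem m (+ E 4 0 m)) (cong (λ z → + 2 ℤ.+ + 4 ℤ.* m ℤ.+ (+ E 4 0 m ℤ.+ z)) (sym (square-ℤ 4 m))))
        where
        lem : ∀ m E → + 1 ℤ.+ (E ℤ.+ + 1 ℤ.* ((+ 1 ℤ.+ + 2 ℤ.* m) ℤ.* (+ 1 ℤ.+ + 2 ℤ.* m))) ≡ + 2 ℤ.+ + 4 ℤ.* m ℤ.+ (E ℤ.+ + 4 ℤ.* (m ℤ.* m))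
        lem = ℤ-solve
      term : ∀ m → q^ 1 ⊠ (T 4 m ⊠ (q^ (1 * ∣ odd m ∣ * ∣ odd m ∣) ⊠ e (+ 2 ℤ.+ + 4 ℤ.* m))) ≈
        T 4 m ⊠ q^ (4 * ∣ m ∣ * ∣ m ∣) ⊞ ⊝ 𝟙 ⊠ (T 4 m ⊠ (q^ (4 * ∣ m ∣ * ∣ m ∣) ⊠ e (+ 2 ℤ.+ + 4 ℤ.* m)))
      term m = begin
        q^ 1 ⊠ (s ⊠ q^ (E 4 0 m) ⊠ (q^ o ⊠ ε)) ≈⟨ solve 5 (λ Q s a b e → Q :* (s :* a :* (b :* e)) := s :* (Q :* (a :* b) :* e)) ≈-refl _ _ _ _ _ ⟩
        s ⊠ (q^ 1 ⊠ (q^ (E 4 0 m) ⊠ q^ o) ⊠ ε) ≈⟨ ⊠-congʳ (⊠-congˡ (≈-trans (q^-+ 1 _) (⊠-congʳ (q^-+ _ _)))) ⟨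
        s ⊠ (q^ (A m) ⊠ ε) ≈⟨ ⊠-congʳ (e-swap (+ 2 ℤ.+ + 4 ℤ.* m) (A m) (B m) (AB m)) ⟩
        s ⊠ (q^ (B m) ⊟ q^ (B m) ⊠ ε) ≈⟨ ⊠-congʳ (⊞-cong (q^-+ _ _) (⊝-cong (⊠-congˡ (q^-+ _ _)))) ⟩
        s ⊠ (q^ (E 4 0 m) ⊠ q^ p ⊟ q^ (E 4 0 m) ⊠ q^ p ⊠ ε) ≈⟨ solve 4 (λ s a b e → s :* (a :* b :- a :* b :* e) := s :* a :* b :+ :- :1 :* (s :* a :* (b :* e))) ≈-refl _ _ _ _ ⟩
        T 4 m ⊠ q^ p ⊞ ⊝ 𝟙 ⊠ (T 4 m ⊠ (q^ p ⊠ ε)) ∎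
        where
        s = pow (⊝ 𝟙) ∣ m ∣
        ε = e (+ 2 ℤ.+ + 4 ℤ.* m)
        o = 1 * ∣ odd m ∣ * ∣ odd m ∣
        p = 4 * ∣ m ∣ * ∣ m ∣
      qY′ : q^ 1 ⊠ Y′ ≈ P ⊞ ⊝ 𝟙 ⊠ Z
      qY′ = ≈-trans (≈-sym (∑-⊠ˡ _ (Tame-⊠ʳ _ τ₄))) (≈-trans (∑-cong (Tame-⊠ˡ _ (Tame-⊠ʳ _ τ₄)) (Tame-⊞ (Tame-⊠ʳ _ τ₄) (Tame-⊠ˡ _ (Tame-⊠ʳ _ τ₄))) term)
        (≈-trans (∑-⊞ (Tame-⊠ʳ _ τ₄) (Tame-⊠ˡ _ (Tame-⊠ʳ _ τ₄))) (⊞-congʳ (∑-⊠ˡ _ (Tame-⊠ʳ _ τ₄)))))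

  pp-split : ∀ η α b n → pp η α b (n + n) ≈ pp η α (b + b) n ⊠ pp η (α + b) (b + b) n
  pp-split η α b zero    = ≈-sym (⊠-identityˡ 𝟙)
  pp-split η α b (suc n) rewrite ℕP.+-suc n n = ≈-trans (⊠-cong (⊠-cong (pp-split η α b n) (fac (lem₁ α b n))) (fac (lem₂ α b n)))
    (solve 4 (λ x y z w → x :* y :* z :* w := (x :* z) :* (y :* w)) ≈-refl _ _ _ _)
    where
    fac : ∀ {i j} → i ≡ j → 𝟙 ⊞ η ⊠ q^ i ≈ 𝟙 ⊞ η ⊠ q^ j
    fac refl = ≈-refl
    lem₁ : ∀ α b n → α + b * (n + n) ≡ α + (b + b) * n
    lem₁ = ℕ-solve
    lem₂ : ∀ α b n → α + b * suc (n + n) ≡ α + b + (b + b) * n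
    lem₂ = ℕ-solve

  pp-± : ∀ α b n → pp (⊝ 𝟙) α b n ⊠ pp 𝟙 α b n ≈ pp (⊝ 𝟙) (α + α) (b + b) n
  pp-± α b zero    = ⊠-identityˡ 𝟙
  pp-± α b (suc n) = ≈-trans (solve 3 (λ x y q → x :* (:1 :+ :- :1 :* q) :* (y :* (:1 :+ :1 :* q)) := x :* y :* (:1 :+ :- :1 :* (q :* q))) ≈-refl _ _ _)
    (⊠-cong (pp-± α b n) (⊞-congʳ (⊠-congʳ (≈-trans (≈-sym (q^-+ _ _)) (q^-≡ (lem α b n))))))
    where
    lem : ∀ α b n → α + b * n + (α + b * n) ≡ α + α + (b + b) * n
    lem = ℕ-solve

  pp-0 : ∀ b n → pp 𝟙 0 b (suc n) ≈ (𝟙 ⊞ 𝟙) ⊠ pp 𝟙 b b n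
  pp-0 b zero    = ≈-trans (⊠-congʳ (⊞-congʳ (⊠-congʳ (≈-trans (q^-≡ (ℕP.*-zeroʳ b)) q^-0))))
    (solve 0 (:1 :* (:1 :+ :1 :* :1) := (:1 :+ :1) :* :1) ≈-refl)
  pp-0 b (suc n) = ≈-trans (⊠-cong (pp-0 b n) (⊞-congʳ (⊠-congʳ (q^-≡ (ℕP.*-suc b n))))) (⊠-assoc _ _ _)

  module _ {b : ℕ} (b≥1 : 1 ≤ b) where
    private
      b2 : 1 ≤ b + b
      b2 = ℕP.≤-trans b≥1 (ℕP.m≤m+n b b)
      ap : ∀ η α {c} → 1 ≤ c → ∀ N → pp η α c N ≈[ N ] pp∞ η α c
      ap η α l N = lim-approx (pp-Cauchy η α l) N

    pp∞-split : ∀ η α → pp∞ η α b ≈ pp∞ η α (b + b) ⊠ pp∞ η (α + b) (b + b)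
    pp∞-split η α = []⇒≈ λ N → []-trans ([]-mono (ℕP.m≤m+n N N) ([]-sym (ap η α b≥1 (N + N))))
      ([]-trans (≈⇒[] (pp-split η α b N)) (⊠-cong[] (ap η α b2 N) (ap η (α + b) b2 N)))

    pp∞-± : ∀ α → pp∞ (⊝ 𝟙) α b ⊠ pp∞ 𝟙 α b ≈ pp∞ (⊝ 𝟙) (α + α) (b + b)
    pp∞-± α = []⇒≈ λ N → []-trans (⊠-cong[] ([]-sym (ap _ α b≥1 N)) ([]-sym (ap _ α b≥1 N)))
      ([]-trans (≈⇒[] (pp-± α b N)) (ap _ (α + α) b2 N))

    pp∞-0 : pp∞ 𝟙 0 b ≈ (𝟙 ⊞ 𝟙) ⊠ pp∞ 𝟙 b b
    pp∞-0 = []⇒≈ λ N → []-trans ([]-mono (ℕP.n≤1+n N) ([]-sym (ap 𝟙 0 b≥1 (suc N))))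
      ([]-trans (≈⇒[] (pp-0 b N)) (⊠-cong[] []-refl (ap 𝟙 b b≥1 N)))

    J≈pp∞ : J b ≈ pp∞ (⊝ 𝟙) b b
    J≈pp∞ = []⇒≈ λ N → []-trans ([]-sym (lim-approx (qf-Cauchy b≥1) N)) ([]-trans (≈⇒[] (qf≈pp b N)) (ap _ b b≥1 N))

  J-double : ∀ {b} → 1 ≤ b → J b ⊠ pp∞ 𝟙 b b ≈ J (b + b)
  J-double {b} l = ≈-trans (⊠-congˡ (J≈pp∞ l)) (≈-trans (pp∞-± l b) (≈-sym (J≈pp∞ (ℕP.≤-trans l (ℕP.m≤m+n b b)))))

  J-halve : ∀ {b} → 1 ≤ b → J b ≈ pp∞ (⊝ 𝟙) b (b + b) ⊠ J (b + b)
  J-halve {b} l = ≈-trans (J≈pp∞ l) (≈-trans (pp∞-split l (⊝ 𝟙) b) (⊠-congʳ (≈-sym (J≈pp∞ (ℕP.≤-trans l (ℕP.m≤m+n b b))))))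

open CrossMultiplication

-- Eta quotients as exponent vectors and the two dissection formulas

module EtaQuotients where

  private variable
    f u : S

  pow-cong : ∀ n → f ≈ u → pow f n ≈ pow u n
  pow-cong zero    p = ≈-refl
  pow-cong (suc n) p = ⊠-cong p (pow-cong n p)

  pow-V : ∀ n f → V (pow f n) ≈ pow (V f) n
  pow-V zero    f = V-K _
  pow-V (suc n) f = ≈-trans (V-⊠ _ _) (⊠-congʳ (pow-V n f))

  pz : S → ℤ → S
  pz u (+ n)    = pow u n
  pz u -[1+ n ] = pow (invS u) (suc n)

  pz-suc : U u → ∀ a → u ⊠ pz u a ≈ pz u (ℤ.suc a)
  pz-suc v (+ n)          = ≈-refl
  pz-suc v -[1+ zero ]    = ≈-trans (⊠-congʳ (⊠-identityʳ _)) (⊠-invS v)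
  pz-suc v -[1+ suc n ]   = ≈-trans (≈-sym (⊠-assoc _ _ _)) (≈-trans (⊠-congˡ (⊠-invS v)) (⊠-identityˡ _))

  pz-pred : U u → ∀ a → invS u ⊠ pz u a ≈ pz u (ℤ.pred a)
  pz-pred {u} v a = U-cancel v (≈-trans (≈-sym (⊠-assoc _ _ _)) (≈-trans (⊠-congˡ (⊠-invS v)) (≈-trans (⊠-identityˡ _)
    (≈-sym (≈-trans (pz-suc v (ℤ.pred a)) (≡⇒≈ (cong (pz u) (ℤP.suc-pred a))))))))

  pz-⊠ : U u → ∀ a b → pz u a ⊠ pz u b ≈ pz u (a ℤ.+ b)
  pz-⊠ {u} v (+ zero) b        = ≈-trans (⊠-identityˡ _) (≡⇒≈ (cong (pz u) (sym (ℤP.+-identityˡ b))))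
  pz-⊠ {u} v (+ suc n) b       = ≈-trans (⊠-assoc _ _ _) (≈-trans (⊠-congʳ (pz-⊠ v (+ n) b))
    (≈-trans (pz-suc v (+ n ℤ.+ b)) (≡⇒≈ (cong (pz u) (sym (ℤP.+-assoc (+ 1) (+ n) b))))))
  pz-⊠ {u} v -[1+ zero ] b     = ≈-trans (⊠-congˡ (⊠-identityʳ _)) (pz-pred v b)
  pz-⊠ {u} v -[1+ suc n ] b    = ≈-trans (⊠-assoc _ _ _) (≈-trans (⊠-congʳ (pz-⊠ v -[1+ n ] b))
    (≈-trans (pz-pred v (-[1+ n ] ℤ.+ b)) (≡⇒≈ (cong (pz u) (sym (ℤP.+-assoc -[1+ 0 ] -[1+ n ] b))))))

  pz-cong : U f → ∀ a → f ≈ u → pz f a ≈ pz u a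
  pz-cong v (+ n)    p = pow-cong n p
  pz-cong v -[1+ n ] p = pow-cong (suc n) (invS-cong v p)

  V-pz : U f → ∀ a → V (pz f a) ≈ pz (V f) a
  V-pz v (+ n)    = pow-V n _
  V-pz v -[1+ n ] = ≈-trans (pow-V (suc n) _) (pow-cong (suc n) (V-invS v))

  Ex : Set
  Ex = ℤ × ℤ × ℤ × ℤ × ℤ

  infixl 6 _+ₑ_
  _+ₑ_ : Ex → Ex → Ex
  (a , b , c , d , e) +ₑ (a′ , b′ , c′ , d′ , e′) = (a ℤ.+ a′ , b ℤ.+ b′ , c ℤ.+ c′ , d ℤ.+ d′ , e ℤ.+ e′)

  -ₑ_ : Ex → Ex
  -ₑ (a , b , c , d , e) = (ℤ.- a , ℤ.- b , ℤ.- c , ℤ.- d , ℤ.- e)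

  uJ : ∀ n → U (J (suc n))
  uJ n = U-J 1≤1+

  opaque
    -- J₁^a J₂^b J₄^c J₈^d J₁₆^e
    mon : Ex → S
    mon (a , b , c , d , e) = pz (J 1) a ⊠ (pz (J 2) b ⊠ (pz (J 4) c ⊠ (pz (J 8) d ⊠ pz (J 16) e)))

    mon-def : ∀ a b c d e → mon (a , b , c , d , e) ≈ pz (J 1) a ⊠ (pz (J 2) b ⊠ (pz (J 4) c ⊠ (pz (J 8) d ⊠ pz (J 16) e)))
    mon-def a b c d e = ≈-refl

  mon-⊠ : ∀ v w → mon v ⊠ mon w ≈ mon (v +ₑ w)
  mon-⊠ (a , b , c , d , e) (a′ , b′ , c′ , d′ , e′) = ≈-trans (≈-trans (⊠-cong (mon-def a b c d e) (mon-def a′ b′ c′ d′ e′))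
    (solve 10 (λ a b c d e a′ b′ c′ d′ e′ → a :* (b :* (c :* (d :* e))) :* (a′ :* (b′ :* (c′ :* (d′ :* e′))))
      := (a :* a′) :* ((b :* b′) :* ((c :* c′) :* ((d :* d′) :* (e :* e′))))) ≈-refl _ _ _ _ _ _ _ _ _ _)) (≈-trans
    (⊠-cong (pz-⊠ (uJ _) a a′) (⊠-cong (pz-⊠ (uJ _) b b′) (⊠-cong (pz-⊠ (uJ _) c c′) (⊠-cong (pz-⊠ (uJ _) d d′) (pz-⊠ (uJ _) e e′))))) (≈-sym (mon-def _ _ _ _ _)))

  0ₑ : Ex
  0ₑ = + 0 , + 0 , + 0 , + 0 , + 0

  mon-0 : mon 0ₑ ≈ 𝟙
  mon-0 = ≈-trans (mon-def (+ 0) (+ 0) (+ 0) (+ 0) (+ 0)) (solve 0 (:1 :* (:1 :* (:1 :* (:1 :* :1))) := :1) ≈-refl)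

  +ₑ-inverse : ∀ v → v +ₑ (-ₑ v) ≡ 0ₑ
  +ₑ-inverse (a , b , c , d , e) rewrite ℤP.+-inverseʳ a | ℤP.+-inverseʳ b | ℤP.+-inverseʳ c | ℤP.+-inverseʳ d | ℤP.+-inverseʳ e = refl

  mon-inverse : ∀ v → mon v ⊠ mon (-ₑ v) ≈ 𝟙
  mon-inverse v = ≈-trans (mon-⊠ v (-ₑ v)) (≈-trans (≡⇒≈ (cong mon (+ₑ-inverse v))) mon-0)

  U-mon : ∀ v → U (mon v)
  U-mon v = mon (-ₑ v) , mon-inverse v

  invS-mon : ∀ v → invS (mon v) ≈ mon (-ₑ v)
  invS-mon v = ≈-sym (inverse-unique (mon-inverse v))

  mon-divide : ∀ v → f ⊠ mon v ≈ u → f ≈ u ⊠ mon (-ₑ v)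
  mon-divide {f} {u} v p = ≈-trans (≈-sym (≈-trans (⊠-assoc _ _ _) (≈-trans (⊠-congʳ (mon-inverse v)) (⊠-identityʳ f)))) (⊠-congˡ p)

  mon-quotient : ∀ v w → f ⊠ mon v ≈ mon w → f ≈ mon (w +ₑ (-ₑ v))
  mon-quotient v w p = ≈-trans (mon-divide v p) (mon-⊠ w (-ₑ v))

  -- q ↦ q² moves every exponent one place on; J₁₆ has no next place, so its exponent has to be 0.
  V-mon : ∀ a b c d → V (mon (a , b , c , d , + 0)) ≈ mon (+ 0 , a , b , c , d)
  V-mon a b c d = begin
    V (mon (a , b , c , d , + 0)) ≈⟨ V-cong (mon-def a b c d (+ 0)) ⟩
    V (pz (J 1) a ⊠ (pz (J 2) b ⊠ (pz (J 4) c ⊠ (pz (J 8) d ⊠ 𝟙)))) ≈⟨ ≈-trans (V-⊠ _ _) (⊠-cong (vp a refl) (≈-trans (V-⊠ _ _) (⊠-cong (vp b refl) (≈-trans (V-⊠ _ _) (⊠-cong (vp c refl) (≈-trans (V-⊠ _ _) (⊠-cong (vp d refl) (V-K _)))))))) ⟩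
    pz (J 2) a ⊠ (pz (J 4) b ⊠ (pz (J 8) c ⊠ (pz (J 16) d ⊠ 𝟙))) ≈⟨ solve 4 (λ a b c d → a :* (b :* (c :* (d :* :1))) := :1 :* (a :* (b :* (c :* d)))) ≈-refl _ _ _ _ ⟩
    𝟙 ⊠ (pz (J 2) a ⊠ (pz (J 4) b ⊠ (pz (J 8) c ⊠ pz (J 16) d))) ≈⟨ mon-def (+ 0) a b c d ⟨
    mon (+ 0 , a , b , c , d) ∎
    where
    open ≈-Reasoning
    vp : ∀ {n m} a → suc n + suc n ≡ m → V (pz (J (suc n)) a) ≈ pz (J m) a
    vp {n} a refl = ≈-trans (V-pz (uJ n) a) (≈-sym (pz-cong (uJ _) a (≈-sym (V-J 1≤1+ refl))))

  e₁ e₂ e₄ e₈ : ℤ → Ex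
  e₁ a = a , + 0 , + 0 , + 0 , + 0
  e₂ a = + 0 , a , + 0 , + 0 , + 0
  e₄ a = + 0 , + 0 , a , + 0 , + 0
  e₈ a = + 0 , + 0 , + 0 , a , + 0

  pz₁ : ∀ a → pz (J 1) a ≈ mon (e₁ a)
  pz₁ a = ≈-trans (solve 1 (λ x → x := x :* (:1 :* (:1 :* (:1 :* :1)))) ≈-refl _) (≈-sym (mon-def a (+ 0) (+ 0) (+ 0) (+ 0)))
  pz₂ : ∀ a → pz (J 2) a ≈ mon (e₂ a)
  pz₂ a = ≈-trans (solve 1 (λ x → x := :1 :* (x :* (:1 :* (:1 :* :1)))) ≈-refl _) (≈-sym (mon-def (+ 0) a (+ 0) (+ 0) (+ 0)))
  pz₄ : ∀ a → pz (J 4) a ≈ mon (e₄ a)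
  pz₄ a = ≈-trans (solve 1 (λ x → x := :1 :* (:1 :* (x :* (:1 :* :1)))) ≈-refl _) (≈-sym (mon-def (+ 0) (+ 0) a (+ 0) (+ 0)))
  pz₈ : ∀ a → pz (J 8) a ≈ mon (e₈ a)
  pz₈ a = ≈-trans (solve 1 (λ x → x := :1 :* (:1 :* (:1 :* (x :* :1)))) ≈-refl _) (≈-sym (mon-def (+ 0) (+ 0) (+ 0) a (+ 0)))

  J₁ : J 1 ≈ mon (e₁ (+ 1))
  J₁ = ≈-trans (≈-sym (⊠-identityʳ _)) (pz₁ (+ 1))
  J₂ : J 2 ≈ mon (e₂ (+ 1))
  J₂ = ≈-trans (≈-sym (⊠-identityʳ _)) (pz₂ (+ 1))
  J₄ : J 4 ≈ mon (e₄ (+ 1))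
  J₄ = ≈-trans (≈-sym (⊠-identityʳ _)) (pz₄ (+ 1))
  J₈ : J 8 ≈ mon (e₈ (+ 1))
  J₈ = ≈-trans (≈-sym (⊠-identityʳ _)) (pz₈ (+ 1))

  I∞₁ : I∞ 1 ≈ mon (e₁ -[1+ 0 ])
  I∞₁ = ≈-trans (invS-cong (uJ _) J₁) (invS-mon _)
  I∞₄ : I∞ 4 ≈ mon (e₄ -[1+ 0 ])
  I∞₄ = ≈-trans (invS-cong (uJ _) J₄) (invS-mon _)

  m : ℕ → ℤ
  m n = ℤ.- (+ n)

  private
    ⊠-mon : ∀ {v w} → f ≈ mon v → u ≈ mon w → f ⊠ u ≈ mon (v +ₑ w)
    ⊠-mon p r = ≈-trans (⊠-cong p r) (mon-⊠ _ _)

    -- The pattern here: (Q ; Q²)_∞ is a quotient of two J's, and (-q^a ; q^b)_∞ is (q^(2a) ;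
    -- q^(2b))_∞ divided by (q^a ; q^b)_∞.
    p₁ : pp∞ (⊝ 𝟙) 1 2 ≈ mon (+ 1 , m 1 , + 0 , + 0 , + 0)
    p₁ = mon-quotient (e₂ (+ 1)) (e₁ (+ 1)) (≈-trans (⊠-congʳ (≈-sym J₂)) (≈-trans (≈-sym (J-halve 1≤1+)) J₁))

    n₂ : pp∞ (⊝ 𝟙) 2 4 ≈ mon (+ 0 , + 1 , m 1 , + 0 , + 0)
    n₂ = mon-quotient (e₄ (+ 1)) (e₂ (+ 1)) (≈-trans (⊠-congʳ (≈-sym J₄)) (≈-trans (≈-sym (J-halve 1≤1+)) J₂))

    n₄ : pp∞ (⊝ 𝟙) 4 8 ≈ mon (+ 0 , + 0 , + 1 , m 1 , + 0)
    n₄ = mon-quotient (e₈ (+ 1)) (e₄ (+ 1)) (≈-trans (⊠-congʳ (≈-sym J₈)) (≈-trans (≈-sym (J-halve 1≤1+)) J₄))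

  m₁ : pp∞ 𝟙 1 2 ≈ mon (m 1 , + 2 , m 1 , + 0 , + 0)
  m₁ = mon-quotient (+ 1 , m 1 , + 0 , + 0 , + 0) (+ 0 , + 1 , m 1 , + 0 , + 0)
    (≈-trans (⊠-comm _ _) (≈-trans (⊠-congˡ (≈-sym p₁)) (≈-trans (pp∞-± 1≤1+ 1) n₂)))

  private
    m₂ : pp∞ 𝟙 2 4 ≈ mon (+ 0 , m 1 , + 2 , m 1 , + 0)
    m₂ = mon-quotient (+ 0 , + 1 , m 1 , + 0 , + 0) (+ 0 , + 0 , + 1 , m 1 , + 0)
      (≈-trans (⊠-comm _ _) (≈-trans (⊠-congˡ (≈-sym n₂)) (≈-trans (pp∞-± 1≤1+ 2) n₄)))

    m₄ : pp∞ 𝟙 4 4 ≈ mon (+ 0 , + 0 , m 1 , + 1 , + 0)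
    m₄ = mon-quotient (e₄ (+ 1)) (e₈ (+ 1)) (≈-trans (⊠-comm _ _) (≈-trans (⊠-congˡ (≈-sym J₄)) (≈-trans (J-double 1≤1+) J₈)))

  pp∞-1-1 : pp∞ 𝟙 1 1 ≈ mon (m 1 , + 1 , + 0 , + 0 , + 0)
  pp∞-1-1 = mon-quotient (e₁ (+ 1)) (e₂ (+ 1)) (≈-trans (⊠-comm _ _) (≈-trans (⊠-congˡ (≈-sym J₁)) (≈-trans (J-double 1≤1+) J₂)))

  A₁-mon : A₁ ≈ mon (m 2 , + 4 , + 0 , + 0 , + 0)
  A₁-mon = mon-quotient (+ 2 , m 2 , + 0 , + 0 , + 0) (e₂ (+ 2)) (≈-trans (⊠-comm _ _) (≈-trans (⊠-congˡ (≈-sym (⊠-mon p₁ p₁))) (≈-trans A₁-product (⊠-mon J₂ J₂))))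

  Sb21-mon : Sb 2 (+ 1) ≈ mon (+ 2 , m 2 , + 2 , + 0 , + 0)
  Sb21-mon = mon-quotient (m 2 , + 4 , m 2 , + 0 , + 0) (e₂ (+ 2)) (≈-trans (⊠-comm _ _) (≈-trans (⊠-congˡ (≈-sym (⊠-mon m₁ m₁))) (≈-trans (Appell⁻.Sb-product 1 0 1≤1+) (⊠-mon J₂ J₂))))

  -- The product formula brings in (-q ; q⁴)_∞ and (-q³ ; q⁴)_∞, which are evaluated together as (-q
  -- ; q²)_∞.
  Sb41-mon : Sb 4 (+ 1) ≈ mon (+ 1 , m 2 , + 3 , + 0 , + 0)
  Sb41-mon = mon-quotient (m 1 , + 2 , m 1 , + 0 , + 0) (e₄ (+ 2)) (≈-trans (⊠-comm _ _) (≈-trans (⊠-congˡ (≈-trans (≈-sym m₁) (pp∞-split 1≤1+ 𝟙 1))) (≈-trans (Appell⁻.Sb-product 1 2 1≤1+) (⊠-mon J₄ J₄))))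

  Sb42-mon : Sb 4 (+ 2) ≈ mon (+ 0 , + 2 , m 2 , + 2 , + 0)
  Sb42-mon = mon-quotient (+ 0 , m 2 , + 4 , m 2 , + 0) (e₄ (+ 2)) (≈-trans (⊠-comm _ _) (≈-trans (⊠-congˡ (≈-sym (⊠-mon m₂ m₂))) (≈-trans (Appell⁻.Sb-product 2 1 1≤1+) (⊠-mon J₄ J₄))))

  -- The 2 comes from (-1 ; q⁴)_∞ = 2 (-q⁴ ; q⁴)_∞ and is the origin of the ½ in the theorem.
  Sb40-mon : (𝟙 ⊞ 𝟙) ⊠ Sb 4 (+ 0) ≈ mon (+ 0 , + 0 , + 4 , m 2 , + 0)
  Sb40-mon = mon-quotient (+ 0 , + 0 , m 2 , + 2 , + 0) (e₄ (+ 2)) (begin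
    (𝟙 ⊞ 𝟙) ⊠ Sb 4 (+ 0) ⊠ mon (+ 0 , + 0 , m 2 , + 2 , + 0) ≈⟨ ⊠-congʳ (≈-sym (⊠-mon m₄ m₄)) ⟩
    (𝟙 ⊞ 𝟙) ⊠ Sb 4 (+ 0) ⊠ (pp∞ 𝟙 4 4 ⊠ pp∞ 𝟙 4 4) ≈⟨ solve 3 (λ t s p → t :* s :* (p :* p) := (t :* p) :* p :* s) ≈-refl _ _ _ ⟩
    (𝟙 ⊞ 𝟙) ⊠ pp∞ 𝟙 4 4 ⊠ pp∞ 𝟙 4 4 ⊠ Sb 4 (+ 0) ≈⟨ ⊠-congˡ (⊠-congˡ (pp∞-0 1≤1+)) ⟨
    pp∞ 𝟙 0 4 ⊠ pp∞ 𝟙 4 4 ⊠ Sb 4 (+ 0) ≈⟨ Appell⁻.Sb-product 0 3 1≤1+ ⟩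
    J 4 ⊠ J 4 ≈⟨ ⊠-mon J₄ J₄ ⟩
    mon (e₄ (+ 2)) ∎)
    where open ≈-Reasoning

  half : f ≈ (𝟙 ⊞ 𝟙) ⊠ u → K ½ ⊠ f ≈ u
  half {f} {u} p = ≈-trans (⊠-congʳ p) (≈-trans (≈-sym (⊠-assoc _ _ _)) (≈-trans (⊠-congˡ (≈-trans (⊠-comm _ _) (proj₂ U-2))) (⊠-identityˡ u)))

  module _ where
    open ≈-Reasoning
    private
      -- This one monomial normalises both constants: it turns `Sb 4 (+ 1)` into 1/J₁ and
      -- `Sb 2 (+ 1)` into 1/J₄, the prefactors in the Appell forms of the two series.
      c : Ex
      c = m 2 , + 2 , m 3 , + 0 , + 0

      isolate : ∀ {x y t} → t ≈ x ⊠ Sb 4 (+ 1) ⊞ y ⊠ Sb 2 (+ 1) → t ⊠ mon c ≈ I∞ 1 ⊠ x ⊞ I∞ 4 ⊠ y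
      isolate {x} {y} {t} p = begin
        t ⊠ mon c ≈⟨ ⊠-congˡ p ⟩
        (x ⊠ Sb 4 (+ 1) ⊞ y ⊠ Sb 2 (+ 1)) ⊠ mon c ≈⟨ solve 5 (λ x s y r c → (x :* s :+ y :* r) :* c := (s :* c) :* x :+ (r :* c) :* y) ≈-refl _ _ _ _ _ ⟩
        Sb 4 (+ 1) ⊠ mon c ⊠ x ⊞ Sb 2 (+ 1) ⊠ mon c ⊠ y
          ≈⟨ ⊞-cong (⊠-congˡ (≈-trans (⊠-mon Sb41-mon (≈-refl {mon c})) (≈-sym I∞₁))) (⊠-congˡ (≈-trans (⊠-mon Sb21-mon (≈-refl {mon c})) (≈-sym I∞₄))) ⟩
        I∞ 1 ⊠ x ⊞ I∞ 4 ⊠ y ∎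

    even-formula : I∞ 1 ⊠ X ⊞ gS 𝟙 0 4 4 ≈ K ½ ⊠ mon (m 4 , + 6 , + 1 , m 2 , + 0)
    even-formula = begin
      I∞ 1 ⊠ X ⊞ gS 𝟙 0 4 4 ≈⟨ ⊞-congʳ Y-gS ⟨
      I∞ 1 ⊠ X ⊞ I∞ 4 ⊠ Y ≈⟨ isolate cross₀ ⟨
      A₁ ⊠ Sb 4 (+ 0) ⊠ mon c ≈⟨ half (begin
        mon (m 4 , + 6 , + 1 , m 2 , + 0) ≈⟨ ⊠-mon (⊠-mon A₁-mon Sb40-mon) (≈-refl {mon c}) ⟨
        A₁ ⊠ ((𝟙 ⊞ 𝟙) ⊠ Sb 4 (+ 0)) ⊠ mon c ≈⟨ solve 4 (λ a t s c → a :* (t :* s) :* c := t :* (a :* s :* c)) ≈-refl _ _ _ _ ⟩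
        (𝟙 ⊞ 𝟙) ⊠ (A₁ ⊠ Sb 4 (+ 0) ⊠ mon c) ∎) ⟨
      K ½ ⊠ mon (m 4 , + 6 , + 1 , m 2 , + 0) ∎

    odd-formula : I∞ 1 ⊠ Xo ⊞ I∞ 4 ⊠ Y′ ≈ mon (m 4 , + 8 , m 5 , + 2 , + 0)
    odd-formula = ≈-trans (≈-sym (isolate cross₂)) (⊠-mon (⊠-mon A₁-mon Sb42-mon) (≈-refl {mon c}))

open EtaQuotients

-- Theta functions and the 2-dissections of 1/J₁² and 1/J₁⁴

module ThetaFunctions where

  private variable
    f : S
    N : ℕ

  module TripleProduct (α β : ℕ) (bound : ∀ n → ∣ n ∣ ≤ suc (E α β n)) (b≥1 : 1 ≤ α + β) where
    private
      b = α + β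
      module L = ThetaLimits 𝟙 α β bound b≥1
    open L public using () renaming (t-tame to θ-tame)

    triple-product : ∑ℤ (θ 𝟙 α β) ≈ J b ⊠ (pp∞ 𝟙 α b ⊠ pp∞ 𝟙 β b)
    triple-product = ≈-sym ([]⇒≈ λ N → begin
      J b ⊠ (pp∞ 𝟙 α b ⊠ pp∞ 𝟙 β b)
        ≈⟨ ⊠-cong[] []-refl (⊠-cong[] (up N (lim-approx (pp-Cauchy 𝟙 α b≥1) (suc N))) (up N (lim-approx (pp-Cauchy 𝟙 β b≥1) (suc N)))) ⟨
      J b ⊠ (pp 𝟙 α b (suc N) ⊠ pp 𝟙 β b (suc N)) ≈⟨ ≈⇒[] (⊠-congʳ (≈-sym (W-product 𝟙 𝟙²≈𝟙 α β b≥1 (suc N) (suc N) (suc N) ℕP.≤-refl ℕP.≤-refl))) ⟩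
      J b ⊠ (qf b (suc N + suc N) ⊠ sumZ (suc N) (λ n → θ 𝟙 α β n ⊠ cc b (suc N) n))
        ≈⟨ ⊠-cong[] []-refl (⊠-cong[] ([]-mono (ℕP.≤-trans (ℕP.n≤1+n N) (ℕP.m≤m+n (suc N) (suc N))) (lim-approx (qf-Cauchy b≥1) (suc N + suc N)))
             ([]-trans (≈⇒[] (sumZ-cong (suc N) λ n _ → ≈-sym (⊠-identityʳ _))) (L.cc-sum-limit (λ _ → 𝟙) N))) ⟩
      J b ⊠ (J b ⊠ (I∞ b ⊠ I∞ b ⊠ ∑ℤ (λ n → θ 𝟙 α β n ⊠ 𝟙)))
        ≈⟨ ≈⇒[] (⊠-congʳ (⊠-congʳ (⊠-congʳ (∑-cong (Tame-⊠ʳ _ L.t-tame) L.t-tame λ n → ⊠-identityʳ _)))) ⟩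
      J b ⊠ (J b ⊠ (I∞ b ⊠ I∞ b ⊠ ∑ℤ (θ 𝟙 α β))) ≈⟨ ≈⇒[] (solve 3 (λ j i s → j :* (j :* (i :* i :* s)) := (j :* i) :* (j :* i) :* s) ≈-refl _ _ _) ⟩
      (J b ⊠ I∞ b) ⊠ (J b ⊠ I∞ b) ⊠ ∑ℤ (θ 𝟙 α β) ≈⟨ ≈⇒[] (⊠-congˡ (≈-trans (⊠-cong (⊠-invS (U-J b≥1)) (⊠-invS (U-J b≥1))) 𝟙²≈𝟙)) ⟩
      𝟙 ⊠ ∑ℤ (θ 𝟙 α β) ≈⟨ ≈⇒[] (⊠-identityˡ _) ⟩
      ∑ℤ (θ 𝟙 α β) ∎)
      where
      open module R {N} = []-Reasoning N
      up : ∀ N {f g} → f ≈[ suc N ] g → f ≈[ N ] g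
      up N = []-mono (ℕP.n≤1+n N)

  E11-bound : ∀ n → ∣ n ∣ ≤ suc (E 1 1 n)
  E11-bound (+ n)    = ℕP.m≤n⇒m≤1+n (ℕP.≤-trans (n≤b*n {1} n 1≤1+) (ℕP.m≤n+m (1 * n) (2 * tri n)))
  E11-bound -[1+ n ] = ℕP.m≤n⇒m≤1+n (ℕP.≤-trans (n≤b*n {1} (suc n) 1≤1+) (ℕP.m≤n+m (1 * suc n) (2 * tri (suc n))))

  module Phi = TripleProduct 1 1 E11-bound 1≤1+
  module Psi = TripleProduct 1 0 (E-bound 1≤1+) 1≤1+

  -- Ramanujan's theta functions: φ is the sum of q^(n²) over ℤ and ψ that of q^(n(n+1)/2) over n ≥
  -- 0, so the bilateral series counts ψ twice.
  φ ψ : S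
  φ = mon (m 2 , + 5 , m 2 , + 0 , + 0)
  ψ = mon (m 1 , + 2 , + 0 , + 0 , + 0)

  φ-series : ∑ℤ (θ 𝟙 1 1) ≈ φ
  φ-series = ≈-trans Phi.triple-product (≈-trans (⊠-cong J₂ (≈-trans (⊠-cong m₁ m₁) (mon-⊠ _ _))) (mon-⊠ _ _))

  ψ-series : ∑ℤ (θ 𝟙 1 0) ≈ (𝟙 ⊞ 𝟙) ⊠ ψ
  ψ-series = begin
    ∑ℤ (θ 𝟙 1 0) ≈⟨ Psi.triple-product ⟩
    J 1 ⊠ (pp∞ 𝟙 1 1 ⊠ pp∞ 𝟙 0 1) ≈⟨ ⊠-congʳ (⊠-congʳ (pp∞-0 1≤1+)) ⟩
    J 1 ⊠ (pp∞ 𝟙 1 1 ⊠ ((𝟙 ⊞ 𝟙) ⊠ pp∞ 𝟙 1 1)) ≈⟨ solve 3 (λ j p t → j :* (p :* (t :* p)) := t :* (j :* (p :* p))) ≈-refl _ _ _ ⟩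
    (𝟙 ⊞ 𝟙) ⊠ (J 1 ⊠ (pp∞ 𝟙 1 1 ⊠ pp∞ 𝟙 1 1)) ≈⟨ ⊠-congʳ (≈-trans (⊠-cong J₁ (≈-trans (⊠-cong pp∞-1-1 pp∞-1-1) (mon-⊠ _ _))) (mon-⊠ _ _)) ⟩
    (𝟙 ⊞ 𝟙) ⊠ ψ ∎
    where open ≈-Reasoning

  pow-𝟙 : ∀ n → pow 𝟙 n ≈ 𝟙
  pow-𝟙 zero    = ≈-refl
  pow-𝟙 (suc n) = ≈-trans (⊠-identityˡ _) (pow-𝟙 n)

  θ-𝟙 : ∀ α β n → θ 𝟙 α β n ≈ q^ (E α β n)
  θ-𝟙 α β n = ≈-trans (⊠-congˡ (pow-𝟙 ∣ n ∣)) (⊠-identityˡ _)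

  Tame-even : ∀ {F} → Tame F → Tame (λ n → F (n ℤ.+ n))
  Tame-even t N (+ n)    l = t N (+ (n + n)) (ℕP.≤-trans l (ℕP.m≤m+n n n))
  Tame-even t N -[1+ n ] l = t N -[1+ suc (n + n) ] (ℕP.≤-trans l (s≤s (ℕP.m≤n⇒m≤1+n (ℕP.m≤m+n n n))))

  Tame-odd : ∀ {F} → Tame F → Tame (λ n → F (ℤ.suc (n ℤ.+ n)))
  Tame-odd t N (+ n)    l = t N (+ suc (n + n)) (ℕP.≤-trans l (ℕP.m≤n⇒m≤1+n (ℕP.m≤m+n n n)))
  Tame-odd t N -[1+ n ] l = t N -[1+ n + n ] (ℕP.≤-trans l (s≤s (ℕP.m≤m+n n n)))

  private
    2+ = 𝟙 ⊞ 𝟙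

  -- (2n)² = 4n² and (2n + 1)² = 1 + 8 · n(n + 1)/2.
  φ-dissect : φ ≈ V (V φ) ⊞ q^ 1 ⊠ (2+ ⊠ V (V (V ψ)))
  φ-dissect = begin
    φ ≈⟨ φ-series ⟨
    ∑ℤ F ≈⟨ ∑-parity τ (Tame-even τ) (Tame-odd τ) ⟩
    ∑ℤ (λ n → F (n ℤ.+ n)) ⊞ ∑ℤ (λ n → F (ℤ.suc (n ℤ.+ n)))
      ≈⟨ ⊞-cong (∑-cong (Tame-even τ) (V-tame (V-tame τ)) ev) (∑-cong (Tame-odd τ) (Tame-⊠ˡ _ (V-tame (V-tame (V-tame ρ)))) od) ⟩
    ∑ℤ (λ n → V (V (F n))) ⊞ ∑ℤ (λ n → q^ 1 ⊠ V (V (V (G n))))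
      ≈⟨ ⊞-cong (≈-sym (≈-trans (V-cong (V-∑ τ)) (V-∑ (V-tame τ))))
           (≈-trans (∑-⊠ˡ _ (V-tame (V-tame (V-tame ρ)))) (⊠-congʳ (≈-sym (≈-trans (V-cong (≈-trans (V-cong (V-∑ ρ)) (V-∑ (V-tame ρ)))) (V-∑ (V-tame (V-tame ρ))))))) ⟩
    V (V (∑ℤ F)) ⊞ q^ 1 ⊠ V (V (V (∑ℤ G))) ≈⟨ ⊞-cong (V-cong (V-cong φ-series)) (⊠-congʳ (V-cong (V-cong (≈-trans (V-cong ψ-series) (V2 ψ))))) ⟩
    V (V φ) ⊞ q^ 1 ⊠ V (V (2+ ⊠ V ψ)) ≈⟨ ⊞-congʳ (⊠-congʳ (≈-trans (V-cong (V2 _)) (V2 _))) ⟩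
    V (V φ) ⊞ q^ 1 ⊠ (2+ ⊠ V (V (V ψ))) ∎
    where
    open ≈-Reasoning
    F = θ 𝟙 1 1
    G = θ 𝟙 1 0
    τ = Phi.θ-tame
    ρ = Psi.θ-tame
    V2 : ∀ f → V (2+ ⊠ f) ≈ 2+ ⊠ V f
    V2 f = ≈-trans (V-⊠ _ _) (⊠-congˡ (≈-trans (V-⊞ _ _) (⊞-cong (V-K _) (V-K _))))
    VV : ∀ a → V (V (q^ a)) ≈ q^ (a + a + (a + a))
    VV a = ≈-trans (V-cong (V-q^ a)) (V-q^ (a + a))
    ev : ∀ n → F (n ℤ.+ n) ≈ V (V (F n))
    ev n = ≈-trans (θ-𝟙 1 1 (n ℤ.+ n)) (≈-trans (q^-≡ ex) (≈-sym (≈-trans (V-cong (V-cong (θ-𝟙 1 1 n))) (VV _))))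
      where
      a = E 1 1 n
      lem : ∀ n → (+ 1 ℤ.+ + 1) ℤ.* ((n ℤ.+ n) ℤ.* (n ℤ.+ n ℤ.- + 1)) ℤ.+ + 2 ℤ.* (+ 1 ℤ.* (n ℤ.+ n)) ≡
        ((+ 1 ℤ.+ + 1) ℤ.* (n ℤ.* (n ℤ.- + 1)) ℤ.+ + 2 ℤ.* (+ 1 ℤ.* n) ℤ.+ ((+ 1 ℤ.+ + 1) ℤ.* (n ℤ.* (n ℤ.- + 1)) ℤ.+ + 2 ℤ.* (+ 1 ℤ.* n)))
        ℤ.+ ((+ 1 ℤ.+ + 1) ℤ.* (n ℤ.* (n ℤ.- + 1)) ℤ.+ + 2 ℤ.* (+ 1 ℤ.* n) ℤ.+ ((+ 1 ℤ.+ + 1) ℤ.* (n ℤ.* (n ℤ.- + 1)) ℤ.+ + 2 ℤ.* (+ 1 ℤ.* n)))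
      lem = ℤ-solve
      ex : E 1 1 (n ℤ.+ n) ≡ a + a + (a + a)
      ex = eq-2 (E 1 1 (n ℤ.+ n)) (a + a + (a + a)) (E-2 1 1 (n ℤ.+ n)) (add-2 (a + a) (a + a) (add-2 a a (E-2 1 1 n) (E-2 1 1 n)) (add-2 a a (E-2 1 1 n) (E-2 1 1 n))) (lem n)
    od : ∀ n → F (ℤ.suc (n ℤ.+ n)) ≈ q^ 1 ⊠ V (V (V (G n)))
    od n = ≈-trans (θ-𝟙 1 1 (ℤ.suc (n ℤ.+ n))) (≈-trans (q^-≡ ex) (≈-trans (q^-+ 1 _) (⊠-congʳ (≈-sym (≈-trans (V-cong (≈-trans (V-cong (V-cong (θ-𝟙 1 0 n))) (VV _))) (V-q^ _))))))
      where
      a = E 1 0 n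
      c = a + a + (a + a)
      p = (+ 1 ℤ.+ + 0) ℤ.* (n ℤ.* (n ℤ.- + 1)) ℤ.+ + 2 ℤ.* (+ 1 ℤ.* n)
      c-2 : + 2 ℤ.* + c ≡ p ℤ.+ p ℤ.+ (p ℤ.+ p)
      c-2 = add-2 (a + a) (a + a) (add-2 a a (E-2 1 0 n) (E-2 1 0 n)) (add-2 a a (E-2 1 0 n) (E-2 1 0 n))
      lem₀ : ∀ p → p ℤ.+ p ℤ.+ (p ℤ.+ p) ≡ + 4 ℤ.* p
      lem₀ = ℤ-solve
      lem : ∀ n → (+ 1 ℤ.+ + 1) ℤ.* ((+ 1 ℤ.+ (n ℤ.+ n)) ℤ.* (+ 1 ℤ.+ (n ℤ.+ n) ℤ.- + 1)) ℤ.+ + 2 ℤ.* (+ 1 ℤ.* (+ 1 ℤ.+ (n ℤ.+ n))) ≡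
        + 2 ℤ.+ (+ 4 ℤ.* ((+ 1 ℤ.+ + 0) ℤ.* (n ℤ.* (n ℤ.- + 1)) ℤ.+ + 2 ℤ.* (+ 1 ℤ.* n)) ℤ.+ + 4 ℤ.* ((+ 1 ℤ.+ + 0) ℤ.* (n ℤ.* (n ℤ.- + 1)) ℤ.+ + 2 ℤ.* (+ 1 ℤ.* n)))
      lem = ℤ-solve
      ex : E 1 1 (ℤ.suc (n ℤ.+ n)) ≡ 1 + (c + c)
      ex = eq-2 (E 1 1 (ℤ.suc (n ℤ.+ n))) (1 + (c + c)) (E-2 1 1 (ℤ.suc (n ℤ.+ n))) (add-2 1 (c + c) refl (add-2 c c (trans c-2 (lem₀ p)) (trans c-2 (lem₀ p)))) (lem n)

  opaque
    unfolding V _⊞_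
    V-gain : f ≈[ suc N ] 𝟘 → V f ≈[ suc (suc N) ] 𝟘
    V-gain {f} {N} p = mk[] go
      where
      go : ∀ k → k < suc (suc N) → coef (V f) k ≡ coef 𝟘 k
      go zero          _ = below p 0 (s≤s z≤n)
      go (suc zero)    _ = refl
      go (suc (suc k)) (s≤s (s≤s l)) = trans (Vc-cong< N {g = const 0ℚ} (λ i i<N → trans (below p (suc i) (s≤s i<N)) (sym (const-0 i))) k l)
        (trans (at (V-K 0ℚ) k) (const-0 k))

    neg-fixed : ∀ x → x ≡ ℚ.- x → x ≡ 0ℚ
    neg-fixed x p = trans (sym (ℚP.*-identityˡ x)) (trans (cong (ℚ._* x) {1ℚ} {½ ℚ.* (1ℚ ℚ.+ 1ℚ)} refl) (trans (ℚP.*-assoc ½ (1ℚ ℚ.+ 1ℚ) x)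
      (trans (cong (½ ℚ.*_) (trans (ℚP.*-distribʳ-+ x 1ℚ 1ℚ) (trans (cong₂ ℚ._+_ (ℚP.*-identityˡ x) (trans (ℚP.*-identityˡ x) p)) (ℚP.+-inverseʳ x)))) (ℚP.*-zeroʳ ½))))

    -- The constant term equals its negative, hence is 0; after that each use of f(q) = -f(q²)
    -- raises the order of vanishing.
    V-antifixed : f ≈ ⊝ V f → f ≈ 𝟘
    V-antifixed {f} p = []⇒≈ λ N → []-mono (ℕP.n≤1+n N) (go N)
      where
      go : ∀ N → f ≈[ suc N ] 𝟘
      go zero    = mk[] λ { zero _ → neg-fixed (coef f 0) (at p 0) ; (suc k) (s≤s ()) }
      go (suc N) = []-trans (≈⇒[] p) ([]-trans (⊝-cong[] (V-gain (go N))) (≈⇒[] (solve 0 (:- :0 := :0) ≈-refl)))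

  private
    4+ = 2+ ⊠ 2+

  -- The defect of this identity is anti-invariant under q ↦ q², by the dissection of φ.
  φ²-dissect : φ ⊠ φ ≈ V φ ⊠ V φ ⊞ 4+ ⊠ (q^ 1 ⊠ (V (V ψ) ⊠ V (V ψ)))
  φ²-dissect = linear 𝟙 Δ≈0 (solve 2 (λ x y → x :+ :1 :* :0 := y :+ :1 :* (x :- y)) ≈-refl _ _)
    where
    open ≈-Reasoning
    a = V φ
    b = V (V ψ)
    Δ = φ ⊠ φ ⊟ (a ⊠ a ⊞ 4+ ⊠ (q^ 1 ⊠ (b ⊠ b)))
    -- The classical φ(q) ψ(q²) = ψ(q)² at q⁴, which rewrites the middle term of the square of the
    -- dissection of φ.
    ab : V a ⊠ V b ≈ b ⊠ b
    ab = begin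
      V (V φ) ⊠ V (V (V ψ)) ≈⟨ ⊠-cong (≈-trans (V-cong (V-mon _ _ _ _)) (V-mon _ _ _ _)) (≈-trans (V-cong (≈-trans (V-cong (V-mon _ _ _ _)) (V-mon _ _ _ _))) (V-mon _ _ _ _)) ⟩
      mon (+ 0 , + 0 , m 2 , + 5 , m 2) ⊠ mon (+ 0 , + 0 , + 0 , m 1 , + 2) ≈⟨ ≈-trans (mon-⊠ _ _) (≈-sym (mon-⊠ _ _)) ⟩
      mon (+ 0 , + 0 , m 1 , + 2 , + 0) ⊠ mon (+ 0 , + 0 , m 1 , + 2 , + 0) ≈⟨ ⊠-cong bb bb ⟨
      b ⊠ b ∎
      where
      bb : b ≈ mon (+ 0 , + 0 , m 1 , + 2 , + 0)
      bb = ≈-trans (V-cong (V-mon _ _ _ _)) (V-mon _ _ _ _)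
    V4 : V 4+ ≈ 4+
    V4 = ≈-trans (V-⊠ _ _) (⊠-cong V2 V2)
      where
      V2 : V 2+ ≈ 2+
      V2 = ≈-trans (V-⊞ _ _) (⊞-cong (V-K _) (V-K _))
    VΔ : V Δ ≈ V φ ⊠ V φ ⊟ (V a ⊠ V a ⊞ 4+ ⊠ (q^ 1 ⊠ q^ 1 ⊠ (V b ⊠ V b)))
    VΔ = ≈-trans (V-⊞ _ _) (⊞-cong (V-⊠ _ _) (≈-trans (V-⊝ _) (⊝-cong (≈-trans (V-⊞ _ _) (⊞-cong (V-⊠ _ _)
      (≈-trans (V-⊠ _ _) (⊠-cong V4 (≈-trans (V-⊠ _ _) (⊠-cong (≈-trans (V-q^ 1) (q^-+ 1 1)) (V-⊠ _ _))))))))))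
    Δ≈0 : Δ ≈ 𝟘
    Δ≈0 = V-antifixed (begin
      Δ ≈⟨ ⊞-cong (⊠-cong φ-dissect φ-dissect) (⊝-cong ≈-refl) ⟩
      (V a ⊞ q^ 1 ⊠ (2+ ⊠ V b)) ⊠ (V a ⊞ q^ 1 ⊠ (2+ ⊠ V b)) ⊟ (a ⊠ a ⊞ 4+ ⊠ (q^ 1 ⊠ (b ⊠ b)))
        ≈⟨ linear (4+ ⊠ q^ 1) ab (solve 5 (λ A B q a b → let t = :1 :+ :1 in
             (A :+ q :* (t :* B)) :* (A :+ q :* (t :* B)) :- (a :* a :+ t :* t :* (q :* (b :* b))) :+ t :* t :* q :* (b :* b)
             := :- (a :* a :- (A :* A :+ t :* t :* (q :* q :* (B :* B)))) :+ t :* t :* q :* (A :* B)) ≈-refl (V a) (V b) (q^ 1) a b) ⟩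
      ⊝ (V φ ⊠ V φ ⊟ (V a ⊠ V a ⊞ 4+ ⊠ (q^ 1 ⊠ q^ 1 ⊠ (V b ⊠ V b)))) ≈⟨ ⊝-cong VΔ ⟨
      ⊝ V Δ ∎)

  -- From φ = J₂⁵/(J₁² J₄²), the reciprocal 1/J₁² is φ times a series in q²; in the same way 1/J₁⁴
  -- is φ² times such a series.
  dissect₂ : mon (e₁ (m 2)) ≈ mon (+ 0 , m 5 , + 0 , + 5 , m 2) ⊞ q^ 1 ⊠ (2+ ⊠ mon (+ 0 , m 5 , + 2 , m 1 , + 2))
  dissect₂ = begin
    mon (e₁ (m 2)) ≈⟨ mon-⊠ _ _ ⟨
    φ ⊠ mon c ≈⟨ ⊠-congˡ φ-dissect ⟩
    (V (V φ) ⊞ q^ 1 ⊠ (2+ ⊠ V (V (V ψ)))) ⊠ mon c ≈⟨ solve 5 (λ a q t b c → (a :+ q :* (t :* b)) :* c := a :* c :+ q :* (t :* (b :* c))) ≈-refl _ _ _ _ _ ⟩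
    V (V φ) ⊠ mon c ⊞ q^ 1 ⊠ (2+ ⊠ (V (V (V ψ)) ⊠ mon c))
      ≈⟨ ⊞-cong (≈-trans (⊠-congˡ (≈-trans (V-cong (V-mon _ _ _ _)) (V-mon _ _ _ _))) (mon-⊠ _ _))
           (⊠-congʳ (⊠-congʳ (≈-trans (⊠-congˡ (≈-trans (V-cong (≈-trans (V-cong (V-mon _ _ _ _)) (V-mon _ _ _ _))) (V-mon _ _ _ _))) (mon-⊠ _ _)))) ⟩
    mon (+ 0 , m 5 , + 0 , + 5 , m 2) ⊞ q^ 1 ⊠ (2+ ⊠ mon (+ 0 , m 5 , + 2 , m 1 , + 2)) ∎
    where
    open ≈-Reasoning
    c : Ex
    c = + 0 , m 5 , + 2 , + 0 , + 0

  dissect₄ : mon (e₁ (m 4)) ≈ mon (+ 0 , m 14 , + 14 , m 4 , + 0) ⊞ q^ 1 ⊠ (4+ ⊠ mon (+ 0 , m 10 , + 2 , + 4 , + 0))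
  dissect₄ = begin
    mon (e₁ (m 4)) ≈⟨ ≈-trans (⊠-congˡ (mon-⊠ _ _)) (mon-⊠ _ _) ⟨
    φ ⊠ φ ⊠ mon c ≈⟨ ⊠-congˡ φ²-dissect ⟩
    (V φ ⊠ V φ ⊞ 4+ ⊠ (q^ 1 ⊠ (V (V ψ) ⊠ V (V ψ)))) ⊠ mon c ≈⟨ solve 5 (λ a q t b c → (a :+ t :* (q :* b)) :* c := a :* c :+ q :* (t :* (b :* c))) ≈-refl _ _ _ _ _ ⟩
    V φ ⊠ V φ ⊠ mon c ⊞ q^ 1 ⊠ (4+ ⊠ (V (V ψ) ⊠ V (V ψ) ⊠ mon c))
      ≈⟨ ⊞-cong (≈-trans (⊠-congˡ (≈-trans (⊠-cong (V-mon _ _ _ _) (V-mon _ _ _ _)) (mon-⊠ _ _))) (mon-⊠ _ _))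
           (⊠-congʳ (⊠-congʳ (≈-trans (⊠-congˡ (≈-trans (⊠-cong bb bb) (mon-⊠ _ _))) (mon-⊠ _ _)))) ⟩
    mon (+ 0 , m 14 , + 14 , m 4 , + 0) ⊞ q^ 1 ⊠ (4+ ⊠ mon (+ 0 , m 10 , + 2 , + 4 , + 0)) ∎
    where
    open ≈-Reasoning
    c : Ex
    c = + 0 , m 10 , + 4 , + 0 , + 0
    bb : V (V ψ) ≈ mon (+ 0 , + 0 , m 1 , + 2 , + 0)
    bb = ≈-trans (V-cong (V-mon _ _ _ _)) (V-mon _ _ _ _)

open ThetaFunctions

-- Generating function of odd Durfee symbols

module Symbols where

  private variable
    f u : S
    N : ℕ
    A B : Set

  -- For given D the two rows are independent partitions into odd parts at most 2D + 1. The sum over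
  -- D is q ω(q), where ω is Ramanujan's third order mock theta function.
  durfee : ℕ → S
  durfee D = q^ (2 * D * D + 2 * D + 1) ⊠ invS (pp (⊝ 𝟙) 1 2 (suc D) ⊠ pp (⊝ 𝟙) 1 2 (suc D))

  durfeeSeries : S
  durfeeSeries = lim (λ N → sumS N durfee)

  durfee-Cauchy : Cauchy (λ N → sumS N durfee)
  durfee-Cauchy N = []-sym ([]-trans (⊞-cong[] []-refl (q^-vanish _ _ (ℕP.≤-trans (n≤b*n {2} N 1≤1+) (ℕP.≤-trans (ℕP.m≤n+m (2 * N) (2 * N * N)) (ℕP.m≤m+n _ 1))))) (≈⇒[] (⊞-identityʳ _)))

  U-pp₁ : ∀ n → U (pp (⊝ 𝟙) 1 2 n)
  U-pp₁ zero    = U-𝟙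
  U-pp₁ (suc n) = U-⊠ (U-pp₁ n) (U-1+cq^ _ 1≤1+)

  -- Telescoping with t_n = q^(2n²)/(q ; q²)_n². With z = q^(2n+1) and t_n divided out, the step is
  -- 1/(1 - z) + z²/(1 - z)² = 1 + z/(1 - z)², and t_0 = 1 supplies the constant.
  durfeeSeries-gS : 𝟙 ⊞ durfeeSeries ≈ gS (⊝ 𝟙) 1 1 2
  durfeeSeries-gS = []⇒≈ λ N → begin
    𝟙 ⊞ durfeeSeries ≈⟨ ⊞-cong[] []-refl (lim-approx durfee-Cauchy N) ⟨
    𝟙 ⊞ sumS N durfee ≈⟨ ≈⇒[] (telescope N) ⟨
    sumS N a ⊞ t N ≈⟨ ⊞-cong[] (lim-approx a-Cauchy N) (q^-vanish _ _ (n≤b*n*n {2} N 1≤1+)) ⟩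
    gS (⊝ 𝟙) 1 1 2 ⊞ 𝟘 ≈⟨ ≈⇒[] (⊞-identityʳ _) ⟩
    gS (⊝ 𝟙) 1 1 2 ∎
    where
    open module R {N} = []-Reasoning N
    p : ℕ → S
    p = pp (⊝ 𝟙) 1 2
    a t : ℕ → S
    a n = q^ (2 * n * n) ⊠ invS (p (suc n) ⊠ p n)
    t n = q^ (2 * n * n) ⊠ invS (p n ⊠ p n)
    a-Cauchy : Cauchy (λ N → sumS N a)
    a-Cauchy N = []-sym ([]-trans (⊞-cong[] []-refl (q^-vanish _ _ (n≤b*n*n {2} N 1≤1+))) (≈⇒[] (⊞-identityʳ _)))
    step : ∀ n → a n ⊞ t (suc n) ≈ t n ⊞ durfee n
    step n = linear (Q ⊠ v ⊠ v ⊠ (𝟙 ⊟ z ⊠ w)) (⊠-invS uf) (≈-trans (⊞-cong (⊞-cong aE tE′) ≈-refl) (≈-trans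
      (solve 4 (λ Q v w z → Q :* (v :* w :* v) :+ Q :* (z :* z) :* (v :* w :* (v :* w)) :+ Q :* v :* v :* (:1 :- z :* w) :* :1
        := Q :* (v :* v) :+ Q :* z :* (v :* w :* (v :* w)) :+ Q :* v :* v :* (:1 :- z :* w) :* ((:1 :+ :- :1 :* z) :* w)) ≈-refl Q v w z)
      (≈-sym (⊞-cong (⊞-cong tE dE) ≈-refl))))
      where
      Q = q^ (2 * n * n)
      z = q^ (1 + 2 * n)
      fz = 𝟙 ⊞ ⊝ 𝟙 ⊠ z
      uf : U fz
      uf = U-1+cq^ (⊝ 𝟙) 1≤1+
      v = invS (p n)
      w = invS fz
      vw : invS (p (suc n)) ≈ v ⊠ w
      vw = invS-⊠ (U-pp₁ n) uf
      aE : a n ≈ Q ⊠ (v ⊠ w ⊠ v)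
      aE = ⊠-congʳ (≈-trans (invS-⊠ (U-pp₁ (suc n)) (U-pp₁ n)) (⊠-congˡ vw))
      tE : t n ≈ Q ⊠ (v ⊠ v)
      tE = ⊠-congʳ (invS-⊠ (U-pp₁ n) (U-pp₁ n))
      pp2 : invS (p (suc n) ⊠ p (suc n)) ≈ v ⊠ w ⊠ (v ⊠ w)
      pp2 = ≈-trans (invS-⊠ (U-pp₁ (suc n)) (U-pp₁ (suc n))) (⊠-cong vw vw)
      tE′ : t (suc n) ≈ Q ⊠ (z ⊠ z) ⊠ (v ⊠ w ⊠ (v ⊠ w))
      tE′ = ⊠-cong (≈-trans (q^-≡ (lem n)) (≈-trans (q^-+ _ _) (⊠-congʳ (q^-+ _ _)))) pp2
        where
        lem : ∀ n → 2 * suc n * suc n ≡ 2 * n * n + ((1 + 2 * n) + (1 + 2 * n))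
        lem = ℕ-solve
      dE : durfee n ≈ Q ⊠ z ⊠ (v ⊠ w ⊠ (v ⊠ w))
      dE = ⊠-cong (≈-trans (q^-≡ (lem n)) (q^-+ _ _)) pp2
        where
        lem : ∀ n → 2 * n * n + 2 * n + 1 ≡ 2 * n * n + (1 + 2 * n)
        lem = ℕ-solve
    telescope : ∀ N → sumS N a ⊞ t N ≈ 𝟙 ⊞ sumS N durfee
    telescope zero    = ≈-trans (⊞-identityˡ _) (≈-trans (⊠-cong q^-0 (≈-trans (invS-cong (U-⊠ U-𝟙 U-𝟙) 𝟙²≈𝟙) invS-𝟙)) (≈-trans 𝟙²≈𝟙 (≈-sym (⊞-identityʳ _))))
    telescope (suc N) = linear 𝟙 (telescope N) (linear 𝟙 (step N) (solve 6 (λ A a t t′ D d → A :+ a :+ t′ :+ :1 :* (:1 :+ D) :+ :1 :* (t :+ d)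
      := :1 :+ (D :+ d) :+ :1 :* (A :+ t) :+ :1 :* (a :+ t′)) ≈-refl (sumS N a) (a N) (t N) (t (suc N)) (sumS N durfee) (durfee N)))

  ind : Bool → S → S
  ind b s = if b then s else 𝟘

  ind-cong : ∀ b → f ≈ u → ind b f ≈ ind b u
  ind-cong true  p = p
  ind-cong false p = ≈-refl

  ind-∧ : ∀ a b s → ind (a ∧ b) s ≈ ind a (ind b s)
  ind-∧ true  b s = ≈-refl
  ind-∧ false b s = ≈-refl

  ind-⊠ : ∀ a f s → ind a (f ⊠ s) ≈ f ⊠ ind a s
  ind-⊠ true  f s = ≈-refl
  ind-⊠ false f s = ≈-sym (⊠-zeroʳ f)

  sumL : (A → S) → List A → S
  sumL f []       = 𝟘
  sumL f (x ∷ xs) = f x ⊞ sumL f xs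

  sumL-cong : ∀ {f g : A → S} → (∀ x → f x ≈ g x) → ∀ xs → sumL f xs ≈ sumL g xs
  sumL-cong p []       = ≈-refl
  sumL-cong p (x ∷ xs) = ⊞-cong (p x) (sumL-cong p xs)

  sumL-⊠ : ∀ c (f : A → S) xs → sumL (λ x → c ⊠ f x) xs ≈ c ⊠ sumL f xs
  sumL-⊠ c f []       = ≈-sym (⊠-zeroʳ c)
  sumL-⊠ c f (x ∷ xs) = ≈-trans (⊞-congʳ (sumL-⊠ c f xs)) (≈-sym (⊠-distribˡ c _ _))

  sumL-ind : ∀ b (f : A → S) xs → sumL (λ x → ind b (f x)) xs ≈ ind b (sumL f xs)
  sumL-ind true  f xs       = ≈-refl
  sumL-ind false f []       = ≈-refl
  sumL-ind false f (x ∷ xs) = ≈-trans (⊞-identityˡ _) (sumL-ind false f xs)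

  sumL-++ : ∀ (f : A → S) xs ys → sumL f (xs ++ ys) ≈ sumL f xs ⊞ sumL f ys
  sumL-++ f []       ys = ≈-sym (⊞-identityˡ _)
  sumL-++ f (x ∷ xs) ys = ≈-trans (⊞-congʳ (sumL-++ f xs ys)) (≈-sym (⊞-assoc _ _ _))

  sumL-map : ∀ (f : B → S) (g : A → B) xs → sumL f (List.map g xs) ≈ sumL (λ x → f (g x)) xs
  sumL-map f g []       = ≈-refl
  sumL-map f g (x ∷ xs) = ⊞-congʳ (sumL-map f g xs)

  sumL-concatMap : ∀ (f : B → S) (g : A → List B) xs → sumL f (concatMap g xs) ≈ sumL (λ x → sumL f (g x)) xs
  sumL-concatMap f g []       = ≈-refl
  sumL-concatMap f g (x ∷ xs) = ≈-trans (sumL-++ f (g x) (concatMap g xs)) (⊞-congʳ (sumL-concatMap f g xs))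

  sumL-applyUpTo : ∀ (f : A → S) (φ : ℕ → A) n → sumL f (applyUpTo φ n) ≈ sumS n (λ i → f (φ i))
  sumL-applyUpTo f φ zero    = ≈-refl
  sumL-applyUpTo f φ (suc n) = ≈-trans (⊞-congʳ (sumL-applyUpTo f (λ i → φ (suc i)) n)) (≈-sym (sumS-head n _))

  -- Merges monotonicity and bound into one condition that the tail inherits with a new bound, so
  -- that generating functions follow by removing the first entry.
  row : ℕ → List ℕ → Bool
  row B []       = true
  row B (x ∷ xs) = (isOdd x ∧ (x ≤ᵇ B)) ∧ row x xs

  bounded : ℕ → List ℕ → Bool
  bounded B = List.foldr (λ x r → isOdd x ∧ (x ≤ᵇ B) ∧ r) true

  ≤ᵇ-trans : ∀ x y z → (x ≤ᵇ y) ≡ true → (y ≤ᵇ z) ≡ true → (x ≤ᵇ z) ≡ true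
  ≤ᵇ-trans x y z p r = to (ℕP.≤⇒≤ᵇ (ℕP.≤-trans (ℕP.≤ᵇ⇒≤ x y (from p)) (ℕP.≤ᵇ⇒≤ y z (from r))))
    where
    to : ∀ {b} → Data.Bool.T b → b ≡ true
    to {true} _ = refl
    from : ∀ {b} → b ≡ true → Data.Bool.T b
    from refl = _

  row-valid : ∀ B xs → (nonIncreasing xs ∧ bounded B xs) ≡ row B xs
  row-valid B []       = refl
  row-valid B (x ∷ []) with isOdd x | x ≤ᵇ B
  ... | true  | true  = refl
  ... | true  | false = refl
  ... | false | _     = refl
  row-valid B (x ∷ y ∷ ys) with row-valid B (y ∷ ys)
  ... | ih with isOdd x | x ≤ᵇ B in x≤B
  ...   | false | _     = BoolP.∧-zeroʳ _
  ...   | true  | false = BoolP.∧-zeroʳ _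
  ...   | true  | true with y ≤ᵇ x in y≤x
  ...     | false = sym (trans (BoolP.∧-assoc (isOdd y) false (row y ys)) (BoolP.∧-zeroʳ (isOdd y)))
  ...     | true  = trans ih (cong (λ b → (isOdd y ∧ b) ∧ row y ys) (≤ᵇ-trans y x B y≤x x≤B))

  module RowSeries (n : ℕ) where
    rowSum : ℕ → ℕ → S
    rowSum l B = sumL (λ xs → ind (row B xs) (q^ (sum xs))) (allLists l n)

    rowSum-suc : ∀ l B → rowSum (suc l) B ≈ sumS (suc n) (λ x → ind (isOdd x ∧ (x ≤ᵇ B)) (q^ x ⊠ rowSum l x))
    rowSum-suc l B = ≈-trans (sumL-concatMap _ (λ x → List.map (x ∷_) (allLists l n)) (upTo (suc n))) (≈-trans (sumL-applyUpTo _ (λ x → x) (suc n))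
      (sumS-cong (suc n) λ x _ → begin
        sumL (λ xs → ind (row B xs) (q^ (sum xs))) (List.map (x ∷_) (allLists l n)) ≈⟨ sumL-map _ (x ∷_) (allLists l n) ⟩
        sumL (λ xs → ind ((isOdd x ∧ (x ≤ᵇ B)) ∧ row x xs) (q^ (x + sum xs))) (allLists l n)
          ≈⟨ sumL-cong (λ xs → ≈-trans (ind-∧ (isOdd x ∧ (x ≤ᵇ B)) (row x xs) _) (ind-cong (isOdd x ∧ (x ≤ᵇ B)) (≈-trans (ind-cong (row x xs) (q^-+ x (sum xs))) (ind-⊠ (row x xs) _ _)))) (allLists l n) ⟩
        sumL (λ xs → ind (isOdd x ∧ (x ≤ᵇ B)) (q^ x ⊠ ind (row x xs) (q^ (sum xs)))) (allLists l n)
          ≈⟨ ≈-trans (sumL-ind (isOdd x ∧ (x ≤ᵇ B)) _ (allLists l n)) (ind-cong (isOdd x ∧ (x ≤ᵇ B)) (sumL-⊠ (q^ x) _ (allLists l n))) ⟩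
        ind (isOdd x ∧ (x ≤ᵇ B)) (q^ x ⊠ rowSum l x) ∎))
      where open ≈-Reasoning

    -- Odd entries are at least 1, so the weight of a row is at least its length.
    rowSum-small : ∀ l B → rowSum l B ≈[ l ] 𝟘
    rowSum-small zero    B = mk[] λ _ ()
    rowSum-small (suc l) B = []-trans (≈⇒[] (rowSum-suc l B)) ([]-trans (sumS-cong[] {suc l} (suc n) {G = λ _ → 𝟘} (λ x _ → term x)) (≈⇒[] (sumS-zero (suc n) λ _ _ → ≈-refl)))
      where
      term : ∀ x → ind (isOdd x ∧ (x ≤ᵇ B)) (q^ x ⊠ rowSum l x) ≈[ suc l ] 𝟘
      term zero = []-refl
      term (suc x) with isOdd (suc x) ∧ (suc x ≤ᵇ B)
      ... | false = []-refl
      ... | true  = []-trans ([]-mono (s≤s (ℕP.m≤n+m l x)) (q^-mod (suc x) (rowSum-small l (suc x)))) (≈⇒[] (⊠-zeroʳ _))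

    -- 2D + 1 in steps of two, in which parities and bounds can be compared by recursion.
    c : ℕ → ℕ
    c zero    = 1
    c (suc D) = suc (suc (c D))

    c-eq : ∀ D → c D ≡ 1 + 2 * D
    c-eq zero    = refl
    c-eq (suc D) = trans (cong (λ k → suc (suc k)) (c-eq D)) (lem D)
      where
      lem : ∀ D → suc (suc (1 + 2 * D)) ≡ 1 + 2 * suc D
      lem = ℕ-solve

    -- No odd number lies strictly between 2D + 1 and 2D + 3.
    split : ∀ D x s → ind (isOdd x ∧ (x ≤ᵇ c (suc D))) s ≈ ind (isOdd x ∧ (x ≤ᵇ c D)) s ⊞ ind (x ≡ᵇ c (suc D)) s
    split D zero s = ≈-sym (⊞-identityˡ _)
    split D (suc zero) s = ≈-trans (≈-sym (⊞-identityʳ s)) (⊞-cong (≡⇒≈ (lem D)) ≈-refl)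
      where
      lem : ∀ D → s ≡ ind (isOdd 1 ∧ (1 ≤ᵇ c D)) s
      lem zero = refl
      lem (suc D) = refl
    split zero (suc (suc zero)) s = ≈-sym (⊞-identityˡ _)
    split zero (suc (suc (suc zero))) s = ≈-sym (⊞-identityˡ _)
    split zero (suc (suc (suc (suc x)))) s = ≈-trans (lem₁ (isOdd (suc (suc (suc (suc x))))) s) (≈-trans (≈-sym (⊞-identityˡ _)) (⊞-cong (≈-sym (lem₁ (isOdd (suc (suc (suc (suc x))))) s)) ≈-refl))
      where
      lem₁ : ∀ b s → ind (b ∧ false) s ≈ 𝟘
      lem₁ true s = ≈-refl
      lem₁ false s = ≈-refl
    split (suc D) (suc (suc x)) s = ≈-trans (≡⇒≈ (cong (λ b → ind (isOdd x ∧ b) s) (ss x (c (suc D))))) (≈-trans (split D x s) (⊞-cong (≡⇒≈ (cong (λ b → ind (isOdd x ∧ b) s) (sym (ss x (c D))))) ≈-refl))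
      where
      ss : ∀ x y → (suc (suc x) ≤ᵇ suc (suc y)) ≡ (x ≤ᵇ y)
      ss zero    y = refl
      ss (suc x) y = refl

    base : ∀ x s → ind (isOdd x ∧ (x ≤ᵇ 1)) s ≈ ind (x ≡ᵇ 1) s
    base zero s = ≈-refl
    base (suc zero) s = ≈-refl
    base (suc (suc x)) s with isOdd (suc (suc x))
    ... | true = ≈-refl
    ... | false = ≈-refl

    -- A value k > n is missing from the range, but then q^k vanishes modulo q^(n+1).
    pick : ∀ k (F : ℕ → S) → sumS (suc n) (λ x → ind (x ≡ᵇ k) (q^ x ⊠ F x)) ≈[ suc n ] q^ k ⊠ F k
    pick k F = go (suc n) k (λ x → q^ x ⊠ F x) λ l → q^-vanish k (F k) l
      where
      go : ∀ j k (G : ℕ → S) → (j ≤ k → G k ≈[ N ] 𝟘) → sumS j (λ x → ind (x ≡ᵇ k) (G x)) ≈[ N ] G k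
      go zero    k       G v = []-sym (v z≤n)
      go (suc j) zero    G v = []-trans (≈⇒[] (sumS-head j _)) ([]-trans (⊞-cong[] []-refl (≈⇒[] (sumS-zero j λ _ _ → ≈-refl))) (≈⇒[] (⊞-identityʳ _)))
      go (suc j) (suc k) G v = []-trans (≈⇒[] (sumS-head j _)) ([]-trans (≈⇒[] (⊞-identityˡ _)) (go j k (λ x → G (suc x)) λ l → v (s≤s l)))

    -- Either the first entry, which is the largest, equals 2D + 3, or the whole row is bounded by
    -- 2D + 1.
    rowSum-rec : ∀ l D → rowSum (suc l) (c (suc D)) ≈[ suc n ] rowSum (suc l) (c D) ⊞ q^ (c (suc D)) ⊠ rowSum l (c (suc D))
    rowSum-rec l D = []-trans (≈⇒[] (≈-trans (rowSum-suc l (c (suc D))) (≈-trans (sumS-cong (suc n) λ x _ → split D x _) (≈-trans (sumS-⊞ (suc n) _ _) (⊞-cong (≈-sym (rowSum-suc l (c D))) ≈-refl)))))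
      (⊞-cong[] []-refl (pick (c (suc D)) (rowSum l)))

    rowSum-base : ∀ l → rowSum (suc l) 1 ≈[ suc n ] q^ 1 ⊠ rowSum l 1
    rowSum-base l = []-trans (≈⇒[] (≈-trans (rowSum-suc l 1) (sumS-cong (suc n) λ x _ → base x _))) (pick 1 (rowSum l))

    rowSum-0 : ∀ B → rowSum 0 B ≈ 𝟙
    rowSum-0 B = ≈-trans (⊞-identityʳ _) q^-0

    Row : ℕ → S
    Row B = sumS (suc n) (λ l → rowSum l B)

    private
      -- The cutoff at length n is harmless: a row of length n together with one more positive entry
      -- weighs more than n.
      last : ∀ k B → 1 ≤ k → q^ k ⊠ rowSum n B ≈[ suc n ] 𝟘
      last k B l = []-trans ([]-mono (ℕP.+-monoˡ-≤ n l) (q^-mod k (rowSum-small n B))) (≈⇒[] (⊠-zeroʳ _))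

    Row-base : (𝟙 ⊞ ⊝ 𝟙 ⊠ q^ 1) ⊠ Row 1 ≈[ suc n ] 𝟙
    Row-base = begin
      (𝟙 ⊞ ⊝ 𝟙 ⊠ q^ 1) ⊠ Row 1 ≈⟨ ≈⇒[] (solve 2 (λ q r → (:1 :+ :- :1 :* q) :* r := r :- q :* r) ≈-refl _ _) ⟩
      Row 1 ⊟ q^ 1 ⊠ (sumS n (λ l → rowSum l 1) ⊞ rowSum n 1)
        ≈⟨ ⊞-cong[] (≈⇒[] (sumS-head n _)) (⊝-cong[] (≈⇒[] (⊠-distribˡ _ _ _))) ⟩
      rowSum 0 1 ⊞ sumS n (λ l → rowSum (suc l) 1) ⊟ (q^ 1 ⊠ sumS n (λ l → rowSum l 1) ⊞ q^ 1 ⊠ rowSum n 1)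
        ≈⟨ ⊞-cong[] (⊞-cong[] (≈⇒[] (rowSum-0 1)) ([]-trans (sumS-cong[] n λ l _ → rowSum-base l) (≈⇒[] (sumS-⊠ˡ n _ _)))) (⊝-cong[] (⊞-cong[] []-refl (last 1 1 1≤1+))) ⟩
      𝟙 ⊞ q^ 1 ⊠ sumS n (λ l → rowSum l 1) ⊟ (q^ 1 ⊠ sumS n (λ l → rowSum l 1) ⊞ 𝟘)
        ≈⟨ ≈⇒[] (solve 1 (λ x → :1 :+ x :- (x :+ :0) := :1) ≈-refl _) ⟩
      𝟙 ∎
      where open []-Reasoning (suc n)

    Row-step : ∀ D → (𝟙 ⊞ ⊝ 𝟙 ⊠ q^ (c (suc D))) ⊠ Row (c (suc D)) ≈[ suc n ] Row (c D)
    Row-step D = begin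
      (𝟙 ⊞ ⊝ 𝟙 ⊠ q^ k) ⊠ Row k ≈⟨ ≈⇒[] (solve 2 (λ q r → (:1 :+ :- :1 :* q) :* r := r :- q :* r) ≈-refl _ _) ⟩
      Row k ⊟ q^ k ⊠ (sumS n (λ l → rowSum l k) ⊞ rowSum n k)
        ≈⟨ ⊞-cong[] (≈⇒[] (sumS-head n _)) (⊝-cong[] (≈⇒[] (⊠-distribˡ _ _ _))) ⟩
      rowSum 0 k ⊞ sumS n (λ l → rowSum (suc l) k) ⊟ (q^ k ⊠ sumS n (λ l → rowSum l k) ⊞ q^ k ⊠ rowSum n k)
        ≈⟨ ⊞-cong[] (⊞-cong[] (≈⇒[] (rowSum-0 k)) ([]-trans (sumS-cong[] n λ l _ → rowSum-rec l D) (≈⇒[] (≈-trans (sumS-⊞ n _ _) (⊞-congʳ (sumS-⊠ˡ n _ _)))))) (⊝-cong[] (⊞-cong[] []-refl (last k k 1≤1+))) ⟩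
      𝟙 ⊞ (sumS n (λ l → rowSum (suc l) (c D)) ⊞ q^ k ⊠ sumS n (λ l → rowSum l k)) ⊟ (q^ k ⊠ sumS n (λ l → rowSum l k) ⊞ 𝟘)
        ≈⟨ ≈⇒[] (solve 2 (λ y x → :1 :+ (y :+ x) :- (x :+ :0) := :1 :+ y) ≈-refl _ _) ⟩
      𝟙 ⊞ sumS n (λ l → rowSum (suc l) (c D)) ≈⟨ ≈⇒[] (≈-trans (⊞-cong (≈-sym (rowSum-0 (c D))) ≈-refl) (≈-sym (sumS-head n _))) ⟩
      Row (c D) ∎
      where
      open []-Reasoning (suc n)
      k = c (suc D)

    Row-product : ∀ D → pp (⊝ 𝟙) 1 2 (suc D) ⊠ Row (c D) ≈[ suc n ] 𝟙
    Row-product zero    = []-trans (⊠-cong[] (≈⇒[] (⊠-identityˡ _)) []-refl) Row-base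
    Row-product (suc D) = []-trans (≈⇒[] (≈-trans (⊠-assoc _ _ _) (⊠-congʳ (⊠-congˡ (⊞-congʳ (⊠-congʳ (q^-≡ (sym (c-eq (suc D))))))))))
      ([]-trans (⊠-cong[] []-refl (Row-step D)) (Row-product D))

    Row-inverse : ∀ D → Row (1 + 2 * D) ≈[ suc n ] invS (pp (⊝ 𝟙) 1 2 (suc D))
    Row-inverse D = begin
      Row (1 + 2 * D) ≈⟨ ≈⇒[] (≡⇒≈ (cong Row (sym (c-eq D)))) ⟩
      Row (c D) ≈⟨ ≈⇒[] (≈-trans (≈-sym (⊠-identityˡ _)) (⊠-congˡ (≈-sym (≈-trans (⊠-comm _ _) (⊠-invS (U-pp₁ (suc D))))))) ⟩
      invS P ⊠ P ⊠ Row (c D) ≈⟨ ≈⇒[] (⊠-assoc _ _ _) ⟩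
      invS P ⊠ (P ⊠ Row (c D)) ≈⟨ ⊠-cong[] []-refl (Row-product D) ⟩
      invS P ⊠ 𝟙 ≈⟨ ≈⇒[] (⊠-identityʳ _) ⟩
      invS P ∎
      where
      open []-Reasoning (suc n)
      P = pp (⊝ 𝟙) 1 2 (suc D)

  opaque
    unfolding _⊞_
    -- Passage from counting to series: the part of the test that fixes the weight is read as
    -- extraction of a coefficient.
    count-coef : ∀ (n : ℕ) (p r : A → Bool) (wt : A → ℕ) → (∀ x → p x ≡ (r x ∧ (wt x ≡ᵇ n))) → ∀ xs →
      ℕ→ℚ (length (filter (λ x → p x Data.Bool.≟ true) xs)) ≡ coef (sumL (λ x → ind (r x) (q^ (wt x))) xs) n
    count-coef n p r wt e []       = sym (const-0 n)
    count-coef n p r wt e (x ∷ xs) with p x | e x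
    ... | b | eb with r x | wt x ≡ᵇ n in w
    ...   | false | _     rewrite eb = trans (count-coef n p r wt e xs) (sym (trans (cong (ℚ._+ coef (sumL (λ x → ind (r x) (q^ (wt x))) xs) n) (const-0 n)) (ℚP.+-identityˡ _)))
    ...   | true  | false rewrite eb | w = trans (count-coef n p r wt e xs) (sym (ℚP.+-identityˡ _))
    ...   | true  | true  rewrite eb | w = trans (/1-+ (+ 1) (+ length (filter (λ x → p x Data.Bool.≟ true) xs))) (cong (1ℚ ℚ.+_) (count-coef n p r wt e xs))

  weight : OddDurfeeData → ℕ
  weight (D , as , bs) = sum as + sum bs + (2 * D * D + 2 * D + 1)

  rows : OddDurfeeData → Bool
  rows (D , as , bs) = row (1 + 2 * D) as ∧ row (1 + 2 * D) bs

  validRow≡row : ∀ D xs → validRow D xs ≡ row (1 + 2 * D) xs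
  validRow≡row D xs = trans (row-valid (2 * D + 1) xs) (cong (λ B → row B xs) (ℕP.+-comm (2 * D) 1))

  isOddDurfee-split : ∀ n σ → isOddDurfeeOf n σ ≡ (rows σ ∧ (weight σ ≡ᵇ n))
  isOddDurfee-split n (D , as , bs) = trans (cong₂ (λ x y → x ∧ y ∧ (weight (D , as , bs) ≡ᵇ n)) (validRow≡row D as) (validRow≡row D bs))
    (sym (BoolP.∧-assoc (row (1 + 2 * D) as) (row (1 + 2 * D) bs) _))

  candidates-sum : ∀ n → sumL (λ σ → ind (rows σ) (q^ (weight σ))) (candidates n) ≈[ suc n ] sumS (suc n) durfee
  candidates-sum n = []-trans (≈⇒[] (≈-trans (sumL-concatMap W (λ D → symbols D) (upTo (suc n))) (sumL-applyUpTo (λ D → sumL W (symbols D)) (λ x → x) (suc n)))) (sumS-cong[] (suc n) λ D _ → inner D)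
    where
    open RowSeries n
    W : OddDurfeeData → S
    W σ = ind (rows σ) (q^ (weight σ))
    symbols₂ : ℕ → List ℕ → List OddDurfeeData
    symbols₂ D as = List.map (λ bs → (D , as , bs)) (rowsUpTo n)
    symbols : ℕ → List OddDurfeeData
    symbols D = concatMap (symbols₂ D) (rowsUpTo n)
    R : ℕ → List ℕ → S
    R D as = ind (row (1 + 2 * D) as) (q^ (sum as))
    Row≈ : ∀ D → sumL (R D) (rowsUpTo n) ≈ Row (1 + 2 * D)
    Row≈ D = ≈-trans (sumL-concatMap (R D) (λ l → allLists l n) (upTo (suc n))) (sumL-applyUpTo (λ l → sumL (R D) (allLists l n)) (λ x → x) (suc n))
    term : ∀ D as bs → ind (rows (D , as , bs)) (q^ (weight (D , as , bs))) ≈ q^ (2 * D * D + 2 * D + 1) ⊠ R D as ⊠ R D bs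
    term D as bs with row (1 + 2 * D) as | row (1 + 2 * D) bs
    ... | true  | true  = ≈-trans (q^-+ _ _) (≈-trans (⊠-congˡ (q^-+ (sum as) (sum bs))) (solve 3 (λ a b c → a :* b :* c := c :* a :* b) ≈-refl _ _ _))
    ... | true  | false = ≈-sym (⊠-zeroʳ _)
    ... | false | true  = solve 2 (λ c b → :0 := c :* :0 :* b) ≈-refl _ _
    ... | false | false = ≈-sym (⊠-zeroʳ _)
    inner : ∀ D → sumL W (symbols D) ≈[ suc n ] durfee D
    inner D = begin
      sumL W (symbols D)
        ≈⟨ ≈⇒[] (≈-trans (sumL-concatMap W (symbols₂ D) (rowsUpTo n)) (sumL-cong (λ as → ≈-trans (sumL-map W (λ bs → (D , as , bs)) (rowsUpTo n))
             (≈-trans (sumL-cong (term D as) (rowsUpTo n)) (≈-trans (sumL-⊠ (C ⊠ R D as) (R D) (rowsUpTo n)) (⊠-congʳ (Row≈ D))))) (rowsUpTo n))) ⟩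
      sumL (λ as → C ⊠ R D as ⊠ Row (1 + 2 * D)) (rowsUpTo n)
        ≈⟨ ≈⇒[] (≈-trans (sumL-cong (λ as → solve 3 (λ c a r → c :* a :* r := c :* r :* a) ≈-refl C (R D as) (Row (1 + 2 * D))) (rowsUpTo n)) (≈-trans (sumL-⊠ (C ⊠ Row (1 + 2 * D)) (R D) (rowsUpTo n)) (⊠-congʳ (Row≈ D)))) ⟩
      C ⊠ Row (1 + 2 * D) ⊠ Row (1 + 2 * D) ≈⟨ ⊠-cong[] (⊠-cong[] []-refl (Row-inverse D)) (Row-inverse D) ⟩
      C ⊠ invS P ⊠ invS P ≈⟨ ≈⇒[] (≈-trans (⊠-assoc _ _ _) (⊠-congʳ (≈-sym (invS-⊠ (U-pp₁ (suc D)) (U-pp₁ (suc D)))))) ⟩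
      durfee D ∎
      where
      open []-Reasoning (suc n)
      C = q^ (2 * D * D + 2 * D + 1)
      P = pp (⊝ 𝟙) 1 2 (suc D)

  isOdd-spec : ∀ x → isOdd x ≡ true → ∃ λ j → x ≡ 1 + (j + j)
  isOdd-spec (suc zero)    p = 0 , refl
  isOdd-spec (suc (suc x)) p with isOdd-spec x p
  ... | j , refl = suc j , cong (λ k → suc (suc k)) (sym (ℕP.+-suc j j))

  row-parity : ∀ B xs → row B xs ≡ true → ∃ λ j → sum xs ≡ length xs + (j + j)
  row-parity B []       p = 0 , refl
  row-parity B (x ∷ xs) p with isOdd x in ox | x ≤ᵇ B | row x xs in rx
  ... | true | true | true with isOdd-spec x ox | row-parity x xs rx
  ...   | i , refl | j , eq = i + j , trans (cong (λ k → 1 + (i + i) + k) eq) (lem i j (length xs))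
    where
    lem : ∀ i j l → 1 + (i + i) + (l + (j + j)) ≡ suc l + ((i + j) + (i + j))
    lem = ℕ-solve

  even-%ℕ : ∀ z → (z ℤ.+ z) %ℕ 2 ≡ 0
  even-%ℕ (+ n) = go n
    where
    go : ∀ n → (+ (n + n)) %ℕ 2 ≡ 0
    go zero    = refl
    go (suc n) rewrite ℕP.+-suc n n = go n
  even-%ℕ -[1+ n ] = go n
    where
    go : ∀ n → -[1+ suc (n + n) ] %ℕ 2 ≡ 0
    go zero    = refl
    go (suc n) rewrite ℕP.+-suc n n = go n

  -- a symbol of n has odd rank of the parity of n + 1, so N⁰ counts all symbols
  rank-parity : ∀ a n k → + n ≡ a ℤ.+ + 1 ℤ.+ (k ℤ.+ k) → ∀ σ → isOddDurfeeOf n σ ≡ true → (((oddRank σ ℤ.- a) %ℕ 2) ≡ᵇ 0) ≡ true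
  rank-parity a n k e σ@(D , as , bs) p with rows σ in rσ | weight σ ≡ᵇ n in wσ | trans (sym (isOddDurfee-split n σ)) p
  ... | true | true | _ with row (1 + 2 * D) as in ra | row (1 + 2 * D) bs in rb
  ...   | true | true with row-parity (1 + 2 * D) as ra | row-parity (1 + 2 * D) bs rb
  ...     | i , ei | j , ej = cong (_≡ᵇ 0) (trans (cong (_%ℕ 2) eq) (even-%ℕ z))
    where
    s t : ℤ
    s = + length as
    t = + length bs
    -- From n = s + t + 2(i + j + D² + D) + 1 and n = a + 1 + 2k follows s - t - a = 2(k - t - i - j
    -- - D² - D); `z` is half of it.
    z : ℤ
    z = k ℤ.- t ℤ.- + i ℤ.- + j ℤ.- + (D * D + D)
    w : weight σ ≡ n
    w = ℕP.≡ᵇ⇒≡ (weight σ) n (subst Data.Bool.T (sym wσ) _)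
    lem₁ : ∀ l i r j D → l + (i + i) + (r + (j + j)) + (2 * D * D + 2 * D + 1) ≡ l + r + ((i + i) + (j + j) + ((D * D + D) + (D * D + D)) + 1)
    lem₁ = ℕ-solve
    n≡ : + n ≡ s ℤ.+ t ℤ.+ ((+ i ℤ.+ + i) ℤ.+ (+ j ℤ.+ + j) ℤ.+ (+ (D * D + D) ℤ.+ + (D * D + D)) ℤ.+ + 1)
    n≡ = cong +_ (trans (sym w) (trans (cong₂ (λ x y → x + y + (2 * D * D + 2 * D + 1)) ei ej) (lem₁ (length as) i (length bs) j D)))
    lem₂ : ∀ a s t i j d k n → n ≡ s ℤ.+ t ℤ.+ ((i ℤ.+ i) ℤ.+ (j ℤ.+ j) ℤ.+ (d ℤ.+ d) ℤ.+ + 1) → n ≡ a ℤ.+ + 1 ℤ.+ (k ℤ.+ k) →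
      s ℤ.- t ℤ.- a ≡ (k ℤ.- t ℤ.- i ℤ.- j ℤ.- d) ℤ.+ (k ℤ.- t ℤ.- i ℤ.- j ℤ.- d)
    lem₂ a s t i j d k n p r = trans (lem₃ a s t i j d) (trans (cong (λ x → x ℤ.- a ℤ.- + 1 ℤ.- (t ℤ.+ t ℤ.+ (i ℤ.+ i) ℤ.+ (j ℤ.+ j) ℤ.+ (d ℤ.+ d))) (trans (sym p) r)) (lem₄ a t i j d k))
      where
      lem₃ : ∀ a s t i j d → s ℤ.- t ℤ.- a ≡ s ℤ.+ t ℤ.+ ((i ℤ.+ i) ℤ.+ (j ℤ.+ j) ℤ.+ (d ℤ.+ d) ℤ.+ + 1) ℤ.- a ℤ.- + 1 ℤ.- (t ℤ.+ t ℤ.+ (i ℤ.+ i) ℤ.+ (j ℤ.+ j) ℤ.+ (d ℤ.+ d))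
      lem₃ = ℤ-solve
      lem₄ : ∀ a t i j d k → a ℤ.+ + 1 ℤ.+ (k ℤ.+ k) ℤ.- a ℤ.- + 1 ℤ.- (t ℤ.+ t ℤ.+ (i ℤ.+ i) ℤ.+ (j ℤ.+ j) ℤ.+ (d ℤ.+ d)) ≡ (k ℤ.- t ℤ.- i ℤ.- j ℤ.- d) ℤ.+ (k ℤ.- t ℤ.- i ℤ.- j ℤ.- d)
      lem₄ = ℤ-solve
    eq : oddRank σ ℤ.- a ≡ z ℤ.+ z
    eq = lem₂ a s t (+ i) (+ j) (+ (D * D + D)) k (+ n) n≡ e

  -- The parity hypothesis on `n` makes the rank condition automatic, so the count is that of all
  -- symbols.
  N0-coef : ∀ a n k → + n ≡ a ℤ.+ + 1 ℤ.+ (k ℤ.+ k) → ℕ→ℚ (N0 a 2 n) ≡ coef durfeeSeries n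
  N0-coef a n k e = trans (count-coef n _ rows weight pred (candidates n)) (below (candidates-sum n) n ℕP.≤-refl)
    where
    pred : ∀ σ → (isOddDurfeeOf n σ ∧ (((oddRank σ ℤ.- a) %ℕ 2) ≡ᵇ 0)) ≡ (rows σ ∧ (weight σ ≡ᵇ n))
    pred σ with isOddDurfeeOf n σ in eq
    ... | false = trans (sym eq) (isOddDurfee-split n σ)
    ... | true  = trans (rank-parity a n k e σ eq) (trans (sym eq) (isOddDurfee-split n σ))

open Symbols

-- Iterated 2-dissections of P

module Dissections where

  private variable
    f u : S

  module _ where
    open ≈-Reasoning

    -- P(q) = Pe(q²) + q Po(q²). `L` is g(-q ; q²), an honest power series because its series part
    -- has constant term 1, and `Pe′` is Pe/q.
    Pe Po L Pe′ : S
    Pe = I∞ 1 ⊠ X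
    Po = I∞ 1 ⊠ Xo
    L   = tl (𝟙 ⊟ gS 𝟙 1 1 2)
    Pe′ = tl Pe

    durfeeSeries-dissect : durfeeSeries ≈ V Pe ⊞ q^ 1 ⊠ V Po
    durfeeSeries-dissect = begin
      durfeeSeries ≈⟨ solve 1 (λ d → d := :- :1 :+ (:1 :+ d)) ≈-refl _ ⟩
      ⊝ 𝟙 ⊞ (𝟙 ⊞ durfeeSeries) ≈⟨ ⊞-congʳ (≈-trans durfeeSeries-gS gS-dissect⁺) ⟩
      ⊝ 𝟙 ⊞ (V (I∞ 1 ⊠ Xe) ⊞ 𝟙 ⊠ q^ 1 ⊠ V Po) ≈⟨ ⊞-congʳ (⊞-cong (≈-trans (V-cong even-part) (≈-trans (V-⊞ _ _) (⊞-cong (V-K _) ≈-refl))) ≈-refl) ⟩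
      ⊝ 𝟙 ⊞ (𝟙 ⊞ V Pe ⊞ 𝟙 ⊠ q^ 1 ⊠ V Po) ≈⟨ solve 3 (λ a q b → :- :1 :+ (:1 :+ a :+ :1 :* q :* b) := a :+ q :* b) ≈-refl _ _ _ ⟩
      V Pe ⊞ q^ 1 ⊠ V Po ∎

    1-gS : 𝟙 ⊟ gS 𝟙 1 1 2 ≈ ⊝ V Pe ⊞ q^ 1 ⊠ V Po
    1-gS = begin
      𝟙 ⊟ gS 𝟙 1 1 2 ≈⟨ ⊞-congʳ (⊝-cong (≈-trans gS-dissect⁻ (⊞-cong (≈-trans (V-cong even-part) (≈-trans (V-⊞ _ _) (⊞-cong (V-K _) ≈-refl))) ≈-refl))) ⟩
      𝟙 ⊟ (𝟙 ⊞ V Pe ⊞ ⊝ 𝟙 ⊠ q^ 1 ⊠ V Po) ≈⟨ solve 3 (λ a q b → :1 :- (:1 :+ a :+ :- :1 :* q :* b) := :- a :+ q :* b) ≈-refl _ _ _ ⟩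
      ⊝ V Pe ⊞ q^ 1 ⊠ V Po ∎

    -- No symbol has weight 0, since 2D² + 2D + 1 ≥ 1.
    coef₀-Pe : coef Pe 0 ≡ 0ℚ
    coef₀-Pe = trans (sym (dissect-even durfeeSeries-dissect 0)) (trans (sym (below (lim-approx durfee-Cauchy 1) 0 (s≤s z≤n)))
      (trans (below ([]-trans (≈⇒[] (⊞-identityˡ _)) (q^-vanish {1} 1 _ ℕP.≤-refl)) 0 (s≤s z≤n)) (coef-𝟘 0)))

    Pe≈ : Pe ≈ q^ 1 ⊠ Pe′
    Pe≈ = ≈-trans (hd-tl Pe) (≈-trans (⊞-cong (≡⇒≈ (cong K coef₀-Pe)) ≈-refl) (⊞-identityˡ _))

    V-Pe : V Pe ≈ q^ 1 ⊠ (q^ 1 ⊠ V Pe′)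
    V-Pe = ≈-trans (V-cong Pe≈) (≈-trans (V-q⊠ _) (≈-trans (⊠-congˡ (q^-+ 1 1)) (⊠-assoc _ _ _)))

    1-gS-q : 𝟙 ⊟ gS 𝟙 1 1 2 ≈ q^ 1 ⊠ (V Po ⊟ q^ 1 ⊠ V Pe′)
    1-gS-q = ≈-trans 1-gS (≈-trans (⊞-cong (⊝-cong V-Pe) ≈-refl) (solve 3 (λ q a b → :- (q :* (q :* a)) :+ q :* b := q :* (b :- q :* a)) ≈-refl _ _ _))

    L-q : q^ 1 ⊠ L ≈ 𝟙 ⊟ gS 𝟙 1 1 2
    L-q = ≈-sym (≈-trans (hd-tl _) (≈-trans (⊞-cong (≡⇒≈ (cong K z)) ≈-refl) (⊞-identityˡ _)))
      where
      z : coef (𝟙 ⊟ gS 𝟙 1 1 2) 0 ≡ 0ℚ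
      z = trans (at 1-gS-q 0) (q^-low 1 _ 0 (s≤s z≤n))

    -- The division by q in g(-q ; q²) exchanges the halves: Po becomes the even one and -Pe/q the
    -- odd one.
    L-dissect : L ≈ V Po ⊞ q^ 1 ⊠ V (⊝ Pe′)
    L-dissect = q^-cancel 1 (≈-trans L-q (≈-trans 1-gS-q (⊠-congʳ (⊞-congʳ (≈-trans (solve 2 (λ q a → :- (q :* a) := q :* :- a) ≈-refl _ _) (⊠-congʳ (≈-sym (V-⊝ _))))))))

    V-gS : ∀ α α′ β β′ b b′ → α + α ≡ α′ → β + β ≡ β′ → b + b ≡ b′ → 1 ≤ b → V (gS 𝟙 α β b) ≈ gS 𝟙 α′ β′ b′
    V-gS α _ β _ b _ refl refl refl l = V-lim (cauchy α β l) (cauchy (α + α) (β + β) (ℕP.≤-trans l (ℕP.m≤m+n b b))) λ N →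
      ≈-trans (V-sumS N _) (sumS-cong N λ n _ → ≈-trans (V-⊠ _ _) (⊠-cong (≈-trans (V-q^ _) (q^-≡ (lem b n)))
        (≈-trans (V-invS (U-⊠ (U-pp α b (suc n)) (U-pp β b n))) (≈-sym (invS-cong (U-⊠ (U-pp (α + α) (b + b) (suc n)) (U-pp (β + β) (b + b) n))
          (≈-sym (≈-trans (V-⊠ _ _) (⊠-cong (V-pp 𝟙 (V-K _) refl refl (suc n)) (V-pp 𝟙 (V-K _) refl refl n)))))))))
      where
      lem : ∀ b n → b * n * n + b * n * n ≡ (b + b) * n * n
      lem = ℕ-solve
      cauchy : ∀ α β {b} → 1 ≤ b → Cauchy (λ N → sumS N (λ n → q^ (b * n * n) ⊠ invS (pp 𝟙 α b (suc n) ⊠ pp 𝟙 β b n)))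
      cauchy α β {b} l N = []-sym ([]-trans (⊞-cong[] []-refl (q^-vanish _ _ (n≤b*n*n N l))) (≈⇒[] (⊞-identityʳ _)))

    private
      2+ 4+ : S
      2+ = 𝟙 ⊞ 𝟙
      4+ = 2+ ⊠ 2+

    -- Θ₁ is the theta part for odd n and ½ Θ₄ that for even n; the pairs (Θ₂, 4 Θ₃) and (Θ₅, 4 Θ₆)
    -- are the halves of Θ₁ and Θ₄.
    Θ₁ Θ₂ Θ₃ Θ₄ Θ₅ Θ₆ : S
    Θ₁ = mon (m 4 , + 8 , m 5 , + 2 , + 0)
    Θ₂ = mon (m 6 , + 9 , m 2 , + 0 , + 0)
    Θ₃ = mon (m 2 , m 3 , + 6 , + 0 , + 0)
    Θ₄ = mon (m 4 , + 6 , + 1 , m 2 , + 0)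
    Θ₅ = mon (m 8 , + 15 , m 6 , + 0 , + 0)
    Θ₆ = mon (m 4 , + 3 , + 2 , + 0 , + 0)

    Po≈ : q^ 1 ⊠ Po ≈ q^ 1 ⊠ Θ₁ ⊟ (𝟙 ⊟ gS 𝟙 2 2 4)
    Po≈ = ≈-trans (linear (q^ 1) odd-formula (solve 4 (λ q p y t → q :* p :+ q :* t := q :* t :- q :* y :+ q :* (p :+ y)) ≈-refl (q^ 1) Po (I∞ 4 ⊠ Y′) Θ₁))
      (⊞-congʳ (⊝-cong (≈-trans (solve 3 (λ q i y → q :* (i :* y) := i :* (q :* y)) ≈-refl _ _ _) Y′-gS)))

    -- g(-q² ; q⁴) is g(-q ; q²) at q², so the mock part of Po is an odd series. This is why no g
    -- occurs for 4n + 1.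
    Po≈L : Po ≈ Θ₁ ⊟ q^ 1 ⊠ V L
    Po≈L = q^-cancel 1 (≈-trans Po≈ (≈-trans (⊞-congʳ (⊝-cong eq)) (solve 3 (λ q t v → q :* t :- q :* (q :* v) := q :* (t :- q :* v)) ≈-refl _ _ _)))
      where
      eq : 𝟙 ⊟ gS 𝟙 2 2 4 ≈ q^ 1 ⊠ (q^ 1 ⊠ V L)
      eq = begin
        𝟙 ⊟ gS 𝟙 2 2 4 ≈⟨ ⊞-cong (≈-sym (V-K _)) (⊝-cong (≈-sym (V-gS 1 2 1 2 2 4 refl refl refl 1≤1+))) ⟩
        V 𝟙 ⊟ V (gS 𝟙 1 1 2) ≈⟨ ≈-trans (V-⊞ _ _) (⊞-congʳ (V-⊝ _)) ⟨
        V (𝟙 ⊟ gS 𝟙 1 1 2) ≈⟨ V-cong L-q ⟨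
        V (q^ 1 ⊠ L) ≈⟨ ≈-trans (V-q⊠ _) (≈-trans (⊠-congˡ (q^-+ 1 1)) (⊠-assoc _ _ _)) ⟩
        q^ 1 ⊠ (q^ 1 ⊠ V L) ∎

    private
      V-Kmon : ∀ z a b c d → V (K z ⊠ mon (a , b , c , d , + 0)) ≈ K z ⊠ mon (+ 0 , a , b , c , d)
      V-Kmon z a b c d = ≈-trans (V-⊠ _ _) (⊠-cong (V-K _) (V-mon a b c d))

      4+≈ : 4+ ≈ ι (+ 4)
      4+≈ = solve 0 ((:1 :+ :1) :* (:1 :+ :1) := con (+ 4)) ≈-refl

      2+≈ : 2+ ≈ ι (+ 2)
      2+≈ = solve 0 (:1 :+ :1 := con (+ 2)) ≈-refl

      -- J₁ is the only factor that is not a series in q², so the dissection of 1/J₁⁴ is multiplied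
      -- by the remaining factors.
      use₄ : ∀ b c d → mon (m 4 , b , c , d , + 0) ≈
        V (mon ((m 14 ℤ.+ b) , (+ 14 ℤ.+ c) , (m 4 ℤ.+ d) , + 0 , + 0)) ⊞ q^ 1 ⊠ V (ι (+ 4) ⊠ mon ((m 10 ℤ.+ b) , (+ 2 ℤ.+ c) , (+ 4 ℤ.+ d) , + 0 , + 0))
      use₄ b c d = begin
        mon (m 4 , b , c , d , + 0) ≈⟨ ≡⇒≈ (cong₂ (λ x y → mon (m 4 , x , y , d , + 0)) (sym (ℤP.+-identityˡ b)) (sym (ℤP.+-identityˡ c))) ⟩
        mon (m 4 , + 0 ℤ.+ b , + 0 ℤ.+ c , d , + 0) ≈⟨ ≡⇒≈ (cong (λ x → mon (m 4 , + 0 ℤ.+ b , + 0 ℤ.+ c , x , + 0)) (sym (ℤP.+-identityˡ d))) ⟩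
        mon (e₁ (m 4) +ₑ w) ≈⟨ mon-⊠ (e₁ (m 4)) w ⟨
        mon (e₁ (m 4)) ⊠ mon w ≈⟨ ⊠-congˡ dissect₄ ⟩
        (A ⊞ q^ 1 ⊠ (4+ ⊠ B)) ⊠ mon w ≈⟨ solve 5 (λ a q t b c → (a :+ q :* (t :* b)) :* c := a :* c :+ q :* (t :* (b :* c))) ≈-refl _ _ _ _ _ ⟩
        A ⊠ mon w ⊞ q^ 1 ⊠ (4+ ⊠ (B ⊠ mon w)) ≈⟨ ⊞-cong (mon-⊠ _ w) (⊠-congʳ (⊠-cong 4+≈ (mon-⊠ _ w))) ⟩
        mon (+ 0 , (m 14 ℤ.+ b) , (+ 14 ℤ.+ c) , (m 4 ℤ.+ d) , + 0) ⊞ q^ 1 ⊠ (ι (+ 4) ⊠ mon (+ 0 , (m 10 ℤ.+ b) , (+ 2 ℤ.+ c) , (+ 4 ℤ.+ d) , + 0))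
          ≈⟨ ⊞-cong (V-mon _ _ _ _) (⊠-congʳ (V-Kmon _ _ _ _ _)) ⟨
        V (mon ((m 14 ℤ.+ b) , (+ 14 ℤ.+ c) , (m 4 ℤ.+ d) , + 0 , + 0)) ⊞ q^ 1 ⊠ V (ι (+ 4) ⊠ mon ((m 10 ℤ.+ b) , (+ 2 ℤ.+ c) , (+ 4 ℤ.+ d) , + 0 , + 0)) ∎
        where
        w : Ex
        w = + 0 , b , c , d , + 0
        A = mon (+ 0 , m 14 , + 14 , m 4 , + 0)
        B = mon (+ 0 , m 10 , + 2 , + 4 , + 0)

    Θ₁-dissect : Θ₁ ≈ V Θ₂ ⊞ q^ 1 ⊠ V (ι (+ 4) ⊠ Θ₃)
    Θ₁-dissect = use₄ (+ 8) (m 5) (+ 2)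

    Θ₄-dissect : Θ₄ ≈ V Θ₅ ⊞ q^ 1 ⊠ V (ι (+ 4) ⊠ Θ₆)
    Θ₄-dissect = use₄ (+ 6) (+ 1) (m 2)

    Θ₂e Θ₂o Θ₃e Θ₃o Θ₅e Θ₅o Θ₆e Θ₆o : S
    Θ₂e = mon (m 10 , + 12 , + 1 , m 2 , + 0) ⊞ ι (+ 8) ⊠ (q^ 1 ⊠ mon (m 6 , + 2 , + 3 , + 2 , + 0))
    Θ₂o = ι (+ 2) ⊠ (mon (m 10 , + 14 , m 5 , + 2 , + 0) ⊞ ι (+ 2) ⊠ mon (m 6 , + 0 , + 9 , m 2 , + 0))
    Θ₃e = mon (m 8 , + 6 , + 5 , m 2 , + 0)
    Θ₃o = ι (+ 2) ⊠ mon (m 8 , + 8 , m 1 , + 2 , + 0)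
    Θ₅e = mon (m 13 , + 22 , m 8 , + 0 , + 0) ⊞ ι (+ 16) ⊠ (q^ 1 ⊠ mon (m 5 , m 2 , + 8 , + 0 , + 0))
    Θ₅o = ι (+ 8) ⊠ mon (m 9 , + 10 , + 0 , + 0 , + 0)
    Θ₆e = mon (m 11 , + 16 , m 4 , + 0 , + 0)
    Θ₆o = ι (+ 4) ⊠ mon (m 7 , + 4 , + 4 , + 0 , + 0)

    Θ₆-dissect : Θ₆ ≈ V Θ₆e ⊞ q^ 1 ⊠ V Θ₆o
    Θ₆-dissect = use₄ (+ 3) (+ 2) (+ 0)

    private
      A₄ B₄ A₂ B₂ : S
      A₄ = mon (+ 0 , m 14 , + 14 , m 4 , + 0)
      B₄ = mon (+ 0 , m 10 , + 2 , + 4 , + 0)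
      A₂ = mon (+ 0 , m 5 , + 0 , + 5 , m 2)
      B₂ = mon (+ 0 , m 5 , + 2 , m 1 , + 2)
      mmm : ∀ u v w → mon u ⊠ mon v ⊠ mon w ≈ mon (u +ₑ v +ₑ w)
      mmm u v w = ≈-trans (⊠-congˡ (mon-⊠ u v)) (mon-⊠ _ w)
      V-qmon : ∀ z a b c d → V (K z ⊠ (q^ 1 ⊠ mon (a , b , c , d , + 0))) ≈ K z ⊠ (q^ 1 ⊠ q^ 1 ⊠ mon (+ 0 , a , b , c , d))
      V-qmon z a b c d = ≈-trans (V-⊠ _ _) (⊠-cong (V-K _) (≈-trans (V-q⊠ _) (⊠-cong (q^-+ 1 1) (V-mon a b c d))))

    Θ₃-dissect : Θ₃ ≈ V Θ₃e ⊞ q^ 1 ⊠ V Θ₃o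
    Θ₃-dissect = begin
      Θ₃ ≈⟨ mon-⊠ (e₁ (m 2)) w ⟨
      mon (e₁ (m 2)) ⊠ mon w ≈⟨ ⊠-congˡ dissect₂ ⟩
      (A₂ ⊞ q^ 1 ⊠ (2+ ⊠ B₂)) ⊠ mon w ≈⟨ solve 5 (λ a q t b c → (a :+ q :* (t :* b)) :* c := a :* c :+ q :* (t :* (b :* c))) ≈-refl _ _ _ _ _ ⟩
      A₂ ⊠ mon w ⊞ q^ 1 ⊠ (2+ ⊠ (B₂ ⊠ mon w)) ≈⟨ ⊞-cong (mon-⊠ _ w) (⊠-congʳ (⊠-cong 2+≈ (mon-⊠ _ w))) ⟩
      mon (+ 0 , m 8 , + 6 , + 5 , m 2) ⊞ q^ 1 ⊠ (ι (+ 2) ⊠ mon (+ 0 , m 8 , + 8 , m 1 , + 2)) ≈⟨ ⊞-cong (V-mon _ _ _ _) (⊠-congʳ (V-Kmon _ _ _ _ _)) ⟨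
      V Θ₃e ⊞ q^ 1 ⊠ V Θ₃o ∎
      where
      w : Ex
      w = + 0 , m 3 , + 6 , + 0 , + 0

    -- 1/J₁⁶ is taken as 1/J₁⁴ times 1/J₁². Their odd parts have the constants 4 and 2: the product
    -- gives 8 q², and the cross terms give 2 and 4.
    Θ₂-dissect : Θ₂ ≈ V Θ₂e ⊞ q^ 1 ⊠ V Θ₂o
    Θ₂-dissect = begin
      Θ₂ ≈⟨ mmm (e₁ (m 4)) (e₁ (m 2)) w ⟨
      mon (e₁ (m 4)) ⊠ mon (e₁ (m 2)) ⊠ mon w ≈⟨ ⊠-congˡ (⊠-cong dissect₄ dissect₂) ⟩
      (A₄ ⊞ q^ 1 ⊠ (4+ ⊠ B₄)) ⊠ (A₂ ⊞ q^ 1 ⊠ (2+ ⊠ B₂)) ⊠ mon w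
        ≈⟨ solve 6 (λ q a b c d w → let t = :1 :+ :1 in (a :+ q :* (t :* t :* b)) :* (c :+ q :* (t :* d)) :* w
             := a :* c :* w :+ con (+ 8) :* (q :* q :* (b :* d :* w)) :+ q :* (con (+ 2) :* (a :* d :* w :+ con (+ 2) :* (b :* c :* w)))) ≈-refl (q^ 1) A₄ B₄ A₂ B₂ (mon w) ⟩
      A₄ ⊠ A₂ ⊠ mon w ⊞ ι (+ 8) ⊠ (q^ 1 ⊠ q^ 1 ⊠ (B₄ ⊠ B₂ ⊠ mon w)) ⊞ q^ 1 ⊠ (ι (+ 2) ⊠ (A₄ ⊠ B₂ ⊠ mon w ⊞ ι (+ 2) ⊠ (B₄ ⊠ A₂ ⊠ mon w)))
        ≈⟨ ⊞-cong (⊞-cong (mmm _ _ w) (⊠-congʳ (⊠-congʳ (mmm _ _ w)))) (⊠-congʳ (⊠-congʳ (⊞-cong (mmm _ _ w) (⊠-congʳ (mmm _ _ w))))) ⟩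
      mon (+ 0 , m 10 , + 12 , + 1 , m 2) ⊞ ι (+ 8) ⊠ (q^ 1 ⊠ q^ 1 ⊠ mon (+ 0 , m 6 , + 2 , + 3 , + 2)) ⊞ q^ 1 ⊠ (ι (+ 2) ⊠ (mon (+ 0 , m 10 , + 14 , m 5 , + 2) ⊞ ι (+ 2) ⊠ mon (+ 0 , m 6 , + 0 , + 9 , m 2)))
        ≈⟨ ⊞-cong (≈-trans (V-⊞ _ _) (⊞-cong (V-mon _ _ _ _) (V-qmon _ _ _ _ _)))
             (⊠-congʳ (≈-trans (V-⊠ _ _) (⊠-cong (V-K _) (≈-trans (V-⊞ _ _) (⊞-cong (V-mon _ _ _ _) (V-Kmon _ _ _ _ _)))))) ⟨
      V Θ₂e ⊞ q^ 1 ⊠ V Θ₂o ∎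
      where
      w : Ex
      w = + 0 , + 9 , m 2 , + 0 , + 0

    -- 1/J₁⁸ is the square of 1/J₁⁴: 4² = 16 and 2 · 4 = 8.
    Θ₅-dissect : Θ₅ ≈ V Θ₅e ⊞ q^ 1 ⊠ V Θ₅o
    Θ₅-dissect = begin
      Θ₅ ≈⟨ mmm (e₁ (m 4)) (e₁ (m 4)) w ⟨
      mon (e₁ (m 4)) ⊠ mon (e₁ (m 4)) ⊠ mon w ≈⟨ ⊠-congˡ (⊠-cong dissect₄ dissect₄) ⟩
      (A₄ ⊞ q^ 1 ⊠ (4+ ⊠ B₄)) ⊠ (A₄ ⊞ q^ 1 ⊠ (4+ ⊠ B₄)) ⊠ mon w
        ≈⟨ solve 4 (λ q a b w → let t = :1 :+ :1 in (a :+ q :* (t :* t :* b)) :* (a :+ q :* (t :* t :* b)) :* w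
             := a :* a :* w :+ con (+ 16) :* (q :* q :* (b :* b :* w)) :+ q :* (con (+ 8) :* (a :* b :* w))) ≈-refl (q^ 1) A₄ B₄ (mon w) ⟩
      A₄ ⊠ A₄ ⊠ mon w ⊞ ι (+ 16) ⊠ (q^ 1 ⊠ q^ 1 ⊠ (B₄ ⊠ B₄ ⊠ mon w)) ⊞ q^ 1 ⊠ (ι (+ 8) ⊠ (A₄ ⊠ B₄ ⊠ mon w))
        ≈⟨ ⊞-cong (⊞-cong (mmm _ _ w) (⊠-congʳ (⊠-congʳ (mmm _ _ w)))) (⊠-congʳ (⊠-congʳ (mmm _ _ w))) ⟩
      mon (+ 0 , m 13 , + 22 , m 8 , + 0) ⊞ ι (+ 16) ⊠ (q^ 1 ⊠ q^ 1 ⊠ mon (+ 0 , m 5 , m 2 , + 8 , + 0)) ⊞ q^ 1 ⊠ (ι (+ 8) ⊠ mon (+ 0 , m 9 , + 10 , + 0 , + 0))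
        ≈⟨ ⊞-cong (≈-trans (V-⊞ _ _) (⊞-cong (V-mon _ _ _ _) (V-qmon _ _ _ _ _))) (⊠-congʳ (V-Kmon _ _ _ _ _)) ⟨
      V Θ₅e ⊞ q^ 1 ⊠ V Θ₅o ∎
      where
      w : Ex
      w = + 0 , + 15 , m 6 , + 0 , + 0

    dissect-⊞ : ∀ {a b a′ b′} → f ≈ V a ⊞ q^ 1 ⊠ V b → u ≈ V a′ ⊞ q^ 1 ⊠ V b′ → f ⊞ u ≈ V (a ⊞ a′) ⊞ q^ 1 ⊠ V (b ⊞ b′)
    dissect-⊞ p r = ≈-trans (⊞-cong p r) (≈-trans (solve 5 (λ q a b c d → a :+ q :* b :+ (c :+ q :* d) := a :+ c :+ q :* (b :+ d)) ≈-refl _ _ _ _ _)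
      (⊞-cong (≈-sym (V-⊞ _ _)) (⊠-congʳ (≈-sym (V-⊞ _ _)))))

    dissect-⊝ : ∀ {a b} → f ≈ V a ⊞ q^ 1 ⊠ V b → ⊝ f ≈ V (⊝ a) ⊞ q^ 1 ⊠ V (⊝ b)
    dissect-⊝ p = ≈-trans (⊝-cong p) (≈-trans (solve 3 (λ q a b → :- (a :+ q :* b) := :- a :+ q :* :- b) ≈-refl _ _ _)
      (⊞-cong (≈-sym (V-⊝ _)) (⊠-congʳ (≈-sym (V-⊝ _)))))

    dissect-K : ∀ {a b} c → f ≈ V a ⊞ q^ 1 ⊠ V b → K c ⊠ f ≈ V (K c ⊠ a) ⊞ q^ 1 ⊠ V (K c ⊠ b)
    dissect-K c p = ≈-trans (⊠-congʳ p) (≈-trans (solve 4 (λ k q a b → k :* (a :+ q :* b) := k :* a :+ q :* (k :* b)) ≈-refl _ _ _ _)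
      (⊞-cong (≈-sym (V-K⊠ c _)) (⊠-congʳ (≈-sym (V-K⊠ c _)))))

    dissect-V : ∀ a → V a ≈ V a ⊞ q^ 1 ⊠ V 𝟘
    dissect-V a = ≈-sym (≈-trans (⊞-congʳ (≈-trans (⊠-congʳ (V-K _)) (⊠-zeroʳ _))) (⊞-identityʳ _))

    dissect-qV : ∀ b → q^ 1 ⊠ V b ≈ V 𝟘 ⊞ q^ 1 ⊠ V b
    dissect-qV b = ≈-sym (≈-trans (⊞-cong (V-K _) ≈-refl) (⊞-identityˡ _))

    Pe≈gS : Pe ≈ K ½ ⊠ Θ₄ ⊟ gS 𝟙 0 4 4
    Pe≈gS = linear 𝟙 even-formula (solve 3 (λ p s t → p :+ :1 :* t := t :- s :+ :1 :* (p :+ s)) ≈-refl Pe (gS 𝟙 0 4 4) (K ½ ⊠ Θ₄))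

    -- The zero is the even half of the mock part q L(q²), kept in the shape that `dissect-⊞`
    -- produces.
    Po-dissect : Po ≈ V (Θ₂ ⊟ 𝟘) ⊞ q^ 1 ⊠ V (ι (+ 4) ⊠ Θ₃ ⊟ L)
    Po-dissect = ≈-trans Po≈L (dissect-⊞ Θ₁-dissect (dissect-⊝ (dissect-qV L)))

    -- g(-1 ; q⁴) is g(-1 ; q²) at q², so the mock part is even and 4n + 2 gives a pure eta
    -- quotient.
    Pe-dissect : Pe ≈ V (K ½ ⊠ Θ₅ ⊟ gS 𝟙 0 2 2) ⊞ q^ 1 ⊠ V (K ½ ⊠ (ι (+ 4) ⊠ Θ₆) ⊟ 𝟘)
    Pe-dissect = ≈-trans Pe≈gS (dissect-⊞ (dissect-K ½ Θ₄-dissect) (dissect-⊝ (≈-trans (≈-sym (V-gS 0 0 2 4 2 4 refl refl refl 1≤1+)) (dissect-V _))))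

    -- The halves of `L` are Po and -Pe′. Hence residue 3 modulo 8 meets Po again with opposite
    -- sign, and residue 7 meets Pe divided by q.
    Po₁-dissect : ι (+ 4) ⊠ Θ₃ ⊟ L ≈ V (ι (+ 4) ⊠ Θ₃e ⊟ Po) ⊞ q^ 1 ⊠ V (ι (+ 4) ⊠ Θ₃o ⊞ ⊝ (⊝ Pe′))
    Po₁-dissect = dissect-⊞ (dissect-K _ Θ₃-dissect) (dissect-⊝ L-dissect)

    Pe₀-dissect : K ½ ⊠ Θ₅ ⊟ gS 𝟙 0 2 2 ≈ V (K ½ ⊠ Θ₅e ⊟ gS 𝟙 0 1 1) ⊞ q^ 1 ⊠ V (K ½ ⊠ Θ₅o ⊟ 𝟘)
    Pe₀-dissect = dissect-⊞ (dissect-K ½ Θ₅-dissect) (dissect-⊝ (≈-trans (≈-sym (V-gS 0 0 1 2 1 2 refl refl refl 1≤1+)) (dissect-V _)))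

    Pe₁-dissect : K ½ ⊠ (ι (+ 4) ⊠ Θ₆) ⊟ 𝟘 ≈ V (K ½ ⊠ (ι (+ 4) ⊠ Θ₆e) ⊟ 𝟘) ⊞ q^ 1 ⊠ V (K ½ ⊠ (ι (+ 4) ⊠ Θ₆o) ⊟ 𝟘)
    Pe₁-dissect = dissect-⊞ (dissect-K ½ (dissect-K _ Θ₆-dissect)) (dissect-⊝ (≈-trans (≈-sym (V-K _)) (dissect-V 𝟘)))

open Dissections

-- Translation into the stated identities of Laurent series

module Assembly where

  private variable
    u F G : S

  opaque
    unfolding _⊞_

    s-⊛ : ∀ {x y : PS} {F G} → ser x ≈ F → ser y ≈ G → ser (x ⊛ y) ≈ F ⊠ G
    s-⊛ p r = ⊠-cong p r

    s-⊕ : ∀ {x y : PS} {F G} → ser x ≈ F → ser y ≈ G → ser (x ⊕ y) ≈ F ⊞ G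
    s-⊕ p r = ⊞-cong p r

    s-⊖ : ∀ {x y : PS} {F G} → ser x ≈ F → ser y ≈ G → ser (x ⊖ y) ≈ F ⊟ G
    s-⊖ p r = ⊞-cong p (⊝-cong r)

    s-· : ∀ c {x : PS} {F} → ser x ≈ F → ser (c · x) ≈ K c ⊠ F
    s-· c {x} p = ≈-trans {u = K c ⊠ ser x} (mk≈ λ n → sym (const-⊛ c x n)) (⊠-cong (≈-refl {K c}) p)

    s-X : ∀ k → ser (X^ k) ≈ q^ k
    s-X k = ≈-refl

    s-1 : ser oneS ≈ 𝟙
    s-1 = ≈-refl

    s-inv : ∀ {x : PS} {F} → U F → ser x ≈ F → ser (inv x) ≈ invS F
    s-inv {x} v p = invS-cong (U-cong (≈-sym p) v) p

  s-^ : ∀ {x : PS} n → ser x ≈ F → ser (x ^ₛ n) ≈ pow F n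
  s-^ zero    p = s-1
  s-^ (suc n) p = s-⊛ p (s-^ n p)

  prod-qf : ∀ b n → ser (prodTo n (λ k → oneS ⊖ X^ (b * suc k))) ≈ qf b n
  prod-qf b zero    = s-1
  prod-qf b (suc n) = s-⊛ (prod-qf b n) (s-⊖ s-1 (s-X _))

  -- The coefficient of q^n is defined with n factors while the limit takes n + 1; the extra factor
  -- is 1 modulo q^(n+1).
  s-J : ∀ b → ser (Jm (suc b)) ≈ J (suc b)
  s-J b = mk≈ λ n → trans (at (prod-qf (suc b) n) n) (below ([]-sym step) n ℕP.≤-refl)
    where
    step : ∀ {n} → qf (suc b) (suc n) ≈[ suc n ] qf (suc b) n
    step {n} = []-trans (⊠-cong[] []-refl (⊞-cong[] []-refl (⊝-cong[] ([]-trans (≈⇒[] (≈-sym (⊠-identityʳ _))) (q^-vanish _ 𝟙 (n≤b*n {suc b} (suc n) 1≤1+))))))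
      (≈⇒[] (solve 1 (λ x → x :* (:1 :- :0) := x) ≈-refl _))

  s-poch : ∀ α b n → ser (poch -1ℚ α b n) ≈ pp 𝟙 α b n
  s-poch α b zero    = s-1
  s-poch α b (suc n) = s-⊛ (s-poch α b n) (≈-trans (s-⊖ s-1 (s-· -1ℚ (s-X (α + b * n)))) (⊞-cong ≈-refl
    (solve 1 (λ x → :- (con -[1+ 0 ] :* x) := :1 :* x) ≈-refl _)))

  -- The cutoffs agree exactly: `sumTo k` has k + 1 terms, as many as the limit takes for
  -- coefficient k. As -1 is its own reciprocal, both products have η = 1.
  s-gSum : ∀ α b → ser (gSum -1ℚ α b) ≈ gS 𝟙 α (b ∸ α) b
  s-gSum α b = mk≈ λ k → go k k
    where
    T₁ : ℕ → PS
    T₁ n = X^ (b * n * n) ⊛ inv (poch -1ℚ α b (suc n) ⊛ poch (recip -1ℚ) (b ∸ α) b n)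
    T₂ : ℕ → S
    T₂ n = q^ (b * n * n) ⊠ invS (pp 𝟙 α b (suc n) ⊠ pp 𝟙 (b ∸ α) b n)
    term : ∀ n → ser (T₁ n) ≈ T₂ n
    term n = s-⊛ (s-X (b * n * n)) (s-inv (U-⊠ (U-pp α b (suc n)) (U-pp (b ∸ α) b n)) (s-⊛ (s-poch α b (suc n)) (s-poch (b ∸ α) b n)))
    go : ∀ j k → sumTo j (λ n → T₁ n k) ≡ coef (sumS (suc j) T₂) k
    go zero    k = trans (at (term 0) k) (sym (at (⊞-identityˡ (T₂ 0)) k))
    go (suc j) k = trans (cong₂ ℚ._+_ (go j k) (at (term (suc j)) k)) (sym (coef-⊞ (sumS (suc j) T₂) (T₂ (suc j)) k))

  -- LR ℓ k F : the Laurent series ℓ is q^{-k} F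
  record LR (ℓ : Laurent) (k : ℕ) (F : S) : Set where
    constructor mkLR
    field rep : q^ k ⊠ ser (series ℓ) ≈ q^ (negExp ℓ) ⊠ F
  open LR

  -- Once both sides are referred to the same q^(-k), that power cancels; `LR-raise` provides the
  -- common k.
  LR-≈L : ∀ {ℓ ℓ′ k} → LR ℓ k F → LR ℓ′ k G → F ≈ G → ℓ ≈L ℓ′
  LR-≈L {F} {G} {ℓ} {ℓ′} {k} p r e n = at (≈-trans (s-⊛ (s-X _) ≈-refl) (≈-trans main (≈-sym (s-⊛ (s-X _) ≈-refl)))) n
    where
    open ≈-Reasoning
    a = q^ (negExp ℓ)
    b = q^ (negExp ℓ′)
    main : b ⊠ ser (series ℓ) ≈ a ⊠ ser (series ℓ′)
    main = q^-cancel k (begin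
      q^ k ⊠ (b ⊠ ser (series ℓ)) ≈⟨ solve 3 (λ k b s → k :* (b :* s) := b :* (k :* s)) ≈-refl _ _ _ ⟩
      b ⊠ (q^ k ⊠ ser (series ℓ)) ≈⟨ ⊠-congʳ (≈-trans (rep p) (⊠-congʳ e)) ⟩
      b ⊠ (a ⊠ G) ≈⟨ solve 3 (λ a b s → b :* (a :* s) := a :* (b :* s)) ≈-refl _ _ _ ⟩
      a ⊠ (b ⊠ G) ≈⟨ ⊠-congʳ (rep r) ⟨
      a ⊠ (q^ k ⊠ ser (series ℓ′)) ≈⟨ solve 3 (λ k b s → b :* (k :* s) := k :* (b :* s)) ≈-refl _ _ _ ⟩
      q^ k ⊠ (a ⊠ ser (series ℓ′)) ∎)

  LR-↑ : ∀ {x : PS} → ser x ≈ F → LR (↑ x) 0 F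
  LR-↑ p = mkLR (⊠-congʳ p)

  LR-raise : ∀ {ℓ k} j → LR ℓ k F → LR ℓ (j + k) (q^ j ⊠ F)
  LR-raise {F} {ℓ} {k} j p = mkLR (≈-trans (⊠-congˡ (q^-+ j k)) (≈-trans (⊠-assoc _ _ _) (≈-trans (⊠-congʳ (rep p))
    (solve 3 (λ a b s → a :* (b :* s) := b :* (a :* s)) ≈-refl _ _ _))))

  LR-+ : ∀ {ℓ ℓ′ k} → LR ℓ k F → LR ℓ′ k G → LR (ℓ +L ℓ′) k (F ⊞ G)
  LR-+ {F} {G} {ℓ} {ℓ′} {k} p r = mkLR (begin
    q^ k ⊠ ser (X^ (negExp ℓ′) ⊛ series ℓ ⊕ X^ (negExp ℓ) ⊛ series ℓ′) ≈⟨ ⊠-congʳ (s-⊕ (s-⊛ (s-X _) ≈-refl) (s-⊛ (s-X _) ≈-refl)) ⟩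
    q^ k ⊠ (b ⊠ ser (series ℓ) ⊞ a ⊠ ser (series ℓ′)) ≈⟨ solve 5 (λ k a b s t → k :* (b :* s :+ a :* t) := b :* (k :* s) :+ a :* (k :* t)) ≈-refl _ _ _ _ _ ⟩
    b ⊠ (q^ k ⊠ ser (series ℓ)) ⊞ a ⊠ (q^ k ⊠ ser (series ℓ′)) ≈⟨ ⊞-cong (⊠-congʳ (rep p)) (⊠-congʳ (rep r)) ⟩
    b ⊠ (a ⊠ F) ⊞ a ⊠ (b ⊠ G) ≈⟨ solve 4 (λ a b s t → b :* (a :* s) :+ a :* (b :* t) := a :* b :* (s :+ t)) ≈-refl _ _ _ _ ⟩
    a ⊠ b ⊠ (F ⊞ G) ≈⟨ ⊠-congˡ (q^-+ _ _) ⟨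
    q^ (negExp ℓ + negExp ℓ′) ⊠ (F ⊞ G) ∎)
    where
    open ≈-Reasoning
    a = q^ (negExp ℓ)
    b = q^ (negExp ℓ′)

  LR-neg : ∀ {ℓ k} → LR ℓ k F → LR (negL ℓ) k (⊝ F)
  LR-neg {F} {ℓ} {k} p = mkLR (≈-trans (⊠-congʳ (s-· (ℚ.- 1ℚ) ≈-refl)) (≈-trans
    (solve 2 (λ k s → k :* (con -[1+ 0 ] :* s) := :- (k :* s)) ≈-refl _ _) (≈-trans (⊝-cong (rep p)) (solve 2 (λ a s → :- (a :* s) := a :* :- s) ≈-refl _ _))))

  LR-* : ∀ {ℓ ℓ′ k j} → LR ℓ k F → LR ℓ′ j G → LR (ℓ *L ℓ′) (k + j) (F ⊠ G)
  LR-* {F} {G} {ℓ} {ℓ′} {k} {j} p r = mkLR (≈-trans (⊠-cong (q^-+ k j) (s-⊛ ≈-refl ≈-refl)) (≈-trans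
    (solve 4 (λ a b s t → a :* b :* (s :* t) := a :* s :* (b :* t)) ≈-refl _ _ _ _) (≈-trans (⊠-cong (rep p) (rep r)) (≈-trans
    (solve 4 (λ a b s t → a :* s :* (b :* t) := a :* b :* (s :* t)) ≈-refl _ _ _ _) (⊠-congˡ (≈-sym (q^-+ _ _)))))))

  -- At x = -q^α the prefactor 1/x is -q^(-α), which turns -1 + series into 1 - series.
  LR-g : ∀ α b → LR (g -1ℚ α b) α (𝟙 ⊟ gS 𝟙 α (b ∸ α) b)
  LR-g α b = mkLR (⊠-congʳ (≈-trans (s-· (recip -1ℚ) (s-⊖ (s-gSum α b) s-1)) (solve 1 (λ s → con -[1+ 0 ] :* (s :- :1) := :1 :- s) ≈-refl _)))

  LR-q⁻¹ : LR q⁻¹ 1 𝟙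
  LR-q⁻¹ = mkLR (⊠-congʳ s-1)

  pow₁ : ∀ n → ser (Jm 1 ^ₛ n) ≈ mon (e₁ (+ n))
  pow₁ n = ≈-trans (s-^ n (s-J 0)) (pz₁ (+ n))
  pow₂ : ∀ n → ser (Jm 2 ^ₛ n) ≈ mon (e₂ (+ n))
  pow₂ n = ≈-trans (s-^ n (s-J 1)) (pz₂ (+ n))
  pow₄ : ∀ n → ser (Jm 4 ^ₛ n) ≈ mon (e₄ (+ n))
  pow₄ n = ≈-trans (s-^ n (s-J 3)) (pz₄ (+ n))
  pow₈ : ∀ n → ser (Jm 8 ^ₛ n) ≈ mon (e₈ (+ n))
  pow₈ n = ≈-trans (s-^ n (s-J 7)) (pz₈ (+ n))
  jm₄ : ser (Jm 4) ≈ mon (e₄ (+ 1))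
  jm₄ = ≈-trans (s-J 3) J₄

  infixl 7 _⊛ₘ_
  _⊛ₘ_ : ∀ {x y : PS} {v w} → ser x ≈ mon v → ser y ≈ mon w → ser (x ⊛ y) ≈ mon (v +ₑ w)
  p ⊛ₘ r = ≈-trans (s-⊛ p r) (mon-⊠ _ _)

  invₘ : ∀ {x : PS} {v} → ser x ≈ mon v → ser (inv x) ≈ mon (-ₑ v)
  invₘ {v = v} p = ≈-trans (s-inv (U-mon v) p) (invS-mon v)

  genS : (ℕ → ℕ) → S
  genS f = ser (genFun f)

  N0-odd : ∀ n i → n ≡ suc (i + i) → ℕ→ℚ (N0 (+ 0) 2 n) ≡ coef Po i
  N0-odd n i refl = trans (N0-coef (+ 0) n (+ i) refl) (dissect-odd durfeeSeries-dissect i)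

  N0-even : ∀ n i → n ≡ i + i → ℕ→ℚ (N0 (+ 1) 2 n) ≡ coef Pe i
  -- 2i = 1 + 1 + 2(i - 1); the witness is -1 at i = 0, which is why it ranges over the integers.
  N0-even n i refl = trans (N0-coef (+ 1) n (+ i ℤ.- + 1) (lem (+ i))) (dissect-even durfeeSeries-dissect i)
    where
    lem : ∀ i → i ℤ.+ i ≡ + 1 ℤ.+ + 1 ℤ.+ ((i ℤ.- + 1) ℤ.+ (i ℤ.- + 1))
    lem = ℤ-solve

  gen₂₁ : genS (λ n → N0 (+ 0) 2 (2 * n + 1)) ≈ Po
  gen₂₁ = mk≈ λ n → N0-odd (2 * n + 1) n (lem n)
    where
    lem : ∀ n → 2 * n + 1 ≡ suc (n + n)
    lem = ℕ-solve

  gen₄₁ : genS (λ n → N0 (+ 0) 2 (4 * n + 1)) ≈ Θ₂ ⊟ 𝟘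
  gen₄₁ = mk≈ λ n → trans (N0-odd (4 * n + 1) (n + n) (lem n)) (dissect-even Po-dissect n)
    where
    lem : ∀ n → 4 * n + 1 ≡ suc (n + n + (n + n))
    lem = ℕ-solve

  gen₄₃ : genS (λ n → N0 (+ 0) 2 (4 * n + 3)) ≈ ι (+ 4) ⊠ Θ₃ ⊟ L
  gen₄₃ = mk≈ λ n → trans (N0-odd (4 * n + 3) (suc (n + n)) (lem n)) (dissect-odd Po-dissect n)
    where
    lem : ∀ n → 4 * n + 3 ≡ suc (suc (n + n) + suc (n + n))
    lem = ℕ-solve

  gen₂₀ : genS (λ n → N0 (+ 1) 2 (2 * n)) ≈ Pe
  gen₂₀ = mk≈ λ n → N0-even (2 * n) n (lem n)
    where
    lem : ∀ n → 2 * n ≡ n + n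
    lem = ℕ-solve

  gen₄₀ : genS (λ n → N0 (+ 1) 2 (4 * n)) ≈ K ½ ⊠ Θ₅ ⊟ gS 𝟙 0 2 2
  gen₄₀ = mk≈ λ n → trans (N0-even (4 * n) (n + n) (lem n)) (dissect-even Pe-dissect n)
    where
    lem : ∀ n → 4 * n ≡ n + n + (n + n)
    lem = ℕ-solve

  gen₄₂ : genS (λ n → N0 (+ 1) 2 (4 * n + 2)) ≈ K ½ ⊠ (ι (+ 4) ⊠ Θ₆) ⊟ 𝟘
  gen₄₂ = mk≈ λ n → trans (N0-even (4 * n + 2) (suc (n + n)) (lem n)) (dissect-odd Pe-dissect n)
    where
    lem : ∀ n → 4 * n + 2 ≡ suc (n + n) + suc (n + n)
    lem = ℕ-solve

  Θ₂-dissect′ : Θ₂ ⊟ 𝟘 ≈ V Θ₂e ⊞ q^ 1 ⊠ V Θ₂o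
  Θ₂-dissect′ = ≈-trans (solve 1 (λ x → x :- :0 := x) ≈-refl _) Θ₂-dissect

  gen₈₁ : genS (λ n → N0 (+ 0) 2 (8 * n + 1)) ≈ Θ₂e
  gen₈₁ = mk≈ λ n → trans (N0-odd (8 * n + 1) (n + n + (n + n)) (lem n)) (trans (dissect-even Po-dissect (n + n)) (dissect-even Θ₂-dissect′ n))
    where
    lem : ∀ n → 8 * n + 1 ≡ suc (n + n + (n + n) + (n + n + (n + n)))
    lem = ℕ-solve

  gen₈₅ : genS (λ n → N0 (+ 0) 2 (8 * n + 5)) ≈ Θ₂o
  gen₈₅ = mk≈ λ n → trans (N0-odd (8 * n + 5) (suc (n + n) + suc (n + n)) (lem n)) (trans (dissect-even Po-dissect (suc (n + n))) (dissect-odd Θ₂-dissect′ n))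
    where
    lem : ∀ n → 8 * n + 5 ≡ suc (suc (n + n) + suc (n + n) + (suc (n + n) + suc (n + n)))
    lem = ℕ-solve

  gen₈₃ : genS (λ n → N0 (+ 0) 2 (8 * n + 3)) ≈ ι (+ 4) ⊠ Θ₃e ⊟ Po
  gen₈₃ = mk≈ λ n → trans (N0-odd (8 * n + 3) (suc (n + n + (n + n))) (lem n)) (trans (dissect-odd Po-dissect (n + n)) (dissect-even Po₁-dissect n))
    where
    lem : ∀ n → 8 * n + 3 ≡ suc (suc (n + n + (n + n)) + suc (n + n + (n + n)))
    lem = ℕ-solve

  gen₈₇ : genS (λ n → N0 (+ 0) 2 (8 * n + 7)) ≈ ι (+ 4) ⊠ Θ₃o ⊞ ⊝ (⊝ Pe′)
  gen₈₇ = mk≈ λ n → trans (N0-odd (8 * n + 7) (suc (suc (n + n) + suc (n + n))) (lem n)) (trans (dissect-odd Po-dissect (suc (n + n))) (dissect-odd Po₁-dissect n))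
    where
    lem : ∀ n → 8 * n + 7 ≡ suc (suc (suc (n + n) + suc (n + n)) + suc (suc (n + n) + suc (n + n)))
    lem = ℕ-solve

  gen₈₀ : genS (λ n → N0 (+ 1) 2 (8 * n)) ≈ K ½ ⊠ Θ₅e ⊟ gS 𝟙 0 1 1
  gen₈₀ = mk≈ λ n → trans (N0-even (8 * n) (n + n + (n + n)) (lem n)) (trans (dissect-even Pe-dissect (n + n)) (dissect-even Pe₀-dissect n))
    where
    lem : ∀ n → 8 * n ≡ n + n + (n + n) + (n + n + (n + n))
    lem = ℕ-solve

  gen₈₄ : genS (λ n → N0 (+ 1) 2 (8 * n + 4)) ≈ K ½ ⊠ Θ₅o ⊟ 𝟘
  gen₈₄ = mk≈ λ n → trans (N0-even (8 * n + 4) (suc (n + n) + suc (n + n)) (lem n)) (trans (dissect-even Pe-dissect (suc (n + n))) (dissect-odd Pe₀-dissect n))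
    where
    lem : ∀ n → 8 * n + 4 ≡ suc (n + n) + suc (n + n) + (suc (n + n) + suc (n + n))
    lem = ℕ-solve

  gen₈₂ : genS (λ n → N0 (+ 1) 2 (8 * n + 2)) ≈ K ½ ⊠ (ι (+ 4) ⊠ Θ₆e) ⊟ 𝟘
  gen₈₂ = mk≈ λ n → trans (N0-even (8 * n + 2) (suc (n + n + (n + n))) (lem n)) (trans (dissect-odd Pe-dissect (n + n)) (dissect-even Pe₁-dissect n))
    where
    lem : ∀ n → 8 * n + 2 ≡ suc (n + n + (n + n)) + suc (n + n + (n + n))
    lem = ℕ-solve

  gen₈₆ : genS (λ n → N0 (+ 1) 2 (8 * n + 6)) ≈ K ½ ⊠ (ι (+ 4) ⊠ Θ₆o) ⊟ 𝟘
  gen₈₆ = mk≈ λ n → trans (N0-even (8 * n + 6) (suc (suc (n + n) + suc (n + n))) (lem n)) (trans (dissect-odd Pe-dissect (suc (n + n))) (dissect-odd Pe₁-dissect n))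
    where
    lem : ∀ n → 8 * n + 6 ≡ suc (suc (n + n) + suc (n + n)) + suc (suc (n + n) + suc (n + n))
    lem = ℕ-solve

  half-even : ∀ z f → K ½ ⊠ (ι (z ℤ.+ z) ⊠ f) ⊟ 𝟘 ≈ ι z ⊠ f
  half-even z f = ≈-trans (solve 1 (λ x → x :- :0 := x) ≈-refl _) (half (≈-trans (⊠-congˡ (ι-+ z z)) (solve 2 (λ a f → (a :+ a) :* f := (:1 :+ :1) :* (a :* f)) ≈-refl _ _)))

  part : ∀ {x y : PS} → ser x ≈ F → ser y ≈ G → F ≈ G → ↑ x ≈L ↑ y
  part p r e = LR-≈L (LR-↑ p) (LR-↑ r) e

  theta₁ : ser (Jm 2 ^ₛ 8 ⊛ Jm 8 ^ₛ 2 ⊛ inv (Jm 1 ^ₛ 4 ⊛ Jm 4 ^ₛ 5)) ≈ Θ₁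
  theta₁ = pow₂ 8 ⊛ₘ pow₈ 2 ⊛ₘ invₘ (pow₁ 4 ⊛ₘ pow₄ 5)

  theta₄ : ser (½ · (Jm 2 ^ₛ 6 ⊛ Jm 4 ⊛ inv (Jm 1 ^ₛ 4 ⊛ Jm 8 ^ₛ 2))) ≈ K ½ ⊠ Θ₄
  theta₄ = s-· ½ (pow₂ 6 ⊛ₘ jm₄ ⊛ₘ invₘ (pow₁ 4 ⊛ₘ pow₈ 2))

  -- The comparison is made after multiplication by q², which clears the prefactor 1/x at x = -q².
  part₁ : ↑ (genFun (λ n → N0 (+ 0) 2 (2 * n + 1))) ≈L negL (↑ (X^ 1) *L g -1ℚ 2 4) +L ↑ (Jm 2 ^ₛ 8 ⊛ Jm 8 ^ₛ 2 ⊛ inv (Jm 1 ^ₛ 4 ⊛ Jm 4 ^ₛ 5))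
  part₁ = LR-≈L (LR-raise 2 (LR-↑ gen₂₁)) (LR-+ (LR-neg (LR-* (LR-↑ (s-X 1)) (LR-g 2 4))) (LR-raise 2 (LR-↑ theta₁)))
    (≈-trans (⊠-congˡ (q^-+ 1 1)) (≈-trans (linear (q^ 1) Po≈ (solve 4 (λ q p t s → q :* q :* p :+ q :* (q :* t :- (:1 :- s)) := :- (q :* (:1 :- s)) :+ q :* q :* t :+ q :* (q :* p)) ≈-refl (q^ 1) Po Θ₁ (gS 𝟙 2 2 4)))
      (⊞-congʳ (⊠-congˡ (≈-sym (q^-+ 1 1))))))

  part₃ : ↑ (genFun (λ n → N0 (+ 0) 2 (4 * n + 3))) ≈L negL (g -1ℚ 1 2) +L ↑ (ℕ→ℚ 4 · (Jm 4 ^ₛ 6 ⊛ inv (Jm 1 ^ₛ 2 ⊛ Jm 2 ^ₛ 3)))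
  part₃ = LR-≈L (LR-raise 1 (LR-↑ gen₄₃)) (LR-+ (LR-neg (LR-g 1 2)) (LR-raise 1 (LR-↑ (s-· (ℕ→ℚ 4) (pow₄ 6 ⊛ₘ invₘ (pow₁ 2 ⊛ₘ pow₂ 3))))))
    (linear (⊝ 𝟙) L-q (solve 4 (λ q t l s → q :* (con (+ 4) :* t :- l) :+ :- :1 :* (:1 :- s) := :- (:1 :- s) :+ q :* (con (+ 4) :* t) :+ :- :1 :* (q :* l)) ≈-refl (q^ 1) Θ₃ L (gS 𝟙 1 1 2)))

  part₈ : ↑ (genFun (λ n → N0 (+ 0) 2 (8 * n + 3))) ≈L ↑ (X^ 1) *L g -1ℚ 2 4 -L ↑ (Jm 2 ^ₛ 8 ⊛ Jm 8 ^ₛ 2 ⊛ inv (Jm 1 ^ₛ 4 ⊛ Jm 4 ^ₛ 5))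
    +L ↑ (ℕ→ℚ 4 · (Jm 2 ^ₛ 6 ⊛ Jm 4 ^ₛ 5 ⊛ inv (Jm 1 ^ₛ 8 ⊛ Jm 8 ^ₛ 2)))
  part₈ = LR-≈L (LR-raise 2 (LR-↑ gen₈₃)) (LR-+ (LR-+ (LR-* (LR-↑ (s-X 1)) (LR-g 2 4)) (LR-neg (LR-raise 2 (LR-↑ theta₁)))) (LR-raise 2 (LR-↑ (s-· (ℕ→ℚ 4) (pow₂ 6 ⊛ₘ pow₄ 5 ⊛ₘ invₘ (pow₁ 8 ⊛ₘ pow₈ 2))))))
    (≈-trans (⊠-congˡ (q^-+ 1 1)) (≈-trans (linear (⊝ q^ 1) Po≈ (solve 5 (λ q p t s z → q :* q :* (con (+ 4) :* z :- p) :+ :- q :* (q :* t :- (:1 :- s))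
        := q :* (:1 :- s) :+ :- (q :* q :* t) :+ q :* q :* (con (+ 4) :* z) :+ :- q :* (q :* p)) ≈-refl (q^ 1) Po Θ₁ (gS 𝟙 2 2 4) Θ₃e))
      (⊞-cong (⊞-congʳ (⊝-cong (⊠-congˡ (≈-sym (q^-+ 1 1))))) (⊠-congˡ (≈-sym (q^-+ 1 1))))))

  -- After multiplication by q, Pe/q is Pe again, and the identity for even n supplies g(-1 ; q⁴)
  -- and its eta quotient.
  part₁₀ : ↑ (genFun (λ n → N0 (+ 0) 2 (8 * n + 7))) ≈L negL q⁻¹ +L q⁻¹ *L g -1ℚ 0 4
    +L q⁻¹ *L ↑ (½ · (Jm 2 ^ₛ 6 ⊛ Jm 4 ⊛ inv (Jm 1 ^ₛ 4 ⊛ Jm 8 ^ₛ 2))) +L ↑ (ℕ→ℚ 8 · (Jm 2 ^ₛ 8 ⊛ Jm 8 ^ₛ 2 ⊛ inv (Jm 1 ^ₛ 8 ⊛ Jm 4)))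
  part₁₀ = LR-≈L (LR-raise 1 (LR-↑ gen₈₇))
    (LR-+ (LR-+ (LR-+ (LR-neg LR-q⁻¹) (LR-* LR-q⁻¹ (LR-g 0 4))) (LR-* LR-q⁻¹ (LR-↑ theta₄))) (LR-raise 1 (LR-↑ (s-· (ℕ→ℚ 8) (pow₂ 8 ⊛ₘ pow₈ 2 ⊛ₘ invₘ (pow₁ 8 ⊛ₘ jm₄))))))
    (linear (⊝ 𝟙) Pe≈ (linear 𝟙 Pe≈gS (solve 6 (λ q z p p′ s t → q :* (con (+ 4) :* (con (+ 2) :* z) :+ :- (:- p′)) :+ :- :1 :* (q :* p′) :+ :1 :* (t :- s)
      := :- :1 :+ :1 :* (:1 :- s) :+ :1 :* t :+ q :* (con (+ 8) :* z) :+ :- :1 :* p :+ :1 :* p) ≈-refl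
      (q^ 1) (mon (m 8 , + 8 , m 1 , + 2 , + 0)) Pe Pe′ (gS 𝟙 0 4 4) (K ½ ⊠ Θ₄))))

  g-part : ∀ b {y : PS} {T} → ser y ≈ T → LR (negL (↑ oneS) +L g -1ℚ 0 b +L ↑ y) 0 (⊝ 𝟙 ⊞ (𝟙 ⊟ gS 𝟙 0 b b) ⊞ T)
  g-part b p = LR-+ (LR-+ (LR-neg (LR-↑ s-1)) (LR-g 0 b)) (LR-↑ p)

  g-simplify : ∀ {s t : S} → t ⊟ s ≈ ⊝ 𝟙 ⊞ (𝟙 ⊟ s) ⊞ t
  g-simplify = solve 2 (λ s t → t :- s := :- :1 :+ (:1 :- s) :+ t) ≈-refl _ _

open Assembly

theorem3p1 : (↑ (genFun (λ n → N0 (+ 0) 2 (2 * n + 1)))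
    ≈L negL (↑ (X^ 1) *L g -1ℚ 2 4)
    +L ↑ (Jm 2 ^ₛ 8 ⊛ Jm 8 ^ₛ 2 ⊛ inv (Jm 1 ^ₛ 4 ⊛ Jm 4 ^ₛ 5)))
    × (↑ (genFun (λ n → N0 (+ 0) 2 (4 * n + 1)))
    ≈L ↑ (Jm 2 ^ₛ 9 ⊛ inv (Jm 1 ^ₛ 6 ⊛ Jm 4 ^ₛ 2)))
    × (↑ (genFun (λ n → N0 (+ 0) 2 (4 * n + 3)))
    ≈L negL (g -1ℚ 1 2)
    +L ↑ (ℕ→ℚ 4 · (Jm 4 ^ₛ 6 ⊛ inv (Jm 1 ^ₛ 2 ⊛ Jm 2 ^ₛ 3))))
    × (↑ (genFun (λ n → N0 (+ 1) 2 (2 * n)))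
    ≈L negL (↑ oneS) +L g -1ℚ 0 4
    +L ↑ (½ · (Jm 2 ^ₛ 6 ⊛ Jm 4 ⊛ inv (Jm 1 ^ₛ 4 ⊛ Jm 8 ^ₛ 2))))
    × (↑ (genFun (λ n → N0 (+ 1) 2 (4 * n)))
    ≈L negL (↑ oneS) +L g -1ℚ 0 2
    +L ↑ (½ · (Jm 2 ^ₛ 15 ⊛ inv (Jm 1 ^ₛ 8 ⊛ Jm 4 ^ₛ 6))))
    × (↑ (genFun (λ n → N0 (+ 1) 2 (4 * n + 2)))
    ≈L ↑ (ℕ→ℚ 2 · (Jm 2 ^ₛ 3 ⊛ Jm 4 ^ₛ 2 ⊛ inv (Jm 1 ^ₛ 4))))
    × (↑ (genFun (λ n → N0 (+ 0) 2 (8 * n + 1)))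
    ≈L ↑ (Jm 2 ^ₛ 12 ⊛ Jm 4 ⊛ inv (Jm 1 ^ₛ 10 ⊛ Jm 8 ^ₛ 2)
    ⊕ ℕ→ℚ 8 · (X^ 1 ⊛ Jm 2 ^ₛ 2 ⊛ Jm 4 ^ₛ 3 ⊛ Jm 8 ^ₛ 2 ⊛ inv (Jm 1 ^ₛ 6))))
    × (↑ (genFun (λ n → N0 (+ 0) 2 (8 * n + 3)))
    ≈L ↑ (X^ 1) *L g -1ℚ 2 4
    -L ↑ (Jm 2 ^ₛ 8 ⊛ Jm 8 ^ₛ 2 ⊛ inv (Jm 1 ^ₛ 4 ⊛ Jm 4 ^ₛ 5))
    +L ↑ (ℕ→ℚ 4 · (Jm 2 ^ₛ 6 ⊛ Jm 4 ^ₛ 5 ⊛ inv (Jm 1 ^ₛ 8 ⊛ Jm 8 ^ₛ 2))))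
    × (↑ (genFun (λ n → N0 (+ 0) 2 (8 * n + 5)))
    ≈L ↑ (ℕ→ℚ 2 · (Jm 2 ^ₛ 14 ⊛ Jm 8 ^ₛ 2 ⊛ inv (Jm 1 ^ₛ 10 ⊛ Jm 4 ^ₛ 5)
    ⊕ ℕ→ℚ 2 · (Jm 4 ^ₛ 9 ⊛ inv (Jm 1 ^ₛ 6 ⊛ Jm 8 ^ₛ 2)))))
    × (↑ (genFun (λ n → N0 (+ 0) 2 (8 * n + 7)))
    ≈L negL q⁻¹ +L q⁻¹ *L g -1ℚ 0 4
    +L q⁻¹ *L ↑ (½ · (Jm 2 ^ₛ 6 ⊛ Jm 4 ⊛ inv (Jm 1 ^ₛ 4 ⊛ Jm 8 ^ₛ 2)))
    +L ↑ (ℕ→ℚ 8 · (Jm 2 ^ₛ 8 ⊛ Jm 8 ^ₛ 2 ⊛ inv (Jm 1 ^ₛ 8 ⊛ Jm 4))))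
    × (↑ (genFun (λ n → N0 (+ 1) 2 (8 * n)))
    ≈L negL (↑ oneS) +L g -1ℚ 0 1
    +L ↑ (½ · (Jm 2 ^ₛ 22 ⊛ inv (Jm 1 ^ₛ 13 ⊛ Jm 4 ^ₛ 8))
    ⊕ ℕ→ℚ 8 · (X^ 1 ⊛ Jm 4 ^ₛ 8 ⊛ inv (Jm 1 ^ₛ 5 ⊛ Jm 2 ^ₛ 2))))
    × (↑ (genFun (λ n → N0 (+ 1) 2 (8 * n + 2)))
    ≈L ↑ (ℕ→ℚ 2 · (Jm 2 ^ₛ 16 ⊛ inv (Jm 1 ^ₛ 11 ⊛ Jm 4 ^ₛ 4))))
    × (↑ (genFun (λ n → N0 (+ 1) 2 (8 * n + 4)))
    ≈L ↑ (ℕ→ℚ 4 · (Jm 2 ^ₛ 10 ⊛ inv (Jm 1 ^ₛ 9))))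
    × (↑ (genFun (λ n → N0 (+ 1) 2 (8 * n + 6)))
    ≈L ↑ (ℕ→ℚ 8 · (Jm 2 ^ₛ 4 ⊛ Jm 4 ^ₛ 4 ⊛ inv (Jm 1 ^ₛ 7))))
theorem3p1 =
    part₁
  , part gen₄₁ (pow₂ 9 ⊛ₘ invₘ (pow₁ 6 ⊛ₘ pow₄ 2)) (solve 1 (λ x → x :- :0 := x) ≈-refl _)
  , part₃
  , LR-≈L (LR-↑ gen₂₀) (g-part 4 theta₄) (≈-trans Pe≈gS g-simplify)
  , LR-≈L (LR-↑ gen₄₀) (g-part 2 (s-· ½ (pow₂ 15 ⊛ₘ invₘ (pow₁ 8 ⊛ₘ pow₄ 6)))) g-simplify
  , part gen₄₂ (s-· (ℕ→ℚ 2) (pow₂ 3 ⊛ₘ pow₄ 2 ⊛ₘ invₘ (pow₁ 4))) (half-even (+ 2) Θ₆)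
  , part gen₈₁ (s-⊕ (pow₂ 12 ⊛ₘ jm₄ ⊛ₘ invₘ (pow₁ 10 ⊛ₘ pow₈ 2)) (s-· (ℕ→ℚ 8) (s-⊛ (s-⊛ (s-⊛ (s-⊛ (s-X 1) (pow₂ 2)) (pow₄ 3)) (pow₈ 2)) (invₘ (pow₁ 6)))))
      (⊞-congʳ (⊠-congʳ (≈-sym (q-mon₄ (e₂ (+ 2)) (e₄ (+ 3)) (e₈ (+ 2)) (e₁ (m 6))))))
  , part₈
  , part gen₈₅ (s-· (ℕ→ℚ 2) (s-⊕ (pow₂ 14 ⊛ₘ pow₈ 2 ⊛ₘ invₘ (pow₁ 10 ⊛ₘ pow₄ 5)) (s-· (ℕ→ℚ 2) (pow₄ 9 ⊛ₘ invₘ (pow₁ 6 ⊛ₘ pow₈ 2))))) ≈-refl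
  , part₁₀
  , LR-≈L (LR-↑ gen₈₀) (g-part 1 (s-⊕ (s-· ½ (pow₂ 22 ⊛ₘ invₘ (pow₁ 13 ⊛ₘ pow₄ 8))) (s-· (ℕ→ℚ 8) (s-⊛ (s-⊛ (s-X 1) (pow₄ 8)) (invₘ (pow₁ 5 ⊛ₘ pow₂ 2))))))
      (≈-trans (⊞-cong Θ₅e-half ≈-refl) g-simplify)
  , part gen₈₂ (s-· (ℕ→ℚ 2) (pow₂ 16 ⊛ₘ invₘ (pow₁ 11 ⊛ₘ pow₄ 4))) (half-even (+ 2) Θ₆e)
  , part gen₈₄ (s-· (ℕ→ℚ 4) (pow₂ 10 ⊛ₘ invₘ (pow₁ 9))) (half-even (+ 4) _)
  , part gen₈₆ (s-· (ℕ→ℚ 8) (pow₂ 4 ⊛ₘ pow₄ 4 ⊛ₘ invₘ (pow₁ 7)))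
      (≈-trans (half-even (+ 2) Θ₆o) (solve 1 (λ x → con (+ 2) :* (con (+ 4) :* x) := con (+ 8) :* x) ≈-refl _))
  where
  -- The factor q stands innermost in a left-nested product and has to be moved aside before
  -- exponent vectors can be merged.
  q-mon₄ : ∀ v₁ v₂ v₃ v₄ → q^ 1 ⊠ mon v₁ ⊠ mon v₂ ⊠ mon v₃ ⊠ mon v₄ ≈ q^ 1 ⊠ mon (v₁ +ₑ v₂ +ₑ v₃ +ₑ v₄)
  q-mon₄ v₁ v₂ v₃ v₄ = ≈-trans (solve 5 (λ q a b c d → q :* a :* b :* c :* d := q :* (a :* b :* c :* d)) ≈-refl _ _ _ _ _)
    (⊠-congʳ (≈-trans (⊠-congˡ (≈-trans (⊠-congˡ (mon-⊠ v₁ v₂)) (mon-⊠ _ v₃))) (mon-⊠ _ v₄)))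
  Θ₅e-half : K ½ ⊠ Θ₅e ≈ K ½ ⊠ mon (m 13 , + 22 , m 8 , + 0 , + 0) ⊞ ι (+ 8) ⊠ (q^ 1 ⊠ mon (e₄ (+ 8)) ⊠ mon (m 5 , m 2 , + 0 , + 0 , + 0))
  Θ₅e-half = ≈-trans (⊠-distribˡ _ _ _) (⊞-congʳ (≈-trans (solve 1 (λ x → x := x :- :0) ≈-refl _) (≈-trans (half-even (+ 8) _)
    (⊠-congʳ (≈-sym (≈-trans (⊠-assoc _ _ _) (⊠-congʳ (mon-⊠ _ _))))))))
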